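{- Let $\rho\geqslant 2$ be an integer. Suppose that non-negative integers $n,d_1,d_2,d_3,\ell,m,k$ satisfy $1\leqslant k\leqslant m\leqslant \ell$, $d_1,d_2,d_3\in\{0,1,\ldots,\rho-1\}$, $d_1>0$, and $$\mathcal{N}_n=d_1\frac{\rho^{\ell}-1}{\rho-1}\rho^{m+k}+d_2\frac{\rho^{m}-1}{\rho-1}\rho^{k}+d_3\frac{\rho^{k}-1}{\rho-1},$$ i.e. the base-$\rho$ expansion of $\mathcal{N}_n$ is the digit $d_1$ repeated $\ell$ times, followed by $d_2$ repeated $m$ times, followed by $d_3$ repeated $k$ times. Then $$\ell+m+k<n<5.6\cdot 10^{48}\cdot (\log\rho)^7.$$
   Context: Narayana's sequence $(\mathcal{N}_n)_{n\geqslant 0}$ is defined by $\mathcal{N}_0=0$, $\mathcal{N}_1=\mathcal{N}_2=\mathcal{N}_3=1$ and $\mathcal{N}_n=\mathcal{N}_{n-1}+\mathcal{N}_{n-3}$ for $n\geqslant 3$. $\log$ denotes the natural logarithm. -}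

module Defs where

open import Data.Nat as ℕ using (ℕ; zero; suc)
open import Data.Integer using (+_)
open import Data.Rational using (ℚ; _+_; _*_; _/_; _≤_; _<_; 0ℚ; 1ℚ)
open import Data.Product using (Σ; _×_)

Narayana : ℕ → ℕ
Narayana 0 = 0
Narayana 1 = 1
Narayana 2 = 1
Narayana (suc (suc (suc n))) = Narayana (suc (suc n)) ℕ.+ Narayana n

-- repunit ρ j = 1 + ρ + ... + ρ^(j-1) = (ρ^j - 1)/(ρ - 1)  (for ρ ≥ 2)
repunit : ℕ → ℕ → ℕ
repunit ρ zero = 0
repunit ρ (suc j) = 1 ℕ.+ ρ ℕ.* repunit ρ j

ℕ→ℚ : ℕ → ℚ
ℕ→ℚ n = (+ n) / 1

_^ℚ_ : ℚ → ℕ → ℚ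
q ^ℚ zero = 1ℚ
q ^ℚ suc n = q * (q ^ℚ n)

expTerm : ℚ → ℕ → ℚ
expTerm q zero = 1ℚ
expTerm q (suc i) = expTerm q i * q * ((+ 1) / suc i)

expPartial : ℚ → ℕ → ℚ
expPartial q zero = 0ℚ
expPartial q (suc N) = expPartial q N + expTerm q N

-- For q ≥ 0:  q < log ρ  ⇔  e^q < ρ  ⇔  ∃ ε > 0, ∀ N, Σ_{i<N} q^i/i! + ε ≤ ρ
LtLog : ℚ → ℕ → Set
LtLog q ρ = Σ ℚ (λ ε → (0ℚ < ε) × (∀ N → expPartial q N + ε ≤ ℕ→ℚ ρ))

C₀ : ℚ
C₀ = ℕ→ℚ (56 ℕ.* (10 ℕ.^ 47))

-- n < C₀ · (log ρ)^7   (for ρ ≥ 2, so log ρ > 0):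
-- ∃ rational q with 0 ≤ q < log ρ and n < C₀ · q^7
LtC₀Log7 : ℕ → ℕ → Set
LtC₀Log7 n ρ = Σ ℚ (λ q → (0ℚ ≤ q) × (LtLog q ρ × (ℕ→ℚ n < C₀ * (q ^ℚ 7))))

{-# OPTIONS --safe #-}
-- Let α be the real root of X³ = X² + 1 and π = 3 + α². By Binet's formula N_n is close to
-- α^(n+2)/π, and since the leading block is at least a third of all digits, the equation makes
-- ζ = d₁ π ρ^e / ((ρ-1) α^(n+2)) exponentially close to 1. Instead of Baker's theorem a direct
-- transcendence argument is used. Dirichlet's principle gives u = α^a/ρ^b very close to 1, and
-- w = u^q ζ removes the large exponents. The pigeonhole principle gives a nonzero
-- F(x,Y) = Σ_{l<8} P_l(x) Y^l with coefficients in ℤ[α] such that F(x,u^x) is tiny on a long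
-- range of x, by Newton interpolation. Because ζ ≈ 1, F is also tiny at the points
-- (r + sq, u^r w^s), where Liouville's inequality makes it vanish. Eliminating the P_l one at a
-- time shows that so many zeros force F = 0. The contradiction needs n ≥ 2^154 g² for
-- 2^g ≤ ρ < 2^(g+1), and g/2 < log ρ gives the stated bound.
module Submission where

open import Defs
open import Algebra.Bundles using (CommutativeRing; RawRing)
open import Algebra.Solver.Ring.AlmostCommutativeRing using (fromCommutativeRing; _-Raw-AlmostCommutative⟶_)
import Algebra.Solver.Ring as RingSolver
open import Algebra.Structures using (IsCommutativeRing)
open import Data.Bool.Base using (Bool; true; false; _xor_; _∧_)
open import Data.Empty using (⊥; ⊥-elim)
open import Data.Fin as Fin using (Fin; toℕ; fromℕ<)
import Data.Fin.Properties as Finₚ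
open import Data.Integer as ℤ using (ℤ; -[1+_])
import Data.Integer.DivMod as ℤDM
import Data.Integer.Properties as ℤₚ
import Data.Integer.Tactic.RingSolver as ℤ-Ring
open import Data.Maybe.Base using (Maybe; just; nothing)
open import Data.Nat as ℕ using (ℕ; zero; suc; s≤s; z≤n)
import Data.Nat.DivMod as DM
open import Data.Nat.Induction using (<-wellFounded; <-rec)
import Data.Nat.Properties as ℕₚ
open import Data.Nat.Tactic.RingSolver using (solve-∀)
open import Data.Product using (_×_; _,_; proj₁; proj₂; ∃-syntax)
open import Data.Rational as ℚ using (ℚ; mkℚ; 0ℚ; 1ℚ)
import Data.Rational.Properties as ℚₚ
import Data.Rational.Solver as ℚ-Solver
import Data.Rational.Unnormalised as ℚᵘ
import Data.Rational.Unnormalised.Properties as ℚᵘₚ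
open import Data.Sum using (_⊎_; inj₁; inj₂)
open import Function using (_∘_)
open import Induction.WellFounded using (Acc; acc)
open import Relation.Binary.Definitions using (tri<; tri≈; tri>)
open import Relation.Binary.PropositionalEquality using (_≡_; _≢_; refl; sym; trans; cong; cong₂; subst; subst₂; isEquivalence; module ≡-Reasoning)
open import Relation.Nullary using (Dec; yes; no; ¬_; contradiction)

-- The obstacle is height. At (x, u^x) itself Liouville's inequality is useless, because the
-- denominator of u^x has a number of bits proportional to a x. But w = d₁ π ρ^(E-bq) / ((ρ-1)
-- α^r₀), with E = ℓ+m+k and r₀ = ν mod a for ν = n+2, has a height that hardly depends on n. So at
-- (r + sq, u^r w^s) the height is governed by r and s alone, while x = r + sq runs up to 2^19 K.
-- All computations are exact in ℚ(α). Its order is generated by nonnegative coordinate vectors and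
-- is decided only between integers, so bounds are pairs of inequalities and comparisons follow a
-- rounding. Complex conjugates never appear: numerators and denominators have natural coordinates,
-- and for these the real value bounds every coordinate. The constant: Dirichlet gives a ≤ 2^64 g,
-- and the power w^S with S = 512 a costs about 512 a² bits, to be small against κ ≈ n/2^20. This
-- asks for κ ≥ 64 · 2^128 g², that is n ≥ 2^154 g², and 2^154 < 4.375 · 10^46 = 5.6 · 10^48 / 2^7.

-- Ordered commutative rings, finite sums and two-sided bounds.

fromℕ : {A : Set} → (A → A → A) → A → A → ℕ → A
fromℕ _+_ 0# 1# zero          = 0#
fromℕ _+_ 0# 1# (suc zero)    = 1#
fromℕ _+_ 0# 1# (suc (suc n)) = 1# + fromℕ _+_ 0# 1# (suc n)

-- Only the closure properties of a positive cone are asked for, neither totality nor decidability.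
-- There are two instances: ℚ(α) for the transcendence argument and ℚ for the logarithm.
record OrderedRing : Set₁ where
  infixl 6 _+_
  infixl 7 _*_
  infix  8 -_
  infix  4 _≤_
  field
    R   : Set
    _+_ : R → R → R
    _*_ : R → R → R
    -_  : R → R
    0#  : R
    1#  : R
    isCommutativeRing : IsCommutativeRing _≡_ _+_ _*_ -_ 0# 1#
    _≤_      : R → R → Set
    ≤-refl   : ∀ {x} → x ≤ x
    ≤-trans  : ∀ {x y z} → x ≤ y → y ≤ z → x ≤ z
    +-mono-≤ : ∀ {x y u v} → x ≤ y → u ≤ v → x + u ≤ y + v
    *-nonneg : ∀ {x y} → 0# ≤ x → 0# ≤ y → 0# ≤ x * y
    0≤1      : 0# ≤ 1#

  -- The separate clause of `fromℕ` for one makes `ι 1` compute to `1#`, so that integer constants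
  -- of the ring solver evaluate definitionally.
  ι : ℕ → R
  ι = fromℕ _+_ 0# 1#

  field
    inv      : ℕ → R
    inv-pos  : ∀ k → 0# ≤ inv k
    inv-spec : ∀ k → ι (suc k) * inv k ≡ 1#

  commutativeRing : CommutativeRing _ _
  commutativeRing = record { isCommutativeRing = isCommutativeRing }

module OrderedRingProperties (𝓡 : OrderedRing) where
  open OrderedRing 𝓡 public
  open CommutativeRing commutativeRing public
    using (+-assoc; +-comm; *-assoc; *-comm; +-identityˡ; +-identityʳ; *-identityˡ; *-identityʳ;
           distribˡ; distribʳ; -‿inverseˡ; -‿inverseʳ; zeroˡ; zeroʳ)
  open import Algebra.Properties.Ring (CommutativeRing.ring commutativeRing) public
    using (-‿distribˡ-*; -‿distribʳ-*; -‿involutive; -0#≈0#; -‿+-comm)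

  infixl 6 _-_
  _-_ : R → R → R
  x - y = x + - y

  ιℤ : ℤ → R
  ιℤ (ℤ.+ n)    = ι n
  ιℤ -[1+ n ] = - ι (suc n)

  ι-suc : ∀ n → ι (suc n) ≡ 1# + ι n
  ι-suc zero    = sym (+-identityʳ 1#)
  ι-suc (suc n) = refl

  ι-+ : ∀ m n → ι (m ℕ.+ n) ≡ ι m + ι n
  ι-+ zero    n = sym (+-identityˡ _)
  ι-+ (suc m) n = trans (ι-suc (m ℕ.+ n)) (trans (cong (1# +_) (ι-+ m n))
    (trans (sym (+-assoc _ _ _)) (cong (_+ ι n) (sym (ι-suc m)))))

  ι-* : ∀ m n → ι (m ℕ.* n) ≡ ι m * ι n
  ι-* zero    n = sym (zeroˡ _)
  ι-* (suc m) n = trans (ι-+ n (m ℕ.* n))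
    (trans (cong₂ _+_ (sym (*-identityˡ _)) (ι-* m n))
    (trans (sym (distribʳ _ _ _)) (cong (_* ι n) (sym (ι-suc m)))))

  ιℤ-neg : ∀ i → ιℤ (ℤ.- i) ≡ - ιℤ i
  ιℤ-neg (ℤ.+ zero)  = sym -0#≈0#
  ιℤ-neg (ℤ.+ suc n) = refl
  ιℤ-neg -[1+ n ]  = sym (-‿involutive _)

  private
    cancel-1 : ∀ x y → x - y ≡ (1# + x) - (1# + y)
    cancel-1 x y = sym (trans (cong ((1# + x) +_) (sym (-‿+-comm 1# y)))
      (trans (cong (_+ (- 1# + - y)) (+-comm 1# x))
      (trans (+-assoc x 1# _) (cong (x +_)
      (trans (sym (+-assoc 1# (- 1#) (- y)))
      (trans (cong (_+ - y) (-‿inverseʳ 1#)) (+-identityˡ _)))))))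

  ιℤ-⊖ : ∀ m n → ιℤ (m ℤ.⊖ n) ≡ ι m - ι n
  ιℤ-⊖ m       zero    = sym (trans (cong (ι m +_) -0#≈0#) (+-identityʳ _))
  ιℤ-⊖ zero    (suc n) = sym (+-identityˡ _)
  ιℤ-⊖ (suc m) (suc n) = trans (cong ιℤ (ℤₚ.[1+m]⊖[1+n]≡m⊖n m n))
    (trans (ιℤ-⊖ m n) (trans (cancel-1 (ι m) (ι n))
      (sym (cong₂ _-_ (ι-suc m) (ι-suc n)))))

  ιℤ-+ : ∀ i j → ιℤ (i ℤ.+ j) ≡ ιℤ i + ιℤ j
  ιℤ-+ (ℤ.+ m)    (ℤ.+ n)    = ι-+ m n
  ιℤ-+ (ℤ.+ m)    -[1+ n ] = ιℤ-⊖ m (suc n)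
  ιℤ-+ -[1+ m ] (ℤ.+ n)    = trans (ιℤ-⊖ n (suc m)) (+-comm _ _)
  ιℤ-+ -[1+ m ] -[1+ n ] = trans
    (cong (λ k → - ι k) (cong suc (sym (ℕₚ.+-suc m n))))
    (trans (cong -_ (ι-+ (suc m) (suc n))) (sym (-‿+-comm _ _)))

  ιℤ-* : ∀ i j → ιℤ (i ℤ.* j) ≡ ιℤ i * ιℤ j
  ιℤ-* (ℤ.+ m) (ℤ.+ n) = trans (cong ιℤ (sym (ℤₚ.pos-* m n))) (ι-* m n)
  ιℤ-* (ℤ.+ m) -[1+ n ] = trans (cong ιℤ (sym (ℤₚ.neg-distribʳ-* (ℤ.+ m) (ℤ.+ suc n))))
    (trans (ιℤ-neg (ℤ.+ m ℤ.* ℤ.+ suc n)) (trans (cong -_ (ιℤ-* (ℤ.+ m) (ℤ.+ suc n))) (-‿distribʳ-* _ _)))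
  ιℤ-* -[1+ m ] (ℤ.+ n) = trans (cong ιℤ (sym (ℤₚ.neg-distribˡ-* (ℤ.+ suc m) (ℤ.+ n))))
    (trans (ιℤ-neg (ℤ.+ suc m ℤ.* ℤ.+ n)) (trans (cong -_ (ιℤ-* (ℤ.+ suc m) (ℤ.+ n))) (-‿distribˡ-* _ _)))
  ιℤ-* -[1+ m ] -[1+ n ] = trans (ι-* (suc m) (suc n))
    (trans (sym (-‿involutive _)) (trans (cong -_ (-‿distribˡ-* _ _)) (-‿distribʳ-* _ _)))

  private
    ℤ-rawRing : RawRing _ _
    ℤ-rawRing = CommutativeRing.rawRing ℤₚ.+-*-commutativeRing

    morphism : ℤ-rawRing -Raw-AlmostCommutative⟶ fromCommutativeRing commutativeRing
    morphism = record
      { ⟦_⟧ = ιℤ ; +-homo = ιℤ-+ ; *-homo = ιℤ-* ; -‿homo = ιℤ-neg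
      ; 0-homo = refl ; 1-homo = refl }

    ιℤ-≟ : ∀ i j → Maybe (ιℤ i ≡ ιℤ j)
    ιℤ-≟ i j with i ℤ.≟ j
    ... | yes eq = just (cong ιℤ eq)
    ... | no _   = nothing

  module Solver = RingSolver ℤ-rawRing (fromCommutativeRing commutativeRing) morphism ιℤ-≟
  open Solver public using (solve; _:+_; _:*_; _:-_; :-_; _:=_)

  # : ∀ {n} → ℕ → Solver.Polynomial n
  # m = Solver.con (ℤ.+ m)

  ≤-reflexive : ∀ {x y} → x ≡ y → x ≤ y
  ≤-reflexive refl = ≤-refl

  +-monoʳ-≤ : ∀ x {y z} → y ≤ z → x + y ≤ x + z
  +-monoʳ-≤ x = +-mono-≤ (≤-refl {x})

  private
    add-sub = solve 2 (λ x y → y := (y :- x) :+ x) refl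
    sub-self = solve 1 (λ x → # 0 := x :- x) refl

  0≤y-x : ∀ {x y} → x ≤ y → 0# ≤ y - x
  0≤y-x {x} {y} p = ≤-trans (≤-reflexive (sub-self x)) (+-mono-≤ p (≤-refl { - x}))

  0≤y-x⁻¹ : ∀ {x y} → 0# ≤ y - x → x ≤ y
  0≤y-x⁻¹ {x} {y} p = ≤-trans (≤-reflexive (sym (+-identityˡ x)))
    (≤-trans (+-mono-≤ p (≤-refl {x})) (≤-reflexive (sym (add-sub x y))))

  -- The usual form of an inequality proof below: a ring identity writes `y - x` as a sum of
  -- products that are visibly nonnegative.
  by-diff : ∀ {x y d} → 0# ≤ d → y - x ≡ d → x ≤ y
  by-diff p eq = 0≤y-x⁻¹ (≤-trans p (≤-reflexive (sym eq)))

  private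
    mul-diff = solve 3 (λ x y z → z :* y :- z :* x := z :* (y :- x)) refl
    neg-diff = solve 2 (λ x y → :- x :- :- y := y :- x) refl

  *-monoʳ-≤ : ∀ {x y z} → 0# ≤ z → x ≤ y → z * x ≤ z * y
  *-monoʳ-≤ {x} {y} {z} 0≤z x≤y = by-diff (*-nonneg 0≤z (0≤y-x x≤y)) (mul-diff x y z)

  *-monoˡ-≤ : ∀ {x y z} → 0# ≤ z → x ≤ y → x * z ≤ y * z
  *-monoˡ-≤ {x} {y} {z} 0≤z x≤y = subst₂ _≤_ (*-comm z x) (*-comm z y) (*-monoʳ-≤ 0≤z x≤y)

  *-mono-≤ : ∀ {x y u v} → 0# ≤ x → 0# ≤ v → x ≤ y → u ≤ v → x * u ≤ y * v
  *-mono-≤ 0≤x 0≤v x≤y u≤v = ≤-trans (*-monoʳ-≤ 0≤x u≤v) (*-monoˡ-≤ 0≤v x≤y)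

  neg-mono-≤ : ∀ {x y} → x ≤ y → - y ≤ - x
  neg-mono-≤ {x} {y} p = by-diff (0≤y-x p) (neg-diff x y)

  +-nonneg : ∀ {x y} → 0# ≤ x → 0# ≤ y → 0# ≤ x + y
  +-nonneg p q = ≤-trans (≤-reflexive (sym (+-identityˡ 0#))) (+-mono-≤ p q)

  0≤ι : ∀ n → 0# ≤ ι n
  0≤ι zero    = ≤-refl
  0≤ι (suc n) = subst (0# ≤_) (sym (ι-suc n)) (+-nonneg 0≤1 (0≤ι n))

  ι-mono-≤ : ∀ {m n} → m ℕ.≤ n → ι m ≤ ι n
  ι-mono-≤ {n = n} z≤n = 0≤ι n
  ι-mono-≤ (s≤s {m} {n} p) = subst₂ _≤_ (sym (ι-suc m)) (sym (ι-suc n)) (+-monoʳ-≤ 1# (ι-mono-≤ p))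

  ½ : R
  ½ = inv 1

  0≤½ : 0# ≤ ½
  0≤½ = inv-pos 1

  private
    halve = solve 2 (λ x h → h :* (x :+ x) := (# 2 :* h) :* x) refl
    half-lem = solve 1 (λ h → h :+ h := # 2 :* h) refl

  0≤2x⇒0≤x : ∀ {x} → 0# ≤ x + x → 0# ≤ x
  0≤2x⇒0≤x {x} p = ≤-trans (*-nonneg 0≤½ p)
    (≤-reflexive (trans (halve x ½) (trans (cong (_* x) (inv-spec 1)) (*-identityˡ x))))

  ½+½ : ½ + ½ ≡ 1#
  ½+½ = trans (half-lem ½) (inv-spec 1)

  infixr 8 _^_
  _^_ : R → ℕ → R
  x ^ zero  = 1#
  x ^ suc n = x * x ^ n

  1^n : ∀ n → 1# ^ n ≡ 1#
  1^n zero    = refl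
  1^n (suc n) = trans (*-identityˡ _) (1^n n)

  ^-+ : ∀ x m n → x ^ (m ℕ.+ n) ≡ x ^ m * x ^ n
  ^-+ x zero    n = sym (*-identityˡ _)
  ^-+ x (suc m) n = trans (cong (x *_) (^-+ x m n)) (sym (*-assoc _ _ _))

  private
    mul-swap = solve 4 (λ x y p q → x :* y :* (p :* q) := x :* p :* (y :* q)) refl

  *-^ : ∀ x y n → (x * y) ^ n ≡ x ^ n * y ^ n
  *-^ x y zero    = sym (*-identityˡ _)
  *-^ x y (suc n) = trans (cong (x * y *_) (*-^ x y n)) (mul-swap x y (x ^ n) (y ^ n))

  ^-* : ∀ x m n → x ^ (m ℕ.* n) ≡ (x ^ m) ^ n
  ^-* x m zero    = cong (x ^_) (ℕₚ.*-zeroʳ m)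
  ^-* x m (suc n) = trans (cong (x ^_) (ℕₚ.*-suc m n))
    (trans (^-+ x m (m ℕ.* n)) (cong (x ^ m *_) (^-* x m n)))

  ι-^ : ∀ m n → ι (m ℕ.^ n) ≡ ι m ^ n
  ι-^ m zero    = refl
  ι-^ m (suc n) = trans (ι-* m (m ℕ.^ n)) (cong (ι m *_) (ι-^ m n))

  ^-inverse : ∀ {x y} → x * y ≡ 1# → ∀ n → x ^ n * y ^ n ≡ 1#
  ^-inverse {x} {y} p n = trans (sym (*-^ x y n)) (trans (cong (_^ n) p) (1^n n))

  ^-nonneg : ∀ {x} → 0# ≤ x → ∀ n → 0# ≤ x ^ n
  ^-nonneg p zero    = 0≤1
  ^-nonneg p (suc n) = *-nonneg p (^-nonneg p n)

  ^-mono-≤ : ∀ {x y} → 0# ≤ x → x ≤ y → ∀ n → x ^ n ≤ y ^ n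
  ^-mono-≤ p q zero    = ≤-refl
  ^-mono-≤ p q (suc n) = *-mono-≤ p (^-nonneg (≤-trans p q) n) q (^-mono-≤ p q n)

  1≤^ : ∀ {x} → 1# ≤ x → ∀ n → 1# ≤ x ^ n
  1≤^ {x} p n = subst (_≤ x ^ n) (1^n n) (^-mono-≤ 0≤1 p n)

  ^-monoʳ-≤ : ∀ {x} → 1# ≤ x → ∀ {m n} → m ℕ.≤ n → x ^ m ≤ x ^ n
  ^-monoʳ-≤ p {n = n} z≤n = 1≤^ p n
  ^-monoʳ-≤ p (s≤s q) = *-monoʳ-≤ (≤-trans 0≤1 p) (^-monoʳ-≤ p q)

  Σ< : ℕ → (ℕ → R) → R
  Σ< zero    f = 0#
  Σ< (suc n) f = Σ< n f + f n

  Σ<-cong : ∀ n {f g} → (∀ i → i ℕ.< n → f i ≡ g i) → Σ< n f ≡ Σ< n g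
  Σ<-cong zero    h = refl
  Σ<-cong (suc n) h = cong₂ _+_ (Σ<-cong n (λ i i<n → h i (ℕₚ.m≤n⇒m≤1+n i<n))) (h n (ℕₚ.n<1+n n))

  private
    add-swap = solve 4 (λ a b c d → (a :+ b) :+ (c :+ d) := (a :+ c) :+ (b :+ d)) refl

  Σ<-+ : ∀ n f g → Σ< n (λ i → f i + g i) ≡ Σ< n f + Σ< n g
  Σ<-+ zero    f g = sym (+-identityˡ _)
  Σ<-+ (suc n) f g = trans (cong (_+ (f n + g n)) (Σ<-+ n f g)) (add-swap _ _ _ _)

  Σ<-*ˡ : ∀ n c f → Σ< n (λ i → c * f i) ≡ c * Σ< n f
  Σ<-*ˡ zero    c f = sym (zeroʳ c)
  Σ<-*ˡ (suc n) c f = trans (cong (_+ c * f n) (Σ<-*ˡ n c f)) (sym (distribˡ _ _ _))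

  Σ<-0 : ∀ n → Σ< n (λ _ → 0#) ≡ 0#
  Σ<-0 zero    = refl
  Σ<-0 (suc n) = trans (+-identityʳ _) (Σ<-0 n)

  Σ<-swap : ∀ m n (f : ℕ → ℕ → R) → Σ< m (λ i → Σ< n (f i)) ≡ Σ< n (λ j → Σ< m (λ i → f i j))
  Σ<-swap zero    n f = sym (Σ<-0 n)
  Σ<-swap (suc m) n f = trans (cong (_+ Σ< n (f m)) (Σ<-swap m n f))
    (sym (Σ<-+ n (λ j → Σ< m (λ i → f i j)) (f m)))

  Σ<-split : ∀ m n f → Σ< (m ℕ.+ n) f ≡ Σ< m f + Σ< n (λ i → f (m ℕ.+ i))
  Σ<-split m zero f = trans (cong (λ k → Σ< k f) (ℕₚ.+-identityʳ m)) (sym (+-identityʳ _))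
  Σ<-split m (suc n) f = trans (cong (λ k → Σ< k f) (ℕₚ.+-suc m n))
    (trans (cong (_+ f (m ℕ.+ n)) (Σ<-split m n f)) (+-assoc _ _ _))

  Σ<-nest : ∀ n m f → Σ< (n ℕ.* m) f ≡ Σ< n (λ i → Σ< m (λ j → f (i ℕ.* m ℕ.+ j)))
  Σ<-nest zero    m f = refl
  Σ<-nest (suc n) m f = trans (cong (λ k → Σ< k f) (ℕₚ.+-comm m (n ℕ.* m)))
    (trans (Σ<-split (n ℕ.* m) m f) (cong (_+ Σ< m (λ j → f (n ℕ.* m ℕ.+ j))) (Σ<-nest n m f)))

  -- Stands for |x| ≤ m. The order comes without totality, so there is no absolute value to speak
  -- of.
  record Bd (x m : R) : Set where
    constructor bd
    field
      lower : - m ≤ x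
      upper : x ≤ m
  open Bd public

  private
    bd-nonneg = solve 2 (λ m x → (x :- :- m) :+ (m :- x) := m :+ m) refl
    mul-upper = solve 4 (λ x y m k → (m :* k :- x :* y) :+ (m :* k :- x :* y) := (m :- x) :* (y :- :- k) :+ (x :- :- m) :* (k :- y)) refl
    mul-lower = solve 4 (λ x y m k → (x :* y :- :- (m :* k)) :+ (x :* y :- :- (m :* k)) := (m :- x) :* (k :- y) :+ (x :- :- m) :* (y :- :- k)) refl
    neg-+ = solve 2 (λ x y → :- (x :+ y) := :- x :+ :- y) refl
    neg-neg = solve 1 (λ x → :- :- x := x) refl

  Bd⇒0≤ : ∀ {x m} → Bd x m → 0# ≤ m
  Bd⇒0≤ {x} {m} (bd l u) = 0≤2x⇒0≤x (≤-trans (+-nonneg (0≤y-x l) (0≤y-x u)) (≤-reflexive (bd-nonneg m x)))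

  Bd-≤ : ∀ {x m k} → m ≤ k → Bd x m → Bd x k
  Bd-≤ p (bd l u) = bd (≤-trans (neg-mono-≤ p) l) (≤-trans u p)

  Bd-0≤ : ∀ {x m} → 0# ≤ x → x ≤ m → Bd x m
  Bd-0≤ {x} {m} p q = bd (≤-trans (≤-trans (neg-mono-≤ (≤-trans p q)) (≤-reflexive -0#≈0#)) p) q

  Bd-self : ∀ {x} → 0# ≤ x → Bd x x
  Bd-self p = Bd-0≤ p ≤-refl

  Bd-0# : ∀ {m} → 0# ≤ m → Bd 0# m
  Bd-0# = Bd-0≤ ≤-refl

  Bd-+ : ∀ {x y m k} → Bd x m → Bd y k → Bd (x + y) (m + k)
  Bd-+ {m = m} {k} (bd l u) (bd l' u') = bd (≤-trans (≤-reflexive (neg-+ m k)) (+-mono-≤ l l')) (+-mono-≤ u u')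

  Bd-neg : ∀ {x m} → Bd x m → Bd (- x) m
  Bd-neg {x} {m} (bd l u) = bd (neg-mono-≤ u) (≤-trans (neg-mono-≤ l) (≤-reflexive (neg-neg m)))

  Bd-- : ∀ {x y m k} → Bd x m → Bd y k → Bd (x - y) (m + k)
  Bd-- p q = Bd-+ p (Bd-neg q)

  -- Twice `m * k - x * y` is `(m - x) * (k + y) + (m + x) * (k - y)`, with nonnegative factors
  -- throughout; the lower bound is similar, and 2 is invertible.
  Bd-* : ∀ {x y m k} → Bd x m → Bd y k → Bd (x * y) (m * k)
  Bd-* {x} {y} {m} {k} (bd l u) (bd l' u') = bd
    (0≤y-x⁻¹ (0≤2x⇒0≤x (≤-trans (+-nonneg (*-nonneg (0≤y-x u) (0≤y-x u')) (*-nonneg (0≤y-x l) (0≤y-x l')))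
      (≤-reflexive (sym (mul-lower x y m k))))))
    (0≤y-x⁻¹ (0≤2x⇒0≤x (≤-trans (+-nonneg (*-nonneg (0≤y-x u) (0≤y-x l')) (*-nonneg (0≤y-x l) (0≤y-x u')))
      (≤-reflexive (sym (mul-upper x y m k))))))

  Bd-^ : ∀ {x m} → Bd x m → ∀ n → Bd (x ^ n) (m ^ n)
  Bd-^ p zero    = Bd-self 0≤1
  Bd-^ p (suc n) = Bd-* p (Bd-^ p n)

  Bd-Σ : ∀ n {f : ℕ → R} {m} → (∀ i → i ℕ.< n → Bd (f i) m) → Bd (Σ< n f) (ι n * m)
  Bd-Σ zero    {m = m} h = Bd-≤ (≤-reflexive (sym (zeroˡ m))) (Bd-0# ≤-refl)
  Bd-Σ (suc n) {m = m} h = Bd-≤ (≤-reflexive (trans (suc-mul (ι n) m) (cong (_* m) (sym (ι-suc n)))))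
      (Bd-+ (Bd-Σ n (λ i i<n → h i (ℕₚ.m≤n⇒m≤1+n i<n))) (h n (ℕₚ.n<1+n n)))
    where
    suc-mul = solve 2 (λ p m → p :* m :+ m := (# 1 :+ p) :* m) refl

-- Digits and codes for the pigeonhole principle.

2^≢0 : ∀ k → ℕ.NonZero (2 ℕ.^ k)
2^≢0 k = ℕₚ.m^n≢0 2 k

n<2^n : ∀ n → n ℕ.< 2 ℕ.^ n
n<2^n zero    = s≤s z≤n
n<2^n (suc n) = ℕₚ.≤-trans (s≤s (n<2^n n)) (ℕₚ.≤-trans (ℕₚ.+-monoˡ-≤ (2 ℕ.^ n) (ℕₚ.m^n>0 2 n))
  (ℕₚ.≤-reflexive (cong (2 ℕ.^ n ℕ.+_) (sym (ℕₚ.+-identityʳ _)))))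

total : (ℕ → ℕ) → ℕ → ℕ
total r zero    = 0
total r (suc U) = r 0 ℕ.+ total (r ∘ suc) U

-- Mixed radix with the bases `2 ^ r 0`, `2 ^ r 1` and so on: the numbers below `2 ^ total r U`
-- enumerate the vectors whose entry `i` has `r i` bits.
digit : (ℕ → ℕ) → ℕ → ℕ → ℕ
digit r N zero    = (N DM.% 2 ℕ.^ r 0) {{2^≢0 (r 0)}}
digit r N (suc i) = digit (r ∘ suc) ((N DM./ 2 ℕ.^ r 0) {{2^≢0 (r 0)}}) i

digit< : ∀ r N i → digit r N i ℕ.< 2 ℕ.^ r i
digit< r N zero    = DM.m%n<n N (2 ℕ.^ r 0) {{2^≢0 (r 0)}}
digit< r N (suc i) = digit< (r ∘ suc) _ i

digit-injective : ∀ r U N N' → N ℕ.< 2 ℕ.^ total r U → N' ℕ.< 2 ℕ.^ total r U →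
  (∀ i → i ℕ.< U → digit r N i ≡ digit r N' i) → N ≡ N'
digit-injective r zero zero zero p q h = refl
digit-injective r zero zero (suc N') p (s≤s ()) h
digit-injective r zero (suc N) N' (s≤s ()) q h
digit-injective r (suc U) N N' p q h =
  trans (DM.m≡m%n+[m/n]*n N b) (trans (cong₂ (λ x y → x ℕ.+ y ℕ.* b) (h 0 (s≤s z≤n))
    (digit-injective (r ∘ suc) U (N DM./ b) (N' DM./ b) (quot N p) (quot N' q) (λ i i<U → h (suc i) (s≤s i<U))))
    (sym (DM.m≡m%n+[m/n]*n N' b)))
  where
  b = 2 ℕ.^ r 0
  instance
    b≢0 : ℕ.NonZero b
    b≢0 = 2^≢0 (r 0)
  quot : ∀ M → M ℕ.< 2 ℕ.^ total r (suc U) → M DM./ b ℕ.< 2 ℕ.^ total (r ∘ suc) U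
  quot M M< = DM.m<n*o⇒m/o<n (ℕₚ.<-≤-trans M<
    (ℕₚ.≤-reflexive (trans (ℕₚ.^-distribˡ-+-* 2 (r 0) (total (r ∘ suc) U)) (ℕₚ.*-comm b _))))

-- Packs a tuple of `T` boxes into one number, since the pigeonhole principle is applied to maps
-- between finite initial segments.
encode : ℕ → (ℕ → ℕ) → ℕ → ℕ
encode H b zero    = 0
encode H b (suc T) = b 0 ℕ.+ encode H (b ∘ suc) T ℕ.* H

encode< : ∀ H b T → (∀ t → t ℕ.< T → b t ℕ.< H) → encode H b T ℕ.< H ℕ.^ T
encode< H b zero    h = s≤s z≤n
encode< H b (suc T) h = ℕₚ.<-≤-trans (ℕₚ.+-monoˡ-< _ (h 0 (s≤s z≤n)))
  (ℕₚ.≤-trans (ℕₚ.*-monoˡ-≤ H (encode< H (b ∘ suc) T (λ t t<T → h (suc t) (s≤s t<T))))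
    (ℕₚ.≤-reflexive (ℕₚ.*-comm _ H)))

encode-injective : ∀ H .{{_ : ℕ.NonZero H}} b b' T → (∀ t → t ℕ.< T → b t ℕ.< H) → (∀ t → t ℕ.< T → b' t ℕ.< H) →
  encode H b T ≡ encode H b' T → ∀ t → t ℕ.< T → b t ≡ b' t
encode-injective H b b' (suc T) h h' eq t t<T = go t t<T
  where
  e  = encode H (b ∘ suc) T
  e' = encode H (b' ∘ suc) T
  head : b 0 ≡ b' 0
  head = trans (sym (DM.m<n⇒m%n≡m (h 0 (s≤s z≤n)))) (trans (sym (DM.[m+kn]%n≡m%n (b 0) e H))
    (trans (cong (DM._% H) eq) (trans (DM.[m+kn]%n≡m%n (b' 0) e' H) (DM.m<n⇒m%n≡m (h' 0 (s≤s z≤n))))))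
  tail : e ≡ e'
  tail = ℕₚ.*-cancelʳ-≡ e e' H (ℕₚ.+-cancelˡ-≡ (b 0) _ _ (trans eq (cong (ℕ._+ e' ℕ.* H) (sym head))))
  go : ∀ t → t ℕ.< suc T → b t ≡ b' t
  go zero    _ = head
  go (suc t) (s≤s t<T) = encode-injective H (b ∘ suc) (b' ∘ suc) T
    (λ s s<T → h (suc s) (s≤s s<T)) (λ s s<T → h' (suc s) (s≤s s<T)) tail t t<T

r≤total : ∀ r U i → i ℕ.< U → r i ℕ.≤ total r U
r≤total r (suc U) zero    _         = ℕₚ.m≤m+n _ _
r≤total r (suc U) (suc i) (s≤s i<U) = ℕₚ.≤-trans (r≤total (r ∘ suc) U i i<U) (ℕₚ.m≤n+m _ _)

same-quotient : ∀ A A' W .{{_ : ℕ.NonZero W}} → A DM./ W ≡ A' DM./ W → A ℕ.≤ A' ℕ.+ W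
same-quotient A A' W eq = begin
  A                                   ≡⟨ DM.m≡m%n+[m/n]*n A W ⟩
  A DM.% W ℕ.+ A DM./ W ℕ.* W         ≤⟨ ℕₚ.+-monoˡ-≤ _ (ℕₚ.<⇒≤ (DM.m%n<n A W)) ⟩
  W ℕ.+ A DM./ W ℕ.* W                ≡⟨ cong (λ z → W ℕ.+ z ℕ.* W) eq ⟩
  W ℕ.+ A' DM./ W ℕ.* W               ≤⟨ ℕₚ.+-monoʳ-≤ W (DM.m/n*n≤m A' W) ⟩
  W ℕ.+ A'                            ≡⟨ ℕₚ.+-comm W A' ⟩
  A' ℕ.+ W                            ∎
  where open ℕₚ.≤-Reasoning

-- Sizes as powers of two, growth of powers, Newton interpolation.

binomial : ℕ → ℕ → ℕ
binomial x       zero    = 1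
binomial zero    (suc k) = 0
binomial (suc x) (suc k) = binomial x k ℕ.+ binomial x (suc k)

module Analysis (𝓡 : OrderedRing) where
  open OrderedRingProperties 𝓡

  2^_ : ℕ → R
  2^ k = ι 2 ^ k

  0≤2^ : ∀ k → 0# ≤ 2^ k
  0≤2^ = ^-nonneg (0≤ι 2)

  1≤ι2 : 1# ≤ ι 2
  1≤ι2 = ι-mono-≤ {1} {2} (s≤s z≤n)

  1≤2^ : ∀ k → 1# ≤ 2^ k
  1≤2^ = 1≤^ 1≤ι2

  2^-mono-≤ : ∀ {m n} → m ℕ.≤ n → 2^ m ≤ 2^ n
  2^-mono-≤ = ^-monoʳ-≤ 1≤ι2

  ι≤2^ : ∀ {m k} → m ℕ.≤ 2 ℕ.^ k → ι m ≤ 2^ k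
  ι≤2^ {m} {k} p = subst (ι m ≤_) (ι-^ 2 k) (ι-mono-≤ p)

  0≤½^ : ∀ k → 0# ≤ ½ ^ k
  0≤½^ = ^-nonneg 0≤½

  2^*½^ : ∀ k → 2^ k * ½ ^ k ≡ 1#
  2^*½^ = ^-inverse (inv-spec 1)

  2^-pull : ∀ {j} i k → i ℕ.+ j ≡ k → ½ ^ i * 2^ k ≡ 2^ j
  2^-pull {j} i k refl = trans (cong (½ ^ i *_) (^-+ (ι 2) i j))
    (trans (sym (*-assoc _ _ _)) (trans (cong (_* 2^ j) (trans (*-comm _ _) (2^*½^ i))) (*-identityˡ _)))

  -- Sz x p q says |x| ≤ 2^(q - p)
  Sz : R → ℕ → ℕ → Set
  Sz x p q = Bd (2^ p * x) (2^ q)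

  private
    sz-alg = solve 4 (λ a b c x → (a :* b) :* (c :* x) := (b :* c) :* (a :* x)) refl
    sz-mul = solve 4 (λ a b x y → (a :* x) :* (b :* y) := (a :* b) :* (x :* y)) refl

  Bd-scale : ∀ {x m c} → 0# ≤ c → Bd x m → Bd (c * x) (c * m)
  Bd-scale p b = Bd-* (Bd-self p) b

  -- Most size estimates end here: a comparison of bounds becomes a linear inequality between
  -- exponents.
  Sz-conv : ∀ {x p q p' q'} → p' ℕ.+ q ℕ.≤ p ℕ.+ q' → Sz x p q → Sz x p' q'
  Sz-conv {x} {p} {q} {p'} {q'} le b = subst (λ z → Bd z (2^ q')) lhs (Bd-≤ rhs (Bd-scale (*-nonneg (0≤2^ p') (0≤½^ p)) b))
    where
    lhs : (2^ p' * ½ ^ p) * (2^ p * x) ≡ 2^ p' * x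
    lhs = trans (sz-alg (2^ p') (½ ^ p) (2^ p) x)
      (trans (cong (_* (2^ p' * x)) (trans (*-comm _ _) (2^*½^ p))) (*-identityˡ _))
    rhs : (2^ p' * ½ ^ p) * 2^ q ≤ 2^ q'
    rhs = ≤-trans (≤-reflexive (trans (trans (cong (_* 2^ q) (*-comm _ _)) (*-assoc _ _ _))
        (cong (½ ^ p *_) (sym (^-+ (ι 2) p' q)))))
      (≤-trans (*-monoʳ-≤ (0≤½^ p) (2^-mono-≤ le)) (≤-reflexive (2^-pull p (p ℕ.+ q') refl)))

  Sz-* : ∀ {x y p q p' q'} → Sz x p q → Sz y p' q' → Sz (x * y) (p ℕ.+ p') (q ℕ.+ q')
  Sz-* {x} {y} {p} {q} {p'} {q'} a b = subst₂ Bd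
    (trans (sz-mul (2^ p) (2^ p') x y) (cong (_* (x * y)) (sym (^-+ (ι 2) p p'))))
    (sym (^-+ (ι 2) q q')) (Bd-* a b)

  Sz-0 : ∀ {x q} → Bd x (2^ q) → Sz x 0 q
  Sz-0 {x} {q} b = subst (λ z → Bd z (2^ q)) (sym (*-identityˡ x)) b

  Sz-0⁻¹ : ∀ {x q} → Sz x 0 q → Bd x (2^ q)
  Sz-0⁻¹ {x} {q} b = subst (λ z → Bd z (2^ q)) (*-identityˡ x) b

  Sz-½^ : ∀ {x p} → Bd x (½ ^ p) → Sz x p 0
  Sz-½^ {x} {p} b = subst (Bd (2^ p * x)) (2^*½^ p) (Bd-scale (0≤2^ p) b)

  Sz-½^⁻¹ : ∀ {x p} → Sz x p 0 → Bd x (½ ^ p)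
  Sz-½^⁻¹ {x} {p} b = subst₂ Bd
    (trans (sym (*-assoc _ _ _)) (trans (cong (_* x) (trans (*-comm _ _) (2^*½^ p))) (*-identityˡ x)))
    (*-identityʳ _) (Bd-scale (0≤½^ p) b)

  Sz-Σ : ∀ n c {f p q} → n ℕ.≤ 2 ℕ.^ c → (∀ i → i ℕ.< n → Sz (f i) p q) → Sz (Σ< n f) p (c ℕ.+ q)
  Sz-Σ n c {f} {p} {q} n≤ h = subst (λ z → Bd z (2^ (c ℕ.+ q))) (Σ<-*ˡ n (2^ p) f)
    (Bd-≤ (≤-trans (*-monoˡ-≤ (0≤2^ q) (ι≤2^ {n} {c} n≤)) (≤-reflexive (sym (^-+ (ι 2) c q)))) (Bd-Σ n h))

  Sz-+ : ∀ {x y p q} → Sz x p q → Sz y p q → Sz (x + y) p (suc q)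
  Sz-+ {x} {y} {p} {q} a b = subst₂ Bd (sym (distribˡ _ _ _)) (double (2^ q)) (Bd-+ a b)
    where
    double = solve 1 (λ x → x :+ x := # 2 :* x) refl

  Sz-^ : ∀ {x p q} → Sz x p q → ∀ n → Sz (x ^ n) (p ℕ.* n) (q ℕ.* n)
  Sz-^ {x} {p} {q} a n = subst₂ Bd (trans (*-^ (2^ p) x n) (cong (_* x ^ n) (sym (^-* (ι 2) p n))))
    (sym (^-* (ι 2) q n)) (Bd-^ a n)

  -- A linear upper bound for as long as it stays below 2: with the slope doubled, each step has
  -- `y * (1# - c * y)` to spare, where `c` is twice the previous exponent.
  bernoulli : ∀ {y} → 0# ≤ y → ∀ j → ι (2 ℕ.* j) * y ≤ 1# → (1# + y) ^ j ≤ 1# + ι (2 ℕ.* j) * y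
  bernoulli {y} 0≤y zero    h = ≤-reflexive (sym (trans (cong (1# +_) (zeroˡ y)) (+-identityʳ 1#)))
  bernoulli {y} 0≤y (suc j) h = ≤-trans (*-monoʳ-≤ (+-nonneg 0≤1 0≤y) (bernoulli 0≤y j c≤1))
    (by-diff (*-nonneg 0≤y (0≤y-x c≤1)) (trans (cong (λ z → (1# + z * y) - (1# + y) * (1# + c * y)) step) (alg c y)))
    where
    c = ι (2 ℕ.* j)
    step : ι (2 ℕ.* suc j) ≡ ι 2 + c
    step = trans (cong ι (ℕₚ.*-suc 2 j)) (ι-+ 2 (2 ℕ.* j))
    c≤1 : c * y ≤ 1#
    c≤1 = ≤-trans (*-monoˡ-≤ 0≤y (ι-mono-≤ (ℕₚ.*-monoʳ-≤ 2 (ℕₚ.n≤1+n j)))) h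
    alg = solve 2 (λ c y → (# 1 :+ (# 2 :+ c) :* y) :- (# 1 :+ y) :* (# 1 :+ c :* y) := y :* (# 1 :- c :* y)) refl

  -- By `bernoulli`, (1 + 2^-(s+1))^(2^s) is at most 2; raise this to the power `k`.
  growth : ∀ s k {z j} → 0# ≤ z → z ≤ 1# + ½ ^ suc s → j ℕ.≤ 2 ℕ.^ s ℕ.* k → z ^ j ≤ 2^ k
  growth s k {z} {j} 0≤z z≤ j≤ = ≤-trans (^-mono-≤ 0≤z z≤ j)
    (≤-trans (^-monoʳ-≤ 1≤b j≤) (≤-trans (≤-reflexive (^-* b (2 ℕ.^ s) k)) (^-mono-≤ (^-nonneg (≤-trans 0≤1 1≤b) (2 ℕ.^ s)) two k)))
    where
    b = 1# + ½ ^ suc s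
    1≤b : 1# ≤ b
    1≤b = ≤-trans (≤-reflexive (sym (+-identityʳ 1#))) (+-monoʳ-≤ 1# (0≤½^ (suc s)))
    one : ι (2 ℕ.* 2 ℕ.^ s) * ½ ^ suc s ≡ 1#
    one = trans (cong (_* ½ ^ suc s) (ι-^ 2 (suc s))) (2^*½^ (suc s))
    two : b ^ (2 ℕ.^ s) ≤ ι 2
    two = ≤-trans (bernoulli (0≤½^ (suc s)) (2 ℕ.^ s) (≤-reflexive one))
      (≤-reflexive (cong (1# +_) one))

  -- W x g = Σ_j C(x,j) g(j): Newton's forward interpolation with differences g
  W : ℕ → (ℕ → R) → R
  W zero    g = g 0
  W (suc x) g = W x g + W x (g ∘ suc)

  W-cong : ∀ x {g g'} → (∀ t → g t ≡ g' t) → W x g ≡ W x g'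
  W-cong zero    h = h 0
  W-cong (suc x) h = cong₂ _+_ (W-cong x h) (W-cong x (h ∘ suc))

  private
    add-swap = solve 4 (λ a b c d → (a :+ b) :+ (c :+ d) := (a :+ c) :+ (b :+ d)) refl

  W-+ : ∀ x g g' → W x (λ t → g t + g' t) ≡ W x g + W x g'
  W-+ zero    g g' = refl
  W-+ (suc x) g g' = trans (cong₂ _+_ (W-+ x g g') (W-+ x (g ∘ suc) (g' ∘ suc))) (add-swap _ _ _ _)

  W-* : ∀ x c g → W x (λ t → c * g t) ≡ c * W x g
  W-* zero    c g = refl
  W-* (suc x) c g = trans (cong₂ _+_ (W-* x c g) (W-* x c (g ∘ suc))) (sym (distribˡ _ _ _))

  W-0 : ∀ x → W x (λ _ → 0#) ≡ 0#
  W-0 zero    = refl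
  W-0 (suc x) = trans (cong₂ _+_ (W-0 x) (W-0 x)) (+-identityʳ 0#)

  W-Σ : ∀ x n (g : ℕ → ℕ → R) → W x (λ t → Σ< n (λ i → g i t)) ≡ Σ< n (λ i → W x (g i))
  W-Σ x zero    g = W-0 x
  W-Σ x (suc n) g = trans (W-+ x _ (g n)) (cong (_+ W x (g n)) (W-Σ x n g))

  -- Binomial theorem: the dominating differences `m * h ^ t` sum to exactly `m * (1# + h) ^ x`.
  W-Bd : ∀ x {g m h} → (∀ t → Bd (g t) (m * h ^ t)) → Bd (W x g) (m * (1# + h) ^ x)
  W-Bd zero    {g} {m} {h} b = b 0
  W-Bd (suc x) {g} {m} {h} b = Bd-≤ (≤-reflexive (alg m h ((1# + h) ^ x)))
    (Bd-+ (W-Bd x b) (W-Bd x {m = m * h} (λ t → Bd-≤ (≤-reflexive (sym (*-assoc m h _))) (b (suc t)))))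
    where
    alg = solve 3 (λ m h p → m :* p :+ m :* h :* p := m :* ((# 1 :+ h) :* p)) refl

  -- For v = 1 + y this is the `t`-th forward difference at 0 of x ↦ C(x,k) v^x. The recursion
  -- combines the product rule with Pascal's rule, and the generating function in `k` is (y + v
  -- z)^t.
  diff : R → R → ℕ → ℕ → R
  diff v y zero    zero    = 1#
  diff v y zero    (suc k) = 0#
  diff v y (suc t) zero    = y * diff v y t zero
  diff v y (suc t) (suc k) = y * diff v y t (suc k) + v * diff v y t k

  newton : ∀ v y → v ≡ 1# + y → ∀ x k → W x (λ t → diff v y t k) ≡ ι (binomial x k) * v ^ x
  newton v y eq zero zero = sym (*-identityˡ 1#)
  newton v y eq zero (suc k) = sym (zeroˡ 1#)
  newton v y eq (suc x) zero = trans (cong₂ _+_ (newton v y eq x zero)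
      (trans (W-* x y (λ t → diff v y t zero)) (cong (y *_) (newton v y eq x zero))))
    (trans (alg y (v ^ x)) (cong (λ z → ι 1 * (z * v ^ x)) (sym eq)))
    where
    alg = solve 2 (λ y p → # 1 :* p :+ y :* (# 1 :* p) := # 1 :* ((# 1 :+ y) :* p)) refl
  newton v y eq (suc x) (suc k) = begin
      W x (λ t → diff v y t (suc k)) + W x (λ t → y * diff v y t (suc k) + v * diff v y t k)
        ≡⟨ cong₂ _+_ (newton v y eq x (suc k)) (trans (W-+ x _ _) (cong₂ _+_
            (trans (W-* x y _) (cong (y *_) (newton v y eq x (suc k))))
            (trans (W-* x v _) (cong (v *_) (newton v y eq x k))))) ⟩
      b₁ * p + (y * (b₁ * p) + v * (b₀ * p))  ≡⟨ alg b₁ b₀ y v p ⟩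
      (1# + y) * (b₁ * p) + v * (b₀ * p)      ≡⟨ cong (λ z → z * (b₁ * p) + v * (b₀ * p)) (sym eq) ⟩
      v * (b₁ * p) + v * (b₀ * p)             ≡⟨ alg' b₁ b₀ v p ⟩
      (b₀ + b₁) * (v * p)                     ≡⟨ cong (_* (v * p)) (sym (ι-+ (binomial x k) (binomial x (suc k)))) ⟩
      ι (binomial (suc x) (suc k)) * (v * p)  ∎
    where
    open ≡-Reasoning
    p = v ^ x
    b₀ = ι (binomial x k)
    b₁ = ι (binomial x (suc k))
    alg = solve 5 (λ b₁ b₀ y v p → b₁ :* p :+ (y :* (b₁ :* p) :+ v :* (b₀ :* p)) := (# 1 :+ y) :* (b₁ :* p) :+ v :* (b₀ :* p)) refl
    alg' = solve 4 (λ b₁ b₀ v p → v :* (b₁ :* p) :+ v :* (b₀ :* p) := (b₀ :+ b₁) :* (v :* p)) refl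

  -- Cauchy's estimate for the coefficients of (y + v z)^t at the radius 1/w. The radius stays free
  -- because low and high differences call for different ones.
  diff-Bd : ∀ {v y V Y w w'} → Bd v V → Bd y Y → 0# ≤ w → 0# ≤ w' → w * w' ≡ 1# →
    ∀ t k → Bd (diff v y t k) (w ^ k * (Y + V * w') ^ t)
  diff-Bd bv by 0≤w 0≤w' ww' zero zero = Bd-≤ (≤-reflexive (sym (*-identityˡ 1#))) (Bd-self 0≤1)
  diff-Bd bv by 0≤w 0≤w' ww' zero (suc k) = Bd-0# (*-nonneg (^-nonneg 0≤w (suc k)) 0≤1)
  diff-Bd {V = V} {Y} {w} {w'} bv by 0≤w 0≤w' ww' (suc t) zero =
    Bd-≤ (by-diff (*-nonneg (*-nonneg (Bd⇒0≤ bv) 0≤w') (^-nonneg 0≤s t)) (alg Y V w' (s ^ t)))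
      (Bd-* by (diff-Bd bv by 0≤w 0≤w' ww' t zero))
    where
    s = Y + V * w'
    0≤s = +-nonneg (Bd⇒0≤ by) (*-nonneg (Bd⇒0≤ bv) 0≤w')
    alg = solve 4 (λ Y V w p → # 1 :* ((Y :+ V :* w) :* p) :- Y :* (# 1 :* p) := V :* w :* p) refl
  diff-Bd {V = V} {Y} {w} {w'} bv by 0≤w 0≤w' ww' (suc t) (suc k) =
    Bd-≤ (≤-reflexive (trans (alg Y V (w ^ k) w (s ^ t))
        (trans (cong (λ z → w * w ^ k * (Y * s ^ t) + V * z * (w ^ k * s ^ t)) (sym ww')) (alg' Y V (w ^ k) w w' (s ^ t)))))
      (Bd-+ (Bd-* by (diff-Bd bv by 0≤w 0≤w' ww' t (suc k))) (Bd-* bv (diff-Bd bv by 0≤w 0≤w' ww' t k)))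
    where
    s = Y + V * w'
    alg = solve 5 (λ Y V wk w p → Y :* ((w :* wk) :* p) :+ V :* (wk :* p) := w :* wk :* (Y :* p) :+ V :* # 1 :* (wk :* p)) refl
    alg' = solve 6 (λ Y V wk w w' p → w :* wk :* (Y :* p) :+ V :* (w :* w') :* (wk :* p) := (w :* wk) :* ((Y :+ V :* w') :* p)) refl

  -- The left side is a single term of the binomial expansion of the right side.
  binomial-bound : ∀ {h} → 0# ≤ h → ∀ x k → ι (binomial x k) * h ^ k ≤ (1# + h) ^ x
  binomial-bound {h} p x zero = ≤-trans (≤-reflexive (*-identityˡ 1#)) (1≤^ 1≤1+h x)
    where 1≤1+h = ≤-trans (≤-reflexive (sym (+-identityʳ 1#))) (+-monoʳ-≤ 1# p)
  binomial-bound {h} p zero (suc k) = ≤-trans (≤-reflexive (zeroˡ _)) 0≤1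
  binomial-bound {h} p (suc x) (suc k) = ≤-trans
    (≤-reflexive (trans (cong (_* (h * h ^ k)) (ι-+ (binomial x k) (binomial x (suc k)))) (alg _ _ h (h ^ k))))
    (≤-trans (+-mono-≤ (*-monoʳ-≤ p (binomial-bound p x k)) (binomial-bound p x (suc k))) (≤-reflexive (alg' h _)))
    where
    alg = solve 4 (λ a b h p → (a :+ b) :* (h :* p) := h :* (a :* p) :+ b :* (h :* p)) refl
    alg' = solve 2 (λ h p → h :* p :+ p := (# 1 :+ h) :* p) refl

-- Siegel's lemma by the pigeonhole principle.

module Siegel (𝓡 : OrderedRing) where
  open OrderedRingProperties 𝓡
  open Analysis 𝓡

  ιℤ-pos-sub : ∀ m n → ιℤ (ℤ.+ m ℤ.- ℤ.+ n) ≡ ι m - ι n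
  ιℤ-pos-sub m n = trans (ιℤ-+ (ℤ.+ m) (ℤ.- (ℤ.+ n))) (cong (ι m +_) (ιℤ-neg (ℤ.+ n)))

  ∣∣-Bd : ∀ i {m} → ℤ.∣ i ∣ ℕ.≤ m → Bd (ιℤ i) (ι m)
  ∣∣-Bd (ℤ.+ n)  p = Bd-0≤ (0≤ι n) (ι-mono-≤ p)
  ∣∣-Bd -[1+ n ] p = Bd-neg (Bd-0≤ (0≤ι (suc n)) (ι-mono-≤ p))

  ι-Bd-diff : ∀ {A A' w} → A ℕ.≤ A' ℕ.+ w → A' ℕ.≤ A ℕ.+ w → Bd (ι A - ι A') (ι w)
  ι-Bd-diff {A} {A'} {w} p q = bd
    (by-diff (0≤y-x (≤-trans (ι-mono-≤ q) (≤-reflexive (ι-+ A w)))) (l (ι A) (ι A') (ι w)))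
    (by-diff (0≤y-x (≤-trans (ι-mono-≤ p) (≤-reflexive (ι-+ A' w)))) (u (ι A) (ι A') (ι w)))
    where
    l = solve 3 (λ a b w → (a :- b) :- :- w := (a :+ w) :- b) refl
    u = solve 3 (λ a b w → w :- (a :- b) := (b :+ w) :- a) refl

  -- Unknown `i` has `r i` bits and coefficient `κ t i` in form `t`; the forms take values up to 2^ρ
  -- and are to be made smaller than 2^-ω. Unknowns of unequal size are essential: they balance the
  -- growth of binomial coefficients.
  module Box (floor : ∀ v → ∃[ i ] Bd (v - ιℤ i) (ι 2)) (reflect : ∀ i j → ιℤ i ≤ ιℤ j → i ℤ.≤ j)
    (U T : ℕ) (r : ℕ → ℕ) (κ : ℕ → ℕ → R) (ρ ω : ℕ)
    (range : ∀ t → t ℕ.< T → ∀ (c : ℕ → ℕ) → (∀ i → i ℕ.< U → c i ℕ.< 2 ℕ.^ r i) →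
      Bd (Σ< U (λ i → ι (c i) * κ t i)) (2^ ρ)) where

    -- `2^ p` bounds the rounding error of a form: `U` terms, each an integer of at most `total r U`
    -- bits times an error of at most 2. A box of width `2^ p` together with this error makes
    -- 2^(p+1), which is 2^-ω after division by the scale `2^ s`.
    p s : ℕ
    p = U ℕ.+ suc (total r U)
    s = ω ℕ.+ suc p

    approx : ℕ → ℕ → ℤ
    approx t i = proj₁ (floor (2^ s * κ t i))

    error : ∀ t (d : ℕ → ℤ) → (∀ i → i ℕ.< U → ℤ.∣ d i ∣ ℕ.≤ 2 ℕ.^ r i) →
      Bd (2^ s * Σ< U (λ i → ιℤ (d i) * κ t i) - Σ< U (λ i → ιℤ (d i) * ιℤ (approx t i))) (2^ p)
    error t d h = subst (λ z → Bd z (2^ p)) (sym eq) (Sz-0⁻¹ {q = p} (Sz-Σ U U {p = 0} {q = suc (total r U)} (ℕₚ.<⇒≤ (n<2^n U)) term))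
      where
      δ = λ i → 2^ s * κ t i - ιℤ (approx t i)
      alg = solve 4 (λ s d k a → s :* (d :* k) :- d :* a := d :* (s :* k :- a)) refl
      eq : 2^ s * Σ< U (λ i → ιℤ (d i) * κ t i) - Σ< U (λ i → ιℤ (d i) * ιℤ (approx t i)) ≡ Σ< U (λ i → ιℤ (d i) * δ i)
      eq = trans (cong₂ _+_ (sym (Σ<-*ˡ U (2^ s) _)) (trans (neg-1 _) (sym (Σ<-*ˡ U (- 1#) _))))
        (trans (sym (Σ<-+ U _ _)) (Σ<-cong U (λ i _ → trans (cong (2^ s * (ιℤ (d i) * κ t i) +_) (sym (neg-1 _)))
          (alg (2^ s) (ιℤ (d i)) (κ t i) (ιℤ (approx t i))))))
        where
        neg-1 = solve 1 (λ x → :- x := (:- # 1) :* x) refl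
      term : ∀ i → i ℕ.< U → Sz (ιℤ (d i) * δ i) 0 (suc (total r U))
      term i i<U = Sz-0 {q = suc (total r U)} (Bd-≤ (≤-reflexive (*-comm _ _)) (Bd-* (Bd-≤ (≤-trans (≤-reflexive (ι-^ 2 (r i)))
          (2^-mono-≤ (r≤total r U i i<U))) (∣∣-Bd (d i) (h i i<U))) (proj₂ (floor (2^ s * κ t i)))))

    partial : ℕ → (ℕ → ℕ) → ℕ → ℤ
    partial t c zero    = ℤ.+ 0
    partial t c (suc n) = partial t c n ℤ.+ ℤ.+ c n ℤ.* approx t n

    form : ℕ → (ℕ → ℕ) → ℤ
    form t c = partial t c U

    ιℤ-form : ∀ t c → ιℤ (form t c) ≡ Σ< U (λ i → ι (c i) * ιℤ (approx t i))
    ιℤ-form t c = go U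
      where
      go : ∀ n → ιℤ (partial t c n) ≡ Σ< n (λ i → ι (c i) * ιℤ (approx t i))
      go zero    = refl
      go (suc n) = trans (ιℤ-+ (partial t c n) (ℤ.+ c n ℤ.* approx t n))
        (cong₂ _+_ (go n) (ιℤ-* (ℤ.+ c n) (approx t n)))

    offset : ℕ
    offset = 2 ℕ.^ suc (s ℕ.+ ρ)

    Small : (ℕ → ℕ) → Set
    Small c = ∀ i → i ℕ.< U → c i ℕ.< 2 ℕ.^ r i

    p≤s : p ℕ.≤ s
    p≤s = ℕₚ.≤-trans (ℕₚ.n≤1+n p) (ℕₚ.m≤n+m (suc p) ω)

    form-Bd : ∀ t c → t ℕ.< T → Small c → Bd (ιℤ (form t c)) (ι offset)
    form-Bd t c t<T small = subst₂ Bd eq (sym (ι-^ 2 (suc (s ℕ.+ ρ))))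
      (Bd-≤ (≤-reflexive (dbl (2^ (s ℕ.+ ρ))))
        (Bd-- (Bd-≤ (≤-reflexive (sym (^-+ (ι 2) s ρ))) (Bd-scale (0≤2^ s) (range t t<T c small)))
          (Bd-≤ (2^-mono-≤ (ℕₚ.≤-trans p≤s (ℕₚ.m≤m+n s ρ)))
            (error t (λ i → ℤ.+ c i) (λ i i<U → ℕₚ.<⇒≤ (small i i<U))))))
      where
      dbl = solve 1 (λ x → x :+ x := # 2 :* x) refl
      cancel = solve 2 (λ x y → x :- (x :- y) := y) refl
      eq = trans (cancel _ _) (sym (ιℤ-form t c))

    lifted : ℕ → (ℕ → ℕ) → ℕ
    lifted t c = ℤ.∣ form t c ℤ.+ ℤ.+ offset ∣

    lifted-spec : ∀ t c → t ℕ.< T → Small c → ι (lifted t c) ≡ ιℤ (form t c) + ι offset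
    lifted-spec t c t<T small = trans (cong ιℤ (ℤₚ.0≤i⇒+∣i∣≡i nonneg)) (ιℤ-+ (form t c) (ℤ.+ offset))
      where
      back = solve 2 (λ f o → f :- :- o := f :+ o) refl
      nonneg : ℤ.+ 0 ℤ.≤ form t c ℤ.+ ℤ.+ offset
      nonneg = reflect (ℤ.+ 0) _ (≤-trans (0≤y-x (Bd.lower (form-Bd t c t<T small)))
        (≤-reflexive (trans (back _ _) (sym (ιℤ-+ (form t c) (ℤ.+ offset))))))

    lifted-≤ : ∀ t c → t ℕ.< T → Small c → lifted t c ℕ.≤ 2 ℕ.* offset
    lifted-≤ t c t<T small = ℤₚ.drop‿+≤+ (reflect _ _ (≤-trans (≤-reflexive (lifted-spec t c t<T small))
      (≤-trans (+-mono-≤ (Bd.upper (form-Bd t c t<T small)) ≤-refl)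
        (≤-reflexive (trans (dbl (ι offset)) (sym (ι-* 2 offset)))))))
      where
      dbl = solve 1 (λ x → x :+ x := # 2 :* x) refl

    box : ℕ → (ℕ → ℕ) → ℕ
    box t c = (lifted t c DM./ 2 ℕ.^ p) {{2^≢0 p}}

    -- The lifted forms stay below 2^(s+ρ+3) = 2^(h+p), so `h` bits name a box of width 2^p.
    h : ℕ
    h = ρ ℕ.+ ω ℕ.+ 4

    box< : ∀ t c → t ℕ.< T → Small c → box t c ℕ.< 2 ℕ.^ h
    box< t c t<T small = DM.m<n*o⇒m/o<n {{2^≢0 p}} (ℕₚ.≤-<-trans (lifted-≤ t c t<T small)
      (ℕₚ.<-≤-trans (ℕₚ.^-monoʳ-< 2 (s≤s (s≤s z≤n)) (ℕₚ.n<1+n (2 ℕ.+ (s ℕ.+ ρ))))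
        (ℕₚ.≤-reflexive (trans (cong (2 ℕ.^_) (arith ρ ω p)) (ℕₚ.^-distribˡ-+-* 2 h p)))))
      where
      arith : ∀ ρ ω p → 3 ℕ.+ (ω ℕ.+ suc p ℕ.+ ρ) ≡ ρ ℕ.+ ω ℕ.+ 4 ℕ.+ p
      arith = solve-∀

    same-box : ∀ t c c' → t ℕ.< T → Small c → Small c' → box t c ≡ box t c' →
      Bd (2^ ω * Σ< U (λ i → (ι (c i) - ι (c' i)) * κ t i)) 1#
    same-box t c c' t<T sc sc' eq = Sz-conv {p = s} {q = suc p} {p' = ω} {q' = 0} (ℕₚ.≤-reflexive (arith ω p))
        (subst₂ Bd lhs (dbl (2^ p)) (Bd-+ (error t d d≤) (subst₂ Bd forms (ι-^ 2 p) boxes)))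
      where
      dbl = solve 1 (λ x → x :+ x := # 2 :* x) refl
      arith : ∀ ω p → ω ℕ.+ suc p ≡ ω ℕ.+ suc p ℕ.+ 0
      arith = solve-∀
      d : ℕ → ℤ
      d i = ℤ.+ c i ℤ.- ℤ.+ c' i
      d≤ : ∀ i → i ℕ.< U → ℤ.∣ d i ∣ ℕ.≤ 2 ℕ.^ r i
      d≤ i i<U = ℕₚ.≤-trans (ℕₚ.≤-reflexive (cong ℤ.∣_∣ (ℤₚ.m-n≡m⊖n (c i) (c' i))))
        (ℕₚ.≤-trans (ℤₚ.∣m⊝n∣≤m⊔n (c i) (c' i)) (ℕₚ.⊔-lub (ℕₚ.<⇒≤ (sc i i<U)) (ℕₚ.<⇒≤ (sc' i i<U))))
      boxes : Bd (ι (lifted t c) - ι (lifted t c')) (ι (2 ℕ.^ p))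
      boxes = ι-Bd-diff (same-quotient _ _ (2 ℕ.^ p) {{2^≢0 p}} eq) (same-quotient _ _ (2 ℕ.^ p) {{2^≢0 p}} (sym eq))
      neg-1 = solve 1 (λ x → :- x := (:- # 1) :* x) refl
      mul-sub = solve 3 (λ a b k → a :* k :+ (:- # 1) :* (b :* k) := (a :- b) :* k) refl
      cancel-o = solve 3 (λ a b o → (a :+ o) :- (b :+ o) := a :- b) refl
      split : Σ< U (λ i → ιℤ (d i) * ιℤ (approx t i)) ≡ ιℤ (form t c) - ιℤ (form t c')
      split = sym (trans (cong₂ _-_ (ιℤ-form t c) (ιℤ-form t c')) (trans (cong (_ +_) (trans (neg-1 _) (sym (Σ<-*ˡ U (- 1#) _))))
        (trans (sym (Σ<-+ U _ _)) (Σ<-cong U (λ i _ → trans (mul-sub (ι (c i)) (ι (c' i)) _)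
          (cong (_* ιℤ (approx t i)) (sym (ιℤ-pos-sub (c i) (c' i)))))))))
      forms : ι (lifted t c) - ι (lifted t c') ≡ Σ< U (λ i → ιℤ (d i) * ιℤ (approx t i))
      forms = trans (cong₂ _-_ (lifted-spec t c t<T sc) (lifted-spec t c' t<T sc')) (trans (cancel-o _ _ _) (sym split))
      back = solve 2 (λ x y → (x :- y) :+ y := x) refl
      lhs : (2^ s * Σ< U (λ i → ιℤ (d i) * κ t i) - Σ< U (λ i → ιℤ (d i) * ιℤ (approx t i)))
        + Σ< U (λ i → ιℤ (d i) * ιℤ (approx t i)) ≡ 2^ s * Σ< U (λ i → (ι (c i) - ι (c' i)) * κ t i)
      lhs = trans (back _ _) (cong (2^ s *_) (Σ<-cong U (λ i _ → cong (_* κ t i) (ιℤ-pos-sub (c i) (c' i)))))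

    -- There are `2 ^ total r U` vectors but only `2 ^ (h * T)` tuples of boxes; the solution is the
    -- difference of two vectors that share all their boxes.
    siegel : T ℕ.* (ρ ℕ.+ ω ℕ.+ 4) ℕ.< total r U → ∃[ d ] (¬ (∀ i → i ℕ.< U → d i ≡ ℤ.+ 0)
      × (∀ i → i ℕ.< U → ℤ.∣ d i ∣ ℕ.≤ 2 ℕ.^ r i)
      × (∀ t → t ℕ.< T → Bd (2^ ω * Σ< U (λ i → ιℤ (d i) * κ t i)) 1#))
    siegel enough = d , nonzero , d≤ , small
      where
      H = 2 ℕ.^ h
      c : Fin (2 ℕ.^ total r U) → ℕ → ℕ
      c N = digit r (toℕ N)
      c-small : ∀ N → Small (c N)
      c-small N i _ = digit< r (toℕ N) i
      boxes< : ∀ N t → t ℕ.< T → box t (c N) ℕ.< H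
      boxes< N t t<T = box< t (c N) t<T (c-small N)
      fewer : H ℕ.^ T ℕ.< 2 ℕ.^ total r U
      fewer = ℕₚ.≤-<-trans (ℕₚ.≤-reflexive (trans (ℕₚ.^-*-assoc 2 h T) (cong (2 ℕ.^_) (ℕₚ.*-comm h T))))
        (ℕₚ.^-monoʳ-< 2 (s≤s (s≤s z≤n)) enough)
      code : Fin (2 ℕ.^ total r U) → Fin (H ℕ.^ T)
      code N = fromℕ< (encode< H (λ t → box t (c N)) T (boxes< N))
      collision = Finₚ.pigeonhole fewer code
      N₁ = proj₁ collision
      N₂ = proj₁ (proj₂ collision)
      same : ∀ t → t ℕ.< T → box t (c N₁) ≡ box t (c N₂)
      same = encode-injective H {{2^≢0 h}} _ _ T (boxes< N₁) (boxes< N₂)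
        (trans (sym (Finₚ.toℕ-fromℕ< _)) (trans (cong toℕ (proj₂ (proj₂ (proj₂ collision)))) (Finₚ.toℕ-fromℕ< _)))
      d : ℕ → ℤ
      d i = ℤ.+ c N₁ i ℤ.- ℤ.+ c N₂ i
      nonzero : ¬ (∀ i → i ℕ.< U → d i ≡ ℤ.+ 0)
      nonzero all0 = ℕₚ.<⇒≢ (proj₁ (proj₂ (proj₂ collision)))
        (digit-injective r U _ _ (Finₚ.toℕ<n N₁) (Finₚ.toℕ<n N₂)
          (λ i i<U → ℤₚ.+-injective (ℤₚ.i-j≡0⇒i≡j _ _ (all0 i i<U))))
      d≤ : ∀ i → i ℕ.< U → ℤ.∣ d i ∣ ℕ.≤ 2 ℕ.^ r i
      d≤ i i<U = ℕₚ.≤-trans (ℕₚ.≤-reflexive (cong ℤ.∣_∣ (ℤₚ.m-n≡m⊖n (c N₁ i) (c N₂ i))))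
        (ℕₚ.≤-trans (ℤₚ.∣m⊝n∣≤m⊔n (c N₁ i) (c N₂ i)) (ℕₚ.⊔-lub (ℕₚ.<⇒≤ (c-small N₁ i i<U)) (ℕₚ.<⇒≤ (c-small N₂ i i<U))))
      small : ∀ t → t ℕ.< T → Bd (2^ ω * Σ< U (λ i → ιℤ (d i) * κ t i)) 1#
      small t t<T = subst (λ z → Bd (2^ ω * z) 1#)
        (Σ<-cong U (λ i _ → cong (_* κ t i) (sym (ιℤ-pos-sub (c N₁ i) (c N₂ i)))))
        (same-box t (c N₁) (c N₂) t<T (c-small N₁) (c-small N₂) (same t t<T))

-- The ordered field generated by the real root of the cubic.

-- The interface that hides the concrete coordinates. Clearing denominators through `integral` is
-- the source of decidable equality, of cancellation and of rounding.
record CubicField : Set₁ where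
  field
    orderedRing : OrderedRing
  open OrderedRingProperties orderedRing
  field
    1≰0      : ¬ (1# ≤ 0#)
    α        : R
    α³       : α * α * α ≡ α * α + 1#
    α-lower  : ι 4 ≤ ι 3 * α
    α-upper  : ι 2 * α ≤ ι 3
    integral : ∀ x → ∃[ d ] ∃[ a ] ∃[ b ] ∃[ c ] (ι (suc d) * x ≡ ιℤ a + ιℤ b * α + ιℤ c * (α * α))

module Construction where
  open ℚ-Solver.+-*-Solver using (solve; con; _:+_; _:*_; _:-_; :-_; _:=_)

  -- cub x y z stands for x + yα + zα²
  record ℚα : Set where
    constructor cub
    field
      c₀ c₁ c₂ : ℚ
  open ℚα

  cub-cong : ∀ {x x' y y' z z'} → x ≡ x' → y ≡ y' → z ≡ z' → cub x y z ≡ cub x' y' z'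
  cub-cong refl refl refl = refl

  infixl 6 _+_
  infixl 7 _*_
  infix  8 -_

  _+_ : ℚα → ℚα → ℚα
  cub x y z + cub x' y' z' = cub (x ℚ.+ x') (y ℚ.+ y') (z ℚ.+ z')

  -_ : ℚα → ℚα
  - cub x y z = cub (ℚ.- x) (ℚ.- y) (ℚ.- z)

  _*_ : ℚα → ℚα → ℚα
  cub a b c * cub d e f = cub
    (a ℚ.* d ℚ.+ (b ℚ.* f ℚ.+ c ℚ.* e) ℚ.+ c ℚ.* f)
    (a ℚ.* e ℚ.+ b ℚ.* d ℚ.+ c ℚ.* f)
    (a ℚ.* f ℚ.+ b ℚ.* e ℚ.+ c ℚ.* d ℚ.+ (b ℚ.* f ℚ.+ c ℚ.* e) ℚ.+ c ℚ.* f)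

  embed : ℚ → ℚα
  embed q = cub q 0ℚ 0ℚ

  0# 1# : ℚα
  0# = embed 0ℚ
  1# = embed 1ℚ

  +-assoc : ∀ u v w → (u + v) + w ≡ u + (v + w)
  +-assoc (cub a b c) (cub d e f) (cub x y z) = cub-cong (ℚₚ.+-assoc a d x) (ℚₚ.+-assoc b e y) (ℚₚ.+-assoc c f z)

  +-comm : ∀ u v → u + v ≡ v + u
  +-comm (cub a b c) (cub d e f) = cub-cong (ℚₚ.+-comm a d) (ℚₚ.+-comm b e) (ℚₚ.+-comm c f)

  +-identityˡ : ∀ u → 0# + u ≡ u
  +-identityˡ (cub a b c) = cub-cong (ℚₚ.+-identityˡ a) (ℚₚ.+-identityˡ b) (ℚₚ.+-identityˡ c)

  +-inverseˡ : ∀ u → - u + u ≡ 0#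
  +-inverseˡ (cub a b c) = cub-cong (ℚₚ.+-inverseˡ a) (ℚₚ.+-inverseˡ b) (ℚₚ.+-inverseˡ c)

  *-comm : ∀ u v → u * v ≡ v * u
  *-comm (cub a b c) (cub d e f) = cub-cong
    (solve 6 (λ a b c d e f → a :* d :+ (b :* f :+ c :* e) :+ c :* f := d :* a :+ (e :* c :+ f :* b) :+ f :* c) refl a b c d e f)
    (solve 6 (λ a b c d e f → a :* e :+ b :* d :+ c :* f := d :* b :+ e :* a :+ f :* c) refl a b c d e f)
    (solve 6 (λ a b c d e f → a :* f :+ b :* e :+ c :* d :+ (b :* f :+ c :* e) :+ c :* f
      := d :* c :+ e :* b :+ f :* a :+ (e :* c :+ f :* b) :+ f :* c) refl a b c d e f)

  *-identityˡ : ∀ u → 1# * u ≡ u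
  *-identityˡ (cub a b c) = cub-cong
    (solve 3 (λ a b c → con 1ℚ :* a :+ (con 0ℚ :* c :+ con 0ℚ :* b) :+ con 0ℚ :* c := a) refl a b c)
    (solve 3 (λ a b c → con 1ℚ :* b :+ con 0ℚ :* a :+ con 0ℚ :* c := b) refl a b c)
    (solve 3 (λ a b c → con 1ℚ :* c :+ con 0ℚ :* b :+ con 0ℚ :* a :+ (con 0ℚ :* c :+ con 0ℚ :* b) :+ con 0ℚ :* c := c) refl a b c)

  distribˡ : ∀ u v w → u * (v + w) ≡ u * v + u * w
  distribˡ (cub a b c) (cub d e f) (cub x y z) = cub-cong
    (solve 9 (λ a b c d e f x y z → a :* (d :+ x) :+ (b :* (f :+ z) :+ c :* (e :+ y)) :+ c :* (f :+ z)
      := (a :* d :+ (b :* f :+ c :* e) :+ c :* f) :+ (a :* x :+ (b :* z :+ c :* y) :+ c :* z)) refl a b c d e f x y z)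
    (solve 9 (λ a b c d e f x y z → a :* (e :+ y) :+ b :* (d :+ x) :+ c :* (f :+ z)
      := (a :* e :+ b :* d :+ c :* f) :+ (a :* y :+ b :* x :+ c :* z)) refl a b c d e f x y z)
    (solve 9 (λ a b c d e f x y z → a :* (f :+ z) :+ b :* (e :+ y) :+ c :* (d :+ x) :+ (b :* (f :+ z) :+ c :* (e :+ y)) :+ c :* (f :+ z)
      := (a :* f :+ b :* e :+ c :* d :+ (b :* f :+ c :* e) :+ c :* f) :+ (a :* z :+ b :* y :+ c :* x :+ (b :* z :+ c :* y) :+ c :* z))
      refl a b c d e f x y z)

  *-assoc : ∀ u v w → (u * v) * w ≡ u * (v * w)
  *-assoc (cub a b c) (cub d e f) (cub x y z) = cub-cong
    (solve 9 (λ a b c d e f x y z →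
      let p = a :* d :+ (b :* f :+ c :* e) :+ c :* f
          q = a :* e :+ b :* d :+ c :* f
          r = a :* f :+ b :* e :+ c :* d :+ (b :* f :+ c :* e) :+ c :* f
          p' = d :* x :+ (e :* z :+ f :* y) :+ f :* z
          q' = d :* y :+ e :* x :+ f :* z
          r' = d :* z :+ e :* y :+ f :* x :+ (e :* z :+ f :* y) :+ f :* z
      in p :* x :+ (q :* z :+ r :* y) :+ r :* z := a :* p' :+ (b :* r' :+ c :* q') :+ c :* r') refl a b c d e f x y z)
    (solve 9 (λ a b c d e f x y z →
      let p = a :* d :+ (b :* f :+ c :* e) :+ c :* f
          q = a :* e :+ b :* d :+ c :* f
          r = a :* f :+ b :* e :+ c :* d :+ (b :* f :+ c :* e) :+ c :* f
          p' = d :* x :+ (e :* z :+ f :* y) :+ f :* z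
          q' = d :* y :+ e :* x :+ f :* z
          r' = d :* z :+ e :* y :+ f :* x :+ (e :* z :+ f :* y) :+ f :* z
      in p :* y :+ q :* x :+ r :* z := a :* q' :+ b :* p' :+ c :* r') refl a b c d e f x y z)
    (solve 9 (λ a b c d e f x y z →
      let p = a :* d :+ (b :* f :+ c :* e) :+ c :* f
          q = a :* e :+ b :* d :+ c :* f
          r = a :* f :+ b :* e :+ c :* d :+ (b :* f :+ c :* e) :+ c :* f
          p' = d :* x :+ (e :* z :+ f :* y) :+ f :* z
          q' = d :* y :+ e :* x :+ f :* z
          r' = d :* z :+ e :* y :+ f :* x :+ (e :* z :+ f :* y) :+ f :* z
      in p :* z :+ q :* y :+ r :* x :+ (q :* z :+ r :* y) :+ r :* z
        := a :* r' :+ b :* q' :+ c :* p' :+ (b :* r' :+ c :* q') :+ c :* r') refl a b c d e f x y z)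

  isCommutativeRing : IsCommutativeRing _≡_ _+_ _*_ -_ 0# 1#
  isCommutativeRing = record
    { isRing = record
      { +-isAbelianGroup = record
        { isGroup = record
          { isMonoid = record
            { isSemigroup = record
              { isMagma = record { isEquivalence = isEquivalence ; ∙-cong = cong₂ _+_ }
              ; assoc = +-assoc }
            ; identity = +-identityˡ , λ u → trans (+-comm u 0#) (+-identityˡ u) }
          ; inverse = +-inverseˡ , λ u → trans (+-comm u (- u)) (+-inverseˡ u)
          ; ⁻¹-cong = cong -_ }
        ; comm = +-comm }
      ; *-cong = cong₂ _*_
      ; *-assoc = *-assoc
      ; *-identity = *-identityˡ , λ u → trans (*-comm u 1#) (*-identityˡ u)
      ; distrib = distribˡ , λ u v w → trans (*-comm (v + w) u) (trans (distribˡ u v w) (cong₂ _+_ (*-comm u v) (*-comm u w))) }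
    ; *-comm = *-comm }

  -- multiplication by α
  step : ℚα → ℚα
  step (cub x y z) = cub z x (y ℚ.+ z)

  step-+ : ∀ u v → step (u + v) ≡ step u + step v
  step-+ (cub a b c) (cub d e f) = cub-cong refl refl
    (solve 4 (λ b c e f → b :+ e :+ (c :+ f) := b :+ c :+ (e :+ f)) refl b c e f)

  step-* : ∀ u v → step (u * v) ≡ step u * v
  step-* (cub a b c) (cub d e f) = cub-cong
    (solve 6 (λ a b c d e f → a :* f :+ b :* e :+ c :* d :+ (b :* f :+ c :* e) :+ c :* f
      := c :* d :+ (a :* f :+ (b :+ c) :* e) :+ (b :+ c) :* f) refl a b c d e f)
    (solve 6 (λ a b c d e f → a :* d :+ (b :* f :+ c :* e) :+ c :* f := c :* e :+ a :* d :+ (b :+ c) :* f) refl a b c d e f)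
    (solve 6 (λ a b c d e f → (a :* e :+ b :* d :+ c :* f) :+ (a :* f :+ b :* e :+ c :* d :+ (b :* f :+ c :* e) :+ c :* f)
      := c :* f :+ a :* e :+ (b :+ c) :* d :+ (a :* f :+ (b :+ c) :* e) :+ (b :+ c) :* f) refl a b c d e f)

  record Pos (u : ℚα) : Set where
    constructor pos
    field
      p₀ : 0ℚ ℚ.≤ c₀ u
      p₁ : 0ℚ ℚ.≤ c₁ u
      p₂ : 0ℚ ℚ.≤ c₂ u

  -- positivity at the real place (Perron-Frobenius): some α^j u has nonnegative coordinates
  data NonNeg (u : ℚα) : Set where
    now   : Pos u → NonNeg u
    later : NonNeg (step u) → NonNeg u

  +-≥0 : ∀ {p q} → 0ℚ ℚ.≤ p → 0ℚ ℚ.≤ q → 0ℚ ℚ.≤ p ℚ.+ q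
  +-≥0 = ℚₚ.+-mono-≤

  *-≥0 : ∀ {p q} → 0ℚ ℚ.≤ p → 0ℚ ℚ.≤ q → 0ℚ ℚ.≤ p ℚ.* q
  *-≥0 {p} {q} h k = ℚₚ.nonNegative⁻¹ (p ℚ.* q)
    {{ℚₚ.nonNeg*nonNeg⇒nonNeg p {{ℚ.nonNegative h}} q {{ℚ.nonNegative k}}}}

  Pos-step : ∀ {u} → Pos u → Pos (step u)
  Pos-step (pos a b c) = pos c a (+-≥0 b c)

  Pos-+ : ∀ {u v} → Pos u → Pos v → Pos (u + v)
  Pos-+ (pos a b c) (pos d e f) = pos (+-≥0 a d) (+-≥0 b e) (+-≥0 c f)

  Pos-* : ∀ {u v} → Pos u → Pos v → Pos (u * v)
  Pos-* (pos a b c) (pos d e f) = pos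
    (+-≥0 (+-≥0 (*-≥0 a d) (+-≥0 (*-≥0 b f) (*-≥0 c e))) (*-≥0 c f))
    (+-≥0 (+-≥0 (*-≥0 a e) (*-≥0 b d)) (*-≥0 c f))
    (+-≥0 (+-≥0 (+-≥0 (+-≥0 (*-≥0 a f) (*-≥0 b e)) (*-≥0 c d)) (+-≥0 (*-≥0 b f) (*-≥0 c e))) (*-≥0 c f))

  NonNeg-step : ∀ {u} → NonNeg u → NonNeg (step u)
  NonNeg-step (now p)   = now (Pos-step p)
  NonNeg-step (later p) = p

  Pos-NonNeg-+ : ∀ {u v} → Pos u → NonNeg v → NonNeg (u + v)
  Pos-NonNeg-+ p (now q) = now (Pos-+ p q)
  Pos-NonNeg-+ {u} {v} p (later q) = later (subst NonNeg (sym (step-+ u v)) (Pos-NonNeg-+ (Pos-step p) q))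

  NonNeg-+ : ∀ {u v} → NonNeg u → NonNeg v → NonNeg (u + v)
  NonNeg-+ (now p) q = Pos-NonNeg-+ p q
  NonNeg-+ {u} {v} (later p) q = later (subst NonNeg (sym (step-+ u v)) (NonNeg-+ p (NonNeg-step q)))

  -- Multiplication by α moves through products, so the powers of α needed by the two factors can be
  -- split off one at a time. `Pos` is closed under products because α³ = α² + 1 has nonnegative
  -- coefficients.
  NonNeg-* : ∀ {u v} → NonNeg u → NonNeg v → NonNeg (u * v)
  NonNeg-* (now p) (now q) = now (Pos-* p q)
  NonNeg-* {u} {v} (later p) q = later (subst NonNeg (sym (step-* u v)) (NonNeg-* p q))
  NonNeg-* {u} {v} p (later q) = later (subst NonNeg
    (sym (trans (cong step (*-comm u v)) (trans (step-* v u) (*-comm (step v) u)))) (NonNeg-* p q))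

  infix 4 _≤_
  _≤_ : ℚα → ℚα → Set
  u ≤ v = NonNeg (v + - u)

  -0≡0 : ∀ u → u + - 0# ≡ u
  -0≡0 (cub a b c) = cub-cong (ℚₚ.+-identityʳ a) (ℚₚ.+-identityʳ b) (ℚₚ.+-identityʳ c)

  ≥0-intro : ∀ {u} → NonNeg u → 0# ≤ u
  ≥0-intro {u} = subst NonNeg (sym (-0≡0 u))

  ≥0-elim : ∀ {u} → 0# ≤ u → NonNeg u
  ≥0-elim {u} = subst NonNeg (-0≡0 u)

  embed-pos : ∀ {q} → 0ℚ ℚ.≤ q → 0# ≤ embed q
  embed-pos p = ≥0-intro (now (pos p ℚₚ.≤-refl ℚₚ.≤-refl))

  open ≡-Reasoning

  embed-* : ∀ p u → embed p * u ≡ cub (p ℚ.* c₀ u) (p ℚ.* c₁ u) (p ℚ.* c₂ u)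
  embed-* p (cub a b c) = cub-cong
    (solve 4 (λ p a b c → p :* a :+ (con 0ℚ :* c :+ con 0ℚ :* b) :+ con 0ℚ :* c := p :* a) refl p a b c)
    (solve 4 (λ p a b c → p :* b :+ con 0ℚ :* a :+ con 0ℚ :* c := p :* b) refl p a b c)
    (solve 4 (λ p a b c → p :* c :+ con 0ℚ :* b :+ con 0ℚ :* a :+ (con 0ℚ :* c :+ con 0ℚ :* b) :+ con 0ℚ :* c := p :* c) refl p a b c)

  int : ℤ → ℚ
  int i = i ℚ./ 1

  int-+ : ∀ i j → int i ℚ.+ int j ≡ int (i ℤ.+ j)
  int-+ i j = ℚₚ.toℚᵘ-injective (ℚᵘₚ.≃-trans (ℚₚ.toℚᵘ-homo-+ (int i) (int j))
    (ℚᵘₚ.≃-trans (ℚᵘₚ.+-cong (ℚₚ.toℚᵘ-fromℚᵘ (ℚᵘ.mkℚᵘ i 0)) (ℚₚ.toℚᵘ-fromℚᵘ (ℚᵘ.mkℚᵘ j 0)))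
    (ℚᵘₚ.≃-trans (ℚᵘ.*≡* (cong (ℤ._* (ℤ.+ 1)) (cong₂ ℤ._+_ (ℤₚ.*-identityʳ i) (ℤₚ.*-identityʳ j))))
    (ℚᵘₚ.≃-sym (ℚₚ.toℚᵘ-fromℚᵘ (ℚᵘ.mkℚᵘ (i ℤ.+ j) 0))))))

  int-* : ∀ i j → int i ℚ.* int j ≡ int (i ℤ.* j)
  int-* i j = ℚₚ.toℚᵘ-injective (ℚᵘₚ.≃-trans (ℚₚ.toℚᵘ-homo-* (int i) (int j))
    (ℚᵘₚ.≃-trans (ℚᵘₚ.*-cong (ℚₚ.toℚᵘ-fromℚᵘ (ℚᵘ.mkℚᵘ i 0)) (ℚₚ.toℚᵘ-fromℚᵘ (ℚᵘ.mkℚᵘ j 0)))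
    (ℚᵘₚ.≃-sym (ℚₚ.toℚᵘ-fromℚᵘ (ℚᵘ.mkℚᵘ (i ℤ.* j) 0)))))

  int-neg : ∀ i → ℚ.- int i ≡ int (ℤ.- i)
  int-neg i = ℚₚ.toℚᵘ-injective (ℚᵘₚ.≃-trans (ℚₚ.toℚᵘ-homo‿- (int i))
    (ℚᵘₚ.≃-trans (ℚᵘₚ.-‿cong (ℚₚ.toℚᵘ-fromℚᵘ (ℚᵘ.mkℚᵘ i 0)))
    (ℚᵘₚ.≃-sym (ℚₚ.toℚᵘ-fromℚᵘ (ℚᵘ.mkℚᵘ (ℤ.- i) 0)))))

  denominator : ∀ p → int (ℚ.↧ p) ℚ.* p ≡ int (ℚ.↥ p)
  denominator p@(mkℚ n d-1 _) = ℚₚ.toℚᵘ-injective (ℚᵘₚ.≃-trans (ℚₚ.toℚᵘ-homo-* (int (ℚ.↧ p)) p)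
    (ℚᵘₚ.≃-trans (ℚᵘₚ.*-congʳ (ℚₚ.toℚᵘ-fromℚᵘ (ℚᵘ.mkℚᵘ (ℚ.↧ p) 0)))
    (ℚᵘₚ.≃-trans (ℚᵘ.*≡* (trans (ℤₚ.*-identityʳ _) (trans (ℤₚ.*-comm (ℚ.↧ p) n)
        (cong (n ℤ.*_) (cong (λ z → ℤ.+ suc z) (sym (ℕₚ.+-identityʳ d-1)))))))
    (ℚᵘₚ.≃-sym (ℚₚ.toℚᵘ-fromℚᵘ (ℚᵘ.mkℚᵘ n 0))))))

  ι : ℕ → ℚα
  ι = fromℕ _+_ 0# 1#

  ι-int : ∀ n → ι n ≡ embed (int (ℤ.+ n))
  ι-int zero = refl
  ι-int (suc zero) = refl
  ι-int (suc (suc n)) = trans (cong (1# +_) (ι-int (suc n))) (cong embed (int-+ (ℤ.+ 1) (ℤ.+ suc n)))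

  int-pos : ∀ n → ℚ.Positive (int (ℤ.+ suc n))
  int-pos n = ℚₚ.normalize-pos (suc n) 1

  int≢0 : ∀ n → ℚ.NonZero (int (ℤ.+ suc n))
  int≢0 n = ℚₚ.pos⇒nonZero (int (ℤ.+ suc n)) {{int-pos n}}

  1/int : ℕ → ℚ
  1/int k = (ℚ.1/ int (ℤ.+ suc k)) {{int≢0 k}}

  inv : ℕ → ℚα
  inv k = embed (1/int k)

  inv-pos : ∀ k → 0# ≤ inv k
  inv-pos k = embed-pos {1/int k} (ℚₚ.<⇒≤ (ℚₚ.positive⁻¹ (1/int k) {{ℚₚ.1/pos⇒pos (int (ℤ.+ suc k)) {{int-pos k}}}}))

  inv-spec : ∀ k → ι (suc k) * inv k ≡ 1#
  inv-spec k = trans (cong (_* inv k) (ι-int (suc k))) (trans (embed-* (int (ℤ.+ suc k)) (inv k)) (cub-cong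
    (ℚₚ.*-inverseʳ (int (ℤ.+ suc k)) {{int≢0 k}})
    (ℚₚ.*-zeroʳ (int (ℤ.+ suc k))) (ℚₚ.*-zeroʳ (int (ℤ.+ suc k)))))

  orderedRing : OrderedRing
  orderedRing = record
    { R = ℚα ; _+_ = _+_ ; _*_ = _*_ ; -_ = -_ ; 0# = 0# ; 1# = 1#
    ; isCommutativeRing = isCommutativeRing
    ; _≤_ = _≤_
    ; ≤-refl = λ {u} → subst NonNeg (sym (trans (+-comm u (- u)) (+-inverseˡ u))) (≥0-elim (embed-pos ℚₚ.≤-refl))
    ; ≤-trans = λ { {cub a b c} {cub d e f} {cub x y z} p q → subst NonNeg (cub-cong (tr a d x) (tr b e y) (tr c f z)) (NonNeg-+ p q) }
    ; +-mono-≤ = λ { {cub a b c} {cub d e f} {cub x y z} {cub x' y' z'} p q →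
        subst NonNeg (cub-cong (mo a d x x') (mo b e y y') (mo c f z z')) (NonNeg-+ p q) }
    ; *-nonneg = λ {u} {v} p q → ≥0-intro {u * v} (NonNeg-* (≥0-elim {u} p) (≥0-elim {v} q))
    ; 0≤1 = embed-pos (ℚₚ.<⇒≤ (ℚₚ.positive⁻¹ 1ℚ))
    ; inv = inv ; inv-pos = inv-pos ; inv-spec = inv-spec }
    where
    tr : ∀ a d x → (d ℚ.+ ℚ.- a) ℚ.+ (x ℚ.+ ℚ.- d) ≡ x ℚ.+ ℚ.- a
    tr = solve 3 (λ a d x → (d :+ :- a) :+ (x :+ :- d) := x :+ :- a) refl
    mo : ∀ a d x x' → (d ℚ.+ ℚ.- a) ℚ.+ (x' ℚ.+ ℚ.- x) ≡ (d ℚ.+ x') ℚ.+ ℚ.- (a ℚ.+ x)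
    mo = solve 4 (λ a d x x' → (d :+ :- a) :+ (x' :+ :- x) := (d :+ x') :+ :- (a :+ x)) refl

  open OrderedRingProperties orderedRing using (ιℤ)

  -- The obstruction that keeps the order nontrivial: these conditions survive `step`, so no number
  -- of steps leads from here to `Pos`.
  record Neg (u : ℚα) : Set where
    constructor neg
    field
      n₀ : c₀ u ℚ.≤ 0ℚ
      n₁ : c₁ u ℚ.≤ 0ℚ
      n₂ : c₂ u ℚ.≤ 0ℚ
      ns : c₀ u ℚ.+ c₁ u ℚ.+ c₂ u ℚ.< 0ℚ

  NonNeg⇒¬Neg : ∀ {u} → NonNeg u → ¬ Neg u
  NonNeg⇒¬Neg (now (pos a b c)) (neg _ _ _ s) = ℚₚ.<-irrefl refl (ℚₚ.<-≤-trans s (+-≥0 (+-≥0 a b) c))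
  NonNeg⇒¬Neg {cub x y z} (later p) (neg a b c s) = NonNeg⇒¬Neg p (neg c a (ℚₚ.+-mono-≤ b c)
    (subst (ℚ._< 0ℚ) (sym (solve 3 (λ x y z → z :+ x :+ (y :+ z) := (x :+ y :+ z) :+ z) refl x y z)) (ℚₚ.+-mono-<-≤ s c)))

  1≰0 : ¬ (1# ≤ 0#)
  1≰0 p = NonNeg⇒¬Neg p (neg (ℚₚ.nonPositive⁻¹ _) ℚₚ.≤-refl ℚₚ.≤-refl (ℚₚ.negative⁻¹ _))

  α : ℚα
  α = cub 0ℚ 1ℚ 0ℚ

  α-lower : ι 4 ≤ ι 3 * α
  -- Six steps suffice: α^6 (3α - 4) = 1 + 2α.
  α-lower = later (later (later (later (later (later (now (pos
    (ℚₚ.nonNegative⁻¹ _) (ℚₚ.nonNegative⁻¹ _) (ℚₚ.nonNegative⁻¹ _))))))))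

  α-upper : ι 2 * α ≤ ι 3
  -- 3 - 2α equals α^-7, so eight steps arrive at α.
  α-upper = later (later (later (later (later (later (later (later (now (pos
    (ℚₚ.nonNegative⁻¹ _) (ℚₚ.nonNegative⁻¹ _) (ℚₚ.nonNegative⁻¹ _))))))))))

  ιℤ-int : ∀ i → ιℤ i ≡ embed (int i)
  ιℤ-int (ℤ.+ n)  = ι-int n
  ιℤ-int -[1+ n ] = trans (cong -_ (ι-int (suc n))) (cub-cong (int-neg (ℤ.+ suc n)) refl refl)

  combination : ∀ a b c → ιℤ a + ιℤ b * α + ιℤ c * (α * α) ≡ cub (int a) (int b) (int c)
  combination a b c = trans
    (cong₂ _+_ (cong₂ _+_ (ιℤ-int a) (trans (cong (_* α) (ιℤ-int b)) (embed-* (int b) α)))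
      (trans (cong (_* (α * α)) (ιℤ-int c)) (embed-* (int c) (α * α))))
    (cub-cong
      (solve 3 (λ x y z → x :+ y :* con 0ℚ :+ z :* con 0ℚ := x) refl (int a) (int b) (int c))
      (solve 3 (λ x y z → con 0ℚ :+ y :* con 1ℚ :+ z :* con 0ℚ := y) refl (int a) (int b) (int c))
      (solve 3 (λ x y z → con 0ℚ :+ y :* con 0ℚ :+ z :* con 1ℚ := z) refl (int a) (int b) (int c)))

  cubicField : CubicField
  cubicField = record
    { orderedRing = orderedRing ; 1≰0 = 1≰0 ; α = α ; α³ = refl
    ; α-lower = α-lower ; α-upper = α-upper ; integral = integral }
    where
    clear : ∀ d p e → int (d ℤ.* ℚ.↧ p ℤ.* e) ℚ.* p ≡ int (d ℤ.* ℚ.↥ p ℤ.* e)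
    clear d p e = begin
      int (d ℤ.* ℚ.↧ p ℤ.* e) ℚ.* p               ≡⟨ cong (ℚ._* p) (sym (trans (cong (ℚ._* int e) (int-* d (ℚ.↧ p))) (int-* (d ℤ.* ℚ.↧ p) e))) ⟩
      int d ℚ.* int (ℚ.↧ p) ℚ.* int e ℚ.* p       ≡⟨ solve 4 (λ d q e p → d :* q :* e :* p := d :* (q :* p) :* e) refl (int d) (int (ℚ.↧ p)) (int e) p ⟩
      int d ℚ.* (int (ℚ.↧ p) ℚ.* p) ℚ.* int e     ≡⟨ cong (λ z → int d ℚ.* z ℚ.* int e) (denominator p) ⟩
      int d ℚ.* int (ℚ.↥ p) ℚ.* int e             ≡⟨ trans (cong (ℚ._* int e) (int-* d (ℚ.↥ p))) (int-* (d ℤ.* ℚ.↥ p) e) ⟩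
      int (d ℤ.* ℚ.↥ p ℤ.* e)                     ∎
    integral : ∀ u → ∃[ d ] ∃[ a ] ∃[ b ] ∃[ c ] (ι (suc d) * u ≡ ιℤ a + ιℤ b * α + ιℤ c * (α * α))
    integral (cub x@(mkℚ _ dx _) y@(mkℚ _ dy _) z@(mkℚ _ dz _)) = d , X , Y , Z ,
      trans (cong (_* cub x y z) (ι-int (suc d))) (trans (embed-* (int D) (cub x y z))
        (trans (cub-cong
          (trans (cong (λ q → int q ℚ.* x) Dx) (clear (ℤ.+ 1) x (ℚ.↧ y ℤ.* ℚ.↧ z)))
          (clear (ℚ.↧ x) y (ℚ.↧ z))
          (trans (cong (λ q → int q ℚ.* z) Dz) (clear (ℚ.↧ x ℤ.* ℚ.↧ y) z (ℤ.+ 1))))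
          (sym (combination X Y Z))))
      where
      D X Y Z : ℤ
      D = ℚ.↧ x ℤ.* ℚ.↧ y ℤ.* ℚ.↧ z
      X = ℤ.+ 1 ℤ.* ℚ.↥ x ℤ.* (ℚ.↧ y ℤ.* ℚ.↧ z)
      Y = ℚ.↧ x ℤ.* ℚ.↥ y ℤ.* ℚ.↧ z
      Z = ℚ.↧ x ℤ.* ℚ.↧ y ℤ.* ℚ.↥ z ℤ.* ℤ.+ 1
      d : ℕ
      d = dz ℕ.+ (dy ℕ.+ dx ℕ.* suc dy) ℕ.* suc dz
      Dx : D ≡ ℤ.+ 1 ℤ.* ℚ.↧ x ℤ.* (ℚ.↧ y ℤ.* ℚ.↧ z)
      Dx = trans (ℤₚ.*-assoc (ℚ.↧ x) (ℚ.↧ y) (ℚ.↧ z)) (cong (ℤ._* (ℚ.↧ y ℤ.* ℚ.↧ z)) (sym (ℤₚ.*-identityˡ (ℚ.↧ x))))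
      Dz : D ≡ ℚ.↧ x ℤ.* ℚ.↧ y ℤ.* ℚ.↧ z ℤ.* ℤ.+ 1
      Dz = sym (ℤₚ.*-identityʳ D)

-- The norm form has only the trivial integral zero.

-- the norm from ℚ(α) of x + yα + wα²
norm : ℤ → ℤ → ℤ → ℤ
norm x y w = x ℤ.* (x ℤ.* (x ℤ.+ y ℤ.+ w) ℤ.+ ℤ.- (w ℤ.* (y ℤ.+ w)))
  ℤ.+ w ℤ.* (w ℤ.* w ℤ.+ ℤ.- (y ℤ.* (x ℤ.+ y ℤ.+ w)))
  ℤ.+ (y ℤ.+ w) ℤ.* (y ℤ.* (y ℤ.+ w) ℤ.+ ℤ.- (x ℤ.* w))

bit : Bool → ℤ
bit false = ℤ.+ 0
bit true  = ℤ.+ 1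

data Parity (b : Bool) (i : ℤ) : Set where
  par : ∀ j → i ≡ bit b ℤ.+ (j ℤ.+ j) → Parity b i

parityℕ : ∀ n → ∃[ b ] Parity b (ℤ.+ n)
parityℕ zero = false , par (ℤ.+ 0) refl
parityℕ (suc n) with parityℕ n
... | false , par j eq = true , par j (trans (cong (ℤ._+_ (ℤ.+ 1)) eq) (cong (ℤ._+_ (ℤ.+ 1)) (ℤₚ.+-identityˡ (j ℤ.+ j))))
... | true  , par j eq = false , par (ℤ.+ 1 ℤ.+ j) (trans (cong (ℤ._+_ (ℤ.+ 1)) eq) (lem j))
  where
  lem : ∀ j → ℤ.+ 1 ℤ.+ (ℤ.+ 1 ℤ.+ (j ℤ.+ j)) ≡ ℤ.+ 0 ℤ.+ ((ℤ.+ 1 ℤ.+ j) ℤ.+ (ℤ.+ 1 ℤ.+ j))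
  lem = ℤ-Ring.solve-∀

parity : ∀ i → ∃[ b ] Parity b i
parity (ℤ.+ n) = parityℕ n
parity -[1+ n ] with parityℕ (suc n)
... | false , par j eq = false , par (ℤ.- j) (trans (cong ℤ.-_ eq) (lem j))
  where
  lem : ∀ j → ℤ.- (ℤ.+ 0 ℤ.+ (j ℤ.+ j)) ≡ ℤ.+ 0 ℤ.+ (ℤ.- j ℤ.+ ℤ.- j)
  lem = ℤ-Ring.solve-∀
... | true , par j eq = true , par (ℤ.- j ℤ.+ ℤ.- (ℤ.+ 1)) (trans (cong ℤ.-_ eq) (lem j))
  where
  lem : ∀ j → ℤ.- (ℤ.+ 1 ℤ.+ (j ℤ.+ j)) ≡ ℤ.+ 1 ℤ.+ ((ℤ.- j ℤ.+ ℤ.- (ℤ.+ 1)) ℤ.+ (ℤ.- j ℤ.+ ℤ.- (ℤ.+ 1)))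
  lem = ℤ-Ring.solve-∀

Parity-+ : ∀ b c {i j} → Parity b i → Parity c j → Parity (b xor c) (i ℤ.+ j)
Parity-+ false false (par p refl) (par q refl) = par (p ℤ.+ q) (lem p q)
  where
  lem : ∀ p q → (ℤ.+ 0 ℤ.+ (p ℤ.+ p)) ℤ.+ (ℤ.+ 0 ℤ.+ (q ℤ.+ q)) ≡ ℤ.+ 0 ℤ.+ ((p ℤ.+ q) ℤ.+ (p ℤ.+ q))
  lem = ℤ-Ring.solve-∀
Parity-+ false true (par p refl) (par q refl) = par (p ℤ.+ q) (lem p q)
  where
  lem : ∀ p q → (ℤ.+ 0 ℤ.+ (p ℤ.+ p)) ℤ.+ (ℤ.+ 1 ℤ.+ (q ℤ.+ q)) ≡ ℤ.+ 1 ℤ.+ ((p ℤ.+ q) ℤ.+ (p ℤ.+ q))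
  lem = ℤ-Ring.solve-∀
Parity-+ true false (par p refl) (par q refl) = par (p ℤ.+ q) (lem p q)
  where
  lem : ∀ p q → (ℤ.+ 1 ℤ.+ (p ℤ.+ p)) ℤ.+ (ℤ.+ 0 ℤ.+ (q ℤ.+ q)) ≡ ℤ.+ 1 ℤ.+ ((p ℤ.+ q) ℤ.+ (p ℤ.+ q))
  lem = ℤ-Ring.solve-∀
Parity-+ true true (par p refl) (par q refl) = par (ℤ.+ 1 ℤ.+ p ℤ.+ q) (lem p q)
  where
  lem : ∀ p q → (ℤ.+ 1 ℤ.+ (p ℤ.+ p)) ℤ.+ (ℤ.+ 1 ℤ.+ (q ℤ.+ q)) ≡ ℤ.+ 0 ℤ.+ ((ℤ.+ 1 ℤ.+ p ℤ.+ q) ℤ.+ (ℤ.+ 1 ℤ.+ p ℤ.+ q))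
  lem = ℤ-Ring.solve-∀

Parity-* : ∀ b c {i j} → Parity b i → Parity c j → Parity (b ∧ c) (i ℤ.* j)
Parity-* false c {j = j} (par p refl) _ = par (p ℤ.* j) (lem p j)
  where
  lem : ∀ p j → (ℤ.+ 0 ℤ.+ (p ℤ.+ p)) ℤ.* j ≡ ℤ.+ 0 ℤ.+ (p ℤ.* j ℤ.+ p ℤ.* j)
  lem = ℤ-Ring.solve-∀
Parity-* true false {i = i} _ (par q refl) = par (i ℤ.* q) (lem i q)
  where
  lem : ∀ i q → i ℤ.* (ℤ.+ 0 ℤ.+ (q ℤ.+ q)) ≡ ℤ.+ 0 ℤ.+ (i ℤ.* q ℤ.+ i ℤ.* q)
  lem = ℤ-Ring.solve-∀
Parity-* true true (par p refl) (par q refl) = par (p ℤ.+ q ℤ.+ ℤ.+ 2 ℤ.* (p ℤ.* q)) (lem p q)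
  where
  lem : ∀ p q → (ℤ.+ 1 ℤ.+ (p ℤ.+ p)) ℤ.* (ℤ.+ 1 ℤ.+ (q ℤ.+ q))
    ≡ ℤ.+ 1 ℤ.+ ((p ℤ.+ q ℤ.+ ℤ.+ 2 ℤ.* (p ℤ.* q)) ℤ.+ (p ℤ.+ q ℤ.+ ℤ.+ 2 ℤ.* (p ℤ.* q)))
  lem = ℤ-Ring.solve-∀

Parity-neg : ∀ b {i} → Parity b i → Parity b (ℤ.- i)
Parity-neg false (par p refl) = par (ℤ.- p) (lem p)
  where
  lem : ∀ p → ℤ.- (ℤ.+ 0 ℤ.+ (p ℤ.+ p)) ≡ ℤ.+ 0 ℤ.+ (ℤ.- p ℤ.+ ℤ.- p)
  lem = ℤ-Ring.solve-∀
Parity-neg true (par p refl) = par (ℤ.- p ℤ.+ ℤ.- (ℤ.+ 1)) (lem p)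
  where
  lem : ∀ p → ℤ.- (ℤ.+ 1 ℤ.+ (p ℤ.+ p)) ≡ ℤ.+ 1 ℤ.+ ((ℤ.- p ℤ.+ ℤ.- (ℤ.+ 1)) ℤ.+ (ℤ.- p ℤ.+ ℤ.- (ℤ.+ 1)))
  lem = ℤ-Ring.solve-∀

0-not-odd : ¬ Parity true (ℤ.+ 0)
0-not-odd (par (ℤ.+ n) ())
0-not-odd (par -[1+ n ] ())

-- The norm form modulo 2, on truth values, so that the seven nonzero residue vectors are settled by
-- evaluation.
normᵇ : Bool → Bool → Bool → Bool
normᵇ x y w = ((x ∧ ((x ∧ ((x xor y) xor w)) xor (w ∧ (y xor w))))
  xor (w ∧ ((w ∧ w) xor (y ∧ ((x xor y) xor w))))) xor ((y xor w) ∧ ((y ∧ (y xor w)) xor (x ∧ w)))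

norm-parity : ∀ a b c {x y w} → Parity a x → Parity b y → Parity c w → Parity (normᵇ a b c) (norm x y w)
norm-parity a b c {x} {y} {w} p q r =
  Parity-+ _ _ (Parity-+ _ _
    (Parity-* a _ p (Parity-+ _ _ (Parity-* a _ p s) (Parity-neg _ (Parity-* c _ r t))))
    (Parity-* c _ r (Parity-+ _ _ (Parity-* c c r r) (Parity-neg _ (Parity-* b _ q s)))))
    (Parity-* _ _ t (Parity-+ _ _ (Parity-* b _ q t) (Parity-neg _ (Parity-* a c p r))))
  where
  s = Parity-+ _ c (Parity-+ a b p q) r
  t = Parity-+ b c q r

norm-double : ∀ x y w → norm (x ℤ.+ x) (y ℤ.+ y) (w ℤ.+ w) ≡ ℤ.+ 8 ℤ.* norm x y w
norm-double = solve
  where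
  solve : ∀ x y w → (x ℤ.+ x) ℤ.* ((x ℤ.+ x) ℤ.* ((x ℤ.+ x) ℤ.+ (y ℤ.+ y) ℤ.+ (w ℤ.+ w)) ℤ.+ ℤ.- ((w ℤ.+ w) ℤ.* ((y ℤ.+ y) ℤ.+ (w ℤ.+ w))))
    ℤ.+ (w ℤ.+ w) ℤ.* ((w ℤ.+ w) ℤ.* (w ℤ.+ w) ℤ.+ ℤ.- ((y ℤ.+ y) ℤ.* ((x ℤ.+ x) ℤ.+ (y ℤ.+ y) ℤ.+ (w ℤ.+ w))))
    ℤ.+ ((y ℤ.+ y) ℤ.+ (w ℤ.+ w)) ℤ.* ((y ℤ.+ y) ℤ.* ((y ℤ.+ y) ℤ.+ (w ℤ.+ w)) ℤ.+ ℤ.- ((x ℤ.+ x) ℤ.* (w ℤ.+ w)))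
    ≡ ℤ.+ 8 ℤ.* (x ℤ.* (x ℤ.* (x ℤ.+ y ℤ.+ w) ℤ.+ ℤ.- (w ℤ.* (y ℤ.+ w)))
    ℤ.+ w ℤ.* (w ℤ.* w ℤ.+ ℤ.- (y ℤ.* (x ℤ.+ y ℤ.+ w)))
    ℤ.+ (y ℤ.+ w) ℤ.* (y ℤ.* (y ℤ.+ w) ℤ.+ ℤ.- (x ℤ.* w)))
  solve = ℤ-Ring.solve-∀

∣j+j∣ : ∀ j → ℤ.∣ j ℤ.+ j ∣ ≡ ℤ.∣ j ∣ ℕ.+ ℤ.∣ j ∣
∣j+j∣ (ℤ.+ n) = refl
∣j+j∣ -[1+ n ] = cong suc (sym (ℕₚ.+-suc n n))

size : ℤ → ℤ → ℤ → ℕ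
size x y w = ℤ.∣ x ∣ ℕ.+ ℤ.∣ y ∣ ℕ.+ ℤ.∣ w ∣

-- X³ - X² - 1 is irreducible modulo 2, so a vanishing norm forces all coordinates to be even: infinite descent
norm-zero : ∀ x y w → norm x y w ≡ ℤ.+ 0 → x ≡ ℤ.+ 0 × y ≡ ℤ.+ 0 × w ≡ ℤ.+ 0
norm-zero x y w = go x y w (<-wellFounded (size x y w))
  where
  odd : ∀ {x y w} → norm x y w ≡ ℤ.+ 0 → Parity true (norm x y w) → ⊥
  odd eq p = 0-not-odd (subst (Parity true) eq p)
  go : ∀ x y w → Acc ℕ._<_ (size x y w) → norm x y w ≡ ℤ.+ 0 → x ≡ ℤ.+ 0 × y ≡ ℤ.+ 0 × w ≡ ℤ.+ 0
  go x y w (acc rs) eq with parity x | parity y | parity w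
  -- In these seven cases `normᵇ` computes to `true`: a nonzero element of the field with eight
  -- elements has norm 1.
  ... | true  , p | true  , q | true  , r = ⊥-elim (odd {x} {y} {w} eq (norm-parity true true true p q r))
  ... | true  , p | true  , q | false , r = ⊥-elim (odd {x} {y} {w} eq (norm-parity true true false p q r))
  ... | true  , p | false , q | true  , r = ⊥-elim (odd {x} {y} {w} eq (norm-parity true false true p q r))
  ... | true  , p | false , q | false , r = ⊥-elim (odd {x} {y} {w} eq (norm-parity true false false p q r))
  ... | false , p | true  , q | true  , r = ⊥-elim (odd {x} {y} {w} eq (norm-parity false true true p q r))
  ... | false , p | true  , q | false , r = ⊥-elim (odd {x} {y} {w} eq (norm-parity false true false p q r))
  ... | false , p | false , q | true  , r = ⊥-elim (odd {x} {y} {w} eq (norm-parity false false true p q r))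
  ... | false , par x' px | false , par y' py | false , par w' pw = result
    where
    ex : x ≡ x' ℤ.+ x'
    ex = trans px (ℤₚ.+-identityˡ _)
    ey : y ≡ y' ℤ.+ y'
    ey = trans py (ℤₚ.+-identityˡ _)
    ew : w ≡ w' ℤ.+ w'
    ew = trans pw (ℤₚ.+-identityˡ _)
    n' : norm x' y' w' ≡ ℤ.+ 0
    n' = ℤₚ.*-cancelˡ-≡ (ℤ.+ 8) (norm x' y' w') (ℤ.+ 0)
      (trans (sym (norm-double x' y' w')) (trans (sym (cong₂ (λ f z → f z) (cong₂ norm ex ey) ew)) eq))
    s' = size x' y' w'
    size≡ : size x y w ≡ s' ℕ.+ s'
    size≡ = trans (cong₂ ℕ._+_ (cong₂ ℕ._+_ (trans (cong ℤ.∣_∣ ex) (∣j+j∣ x')) (trans (cong ℤ.∣_∣ ey) (∣j+j∣ y')))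
      (trans (cong ℤ.∣_∣ ew) (∣j+j∣ w'))) (arith ℤ.∣ x' ∣ ℤ.∣ y' ∣ ℤ.∣ w' ∣)
      where
      arith : ∀ a b c → a ℕ.+ a ℕ.+ (b ℕ.+ b) ℕ.+ (c ℕ.+ c) ≡ a ℕ.+ b ℕ.+ c ℕ.+ (a ℕ.+ b ℕ.+ c)
      arith = solve-∀
    double0 : ∀ {a a'} → a ≡ a' ℤ.+ a' → a' ≡ ℤ.+ 0 → a ≡ ℤ.+ 0
    double0 e refl = e
    all0 : x' ≡ ℤ.+ 0 × y' ≡ ℤ.+ 0 × w' ≡ ℤ.+ 0 → x ≡ ℤ.+ 0 × y ≡ ℤ.+ 0 × w ≡ ℤ.+ 0
    all0 (a , b , c) = double0 ex a , double0 ey b , double0 ew c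
    result : x ≡ ℤ.+ 0 × y ≡ ℤ.+ 0 × w ≡ ℤ.+ 0
    result with s' ℕₚ.≟ 0
    ... | yes s≡0 = all0 (ℤₚ.∣i∣≡0⇒i≡0 (ℕₚ.m+n≡0⇒m≡0 ℤ.∣ x' ∣ xy0) , ℤₚ.∣i∣≡0⇒i≡0 (ℕₚ.m+n≡0⇒n≡0 ℤ.∣ x' ∣ xy0)
                        , ℤₚ.∣i∣≡0⇒i≡0 (ℕₚ.m+n≡0⇒n≡0 (ℤ.∣ x' ∣ ℕ.+ ℤ.∣ y' ∣) s≡0))
      where xy0 = ℕₚ.m+n≡0⇒m≡0 (ℤ.∣ x' ∣ ℕ.+ ℤ.∣ y' ∣) s≡0
    ... | no s≢0 = all0 (go x' y' w' (rs (subst (s' ℕ.<_) (sym size≡) (ℕₚ.m<m+n s' (ℕₚ.n≢0⇒n>0 s≢0)))) n')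

-- Reflection of the order, decidable equality, no zero divisors.

module CubicFieldProperties (𝓚 : CubicField) where
  open CubicField 𝓚 public using (orderedRing; 1≰0; α; α³; α-lower; α-upper; integral)
  open OrderedRingProperties orderedRing public
  open Analysis orderedRing public
  open Siegel orderedRing public

  -- This is where `1≰0` enters: if `i` were larger than `j`, the positive integer `i - j` would be
  -- nonpositive in the field.
  reflect : ∀ i j → ιℤ i ≤ ιℤ j → i ℤ.≤ j
  reflect i j p with i ℤ.≤? j
  ... | yes q = q
  ... | no q with ℤₚ.≰⇒> q
  ... | j<i = contradiction (≤-trans (ι-mono-≤ {1} {suc k} (s≤s z≤n)) suc≤0) 1≰0
    where
    k = ℤ.∣ i ℤ.- ℤ.suc j ∣
    k-spec : i ≡ j ℤ.+ ℤ.+ suc k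
    k-spec = sym (trans (cong (λ z → j ℤ.+ (ℤ.+ 1 ℤ.+ z)) (ℤₚ.0≤i⇒+∣i∣≡i (ℤₚ.i≤j⇒0≤j-i (ℤₚ.i<j⇒suc[i]≤j j<i)))) (lem i j))
      where
      lem : ∀ i j → j ℤ.+ (ℤ.+ 1 ℤ.+ (i ℤ.+ ℤ.- (ℤ.+ 1 ℤ.+ j))) ≡ i
      lem = ℤ-Ring.solve-∀
    cancel = solve 2 (λ x y → # 0 :- y := x :- (x :+ y)) refl
    suc≤0 : ι (suc k) ≤ 0#
    suc≤0 = by-diff (0≤y-x (subst (λ z → z ≤ ιℤ j) (trans (cong ιℤ k-spec) (ιℤ-+ j (ℤ.+ suc k))) p))
      (cancel (ιℤ j) (ι (suc k)))

  ιℤ-injective : ∀ i j → ιℤ i ≡ ιℤ j → i ≡ j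
  ιℤ-injective i j eq = ℤₚ.≤-antisym (reflect i j (≤-reflexive eq)) (reflect j i (≤-reflexive (sym eq)))

  ι-reflect : ∀ m n → ι m ≤ ι n → m ℕ.≤ n
  ι-reflect m n p = ℤₚ.drop‿+≤+ (reflect (ℤ.+ m) (ℤ.+ n) p)

  cancel-ι : ∀ d {x} → 0# ≤ ι (suc d) * x → 0# ≤ x
  cancel-ι d {x} p = ≤-trans (*-nonneg (inv-pos d) p) (≤-reflexive (trans (sym (*-assoc _ _ _))
    (trans (cong (_* x) (trans (*-comm _ _) (inv-spec d))) (*-identityˡ x))))

  cancel-ι-≡ : ∀ d {x} → ι (suc d) * x ≡ 0# → x ≡ 0#
  cancel-ι-≡ d {x} p = trans (sym (*-identityˡ x)) (trans (cong (_* x) (sym (trans (*-comm _ _) (inv-spec d))))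
    (trans (*-assoc _ _ _) (trans (cong (inv d *_) p) (zeroʳ _))))

  1≤α : 1# ≤ α
  1≤α = 0≤y-x⁻¹ (cancel-ι 2 (≤-trans (+-nonneg 0≤1 (0≤y-x α-lower)) (≤-reflexive (alg α))))
    where
    alg = solve 1 (λ a → # 1 :+ (# 3 :* a :- # 4) := # 3 :* (a :- # 1)) refl

  0≤α : 0# ≤ α
  0≤α = ≤-trans 0≤1 1≤α

  α≤2 : α ≤ ι 2
  α≤2 = 0≤y-x⁻¹ (cancel-ι 1 (≤-trans (+-nonneg 0≤1 (0≤y-x α-upper)) (≤-reflexive (alg α))))
    where
    alg = solve 1 (λ a → # 1 :+ (# 3 :- # 2 :* a) := # 2 :* (# 2 :- a)) refl

  α⁻¹ : R
  α⁻¹ = α * (α - 1#)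

  α*α⁻¹ : α * α⁻¹ ≡ 1#
  α*α⁻¹ = trans (alg α) (trans (cong (_- α * α) α³) (alg' (α * α)))
    where
    alg = solve 1 (λ a → a :* (a :* (a :- # 1)) := a :* a :* a :- a :* a) refl
    alg' = solve 1 (λ a → (a :+ # 1) :- a := # 1) refl

  0≤α⁻¹ : 0# ≤ α⁻¹
  0≤α⁻¹ = *-nonneg 0≤α (0≤y-x 1≤α)

  lc : R → R → R → R
  lc x y w = x + y * α + w * (α * α)

  private
    h+ : ∀ {i j x y} → ιℤ i ≡ x → ιℤ j ≡ y → ιℤ (i ℤ.+ j) ≡ x + y
    h+ {i} {j} p q = trans (ιℤ-+ i j) (cong₂ _+_ p q)
    h* : ∀ {i j x y} → ιℤ i ≡ x → ιℤ j ≡ y → ιℤ (i ℤ.* j) ≡ x * y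
    h* {i} {j} p q = trans (ιℤ-* i j) (cong₂ _*_ p q)
    hn : ∀ {i x} → ιℤ i ≡ x → ιℤ (ℤ.- i) ≡ - x
    hn {i} p = trans (ιℤ-neg i) (cong -_ p)

  -- Cofactors of the matrix of multiplication by `lc x y w`. Thus `adj x y w` is the product of the
  -- two other conjugates, expressed inside the field.
  adj₀ adj₁ adj₂ : R → R → R → R
  adj₀ x y w = x * (x + y + w) - w * (y + w)
  adj₁ x y w = w * w - y * (x + y + w)
  adj₂ x y w = y * (y + w) - x * w

  adj : R → R → R → R
  adj x y w = lc (adj₀ x y w) (adj₁ x y w) (adj₂ x y w)

  lc-adj : ∀ a b c → lc (ιℤ a) (ιℤ b) (ιℤ c) * adj (ιℤ a) (ιℤ b) (ιℤ c) ≡ ιℤ (norm a b c)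
  -- The solver knows no relation for α, so the product is written as a reduced expression plus a
  -- multiple of `α * α * α - (α * α + 1#)`, which `α³` then removes.
  lc-adj a b c = trans (alg α x y w (adj₀ x y w) (adj₁ x y w) (adj₂ x y w))
      (trans (cong (λ z → (x * adj₀ x y w + w * adj₁ x y w + (y + w) * adj₂ x y w) +
         (y * adj₀ x y w + x * adj₁ x y w + w * adj₂ x y w) * α +
         (w * adj₀ x y w + (y + w) * adj₁ x y w + (x + y + w) * adj₂ x y w) * (α * α) + (z - (α * α + 1#)) *
         (w * adj₂ x y w * α + (w * adj₁ x y w + y * adj₂ x y w + w * adj₂ x y w))) α³)
      (trans (alg' α x y w) (sym ιnorm)))
    where
    x = ιℤ a
    y = ιℤ b
    w = ιℤ c
    alg = solve 7 (λ α x y w A B C → (x :+ y :* α :+ w :* (α :* α)) :* (A :+ B :* α :+ C :* (α :* α)) := (x :* A :+ w :* B :+ (y :+ w) :* C) :+ (y :* A :+ x :* B :+ w :* C) :* α :+ (w :* A :+ (y :+ w) :* B :+ (x :+ y :+ w) :* C) :* (α :* α) :+ (α :* α :* α :- (α :* α :+ # 1)) :* (w :* C :* α :+ (w :* B :+ y :* C :+ w :* C))) refl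
    alg' = solve 4 (λ α x y w → (x :* (x :* (x :+ y :+ w) :- w :* (y :+ w)) :+ w :* (w :* w :- y :* (x :+ y :+ w)) :+ (y :+ w) :* (y :* (y :+ w) :- x :* w)) :+ (y :* (x :* (x :+ y :+ w) :- w :* (y :+ w)) :+ x :* (w :* w :- y :* (x :+ y :+ w)) :+ w :* (y :* (y :+ w) :- x :* w)) :* α :+ (w :* (x :* (x :+ y :+ w) :- w :* (y :+ w)) :+ (y :+ w) :* (w :* w :- y :* (x :+ y :+ w)) :+ (x :+ y :+ w) :* (y :* (y :+ w) :- x :* w)) :* (α :* α) :+ ((α :* α :+ # 1) :- (α :* α :+ # 1)) :* (w :* (y :* (y :+ w) :- x :* w) :* α :+ (w :* (w :* w :- y :* (x :+ y :+ w)) :+ y :* (y :* (y :+ w) :- x :* w) :+ w :* (y :* (y :+ w) :- x :* w))) := x :* (x :* (x :+ y :+ w) :+ :- (w :* (y :+ w))) :+ w :* (w :* w :+ :- (y :* (x :+ y :+ w))) :+ (y :+ w) :* (y :* (y :+ w) :+ :- (x :* w))) refl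
    s : ιℤ (a ℤ.+ b ℤ.+ c) ≡ x + y + w
    s = h+ {a ℤ.+ b} {c} (h+ {a} {b} refl refl) refl
    t : ιℤ (b ℤ.+ c) ≡ y + w
    t = h+ {b} {c} refl refl
    ιnorm : ιℤ (norm a b c) ≡ x * (x * (x + y + w) + - (w * (y + w))) + w * (w * w + - (y * (x + y + w))) + (y + w) * (y * (y + w) + - (x * w))
    ιnorm = h+ {a ℤ.* (a ℤ.* (a ℤ.+ b ℤ.+ c) ℤ.+ ℤ.- (c ℤ.* (b ℤ.+ c))) ℤ.+ c ℤ.* (c ℤ.* c ℤ.+ ℤ.- (b ℤ.* (a ℤ.+ b ℤ.+ c)))}
                {(b ℤ.+ c) ℤ.* (b ℤ.* (b ℤ.+ c) ℤ.+ ℤ.- (a ℤ.* c))}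
      (h+ {a ℤ.* (a ℤ.* (a ℤ.+ b ℤ.+ c) ℤ.+ ℤ.- (c ℤ.* (b ℤ.+ c)))} {c ℤ.* (c ℤ.* c ℤ.+ ℤ.- (b ℤ.* (a ℤ.+ b ℤ.+ c)))}
        (h* {a} {a ℤ.* (a ℤ.+ b ℤ.+ c) ℤ.+ ℤ.- (c ℤ.* (b ℤ.+ c))} refl
          (h+ {a ℤ.* (a ℤ.+ b ℤ.+ c)} {ℤ.- (c ℤ.* (b ℤ.+ c))} (h* {a} {a ℤ.+ b ℤ.+ c} refl s) (hn {c ℤ.* (b ℤ.+ c)} (h* {c} {b ℤ.+ c} refl t))))
        (h* {c} {c ℤ.* c ℤ.+ ℤ.- (b ℤ.* (a ℤ.+ b ℤ.+ c))} refl
          (h+ {c ℤ.* c} {ℤ.- (b ℤ.* (a ℤ.+ b ℤ.+ c))} (h* {c} {c} refl refl) (hn {b ℤ.* (a ℤ.+ b ℤ.+ c)} (h* {b} {a ℤ.+ b ℤ.+ c} refl s)))))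
      (h* {b ℤ.+ c} {b ℤ.* (b ℤ.+ c) ℤ.+ ℤ.- (a ℤ.* c)} t
        (h+ {b ℤ.* (b ℤ.+ c)} {ℤ.- (a ℤ.* c)} (h* {b} {b ℤ.+ c} refl t) (hn {a ℤ.* c} (h* {a} {c} refl refl))))

  -- A vanishing element has vanishing norm, so `norm-zero` applies.
  independent : ∀ a b c → lc (ιℤ a) (ιℤ b) (ιℤ c) ≡ 0# → a ≡ ℤ.+ 0 × b ≡ ℤ.+ 0 × c ≡ ℤ.+ 0
  independent a b c eq = norm-zero a b c (ιℤ-injective (norm a b c) (ℤ.+ 0)
    (trans (sym (lc-adj a b c)) (trans (cong (_* adj (ιℤ a) (ιℤ b) (ιℤ c)) eq) (zeroˡ _))))

  lc-zero : lc 0# 0# 0# ≡ 0#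
  lc-zero = alg α
    where
    alg = solve 1 (λ a → # 0 :+ # 0 :* a :+ # 0 :* (a :* a) := # 0) refl

  -- Equality is read off the integer coordinates after clearing the denominator; `independent`
  -- justifies the negative answer.
  zero? : ∀ x → Dec (x ≡ 0#)
  zero? x with integral x
  ... | d , a , b , c , eq with a ℤ.≟ ℤ.+ 0 | b ℤ.≟ ℤ.+ 0 | c ℤ.≟ ℤ.+ 0
  ... | yes refl | yes refl | yes refl = yes (cancel-ι-≡ d (trans eq lc-zero))
  ... | no a≢0 | _ | _ = no (λ x≡0 → a≢0 (proj₁ (independent a b c (trans (sym eq) (trans (cong (ι (suc d) *_) x≡0) (zeroʳ _))))))
  ... | yes _ | no b≢0 | _ = no (λ x≡0 → b≢0 (proj₁ (proj₂ (independent a b c (trans (sym eq) (trans (cong (ι (suc d) *_) x≡0) (zeroʳ _)))))))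
  ... | yes _ | yes _ | no c≢0 = no (λ x≡0 → c≢0 (proj₂ (proj₂ (independent a b c (trans (sym eq) (trans (cong (ι (suc d) *_) x≡0) (zeroʳ _)))))))

  abstract
    _≟0 : ∀ x → Dec (x ≡ 0#)
    x ≟0 = zero? x

  cancel-ιℤ-≡ : ∀ i {x} → ¬ i ≡ ℤ.+ 0 → ιℤ i * x ≡ 0# → x ≡ 0#
  cancel-ιℤ-≡ (ℤ.+ zero) i≢0 eq = ⊥-elim (i≢0 refl)
  cancel-ιℤ-≡ (ℤ.+ suc n) i≢0 eq = cancel-ι-≡ n eq
  cancel-ιℤ-≡ -[1+ n ] {x} i≢0 eq = cancel-ι-≡ n (trans (alg (ι (suc n)) x) (trans (cong -_ eq) -0#≈0#))
    where
    alg = solve 2 (λ a x → a :* x := :- ((:- a) :* x)) refl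

  -- Multiplication by the adjugate turns a nonzero `y` into a nonzero integer, which cancels.
  no-zero-divisors : ∀ x y → x * y ≡ 0# → x ≡ 0# ⊎ y ≡ 0#
  no-zero-divisors x y xy≡0 with y ≟0
  ... | yes y≡0 = inj₂ y≡0
  ... | no y≢0 with integral y
  ... | d , a , b , c , eq = inj₁ (cancel-ιℤ-≡ (norm a b c) nonzero (begin
      ιℤ (norm a b c) * x                                  ≡⟨ cong (_* x) (sym (lc-adj a b c)) ⟩
      lc (ιℤ a) (ιℤ b) (ιℤ c) * A * x                      ≡⟨ cong (λ z → z * A * x) (sym eq) ⟩
      ι (suc d) * y * A * x                                ≡⟨ alg (ι (suc d)) y A x ⟩
      ι (suc d) * A * (x * y)                              ≡⟨ cong (ι (suc d) * A *_) xy≡0 ⟩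
      ι (suc d) * A * 0#                                   ≡⟨ zeroʳ _ ⟩
      0#                                                   ∎))
    where
    open ≡-Reasoning
    A = adj (ιℤ a) (ιℤ b) (ιℤ c)
    alg = solve 4 (λ d y A x → d :* y :* A :* x := d :* A :* (x :* y)) refl
    nonzero : ¬ norm a b c ≡ ℤ.+ 0
    nonzero n≡0 with norm-zero a b c n≡0
    ... | refl , refl , refl = y≢0 (cancel-ι-≡ d (trans eq lc-zero))

  abstract
    domain : ∀ x y → x * y ≡ 0# → x ≡ 0# ⊎ y ≡ 0#
    domain = no-zero-divisors

-- Growth of Narayana's sequence.

^-distribʳ-* : ∀ n x y → (x ℕ.* y) ℕ.^ n ≡ x ℕ.^ n ℕ.* y ℕ.^ n
^-distribʳ-* zero    x y = refl
^-distribʳ-* (suc n) x y = trans (cong (x ℕ.* y ℕ.*_) (^-distribʳ-* n x y)) (ℕₚ.[m*n]*[o*p]≡[m*o]*[n*p] x y (x ℕ.^ n) (y ℕ.^ n))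

Narayana-pos : ∀ j → 1 ℕ.≤ Narayana (suc j)
Narayana-pos 0 = s≤s z≤n
Narayana-pos 1 = s≤s z≤n
Narayana-pos (suc (suc j)) = ℕₚ.≤-trans (Narayana-pos (suc j)) (ℕₚ.m≤m+n _ _)

Narayana-mono : ∀ j → Narayana j ℕ.≤ Narayana (suc j)
Narayana-mono 0 = z≤n
Narayana-mono 1 = s≤s z≤n
Narayana-mono (suc (suc j)) = ℕₚ.m≤m+n _ _

Narayana-6 : ∀ j → 6 ℕ.* Narayana j ℕ.≤ Narayana (6 ℕ.+ j)
Narayana-6 j = ℕₚ.≤-trans (ℕₚ.≤-trans (ℕₚ.≤-reflexive (lhs a)) (ℕₚ.+-mono-≤ (ℕₚ.+-mono-≤ (ℕₚ.*-monoʳ-≤ 3 a≤c) (ℕₚ.≤-trans a≤b ℕₚ.≤-refl)) ℕₚ.≤-refl))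
    (ℕₚ.≤-reflexive (rhs a b c))
  where
  a = Narayana j
  b = Narayana (suc j)
  c = Narayana (suc (suc j))
  a≤b = Narayana-mono j
  a≤c = ℕₚ.≤-trans a≤b (Narayana-mono (suc j))
  lhs : ∀ a → 6 ℕ.* a ≡ 3 ℕ.* a ℕ.+ a ℕ.+ 2 ℕ.* a
  lhs = solve-∀
  rhs : ∀ a b c → 3 ℕ.* c ℕ.+ b ℕ.+ 2 ℕ.* a ≡ c ℕ.+ a ℕ.+ b ℕ.+ c ℕ.+ (c ℕ.+ a)
  rhs = solve-∀

-- A factor 36 in twelve steps serves twice: it exceeds 2^5, and it exceeds 2 (5/4)^12.
Narayana-12 : ∀ i → 36 ℕ.^ i ℕ.≤ Narayana (suc (12 ℕ.* i))
Narayana-12 zero = s≤s z≤n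
Narayana-12 (suc i) = ℕₚ.≤-trans (ℕₚ.*-monoʳ-≤ 36 (Narayana-12 i)) (ℕₚ.≤-trans (ℕₚ.≤-reflexive (ℕₚ.*-assoc 6 6 N))
    (ℕₚ.≤-trans (ℕₚ.*-monoʳ-≤ 6 (Narayana-6 j)) (ℕₚ.≤-trans (Narayana-6 (6 ℕ.+ j)) (ℕₚ.≤-reflexive (cong Narayana (arith i))))))
  where
  j = suc (12 ℕ.* i)
  N = Narayana j
  arith : ∀ i → 6 ℕ.+ (6 ℕ.+ suc (12 ℕ.* i)) ≡ suc (12 ℕ.* suc i)
  arith = solve-∀

private
  compare-powers : ∀ A B i m → 5 ℕ.* m ℕ.≤ 4 ℕ.* 2 ℕ.^ i → 2 ℕ.* A ℕ.≤ B ℕ.* 36 →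
    m ℕ.* (5 ℕ.* A ℕ.^ i) ℕ.≤ 4 ℕ.* B ℕ.^ i ℕ.* 36 ℕ.^ i
  compare-powers A B i m 5m≤ num = begin
    m ℕ.* (5 ℕ.* A ℕ.^ i)                       ≡⟨ ar₁ m (A ℕ.^ i) ⟩
    (5 ℕ.* m) ℕ.* A ℕ.^ i                       ≤⟨ ℕₚ.*-monoˡ-≤ (A ℕ.^ i) 5m≤ ⟩
    (4 ℕ.* 2 ℕ.^ i) ℕ.* A ℕ.^ i                 ≡⟨ trans (ℕₚ.*-assoc 4 (2 ℕ.^ i) (A ℕ.^ i)) (cong (4 ℕ.*_) (sym (^-distribʳ-* i 2 A))) ⟩
    4 ℕ.* (2 ℕ.* A) ℕ.^ i                       ≤⟨ ℕₚ.*-monoʳ-≤ 4 (ℕₚ.^-monoˡ-≤ i num) ⟩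
    4 ℕ.* (B ℕ.* 36) ℕ.^ i                      ≡⟨ cong (4 ℕ.*_) (^-distribʳ-* i B 36) ⟩
    4 ℕ.* (B ℕ.^ i ℕ.* 36 ℕ.^ i)                ≡⟨ sym (ℕₚ.*-assoc 4 (B ℕ.^ i) (36 ℕ.^ i)) ⟩
    4 ℕ.* B ℕ.^ i ℕ.* 36 ℕ.^ i                  ∎
    where
    open ℕₚ.≤-Reasoning
    ar₁ : ∀ m z → m ℕ.* (5 ℕ.* z) ≡ 5 ℕ.* m ℕ.* z
    ar₁ = solve-∀

  beats-at : ∀ m i → 5 ℕ.* m ℕ.≤ 4 ℕ.* 2 ℕ.^ i → let j = suc (12 ℕ.* i) in m ℕ.* 5 ℕ.^ j ℕ.≤ 4 ℕ.^ j ℕ.* Narayana j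
  beats-at m i 5m≤ = subst₂ (λ A B → m ℕ.* (5 ℕ.* A) ℕ.≤ 4 ℕ.* B ℕ.* Narayana (suc (12 ℕ.* i)))
    (ℕₚ.^-*-assoc 5 12 i) (ℕₚ.^-*-assoc 4 12 i)
    (ℕₚ.≤-trans (compare-powers (5 ℕ.^ 12) (4 ℕ.^ 12) i m 5m≤ (ℕₚ.≤ᵇ⇒≤ (2 ℕ.* 5 ℕ.^ 12) (4 ℕ.^ 12 ℕ.* 36) _))
      (ℕₚ.*-monoʳ-≤ (4 ℕ.* (4 ℕ.^ 12) ℕ.^ i) (Narayana-12 i)))

-- (5/4)^j bounds the error of `N (suc j)` against `α * N j`. Since the sequence outgrows every
-- multiple of this error, its quotients approximate α well enough to round any field element.
Narayana-beats : ∀ m → ∃[ j ] (1 ℕ.≤ Narayana j × m ℕ.* 5 ℕ.^ j ℕ.≤ 4 ℕ.^ j ℕ.* Narayana j)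
Narayana-beats m = suc (12 ℕ.* suc m) , Narayana-pos (12 ℕ.* suc m) , beats-at m (suc m)
  (ℕₚ.≤-trans (ℕₚ.*-monoˡ-≤ m (s≤s (s≤s (s≤s (s≤s (s≤s (z≤n {3}))))))) (ℕₚ.≤-trans (ℕₚ.*-monoʳ-≤ 8 (ℕₚ.<⇒≤ (n<2^n m)))
    (ℕₚ.≤-reflexive (ℕₚ.*-assoc 4 2 (2 ℕ.^ m)))))

-- Heights, Liouville's inequality, rounding and the Binet formula.

module Arithmetic (𝓚 : CubicField) where
  open CubicFieldProperties 𝓚 public

  -- Membership in ℤ[α] with bounded coordinates, in place of a bound on all conjugates.
  record House (z : R) (m : ℕ) : Set where
    constructor house
    field
      a b c : ℤ
      eq    : z ≡ lc (ιℤ a) (ιℤ b) (ιℤ c)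
      a≤ : ℤ.∣ a ∣ ℕ.≤ m
      b≤ : ℤ.∣ b ∣ ℕ.≤ m
      c≤ : ℤ.∣ c ∣ ℕ.≤ m

  House-0 : ∀ m → House 0# m
  House-0 m = house (ℤ.+ 0) (ℤ.+ 0) (ℤ.+ 0) (sym lc-zero) z≤n z≤n z≤n

  House-≤ : ∀ {z m m'} → m ℕ.≤ m' → House z m → House z m'
  House-≤ p (house a b c eq a≤ b≤ c≤) = house a b c eq (ℕₚ.≤-trans a≤ p) (ℕₚ.≤-trans b≤ p) (ℕₚ.≤-trans c≤ p)

  House-+ : ∀ {z z' m m'} → House z m → House z' m' → House (z + z') (m ℕ.+ m')
  House-+ {m = m} {m'} (house a b c eq a≤ b≤ c≤) (house a' b' c' eq' a'≤ b'≤ c'≤) =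
    house (a ℤ.+ a') (b ℤ.+ b') (c ℤ.+ c')
      (trans (cong₂ _+_ eq eq') (trans (alg _ _ _ _ _ _ α)
        (cong₂ _+_ (cong₂ _+_ (sym (ιℤ-+ a a')) (cong (_* α) (sym (ιℤ-+ b b')))) (cong (_* (α * α)) (sym (ιℤ-+ c c'))))))
      (tri a a' a≤ a'≤) (tri b b' b≤ b'≤) (tri c c' c≤ c'≤)
    where
    alg = solve 7 (λ a b c d e f α → (a :+ b :* α :+ c :* (α :* α)) :+ (d :+ e :* α :+ f :* (α :* α)) := (a :+ d) :+ (b :+ e) :* α :+ (c :+ f) :* (α :* α)) refl
    tri : ∀ i j → ℤ.∣ i ∣ ℕ.≤ m → ℤ.∣ j ∣ ℕ.≤ m' → ℤ.∣ i ℤ.+ j ∣ ℕ.≤ m ℕ.+ m'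
    tri i j p q = ℕₚ.≤-trans (ℤₚ.∣i+j∣≤∣i∣+∣j∣ i j) (ℕₚ.+-mono-≤ p q)

  House-scale : ∀ i {z m k} → ℤ.∣ i ∣ ℕ.≤ k → House z m → House (ιℤ i * z) (k ℕ.* m)
  House-scale i {m = m} {k} i≤ (house a b c eq a≤ b≤ c≤) =
    house (i ℤ.* a) (i ℤ.* b) (i ℤ.* c)
      (trans (cong (ιℤ i *_) eq) (trans (alg _ _ _ _ α)
        (cong₂ _+_ (cong₂ _+_ (sym (ιℤ-* i a)) (cong (_* α) (sym (ιℤ-* i b)))) (cong (_* (α * α)) (sym (ιℤ-* i c))))))
      (mul a a≤) (mul b b≤) (mul c c≤)
    where
    alg = solve 5 (λ i a b c α → i :* (a :+ b :* α :+ c :* (α :* α)) := i :* a :+ i :* b :* α :+ i :* c :* (α :* α)) refl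
    mul : ∀ j → ℤ.∣ j ∣ ℕ.≤ m → ℤ.∣ i ℤ.* j ∣ ℕ.≤ k ℕ.* m
    mul j p = ℕₚ.≤-trans (ℕₚ.≤-reflexive (ℤₚ.∣i*j∣≡∣i∣*∣j∣ i j)) (ℕₚ.*-mono-≤ i≤ p)

  House-Σ : ∀ n {f : ℕ → R} {m} → (∀ i → i ℕ.< n → House (f i) m) → House (Σ< n f) (n ℕ.* m)
  House-Σ zero h = House-0 0
  House-Σ (suc n) {m = m} h = House-≤ (ℕₚ.≤-reflexive (ℕₚ.+-comm (n ℕ.* m) m))
    (House-+ (House-Σ n (λ i i<n → h i (ℕₚ.m≤n⇒m≤1+n i<n))) (h n (ℕₚ.n<1+n n)))

  -- Liouville's inequality: a nonzero element of ℤ[α] has norm at least 1 in absolute value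
  liouville : ∀ {z m δ} → House z m → Bd z δ → ι (25 ℕ.* (m ℕ.* m)) * δ ≤ ½ → z ≡ 0#
  liouville {z} {m} {δ} (house a b c eq a≤ b≤ c≤) bz small = finish (norm-zero a b c N≡0)
    where
    finish : a ≡ ℤ.+ 0 × b ≡ ℤ.+ 0 × c ≡ ℤ.+ 0 → z ≡ 0#
    finish (p , q , r) = trans eq (trans (cong₂ (λ u v → u + v) (cong₂ (λ u v → ιℤ u + ιℤ v * α) p q) (cong (λ v → ιℤ v * (α * α)) r)) lc-zero)
    x = ιℤ a
    y = ιℤ b
    w = ιℤ c
    M = ι m
    bx = ∣∣-Bd a a≤
    by = ∣∣-Bd b b≤
    bw = ∣∣-Bd c c≤
    bα : Bd α (ι 2)
    bα = Bd-0≤ 0≤α α≤2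
    -- With coordinates at most m and α at most 2, the adjugate collects (3 + 2) + 2 (1 + 3) + 4 (2
    -- + 1) = 25 times m².
    size-alg = solve 1 (λ m → ((m :* (m :+ m :+ m) :+ m :* (m :+ m)) :+ (m :* m :+ m :* (m :+ m :+ m)) :* # 2) :+ (m :* (m :+ m) :+ m :* m) :* (# 2 :* # 2) := # 25 :* (m :* m)) refl
    size-adj : Bd (adj x y w) (ι (25 ℕ.* (m ℕ.* m)))
    size-adj = Bd-≤ (≤-reflexive (trans (size-alg M) (sym (trans (ι-* 25 (m ℕ.* m)) (cong (ι 25 *_) (ι-* m m))))))
      (Bd-+ (Bd-+ (Bd-- (Bd-* bx (Bd-+ (Bd-+ bx by) bw)) (Bd-* bw (Bd-+ by bw)))
        (Bd-* (Bd-- (Bd-* bw bw) (Bd-* by (Bd-+ (Bd-+ bx by) bw))) bα))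
        (Bd-* (Bd-- (Bd-* by (Bd-+ by bw)) (Bd-* bx bw)) (Bd-* bα bα)))
    N = norm a b c
    bN : Bd (ιℤ N) ½
    bN = Bd-≤ small (subst (λ v → Bd v (ι (25 ℕ.* (m ℕ.* m)) * δ))
      (trans (*-comm _ _) (trans (cong (_* adj x y w) eq) (lc-adj a b c))) (Bd-* size-adj bz))
    N+N : Bd (ιℤ (N ℤ.+ N)) 1#
    N+N = subst₂ Bd (sym (ιℤ-+ N N)) ½+½ (Bd-+ bN bN)
    zero-of : ∀ N → Bd (ιℤ (N ℤ.+ N)) 1# → N ≡ ℤ.+ 0
    zero-of (ℤ.+ zero) b = refl
    zero-of (ℤ.+ suc n) (bd _ u) with ι-reflect (suc n ℕ.+ suc n) 1 u
    ... | s≤s q = contradiction (ℕₚ.≤-trans (ℕₚ.≤-reflexive (sym (ℕₚ.+-suc n n))) q) (λ ())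
    zero-of -[1+ n ] (bd l _) with ι-reflect (suc (suc (n ℕ.+ n))) 1 (≤-trans (≤-reflexive (sym (neg-neg _))) (≤-trans (neg-mono-≤ l) (≤-reflexive (neg-neg 1#))))
      where
      neg-neg = solve 1 (λ x → :- :- x := x) refl
    ... | s≤s ()
    N≡0 : N ≡ ℤ.+ 0
    N≡0 = zero-of N N+N

  -- Natural coordinates are closed under sums and products because the cubic relation has
  -- nonnegative coefficients. For such elements a height bound can be read off at the real place
  -- alone.
  record NatCoords (z : R) : Set where
    constructor nat
    field
      a b c : ℕ
      eq : z ≡ lc (ι a) (ι b) (ι c)

  NatCoords-ι : ∀ n → NatCoords (ι n)
  NatCoords-ι n = nat n 0 0 (alg (ι n) α)
    where
    alg = solve 2 (λ n α → n := n :+ # 0 :* α :+ # 0 :* (α :* α)) refl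

  NatCoords-α : NatCoords α
  NatCoords-α = nat 0 1 0 (alg α)
    where
    alg = solve 1 (λ α → α := # 0 :+ # 1 :* α :+ # 0 :* (α :* α)) refl

  NatCoords-+ : ∀ {z z'} → NatCoords z → NatCoords z' → NatCoords (z + z')
  NatCoords-+ (nat a b c eq) (nat a' b' c' eq') = nat (a ℕ.+ a') (b ℕ.+ b') (c ℕ.+ c')
    (trans (cong₂ _+_ eq eq') (trans (alg _ _ _ _ _ _ α)
      (cong₂ _+_ (cong₂ _+_ (sym (ι-+ a a')) (cong (_* α) (sym (ι-+ b b')))) (cong (_* (α * α)) (sym (ι-+ c c'))))))
    where
    alg = solve 7 (λ a b c d e f α → (a :+ b :* α :+ c :* (α :* α)) :+ (d :+ e :* α :+ f :* (α :* α)) := (a :+ d) :+ (b :+ e) :* α :+ (c :+ f) :* (α :* α)) refl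

  NatCoords-scale : ∀ n {z} → NatCoords z → NatCoords (ι n * z)
  NatCoords-scale n (nat a b c eq) = nat (n ℕ.* a) (n ℕ.* b) (n ℕ.* c)
    (trans (cong (ι n *_) eq) (trans (alg _ _ _ _ α)
      (cong₂ _+_ (cong₂ _+_ (sym (ι-* n a)) (cong (_* α) (sym (ι-* n b)))) (cong (_* (α * α)) (sym (ι-* n c))))))
    where
    alg = solve 5 (λ i a b c α → i :* (a :+ b :* α :+ c :* (α :* α)) := i :* a :+ i :* b :* α :+ i :* c :* (α :* α)) refl

  NatCoords-step : ∀ {z} → NatCoords z → NatCoords (α * z)
  NatCoords-step (nat a b c eq) = nat c a (b ℕ.+ c) (trans (cong (α *_) eq) (trans (alg _ _ _ α)
    (trans (cong (λ t → ι c * t + ι a * α + ι b * (α * α)) α³) (trans (alg' _ _ _ α)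
      (cong (λ t → ι c + ι a * α + t * (α * α)) (sym (ι-+ b c)))))))
    where
    alg = solve 4 (λ a b c α → α :* (a :+ b :* α :+ c :* (α :* α)) := c :* (α :* α :* α) :+ a :* α :+ b :* (α :* α)) refl
    alg' = solve 4 (λ a b c α → c :* (α :* α :+ # 1) :+ a :* α :+ b :* (α :* α) := c :+ a :* α :+ (b :+ c) :* (α :* α)) refl

  NatCoords-* : ∀ {z z'} → NatCoords z → NatCoords z' → NatCoords (z * z')
  NatCoords-* {z} {z'} (nat a b c eq) n' = subst NatCoords (sym (trans (cong (_* z') eq) (alg _ _ _ α z')))
    (NatCoords-+ (NatCoords-+ (NatCoords-scale a n') (NatCoords-scale b (NatCoords-step n')))
      (NatCoords-scale c (NatCoords-step (NatCoords-step n'))))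
    where
    alg = solve 5 (λ a b c α z → (a :+ b :* α :+ c :* (α :* α)) :* z := a :* z :+ b :* (α :* z) :+ c :* (α :* (α :* z))) refl

  NatCoords-^ : ∀ {z} → NatCoords z → ∀ n → NatCoords (z ^ n)
  NatCoords-^ h zero    = NatCoords-ι 1
  NatCoords-^ h (suc n) = NatCoords-* h (NatCoords-^ h n)

  NatCoords⇒0≤ : ∀ {z} → NatCoords z → 0# ≤ z
  NatCoords⇒0≤ (nat a b c eq) = subst (0# ≤_) (sym eq)
    (+-nonneg (+-nonneg (0≤ι a) (*-nonneg (0≤ι b) 0≤α)) (*-nonneg (0≤ι c) (*-nonneg 0≤α 0≤α)))

  -- for nonnegative coordinates the value at the real place dominates each coordinate
  NatCoords⇒House : ∀ {z m} → NatCoords z → z ≤ ι m → House z m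
  NatCoords⇒House {z} {m} (nat a b c eq) z≤m = house (ℤ.+ a) (ℤ.+ b) (ℤ.+ c) eq
    (ι-reflect a m (≤-trans (by-diff (+-nonneg Bα Cα) (ea (ι a) (ι b) (ι c) α)) lc≤))
    (ι-reflect b m (≤-trans (by-diff (+-nonneg (+-nonneg (0≤ι a) Cα) (*-nonneg (0≤ι b) (0≤y-x 1≤α))) (eb (ι a) (ι b) (ι c) α)) lc≤))
    (ι-reflect c m (≤-trans (by-diff (+-nonneg (+-nonneg (0≤ι a) Bα) (*-nonneg (0≤ι c) (0≤y-x 1≤αα))) (ec (ι a) (ι b) (ι c) α)) lc≤))
    where
    lc≤ = subst (_≤ ι m) eq z≤m
    Bα = *-nonneg (0≤ι b) 0≤α
    Cα = *-nonneg (0≤ι c) (*-nonneg 0≤α 0≤α)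
    1≤αα : 1# ≤ α * α
    1≤αα = ≤-trans (≤-reflexive (sym (*-identityˡ 1#))) (*-mono-≤ 0≤1 0≤α 1≤α 1≤α)
    ea = solve 4 (λ a b c α → (a :+ b :* α :+ c :* (α :* α)) :- a := b :* α :+ c :* (α :* α)) refl
    eb = solve 4 (λ a b c α → (a :+ b :* α :+ c :* (α :* α)) :- b := (a :+ c :* (α :* α)) :+ b :* (α :- # 1)) refl
    ec = solve 4 (λ a b c α → (a :+ b :* α :+ c :* (α :* α)) :- c := (a :+ b :* α) :+ c :* (α :* α :- # 1)) refl

  N : ℕ → R
  N j = ι (Narayana j)

  N-rec : ∀ j → N (3 ℕ.+ j) ≡ N (2 ℕ.+ j) + N j
  N-rec j = ι-+ (Narayana (2 ℕ.+ j)) (Narayana j)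

  dev : ℕ → R
  dev j = α * N j - N (suc j)

  private
    -- For identities that hold modulo the cubic relation: `q` is the cofactor of that relation.
    use-α³ : ∀ {x y} q → x ≡ y + (α * α * α - (α * α + 1#)) * q → x ≡ y
    use-α³ {x} {y} q eq = trans eq (trans (cong (λ t → y + (t - (α * α + 1#)) * q) α³) (alg y (α * α + 1#) q))
      where
      alg = solve 3 (λ y t q → y :+ (t :- t) :* q := y) refl

  -- the recurrence of the two conjugates of α
  dev-rec : ∀ j → dev (2 ℕ.+ j) ≡ (1# - α) * dev (suc j) - α⁻¹ * dev j
  dev-rec j = use-α³ (N j) (trans (cong (λ t → α * N (2 ℕ.+ j) - t) (N-rec j)) (alg (N j) (N (suc j)) (N (2 ℕ.+ j)) α))
    where
    alg = solve 4 (λ a b c α → α :* c :- (c :+ a) := (# 1 :- α) :* (α :* b :- c) :- α :* (α :- # 1) :* (α :* a :- b) :+ (α :* α :* α :- (α :* α :+ # 1)) :* a) refl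

  ¼ : R
  ¼ = inv 3

  5/4 : R
  5/4 = ι 5 * ¼

  0≤5/4 : 0# ≤ 5/4
  0≤5/4 = *-nonneg (0≤ι 5) (inv-pos 3)

  private
    scale-¼ : ∀ x → x ≡ ι 4 * ¼ * x
    scale-¼ x = sym (trans (cong (_* x) (inv-spec 3)) (*-identityˡ x))
    ≤-¼ : ∀ {x y} → ι 4 * x ≤ ι 4 * y → x ≤ y
    ≤-¼ {x} {y} p = 0≤y-x⁻¹ (cancel-ι 3 (≤-trans (0≤y-x p) (≤-reflexive (alg x y))))
      where
      alg = solve 2 (λ x y → # 4 :* y :- # 4 :* x := # 4 :* (y :- x)) refl

  Bd-1-α : Bd (1# - α) (ι 2 * ¼)
  Bd-1-α = bd (≤-¼ (by-diff (*-nonneg (0≤ι 2) (0≤y-x α-upper)) (trans (e₁ α ¼) (trans (cong (λ t → ι 4 * (1# - α) + ι 2 * t) (inv-spec 3)) (e₂ α)))))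
    (≤-trans (by-diff (0≤y-x 1≤α) (e₃ α)) (*-nonneg (0≤ι 2) (inv-pos 3)))
    where
    e₁ = solve 2 (λ α q → # 4 :* (# 1 :- α) :- # 4 :* :- (# 2 :* q) := # 4 :* (# 1 :- α) :+ # 2 :* (# 4 :* q)) refl
    e₂ = solve 1 (λ α → # 4 :* (# 1 :- α) :+ # 2 :* # 1 := # 2 :* (# 3 :- # 2 :* α)) refl
    e₃ = solve 1 (λ α → # 0 :- (# 1 :- α) := α :- # 1) refl

  Bd-α⁻¹ : Bd α⁻¹ (ι 3 * ¼)
  Bd-α⁻¹ = Bd-0≤ 0≤α⁻¹ (≤-¼ (≤-trans (≤-reflexive (*-comm _ _)) (≤-trans (*-monoʳ-≤ 0≤α⁻¹ α-lower)
      (≤-reflexive (trans (e₁ α α⁻¹) (trans (cong (ι 3 *_) α*α⁻¹) (trans (cong (ι 3 *_) (sym (inv-spec 3))) (e₂ ¼))))))))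
    where
    e₁ = solve 2 (λ a b → b :* (# 3 :* a) := # 3 :* (a :* b)) refl
    e₂ = solve 1 (λ q → # 3 :* (# 4 :* q) := # 4 :* (# 3 :* q)) refl

  -- The recurrence has coefficients of size at most 2/4 and 3/4, and (5/4)² exceeds (2/4)(5/4) +
  -- 3/4. The rate 5/4 is crude but still below α, which is at least 4/3.
  Bd-dev : ∀ j → Bd (dev j) (5/4 ^ j)
  Bd-dev 0 = subst (λ t → Bd t 1#) (sym (e α)) (Bd-neg (Bd-self 0≤1))
    where
    e = solve 1 (λ α → α :* # 0 :- # 1 := :- # 1) refl
  Bd-dev 1 = subst (λ t → Bd t (5/4 * 1#)) (sym (e α)) (Bd-≤ (by-diff (*-nonneg (0≤ι 3) (inv-pos 3)) (e' ¼)) (Bd-neg Bd-1-α))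
    where
    e = solve 1 (λ α → α :* # 1 :- # 1 := :- (# 1 :- α)) refl
    e' = solve 1 (λ q → # 5 :* q :* # 1 :- # 2 :* q := # 3 :* q) refl
  Bd-dev (suc (suc j)) = subst (λ t → Bd t (5/4 ^ suc (suc j))) (sym (dev-rec j))
    (Bd-≤ (by-diff (*-nonneg (*-nonneg (0≤ι 3) (*-nonneg (inv-pos 3) (inv-pos 3))) (^-nonneg 0≤5/4 j))
        (trans (cong (λ t → 5/4 * (5/4 * 5/4 ^ j) - (ι 2 * ¼ * (5/4 * 5/4 ^ j) + t)) (scale-¼ (ι 3 * ¼ * 5/4 ^ j))) (e ¼ (5/4 ^ j))))
      (Bd-- (Bd-* Bd-1-α (Bd-dev (suc j))) (Bd-* Bd-α⁻¹ (Bd-dev j))))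
    where
    e = solve 2 (λ q p → # 5 :* q :* (# 5 :* q :* p) :- (# 2 :* q :* (# 5 :* q :* p) :+ # 4 :* q :* (# 3 :* q :* p)) := # 3 :* (q :* q) :* p) refl

  4^*5/4^ : ∀ j → ι (4 ℕ.^ j) * 5/4 ^ j ≡ ι (5 ℕ.^ j)
  4^*5/4^ j = trans (cong (_* 5/4 ^ j) (ι-^ 4 j)) (trans (sym (*-^ (ι 4) 5/4 j))
    (trans (cong (_^ j) (trans (e ¼) (trans (cong (ι 5 *_) (inv-spec 3)) (*-identityʳ _)))) (sym (ι-^ 5 j))))
    where
    e = solve 1 (λ q → # 4 :* (# 5 :* q) := # 5 :* (# 4 :* q)) refl

  cancel-ι-≤ : ∀ n {x y} → 1 ℕ.≤ n → ι n * x ≤ ι n * y → x ≤ y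
  cancel-ι-≤ (suc d) {x} {y} _ p = 0≤y-x⁻¹ (cancel-ι d (≤-trans (0≤y-x p) (≤-reflexive (alg (ι (suc d)) x y))))
    where
    alg = solve 3 (λ d x y → d :* y :- d :* x := d :* (y :- x)) refl

  cancel-Bd : ∀ n {x m} → 1 ℕ.≤ n → Bd (ι n * x) (ι n * m) → Bd x m
  cancel-Bd n {x} {m} p (bd l u) = bd (cancel-ι-≤ n p (≤-trans (≤-reflexive (sym (-‿distribʳ-* _ _))) l)) (cancel-ι-≤ n p u)

  -- α and α² are replaced by the quotients of `N (suc j)` and `N (2 + j)` by `N j`, and integers
  -- are divided. The remainder and the approximation error contribute at most 1 each.
  floor-at : ∀ v d a b c → ι (suc d) * v ≡ lc (ιℤ a) (ιℤ b) (ιℤ c) → ∀ j → 1 ℕ.≤ Narayana j →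
    (ℤ.∣ b ∣ ℕ.+ 4 ℕ.* ℤ.∣ c ∣) ℕ.* 5 ℕ.^ j ℕ.≤ 4 ℕ.^ j ℕ.* Narayana j → ∃[ i ] Bd (v - ιℤ i) (ι 2)
  floor-at v d a b c eq j 1≤N beats = i , cancel-Bd D 1≤D (subst₂ Bd (sym split) (dbl (ι D)) (Bd-+ Bd-rem Bd-err))
    where
    m = ℤ.∣ b ∣ ℕ.+ 4 ℕ.* ℤ.∣ c ∣
    D = suc d ℕ.* Narayana j
    1≤D : 1 ℕ.≤ D
    1≤D = ℕₚ.≤-trans 1≤N (ℕₚ.m≤m+n _ _)
    instance
      D≢0 : ℕ.NonZero D
      D≢0 = ℕ.>-nonZero 1≤D
    num : ℤ
    num = a ℤ.* ℤ.+ Narayana j ℤ.+ b ℤ.* ℤ.+ Narayana (suc j) ℤ.+ c ℤ.* ℤ.+ Narayana (2 ℕ.+ j)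
    i = num ℤDM./ℕ D
    r = num ℤDM.%ℕ D
    dbl = solve 1 (λ x → x :+ x := x :* # 2) refl
    Bd-rem : Bd (ι r) (ι D)
    Bd-rem = Bd-0≤ (0≤ι r) (ι-mono-≤ (ℕₚ.<⇒≤ (ℤDM.n%ℕd<d num D)))
    err = ιℤ b * dev j + ιℤ c * (dev (suc j) + α * dev j)
    f = 5/4 ^ j
    Bd-err : Bd err (ι D)
    Bd-err = Bd-≤ (≤-trans bound (ι-mono-≤ (ℕₚ.m≤m+n (Narayana j) _)))
      (Bd-+ (Bd-* (∣∣-Bd b ℕₚ.≤-refl) (Bd-dev j))
        (Bd-* (∣∣-Bd c ℕₚ.≤-refl) (Bd-+ (Bd-dev (suc j)) (Bd-* (Bd-0≤ 0≤α α≤2) (Bd-dev j)))))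
      where
      e₁ = solve 4 (λ b c q f → ((b :+ # 4 :* c) :* f) :- (b :* f :+ c :* (# 5 :* q :* f :+ # 2 :* f)) := c :* f :* (# 2 :- # 5 :* q)) refl
      1/4-small : 0# ≤ ι 2 - 5/4
      1/4-small = cancel-ι 3 (≤-trans (0≤ι 3) (≤-reflexive (sym (trans (e₂ ¼) (trans (cong (λ t → ι 8 - ι 5 * t) (inv-spec 3)) e₃)))))
        where
        e₂ = solve 1 (λ q → # 4 :* (# 2 :- # 5 :* q) := # 8 :- # 5 :* (# 4 :* q)) refl
        e₃ : ι 8 - ι 5 * 1# ≡ ι 3
        e₃ = solve 0 (# 8 :- # 5 :* # 1 := # 3) refl
      e₄ = solve 3 (λ a b c → a :* (b :* c) := b :* (a :* c)) refl
      bound : ι ℤ.∣ b ∣ * f + ι ℤ.∣ c ∣ * (5/4 * f + ι 2 * f) ≤ N j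
      bound = ≤-trans (by-diff (*-nonneg (*-nonneg (0≤ι ℤ.∣ c ∣) (^-nonneg 0≤5/4 j)) 1/4-small) (e₁ (ι ℤ.∣ b ∣) (ι ℤ.∣ c ∣) ¼ f))
        (≤-trans (≤-reflexive (cong (_* f) (sym (trans (ι-+ ℤ.∣ b ∣ (4 ℕ.* ℤ.∣ c ∣)) (cong (ι ℤ.∣ b ∣ +_) (ι-* 4 ℤ.∣ c ∣))))))
        (cancel-ι-≤ (4 ℕ.^ j) (ℕₚ.m^n>0 4 j) (≤-trans (≤-reflexive (trans (e₄ _ (ι m) f) (trans (cong (ι m *_) (4^*5/4^ j)) (sym (ι-* m (5 ℕ.^ j))))))
          (≤-trans (ι-mono-≤ beats) (≤-reflexive (ι-* (4 ℕ.^ j) (Narayana j)))))))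
    ιnum : ιℤ num ≡ ιℤ a * N j + ιℤ b * N (suc j) + ιℤ c * N (2 ℕ.+ j)
    ιnum = trans (ιℤ-+ (a ℤ.* ℤ.+ Narayana j ℤ.+ b ℤ.* ℤ.+ Narayana (suc j)) (c ℤ.* ℤ.+ Narayana (2 ℕ.+ j)))
      (cong₂ _+_ (trans (ιℤ-+ (a ℤ.* ℤ.+ Narayana j) (b ℤ.* ℤ.+ Narayana (suc j)))
        (cong₂ _+_ (ιℤ-* a (ℤ.+ Narayana j)) (ιℤ-* b (ℤ.+ Narayana (suc j))))) (ιℤ-* c (ℤ.+ Narayana (2 ℕ.+ j))))
    division : ιℤ num ≡ ι r + ιℤ i * ι D
    division = trans (cong ιℤ (ℤDM.a≡a%ℕn+[a/ℕn]*n num D)) (trans (ιℤ-+ (ℤ.+ r) (i ℤ.* ℤ.+ D)) (cong (ι r +_) (ιℤ-* i (ℤ.+ D))))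
    split : ι D * (v - ιℤ i) ≡ ι r + err
    split = begin
      ι D * (v - ιℤ i)                                   ≡⟨ cong (λ t → t * (v - ιℤ i)) (ι-* (suc d) (Narayana j)) ⟩
      ι (suc d) * N j * (v - ιℤ i)                       ≡⟨ e₅ (ι (suc d)) (N j) v (ιℤ i) ⟩
      N j * (ι (suc d) * v) - ιℤ i * (ι (suc d) * N j)   ≡⟨ cong₂ (λ s t → N j * s - ιℤ i * t) eq (sym (ι-* (suc d) (Narayana j))) ⟩
      N j * lc (ιℤ a) (ιℤ b) (ιℤ c) - ιℤ i * ι D         ≡⟨ e₆ (N j) (N (suc j)) (N (2 ℕ.+ j)) (ιℤ a) (ιℤ b) (ιℤ c) (ιℤ i * ι D) α ⟩
      (ιℤ a * N j + ιℤ b * N (suc j) + ιℤ c * N (2 ℕ.+ j)) - ιℤ i * ι D + err   ≡⟨ cong (λ t → t - ιℤ i * ι D + err) (trans (sym ιnum) division) ⟩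
      ι r + ιℤ i * ι D - ιℤ i * ι D + err                ≡⟨ e₇ (ι r) (ιℤ i * ι D) err ⟩
      ι r + err                                          ∎
      where
      open ≡-Reasoning
      e₅ = solve 4 (λ d n v i → d :* n :* (v :- i) := n :* (d :* v) :- i :* (d :* n)) refl
      e₆ = solve 8 (λ p q r a b c t α → p :* (a :+ b :* α :+ c :* (α :* α)) :- t := (a :* p :+ b :* q :+ c :* r) :- t :+ (b :* (α :* p :- q) :+ c :* ((α :* q :- r) :+ α :* (α :* p :- q)))) refl
      e₇ = solve 3 (λ a b c → a :+ b :- b :+ c := a :+ c) refl

  floor : ∀ v → ∃[ i ] Bd (v - ιℤ i) (ι 2)
  floor v = choose (integral v)
    where
    choose : ∃[ d ] ∃[ a ] ∃[ b ] ∃[ c ] (ι (suc d) * v ≡ lc (ιℤ a) (ιℤ b) (ιℤ c)) → ∃[ i ] Bd (v - ιℤ i) (ι 2)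
    choose (d , a , b , c , eq) = floor-at v d a b c eq (proj₁ large) (proj₁ (proj₂ large)) (proj₂ (proj₂ large))
      where large = Narayana-beats (ℤ.∣ b ∣ ℕ.+ 4 ℕ.* ℤ.∣ c ∣)

  power-of-α : ∀ j → α ^ suc j ≡ N (2 ℕ.+ j) + (α - 1#) * N (suc j) + α⁻¹ * N j
  power-of-α zero = e α
    where
    e = solve 1 (λ α → α :* # 1 := # 1 :+ (α :- # 1) :* # 1 :+ α :* (α :- # 1) :* # 0) refl
  power-of-α (suc j) = trans (cong (α *_) (power-of-α j)) (trans (use-α³ (N j) (e (N j) (N (suc j)) (N (2 ℕ.+ j)) α))
      (cong (λ t → t + (α - 1#) * N (2 ℕ.+ j) + α⁻¹ * N (suc j)) (sym (N-rec j))))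
    where
    e = solve 4 (λ a b c α → α :* (c :+ (α :- # 1) :* b :+ α :* (α :- # 1) :* a) := (c :+ a) :+ (α :- # 1) :* c :+ α :* (α :- # 1) :* b :+ (α :* α :* α :- (α :* α :+ # 1)) :* a) refl

  π : R
  π = ι 3 + α * α

  -- 3 + α² = α p'(α) for the minimal polynomial p, so α^(n+2)/π is the dominant term of the Binet formula
  binet : ∀ n → Bd (π * N n - α ^ (2 ℕ.+ n)) (ι 9 * 5/4 ^ n)
  binet n = subst (λ t → Bd t (ι 9 * 5/4 ^ n)) (sym eq) (Bd-≤ bound
      (Bd-* (Bd-0≤ 0≤α α≤2) (Bd-+ (Bd-* Bd-3 (Bd-dev n)) (Bd-dev (suc n)))))
    where
    Bd-3 : Bd (ι 2 * α - 1#) (ι 3)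
    Bd-3 = Bd-0≤ (≤-trans (+-nonneg (0≤y-x 1≤α) 0≤α) (≤-reflexive (f α))) (≤-trans (by-diff 0≤1 (f' α)) α-upper)
      where
      f = solve 1 (λ α → (α :- # 1) :+ α := # 2 :* α :- # 1) refl
      f' = solve 1 (λ α → # 2 :* α :- (# 2 :* α :- # 1) := # 1) refl
    eq : π * N n - α ^ (2 ℕ.+ n) ≡ α * ((ι 2 * α - 1#) * dev n + dev (suc n))
    eq = trans (cong (λ t → π * N n - α * t) (power-of-α n)) (use-α³ (- (ι 3 * N n)) (e (N n) (N (suc n)) (N (2 ℕ.+ n)) α))
      where
      e = solve 4 (λ a b c α → (# 3 :+ α :* α) :* a :- α :* (c :+ (α :- # 1) :* b :+ α :* (α :- # 1) :* a) := α :* ((# 2 :* α :- # 1) :* (α :* a :- b) :+ (α :* b :- c)) :+ (α :* α :* α :- (α :* α :+ # 1)) :* (:- (# 3 :* a))) refl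
    bound : ι 2 * (ι 3 * 5/4 ^ n + 5/4 * 5/4 ^ n) ≤ ι 9 * 5/4 ^ n
    bound = by-diff (*-nonneg (*-nonneg (0≤ι 2) (inv-pos 3)) (^-nonneg 0≤5/4 n))
        (trans (cong (λ t → t - ι 2 * (ι 3 * 5/4 ^ n + 5/4 * 5/4 ^ n)) (scale-¼ _))
        (trans (cong (λ t → ι 4 * ¼ * (ι 9 * 5/4 ^ n) - ι 2 * (t + 5/4 * 5/4 ^ n)) (scale-¼ _)) (e ¼ (5/4 ^ n))))
      where
      e = solve 2 (λ q p → # 4 :* q :* (# 9 :* p) :- # 2 :* (# 4 :* q :* (# 3 :* p) :+ # 5 :* q :* p) := # 2 :* q :* p) refl

-- Polynomial functions and the zero estimate.

binomial-absorb : ∀ x k → suc k ℕ.* binomial x (suc k) ℕ.+ k ℕ.* binomial x k ≡ x ℕ.* binomial x k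
binomial-absorb zero zero = refl
binomial-absorb zero (suc k) = cong₂ ℕ._+_ (ℕₚ.*-zeroʳ (suc (suc k))) (ℕₚ.*-zeroʳ (suc k))
binomial-absorb (suc x) zero = trans (lem (binomial x 1)) (cong suc (trans (lem' (binomial x 1)) (binomial-absorb x zero)))
  where
  lem : ∀ c → 1 ℕ.* (1 ℕ.+ c) ℕ.+ 0 ℕ.* 1 ≡ suc c
  lem = solve-∀
  lem' : ∀ c → c ≡ 1 ℕ.* c ℕ.+ 0 ℕ.* 1
  lem' = solve-∀
binomial-absorb (suc x) (suc k) = trans (lem k c₀ c₁ c₂) (trans (cong₂ (λ s t → c₀ ℕ.+ c₁ ℕ.+ s ℕ.+ t)
    (binomial-absorb x (suc k)) (binomial-absorb x k)) (lem' x c₀ c₁))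
  where
  c₀ = binomial x k
  c₁ = binomial x (suc k)
  c₂ = binomial x (suc (suc k))
  lem : ∀ k c₀ c₁ c₂ → suc (suc k) ℕ.* (c₁ ℕ.+ c₂) ℕ.+ suc k ℕ.* (c₀ ℕ.+ c₁)
    ≡ c₀ ℕ.+ c₁ ℕ.+ (suc (suc k) ℕ.* c₂ ℕ.+ suc k ℕ.* c₁) ℕ.+ (suc k ℕ.* c₁ ℕ.+ k ℕ.* c₀)
  lem = solve-∀
  lem' : ∀ x c₀ c₁ → c₀ ℕ.+ c₁ ℕ.+ x ℕ.* c₁ ℕ.+ x ℕ.* c₀ ≡ suc x ℕ.* (c₀ ℕ.+ c₁)
  lem' = solve-∀

binomial-above : ∀ x k → x ℕ.< k → binomial x k ≡ 0
binomial-above zero    (suc k) _       = refl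
binomial-above (suc x) (suc k) (s≤s p) = cong₂ ℕ._+_ (binomial-above x k p) (binomial-above x (suc k) (ℕₚ.m≤n⇒m≤1+n p))

binomial-diag : ∀ k → binomial k k ≡ 1
binomial-diag zero    = refl
binomial-diag (suc k) = cong₂ ℕ._+_ (binomial-diag k) (binomial-above k (suc k) (ℕₚ.n<1+n k))

-- The remainders modulo `n` stay below `q`, so division by `q` recovers remainder and quotient of
-- `i`.
grid-injective : ∀ n q .{{_ : ℕ.NonZero n}} .{{_ : ℕ.NonZero q}} → n ℕ.≤ q → ∀ i j →
  i DM.% n ℕ.+ i DM./ n ℕ.* q ≡ j DM.% n ℕ.+ j DM./ n ℕ.* q → i ≡ j
grid-injective n q n≤q i j eq = trans (DM.m≡m%n+[m/n]*n i n) (trans (cong₂ (λ r s → r ℕ.+ s ℕ.* n) rem quot)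
    (sym (DM.m≡m%n+[m/n]*n j n)))
  where
  small : ∀ i → i DM.% n ℕ.< q
  small i = ℕₚ.<-≤-trans (DM.m%n<n i n) n≤q
  rem : i DM.% n ≡ j DM.% n
  rem = trans (sym (DM.m<n⇒m%n≡m (small i))) (trans (sym (DM.[m+kn]%n≡m%n (i DM.% n) (i DM./ n) q))
    (trans (cong (DM._% q) eq) (trans (DM.[m+kn]%n≡m%n (j DM.% n) (j DM./ n) q) (DM.m<n⇒m%n≡m (small j)))))
  quot : i DM./ n ≡ j DM./ n
  quot = ℕₚ.*-cancelʳ-≡ (i DM./ n) (j DM./ n) q (ℕₚ.+-cancelˡ-≡ (i DM.% n) _ _ (trans eq (cong (ℕ._+ j DM./ n ℕ.* q) (sym rem))))

module ZeroEstimate (𝓚 : CubicField) where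
  open Arithmetic 𝓚

  -- Polynomial functions of degree below `d`, with one power split off at a time. In `Lead` the
  -- coefficient of x^d is named, and it may be zero.
  Deg : ℕ → (ℕ → R) → Set
  Deg zero    f = ∀ x → f x ≡ 0#
  Deg (suc d) f = ∃[ c ] ∃[ g ] (Deg d g × (∀ x → f x ≡ g x + c * ι x ^ d))

  Lead : ℕ → R → (ℕ → R) → Set
  Lead d c f = ∃[ g ] (Deg d g × (∀ x → f x ≡ g x + c * ι x ^ d))

  private
    interchange = solve 5 (λ a b c d p → (a :+ b :* p) :+ (c :+ d :* p) := (a :+ c) :+ (b :+ d) :* p) refl
    scale-add = solve 4 (λ k a b p → k :* (a :+ b :* p) := k :* a :+ k :* b :* p) refl

  Deg-cong : ∀ d {f g} → (∀ x → f x ≡ g x) → Deg d f → Deg d g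
  Deg-cong zero    e h = λ x → trans (sym (e x)) (h x)
  Deg-cong (suc d) e (c , g , Dg , h) = c , g , Dg , λ x → trans (sym (e x)) (h x)

  Deg-+ : ∀ d {f g} → Deg d f → Deg d g → Deg d (λ x → f x + g x)
  Deg-+ zero    h k = λ x → trans (cong₂ _+_ (h x) (k x)) (+-identityʳ 0#)
  Deg-+ (suc d) (c , f' , Df , h) (c' , g' , Dg , k) = c + c' , (λ x → f' x + g' x) , Deg-+ d Df Dg ,
    λ x → trans (cong₂ _+_ (h x) (k x)) (interchange _ _ _ _ _)

  Deg-* : ∀ d k {f} → Deg d f → Deg d (λ x → k * f x)
  Deg-* zero    k h = λ x → trans (cong (k *_) (h x)) (zeroʳ k)
  Deg-* (suc d) k (c , g , Dg , h) = k * c , (λ x → k * g x) , Deg-* d k Dg , λ x → trans (cong (k *_) (h x)) (scale-add _ _ _ _)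

  Deg-suc : ∀ d {f} → Deg d f → Deg (suc d) f
  Deg-suc d {f} h = 0# , f , h , λ x → sym (trans (cong (f x +_) (zeroˡ _)) (+-identityʳ _))

  Deg-≤ : ∀ {d e f} → d ℕ.≤ e → Deg d f → Deg e f
  Deg-≤ {d} {e} le h = go (ℕₚ.≤⇒≤′ le) h
    where
    go : ∀ {e} → d ℕ.≤′ e → ∀ {f} → Deg d f → Deg e f
    go (ℕ.≤′-reflexive refl) h = h
    go (ℕ.≤′-step {n} p)  h = Deg-suc n (go p h)

  Deg-X : ∀ d {f} → Deg d f → Deg (suc d) (λ x → ι x * f x)
  Deg-X zero    h = Deg-suc 0 (λ x → trans (cong (ι x *_) (h x)) (zeroʳ _))
  Deg-X (suc d) (c , g , Dg , h) = c , (λ x → ι x * g x) , Deg-X d Dg , λ x → trans (cong (ι x *_) (h x)) (alg (ι x) (g x) c (ι x ^ d))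
    where
    alg = solve 4 (λ x g c p → x :* (g :+ c :* p) := x :* g :+ c :* (x :* p)) refl

  Deg-X^ : ∀ d e {f} → Deg d f → Deg (e ℕ.+ d) (λ x → ι x ^ e * f x)
  Deg-X^ d zero    h = Deg-cong d (λ x → sym (*-identityˡ _)) h
  Deg-X^ d (suc e) h = Deg-cong (suc (e ℕ.+ d)) (λ x → sym (*-assoc _ _ _)) (Deg-X (e ℕ.+ d) (Deg-X^ d e h))

  Deg-mul : ∀ d e {f g} → Deg d f → Deg e g → Deg (e ℕ.+ d) (λ x → f x * g x)
  Deg-mul d zero    h k = Deg-≤ z≤n (λ x → trans (cong (_ *_) (k x)) (zeroʳ _))
  Deg-mul d (suc e) {f} h (c , g' , Dg , k) = Deg-suc (e ℕ.+ d) (Deg-cong (e ℕ.+ d)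
      (λ x → trans (alg (f x) (g' x) c (ι x ^ e)) (cong (f x *_) (sym (k x))))
      (Deg-+ (e ℕ.+ d) (Deg-mul d e h Dg) (Deg-* (e ℕ.+ d) c (Deg-X^ d e h))))
    where
    alg = solve 4 (λ f g c p → f :* g :+ c :* (p :* f) := f :* (g :+ c :* p)) refl

  Deg-comm : ∀ d e {f} → Deg (d ℕ.+ e) f → Deg (e ℕ.+ d) f
  Deg-comm d e {f} = subst (λ m → Deg m f) (ℕₚ.+-comm d e)

  Lead-mul : ∀ d e {a b f g} → Lead d a f → Lead e b g → Lead (d ℕ.+ e) (a * b) (λ x → f x * g x)
  Lead-mul d e {a} {b} (f' , Df , h) (g' , Dg , k) =
    (λ x → f' x * g' x + (b * (ι x ^ e * f' x) + a * (ι x ^ d * g' x))) ,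
    Deg-+ (d ℕ.+ e) (Deg-comm e d (Deg-mul d e Df Dg))
      (Deg-+ (d ℕ.+ e) (Deg-comm e d (Deg-* (e ℕ.+ d) b (Deg-X^ d e Df))) (Deg-* (d ℕ.+ e) a (Deg-X^ e d Dg))) ,
    λ x → trans (cong₂ _*_ (h x) (k x)) (trans (alg _ _ a b (ι x ^ d) (ι x ^ e)) (cong (λ t → f' x * g' x + (b * (ι x ^ e * f' x) + a * (ι x ^ d * g' x)) + a * b * t) (sym (^-+ (ι x) d e))))
    where
    alg = solve 6 (λ f g a b p q → (f :+ a :* p) :* (g :+ b :* q) := f :* g :+ (b :* (q :* f) :+ a :* (p :* g)) :+ a :* b :* (p :* q)) refl

  Lead-* : ∀ d k {c f} → Lead d c f → Lead d (k * c) (λ x → k * f x)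
  Lead-* d k (g , Dg , h) = (λ x → k * g x) , Deg-* d k Dg , λ x → trans (cong (k *_) (h x)) (scale-add _ _ _ _)

  Lead-+ : ∀ d {a b f g} → Lead d a f → Lead d b g → Lead d (a + b) (λ x → f x + g x)
  Lead-+ d (f' , Df , h) (g' , Dg , k) = (λ x → f' x + g' x) , Deg-+ d Df Dg , λ x → trans (cong₂ _+_ (h x) (k x)) (interchange _ _ _ _ _)

  Lead-cong : ∀ d {a b f g} → a ≡ b → (∀ x → f x ≡ g x) → Lead d a f → Lead d b g
  Lead-cong d refl e (g' , Dg , h) = g' , Dg , λ x → trans (sym (e x)) (h x)

  Lead-X : Lead 1 1# ι
  Lead-X = (λ _ → 0#) , Deg-suc 0 (λ _ → refl) , λ x → alg (ι x)
    where
    alg = solve 1 (λ x → x := # 0 :+ # 1 :* (x :* # 1)) refl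

  Lead-suc : Lead 1 1# (ι ∘ suc)
  Lead-suc = (λ _ → 1#) , (1# , (λ _ → 0#) , (λ _ → refl) , λ x → alg') , λ x → trans (ι-suc x) (alg (ι x))
    where
    alg = solve 1 (λ x → # 1 :+ x := # 1 :+ # 1 :* (x :* # 1)) refl
    alg' : 1# ≡ 0# + 1# * 1#
    alg' = solve 0 (# 1 := # 0 :+ # 1 :* # 1) refl

  Lead-suc^ : ∀ d → Lead d 1# (λ x → ι (suc x) ^ d)
  Lead-suc^ zero    = (λ _ → 0#) , (λ _ → refl) , λ x → alg
    where
    alg : 1# ≡ 0# + 1# * 1#
    alg = solve 0 (# 1 := # 0 :+ # 1 :* # 1) refl
  Lead-suc^ (suc d) = Lead-cong (suc d) (*-identityˡ 1#) (λ _ → refl) (Lead-mul 1 d Lead-suc (Lead-suc^ d))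

  -- A shift preserves the leading coefficient; the elimination below lives on comparing leading
  -- coefficients before and after it.
  Deg-shift : ∀ d {f} → Deg d f → Deg d (f ∘ suc)
  Lead-shift : ∀ d {c f} → Lead d c f → Lead d c (f ∘ suc)
  Deg-shift zero    h = h ∘ suc
  Deg-shift (suc d) (c , L) = c , Lead-shift d L
  Lead-shift d {c} (g , Dg , h) = Lead-cong d (trans (+-identityˡ _) (*-identityʳ c)) (λ x → sym (h (suc x)))
    (Lead-+ d {a = 0#} (g ∘ suc , Deg-shift d Dg , λ x → sym (trans (cong (g (suc x) +_) (zeroˡ _)) (+-identityʳ _)))
      (Lead-* d c (Lead-suc^ d)))

  power-quotient : ∀ r d → ∃[ h ] (Lead d 1# h × (∀ x → ι x ^ suc d - ι r ^ suc d ≡ (ι x - ι r) * h x))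
  power-quotient r zero = (λ _ → 1#) , ((λ _ → 0#) , (λ _ → refl) , λ x → alg) , λ x → alg' (ι x) (ι r)
    where
    alg : 1# ≡ 0# + 1# * 1#
    alg = solve 0 (# 1 := # 0 :+ # 1 :* # 1) refl
    alg' = solve 2 (λ x r → x :* # 1 :- r :* # 1 := (x :- r) :* # 1) refl
  power-quotient r (suc d) with power-quotient r d
  ... | h , L , eq = (λ x → ι x * h x + ι r ^ suc d) ,
      Lead-cong (suc d) (trans (+-identityʳ _) (*-identityˡ 1#)) (λ _ → refl)
        (Lead-+ (suc d) (Lead-mul 1 d Lead-X L) const) ,
      λ x → trans (alg₁ (ι x) (ι r) (ι x ^ suc d) (ι r ^ suc d)) (trans (cong (λ t → ι x * t + ι r ^ suc d * (ι x - ι r)) (eq x)) (alg₂ (ι x) (ι r) (h x) (ι r ^ suc d)))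
    where
    alg₁ = solve 4 (λ x r p q → x :* p :- r :* q := x :* (p :- q) :+ q :* (x :- r)) refl
    alg₂ = solve 4 (λ x r h q → x :* ((x :- r) :* h) :+ q :* (x :- r) := (x :- r) :* (x :* h :+ q)) refl
    const : Lead (suc d) 0# (λ _ → ι r ^ suc d)
    const = (λ _ → ι r ^ suc d) , Deg-≤ (s≤s z≤n) (ι r ^ suc d , (λ _ → 0#) , (λ _ → refl) , λ x → alg₃ (ι r ^ suc d)) ,
        λ x → sym (trans (cong (ι r ^ suc d +_) (zeroˡ _)) (+-identityʳ _))
      where
      alg₃ = solve 1 (λ c → c := # 0 :+ c :* # 1) refl

  Deg-quotient : ∀ r d {f} → Deg (suc d) f → ∃[ h ] (Deg d h × (∀ x → f x - f r ≡ (ι x - ι r) * h x))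
  Lead-quotient : ∀ r d {c f} → Lead (suc d) c f → ∃[ h ] (Lead d c h × (∀ x → f x - f r ≡ (ι x - ι r) * h x))
  Deg-quotient r zero {f} (c , g , Dg , h) = (λ _ → 0#) , (λ _ → refl) ,
      λ x → trans (cong₂ _-_ (trans (h x) (cong (_+ c * 1#) (Dg x))) (trans (h r) (cong (_+ c * 1#) (Dg r)))) (alg c (ι x) (ι r))
    where
    alg = solve 3 (λ c x r → (# 0 :+ c :* # 1) :- (# 0 :+ c :* # 1) := (x :- r) :* # 0) refl
  Deg-quotient r (suc d) (c , L) with Lead-quotient r d L
  ... | h , L' , eq = h , (c , L') , eq
  Lead-quotient r d {c} {f} (g , Dg , h) with Deg-quotient r d Dg | power-quotient r d
  ... | k , Dk , ek | p , Lp , ep = (λ x → k x + c * p x) ,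
      Lead-cong d (trans (+-identityˡ _) (*-identityʳ c)) (λ _ → refl)
        (Lead-+ d {a = 0#} (k , Dk , λ x → sym (trans (cong (k x +_) (zeroˡ _)) (+-identityʳ _))) (Lead-* d c Lp)) ,
      λ x → trans (cong₂ _-_ (h x) (h r)) (trans (alg₁ (g x) (g r) c (ι x ^ suc d) (ι r ^ suc d))
        (trans (cong₂ (λ s t → s + c * t) (ek x) (ep x)) (alg₂ (ι x - ι r) (k x) c (p x))))
    where
    alg₁ = solve 5 (λ a b c p q → (a :+ c :* p) :- (b :+ c :* q) := (a :- b) :+ c :* (p :- q)) refl
    alg₂ = solve 4 (λ z k c p → z :* k :+ c :* (z :* p) := z :* (k :+ c :* p)) refl

  ι-injective : ∀ m n → ι m ≡ ι n → m ≡ n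
  ι-injective m n eq = ℕₚ.≤-antisym (ι-reflect m n (≤-reflexive eq)) (ι-reflect n m (≤-reflexive (sym eq)))

  sub-zero : ∀ {x y} → x - y ≡ 0# → x ≡ y
  sub-zero {x} {y} eq = trans (alg x y) (trans (cong (_+ y) eq) (+-identityˡ y))
    where
    alg = solve 2 (λ x y → x := (x :- y) :+ y) refl

  -- Factor theorem: division by x - r keeps the leading coefficient, and the remaining roots
  -- survive because there are no zero divisors.
  Lead-roots : ∀ d {c f} (pts : ℕ → ℕ) → Lead d c f → (∀ i → i ℕ.< suc d → f (pts i) ≡ 0#) →
    (∀ i j → i ℕ.< j → j ℕ.< suc d → pts i ≢ pts j) → c ≡ 0#
  Lead-roots zero {c} pts (g , Dg , h) root _ = trans (alg c) (trans (cong (_+ c * 1#) (sym (Dg (pts 0))))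
      (trans (sym (h (pts 0))) (root 0 (s≤s z≤n))))
    where
    alg = solve 1 (λ c → c := # 0 :+ c :* # 1) refl
  Lead-roots (suc d) {c} {f} pts L root distinct = divide (Lead-quotient (pts (suc d)) d L)
    where
    r = pts (suc d)
    divide : ∃[ h ] (Lead d c h × (∀ x → f x - f r ≡ (ι x - ι r) * h x)) → c ≡ 0#
    divide (h , L' , eq) = Lead-roots d pts L' root' (λ i j i<j j<d → distinct i j i<j (ℕₚ.m≤n⇒m≤1+n j<d))
      where
      root' : ∀ i → i ℕ.< suc d → h (pts i) ≡ 0#
      root' i i<d = pick (domain (ι (pts i) - ι r) (h (pts i)) (trans (sym (eq (pts i)))
          (trans (cong₂ _-_ (root i (ℕₚ.m≤n⇒m≤1+n i<d)) (root (suc d) (ℕₚ.n<1+n (suc d)))) (-‿inverseʳ 0#))))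
        where
        pick : ι (pts i) - ι r ≡ 0# ⊎ h (pts i) ≡ 0# → h (pts i) ≡ 0#
        pick (inj₂ h≡0) = h≡0
        pick (inj₁ e) = contradiction (ι-injective _ _ (sub-zero e)) (distinct i (suc d) i<d (ℕₚ.n<1+n (suc d)))

  Deg-roots : ∀ d {f} (pts : ℕ → ℕ) → Deg d f → (∀ i → i ℕ.< d → f (pts i) ≡ 0#) →
    (∀ i j → i ℕ.< j → j ℕ.< d → pts i ≢ pts j) → ∀ x → f x ≡ 0#
  Deg-roots zero    pts h root distinct = h
  Deg-roots (suc d) {f} pts (c , g , Dg , h) root distinct x = trans (f≡g x)
      (Deg-roots d pts Dg (λ i i<d → trans (sym (f≡g (pts i))) (root i (ℕₚ.m≤n⇒m≤1+n i<d)))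
        (λ i j i<j j<d → distinct i j i<j (ℕₚ.m≤n⇒m≤1+n j<d)) x)
    where
    c≡0 = Lead-roots d pts (g , Dg , h) root distinct
    f≡g : ∀ x → f x ≡ g x
    f≡g x = trans (h x) (trans (cong (λ t → g x + t * ι x ^ d) c≡0) (trans (cong (g x +_) (zeroˡ _)) (+-identityʳ _)))

  -- Finds the true degree, by deciding whether each leading coefficient vanishes.
  zero-or-lead : ∀ d {f} → Deg d f → (∀ x → f x ≡ 0#) ⊎ ∃[ e ] ∃[ c ] (c ≢ 0# × Lead e c f)
  zero-or-lead zero    h = inj₁ h
  zero-or-lead (suc d) {f} (c , g , Dg , h) with c ≟0
  ... | no c≢0 = inj₂ (d , c , c≢0 , g , Dg , h)
  ... | yes c≡0 = zero-or-lead d (Deg-cong d (λ x → sym (trans (h x)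
        (trans (cong (λ t → g x + t * ι x ^ d) c≡0) (trans (cong (g x +_) (zeroˡ _)) (+-identityʳ _))))) Dg)

  Σ<-first : ∀ n f → Σ< (suc n) f ≡ f 0 + Σ< n (f ∘ suc)
  Σ<-first n f = trans (Σ<-split 1 n f) (cong (_+ Σ< n (f ∘ suc)) (+-identityˡ (f 0)))

  module Grid (u : R) (q S : ℕ) (Y : ℕ → ℕ → R) (Y-step : ∀ r s → Y (suc r) s ≡ u * Y r s)
    (Y≢0 : ∀ r s → Y r s ≢ 0#) (1≤q : 1 ℕ.≤ q) where

    Vanish : ℕ → ℕ → (ℕ → ℕ → R) → Set
    Vanish j n P = ∀ r s → r ℕ.< n → s ℕ.< S → Σ< (suc j) (λ l → P l (r ℕ.+ s ℕ.* q) * Y r s ^ l) ≡ 0#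

    Y-cancel : ∀ r s {z} → Y r s * z ≡ 0# → z ≡ 0#
    Y-cancel r s {z} eq with domain (Y r s) z eq
    ... | inj₁ e = contradiction e (Y≢0 r s)
    ... | inj₂ e = e

    grid-roots : ∀ d n {f} → Deg d f → n ℕ.≤ q → d ℕ.≤ n ℕ.* S →
      (∀ r s → r ℕ.< n → s ℕ.< S → f (r ℕ.+ s ℕ.* q) ≡ 0#) → ∀ x → f x ≡ 0#
    grid-roots d zero    {f} h n≤q d≤ root x = Deg-roots d (λ i → i) h (λ i i<d → contradiction (ℕₚ.≤-trans i<d d≤) (λ ()))
      (λ i j i<j j<d → ℕₚ.<⇒≢ i<j) x
    grid-roots d n@(suc _) {f} h n≤q d≤ root = Deg-roots d pts h
        (λ i i<d → root (i DM.% n) (i DM./ n) (DM.m%n<n i n)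
          (DM.m<n*o⇒m/o<n {i} {S} {n} (ℕₚ.<-≤-trans i<d (ℕₚ.≤-trans d≤ (ℕₚ.≤-reflexive (ℕₚ.*-comm n S))))))
        (λ i j i<j _ eq → ℕₚ.<⇒≢ i<j (grid-injective n q {{_}} {{ℕ.>-nonZero 1≤q}} n≤q i j eq))
      where
      pts : ℕ → ℕ
      pts i = i DM.% n ℕ.+ i DM./ n ℕ.* q

    drop-first : ∀ j r s (P : ℕ → ℕ → R) → let x = r ℕ.+ s ℕ.* q in
      Σ< (suc (suc j)) (λ l → P l x * Y r s ^ l) ≡ P 0 x + Y r s * Σ< (suc j) (λ l → P (suc l) x * Y r s ^ l)
    drop-first j r s P = trans (Σ<-first (suc j) _) (cong₂ _+_ (*-identityʳ _)
        (trans (Σ<-cong (suc j) (λ l _ → alg (P (suc l) (r ℕ.+ s ℕ.* q)) (Y r s) (Y r s ^ l))) (Σ<-*ˡ (suc j) (Y r s) _)))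
      where
      alg = solve 3 (λ p y z → p :* (y :* z) := y :* (p :* z)) refl

    -- Eliminating P 0 between F(x, Y) and F(x + 1, uY) leaves a relation with one term less
    -- whose coefficients have at most twice the degree.
    zero-estimate : ∀ j d n (P : ℕ → ℕ → R) → (∀ l → l ℕ.≤ j → Deg d (P l)) → (∀ l → 1 ℕ.≤ l → l ℕ.≤ j → u ^ l ≢ 1#) →
      n ℕ.+ j ℕ.≤ q → 2 ℕ.^ j ℕ.* d ℕ.≤ n ℕ.* S → Vanish j (n ℕ.+ j) P → ∀ l → l ℕ.≤ j → ∀ x → P l x ≡ 0#
    zero-estimate zero d n P degs _ n≤q enough vanish zero _ =
      grid-roots d n (degs 0 z≤n) (ℕₚ.≤-trans (ℕₚ.m≤m+n n 0) n≤q) (ℕₚ.≤-trans (ℕₚ.m≤m+n d 0) enough)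
        (λ r s r<n s<S → trans (sym (trans (+-identityˡ _) (*-identityʳ _))) (vanish r s (ℕₚ.<-≤-trans r<n (ℕₚ.m≤m+n n 0)) s<S))
    zero-estimate (suc j) d n P degs u^≢1 n≤q enough vanish = conclude (zero-or-lead d (degs 0 z≤n))
      where
      n+j≤ : n ℕ.+ j ℕ.≤ n ℕ.+ suc j
      n+j≤ = ℕₚ.+-monoʳ-≤ n (ℕₚ.n≤1+n j)
      n+j≤q : n ℕ.+ j ℕ.≤ q
      n+j≤q = ℕₚ.≤-trans n+j≤ n≤q
      d≤ : ∀ i → d ℕ.≤ 2 ℕ.^ i ℕ.* d
      d≤ i = ℕₚ.≤-trans (ℕₚ.≤-reflexive (sym (ℕₚ.*-identityˡ d))) (ℕₚ.*-monoˡ-≤ d (ℕₚ.m^n>0 2 i))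
      Tail = ∀ l → l ℕ.≤ j → ∀ x → P (suc l) x ≡ 0#

      with-head : Tail → (∀ x → P 0 x ≡ 0#) → ∀ l → l ℕ.≤ suc j → ∀ x → P l x ≡ 0#
      with-head tail head zero    _       = head
      with-head tail head (suc l) (s≤s p) = tail l p

      conclude : (∀ x → P 0 x ≡ 0#) ⊎ (∃[ e ] ∃[ c ] (c ≢ 0# × Lead e c (P 0))) → ∀ l → l ℕ.≤ suc j → ∀ x → P l x ≡ 0#
      conclude (inj₁ P0≡0) = with-head (zero-estimate j d n (P ∘ suc) (λ l p → degs (suc l) (s≤s p))
          (λ l 1≤l p → u^≢1 l 1≤l (ℕₚ.m≤n⇒m≤1+n p)) n+j≤q
          (ℕₚ.≤-trans (ℕₚ.*-monoˡ-≤ d (ℕₚ.^-monoʳ-≤ 2 (ℕₚ.n≤1+n j))) enough)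
          (λ r s r<n s<S → Y-cancel r s (trans (sym (trans (cong (λ t → t + Y r s * Σ< (suc j) (λ l → P (suc l) (r ℕ.+ s ℕ.* q) * Y r s ^ l)) (P0≡0 (r ℕ.+ s ℕ.* q))) (+-identityˡ _)))
            (trans (sym (drop-first j r s P)) (vanish r s (ℕₚ.<-≤-trans r<n n+j≤) s<S))))) P0≡0
      conclude (inj₂ (e , c , c≢0 , L)) = with-head tail head
        where
        -- The relation at `suc x` times `P 0 x`, minus the relation at `x` times `P 0 (suc x)`: the
        -- terms without Y cancel and the rest is divisible by Y.
        P' : ℕ → ℕ → R
        P' l x = u ^ suc l * (P 0 x * P (suc l) (suc x)) + (- 1#) * (P 0 (suc x) * P (suc l) x)
        degs' : ∀ l → l ℕ.≤ j → Deg (d ℕ.+ d) (P' l)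
        degs' l p = Deg-+ (d ℕ.+ d) (Deg-* (d ℕ.+ d) (u ^ suc l) (Deg-mul d d (degs 0 z≤n) (Deg-shift d (degs (suc l) (s≤s p)))))
          (Deg-* (d ℕ.+ d) (- 1#) (Deg-mul d d (Deg-shift d (degs 0 z≤n)) (degs (suc l) (s≤s p))))
        vanish' : Vanish j (n ℕ.+ j) P'
        vanish' r s r<n s<S = Y-cancel r s (begin
            y * Σ< (suc j) (λ l → P' l x * y ^ l)
              ≡⟨ cong (y *_) (trans (Σ<-cong (suc j) (λ l _ → trans (alg₁ (u ^ suc l) a (P (suc l) (suc x)) b (P (suc l) x) (y ^ l))
                    (cong (_+ ((- 1#) * b) * (P (suc l) x * y ^ l)) (trans (cong (a *_) (trans (alg₀ u (u ^ l) (P (suc l) (suc x)) (y ^ l)) (cong (λ t → u * (P (suc l) (suc x) * t)) (sym (*-^ u y l))))) (alg₆ a u _)))))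
                  (trans (Σ<-+ (suc j) _ _) (cong₂ _+_ (Σ<-*ˡ (suc j) (a * u) _) (Σ<-*ˡ (suc j) ((- 1#) * b) _)))) ⟩
            y * (a * u * T₁ + (- 1#) * b * T₀)  ≡⟨ alg₂ y a u b T₀ T₁ ⟩
            a * (b + u * y * T₁) - b * (a + y * T₀)  ≡⟨ cong₂ (λ s t → a * s - b * t) next here ⟩
            a * 0# - b * 0#                          ≡⟨ alg₃ a b ⟩
            0#                                       ∎)
          where
          open ≡-Reasoning
          x = r ℕ.+ s ℕ.* q
          y = Y r s
          a = P 0 x
          b = P 0 (suc x)
          T₀ = Σ< (suc j) (λ l → P (suc l) x * y ^ l)
          T₁ = Σ< (suc j) (λ l → P (suc l) (suc x) * (u * y) ^ l)
          alg₀ = solve 4 (λ u v p z → u :* v :* (p :* z) := u :* (p :* (v :* z))) refl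
          alg₁ = solve 6 (λ v a p b q z → (v :* (a :* p) :+ (:- # 1) :* (b :* q)) :* z := a :* (v :* (p :* z)) :+ (:- # 1) :* b :* (q :* z)) refl
          alg₂ = solve 6 (λ y a u b t s → y :* (a :* u :* s :+ (:- # 1) :* b :* t) := a :* (b :+ u :* y :* s) :- b :* (a :+ y :* t)) refl
          alg₃ = solve 2 (λ a b → a :* # 0 :- b :* # 0 := # 0) refl
          alg₆ = solve 3 (λ a u t → a :* (u :* t) := a :* u :* t) refl
          here : a + y * T₀ ≡ 0#
          here = trans (sym (drop-first j r s P)) (vanish r s (ℕₚ.<-≤-trans r<n n+j≤) s<S)
          -- This uses row `suc r`, which is why each elimination costs one of the `n + j` rows.
          next : b + u * y * T₁ ≡ 0#
          next = trans (cong (λ z → b + z * Σ< (suc j) (λ l → P (suc l) (suc x) * z ^ l)) (sym (Y-step r s)))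
            (trans (sym (drop-first j (suc r) s P)) (vanish (suc r) s (ℕₚ.≤-trans (s≤s r<n) (ℕₚ.≤-reflexive (sym (ℕₚ.+-suc n j)))) s<S))
        P'≡0 : ∀ l → l ℕ.≤ j → ∀ x → P' l x ≡ 0#
        P'≡0 = zero-estimate j (d ℕ.+ d) n P' degs' (λ l 1≤l p → u^≢1 l 1≤l (ℕₚ.m≤n⇒m≤1+n p)) n+j≤q
          (ℕₚ.≤-trans (ℕₚ.≤-reflexive (arith (2 ℕ.^ j) d)) enough) vanish'
          where
          arith : ∀ t d → t ℕ.* (d ℕ.+ d) ≡ 2 ℕ.* t ℕ.* d
          arith = solve-∀
        tail : Tail
        tail l p = case (zero-or-lead d (degs (suc l) (s≤s p)))
          where
          case : (∀ x → P (suc l) x ≡ 0#) ⊎ (∃[ e' ] ∃[ c' ] (c' ≢ 0# × Lead e' c' (P (suc l)))) → ∀ x → P (suc l) x ≡ 0#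
          case (inj₁ h) = h
          case (inj₂ (e' , c' , c'≢0 , L')) = ⊥-elim (refute (domain (u ^ suc l - 1#) (c * c') (trans (alg (u ^ suc l) (c * c')) top)))
            where
            alg = solve 2 (λ v t → (v :- # 1) :* t := v :* t :+ (:- # 1) :* t) refl
            -- `P' l` vanishes identically, hence so does its coefficient of degree `e + e'`, which
            -- is (u^(l+1) - 1) c c'.
            top : u ^ suc l * (c * c') + (- 1#) * (c * c') ≡ 0#
            top = Lead-roots (e ℕ.+ e') (λ i → i)
              (Lead-+ (e ℕ.+ e') (Lead-* (e ℕ.+ e') (u ^ suc l) (Lead-mul e e' L (Lead-shift e' L')))
                (Lead-* (e ℕ.+ e') (- 1#) (Lead-mul e e' (Lead-shift e L) L')))
              (λ i _ → P'≡0 l p i) (λ i j i<j _ → ℕₚ.<⇒≢ i<j)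
            refute : u ^ suc l - 1# ≡ 0# ⊎ c * c' ≡ 0# → ⊥
            refute (inj₁ h) = u^≢1 (suc l) (s≤s z≤n) (s≤s p) (sub-zero h)
            refute (inj₂ h) with domain c c' h
            ... | inj₁ h' = c≢0 h'
            ... | inj₂ h' = c'≢0 h'
        head : ∀ x → P 0 x ≡ 0#
        head = grid-roots d n (degs 0 z≤n) (ℕₚ.≤-trans (ℕₚ.m≤m+n n (suc j)) n≤q) (ℕₚ.≤-trans (d≤ (suc j)) enough)
          (λ r s r<n s<S → trans (sym (trans (cong (P 0 _ +_) (trans (cong (Y r s *_)
              (trans (Σ<-cong (suc j) (λ l l<j → trans (cong (_* Y r s ^ l) (tail l (ℕₚ.≤-pred l<j) _)) (zeroˡ _))) (Σ<-0 (suc j)))) (zeroʳ _))) (+-identityʳ _)))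
            (trans (sym (drop-first j r s P)) (vanish r s (ℕₚ.<-≤-trans r<n (ℕₚ.m≤m+n n (suc j))) s<S)))

  -- By (k+1) C(x,k+1) = (x - k) C(x,k), where k + 1 is invertible.
  binomial-Deg : ∀ k → Deg (suc k) (λ x → ι (binomial x k))
  binomial-Deg zero = 1# , (λ _ → 0#) , (λ _ → refl) , λ x → alg
    where
    alg : 1# ≡ 0# + 1# * 1#
    alg = solve 0 (# 1 := # 0 :+ # 1 :* # 1) refl
  binomial-Deg (suc k) = Deg-cong (suc (suc k)) eq (Deg-* (suc (suc k)) (inv k)
      (Deg-+ (suc (suc k)) (Deg-X (suc k) (binomial-Deg k)) (Deg-suc (suc k) (Deg-* (suc k) (- ι k) (binomial-Deg k)))))
    where
    eq : ∀ x → inv k * (ι x * ι (binomial x k) + - ι k * ι (binomial x k)) ≡ ι (binomial x (suc k))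
    eq x = trans (cong (λ t → inv k * (t + - ι k * b)) (trans (sym (ι-* x (binomial x k)))
        (trans (cong ι (sym (binomial-absorb x k))) (trans (ι-+ (suc k ℕ.* binomial x (suc k)) (k ℕ.* binomial x k))
          (cong₂ _+_ (ι-* (suc k) (binomial x (suc k))) (ι-* k (binomial x k)))))))
        (trans (alg (inv k) (ι (suc k)) (ι (binomial x (suc k))) (ι k) b) (trans (cong (_* ι (binomial x (suc k))) (inv-spec k)) (*-identityˡ _)))
      where
      b = ι (binomial x k)
      alg = solve 5 (λ i s c k b → i :* (s :* c :+ k :* b :+ :- k :* b) := s :* i :* c) refl

  -- Evaluation at natural numbers is triangular: C(k,i) = 0 for i > k and C(k,k) = 1, so x = k
  -- isolates `p k` once the earlier coefficients are known to vanish.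
  newton-coefficients : ∀ K (p : ℕ → R) → (∀ x → Σ< K (λ k → p k * ι (binomial x k)) ≡ 0#) → ∀ k → k ℕ.< K → p k ≡ 0#
  newton-coefficients K p h = <-rec _ step
    where
    only : ∀ n k f → (∀ i → i ℕ.< n → i ≢ k → f i ≡ 0#) → k ℕ.< n → Σ< n f ≡ f k
    only (suc n) k f z (s≤s k≤n) with k ℕₚ.≟ n
    ... | yes refl = trans (cong (_+ f k) (trans (Σ<-cong k (λ i i<k → z i (ℕₚ.m≤n⇒m≤1+n i<k) (ℕₚ.<⇒≢ i<k))) (Σ<-0 k))) (+-identityˡ _)
    ... | no k≢n = trans (cong₂ _+_ (only n k f (λ i i<n → z i (ℕₚ.m≤n⇒m≤1+n i<n)) (ℕₚ.≤∧≢⇒< k≤n k≢n))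
                     (z n (ℕₚ.n<1+n n) (λ e → k≢n (sym e)))) (+-identityʳ _)
    step : ∀ k → (∀ {i} → i ℕ.< k → i ℕ.< K → p i ≡ 0#) → k ℕ.< K → p k ≡ 0#
    step k ih k<K = trans (sym (*-identityʳ (p k))) (trans (cong (λ t → p k * ι t) (sym (binomial-diag k)))
        (trans (sym (only K k (λ i → p i * ι (binomial k i)) others k<K)) (h k)))
      where
      others : ∀ i → i ℕ.< K → i ≢ k → p i * ι (binomial k i) ≡ 0#
      others i i<K i≢k with ℕₚ.<-cmp i k
      ... | tri< i<k _ _ = trans (cong (_* ι (binomial k i)) (ih i<k i<K)) (zeroˡ _)
      ... | tri≈ _ i≡k _ = contradiction i≡k i≢k
      ... | tri> _ _ k<i = trans (cong (λ t → p i * ι t) (binomial-above k i k<i)) (zeroʳ _)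

-- The bit budget of the unknown coefficients.

-- Certificate for a linear inequality over ℕ: `X ≤ Y` combines known inequalities, `s` is the
-- slack, and the ring solver checks the identity.
linear : ∀ {X Y a b} s → X ℕ.≤ Y → a ℕ.+ Y ℕ.+ s ≡ b ℕ.+ X → a ℕ.≤ b
linear {X} {Y} {a} {b} s X≤Y eq = ℕₚ.+-cancelʳ-≤ Y a b (ℕₚ.≤-trans (ℕₚ.m≤m+n (a ℕ.+ Y) s)
  (ℕₚ.≤-trans (ℕₚ.≤-reflexive eq) (ℕₚ.+-monoʳ-≤ b X≤Y)))

total-split : ∀ r m n → total r (m ℕ.+ n) ≡ total r m ℕ.+ total (λ i → r (m ℕ.+ i)) n
total-split r zero    n = refl
total-split r (suc m) n = trans (cong (r 0 ℕ.+_) (total-split (r ∘ suc) m n)) (sym (ℕₚ.+-assoc (r 0) _ _))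

total-const : ∀ r n c → (∀ i → i ℕ.< n → r i ≡ c) → total r n ≡ n ℕ.* c
total-const r zero    c h = refl
total-const r (suc n) c h = cong₂ ℕ._+_ (h 0 (s≤s z≤n)) (total-const (r ∘ suc) n c (λ i p → h (suc i) (s≤s p)))

-- the unknown with index i = 24k + 3l + e is the coefficient of α^e C(x,k) Y^l
block : ℕ → ℕ
block i = i DM./ 24

level : ℕ → ℕ
level i = i DM.% 24 DM./ 3

coord : ℕ → ℕ
coord i = i DM.% 24 DM.% 3

level< : ∀ i → level i ℕ.< 8
level< i = DM.m<n*o⇒m/o<n {i DM.% 24} {8} {3} (DM.m%n<n i 24)

coord< : ∀ i → coord i ℕ.< 3
coord< i = DM.m%n<n (i DM.% 24) 3

module _ (k j : ℕ) (j<24 : j ℕ.< 24) where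
  private
    remainder : (k ℕ.* 24 ℕ.+ j) DM.% 24 ≡ j
    remainder = trans (cong (DM._% 24) (ℕₚ.+-comm (k ℕ.* 24) j)) (trans (DM.[m+kn]%n≡m%n j k 24) (DM.m<n⇒m%n≡m j<24))

  block-at : block (k ℕ.* 24 ℕ.+ j) ≡ k
  block-at = ℕₚ.*-cancelʳ-≡ (block (k ℕ.* 24 ℕ.+ j)) k 24 (ℕₚ.+-cancelˡ-≡ j _ _
    (trans (cong (ℕ._+ block (k ℕ.* 24 ℕ.+ j) ℕ.* 24) (sym remainder))
      (trans (sym (DM.m≡m%n+[m/n]*n (k ℕ.* 24 ℕ.+ j) 24)) (ℕₚ.+-comm (k ℕ.* 24) j))))

  level-at : level (k ℕ.* 24 ℕ.+ j) ≡ j DM./ 3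
  level-at = cong (DM._/ 3) remainder

  coord-at : coord (k ℕ.* 24 ℕ.+ j) ≡ j DM.% 3
  coord-at = cong (DM._% 3) remainder

-- The bits granted in block `k`. For x ≤ 2^19 K the factor C(x,k) costs 19 k + 2 K bits, so lower
-- blocks may carry larger coefficients and all products obey one bound 2^(29 K).
weight : ℕ → ℕ → ℕ
weight K k = 8 ℕ.* K ℕ.+ 19 ℕ.* (K ℕ.∸ k)

weights : ℕ → ℕ → ℕ
weights K zero    = 0
weights K (suc n) = weights K n ℕ.+ weight K n

total-weights : ∀ K n → total (λ i → weight K (block i)) (n ℕ.* 24) ≡ 24 ℕ.* weights K n
total-weights K zero    = refl
total-weights K (suc n) = trans (cong (total r) (ℕₚ.+-comm 24 (n ℕ.* 24)))
    (trans (total-split r (n ℕ.* 24) 24) (trans (cong₂ ℕ._+_ (total-weights K n)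
      (total-const _ 24 (weight K n) (λ j j<24 → cong (weight K) (block-at n j j<24)))) (sym (ℕₚ.*-distribˡ-+ 24 (weights K n) (weight K n)))))
  where
  r = λ i → weight K (block i)

weights-sum : ∀ K n c → n ℕ.+ c ≡ K → 2 ℕ.* weights K n ℕ.+ 19 ℕ.* (c ℕ.* c ℕ.+ c) ≡ 16 ℕ.* (n ℕ.* K) ℕ.+ 19 ℕ.* (K ℕ.* K ℕ.+ K)
weights-sum K zero    c refl = refl
weights-sum K (suc n) c eq = trans (cong (λ t → 2 ℕ.* (weights K n ℕ.+ (8 ℕ.* K ℕ.+ 19 ℕ.* t)) ℕ.+ 19 ℕ.* (c ℕ.* c ℕ.+ c)) K∸n)
    (trans (lem (weights K n) K c) (trans (cong (ℕ._+ 16 ℕ.* K) (weights-sum K n (suc c) (trans (ℕₚ.+-suc n c) eq))) (lem' n K)))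
  where
  K∸n : K ℕ.∸ n ≡ suc c
  K∸n = trans (cong (ℕ._∸ n) (trans (sym eq) (sym (ℕₚ.+-suc n c)))) (ℕₚ.m+n∸m≡n n (suc c))
  lem : ∀ w K c → 2 ℕ.* (w ℕ.+ (8 ℕ.* K ℕ.+ 19 ℕ.* suc c)) ℕ.+ 19 ℕ.* (c ℕ.* c ℕ.+ c)
    ≡ 2 ℕ.* w ℕ.+ 19 ℕ.* (suc c ℕ.* suc c ℕ.+ suc c) ℕ.+ 16 ℕ.* K
  lem = solve-∀
  lem' : ∀ n K → 16 ℕ.* (n ℕ.* K) ℕ.+ 19 ℕ.* (K ℕ.* K ℕ.+ K) ℕ.+ 16 ℕ.* K ≡ 16 ℕ.* (suc n ℕ.* K) ℕ.+ 19 ℕ.* (K ℕ.* K ℕ.+ K)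
  lem' = solve-∀

-- 4 K conditions of 99 K + 4 bits need 396 K² + 16 K bits, and the unknowns offer 420 K² + 228 K.
enough-unknowns : ∀ K → 1 ℕ.≤ K → 4 ℕ.* K ℕ.* (28 ℕ.* K ℕ.+ 71 ℕ.* K ℕ.+ 4) ℕ.< total (λ i → weight K (block i)) (K ℕ.* 24)
enough-unknowns K 1≤K = ℕₚ.<-≤-trans (ℕₚ.≤-<-trans (ℕₚ.m≤m+n _ _) (ℕₚ.m<m+n _ {1} (s≤s z≤n)))
    (ℕₚ.≤-trans (linear (24 ℕ.* (K ℕ.* K) ℕ.+ 211 ℕ.* K) 1≤K (lem K)) (ℕₚ.≤-reflexive (trans (sym doubled) (sym (total-weights K K)))))
  where
  half : 2 ℕ.* weights K K ≡ 16 ℕ.* (K ℕ.* K) ℕ.+ 19 ℕ.* (K ℕ.* K ℕ.+ K)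
  half = trans (sym (ℕₚ.+-identityʳ _)) (weights-sum K K 0 (ℕₚ.+-identityʳ K))
  doubled : 24 ℕ.* weights K K ≡ 12 ℕ.* (16 ℕ.* (K ℕ.* K) ℕ.+ 19 ℕ.* (K ℕ.* K ℕ.+ K))
  doubled = trans (ℕₚ.*-assoc 12 2 (weights K K)) (cong (12 ℕ.*_) half)
  lem : ∀ K → 4 ℕ.* K ℕ.* (28 ℕ.* K ℕ.+ 71 ℕ.* K ℕ.+ 4) ℕ.+ 0 ℕ.+ 1 ℕ.+ K ℕ.+ (24 ℕ.* (K ℕ.* K) ℕ.+ 211 ℕ.* K)
    ≡ 12 ℕ.* (16 ℕ.* (K ℕ.* K) ℕ.+ 19 ℕ.* (K ℕ.* K ℕ.+ K)) ℕ.+ 1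
  lem = solve-∀

-- The auxiliary function.

module Auxiliary (𝓚 : CubicField) where
  open Arithmetic 𝓚

  growth-Bd : ∀ s k {z j} → Bd z (1# + ½ ^ suc s) → j ℕ.≤ 2 ℕ.^ s ℕ.* k → Bd (z ^ j) (2^ k)
  growth-Bd s k {z} {j} b j≤ = Bd-≤ (growth s k (Bd⇒0≤ b) ≤-refl j≤) (Bd-^ b j)

  ½^-mono : ∀ {m n} → m ℕ.≤ n → ½ ^ n ≤ ½ ^ m
  ½^-mono {m} {n} p = Bd.upper (Sz-½^⁻¹ {p = m} (Sz-conv {p = n} {q = 0} {p' = m} {q' = 0}
    (ℕₚ.≤-trans (ℕₚ.≤-reflexive (ℕₚ.+-identityʳ m)) (ℕₚ.≤-trans p (ℕₚ.m≤m+n n 0))) (Sz-½^ {p = n} (Bd-self (0≤½^ n)))))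

  ½^-scale : ∀ c n → 2^ c * ½ ^ (c ℕ.+ n) ≡ ½ ^ n
  ½^-scale c n = trans (cong (2^ c *_) (^-+ ½ c n)) (trans (sym (*-assoc _ _ _)) (trans (cong (_* ½ ^ n) (2^*½^ c)) (*-identityˡ _)))

  -- The factor 2^m - 1 closes the induction: from c it passes to 2 c + 1, the extra 1 coming from
  -- the new factor `z`.
  power-near-one′ : ∀ {z δ} → Bd (z - 1#) δ → δ ≤ 1# → ∀ m → Bd (z ^ m - 1#) ((2^ m - 1#) * δ)
  power-near-one′ {z} {δ} b δ≤1 zero = subst₂ Bd (sym (-‿inverseʳ 1#)) (sym (trans (cong (_* δ) (-‿inverseʳ 1#)) (zeroˡ δ))) (Bd-0# ≤-refl)
  power-near-one′ {z} {δ} b δ≤1 (suc m) = subst (λ t → Bd t ((2^ suc m - 1#) * δ)) (alg z (z ^ m))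
      (Bd-≤ bound (Bd-+ (Bd-+ (Bd-* b ih) ih) b))
    where
    ih = power-near-one′ b δ≤1 m
    alg = solve 2 (λ z p → ((z :- # 1) :* (p :- # 1) :+ (p :- # 1)) :+ (z :- # 1) := z :* p :- # 1) refl
    bound : (δ * ((2^ m - 1#) * δ) + (2^ m - 1#) * δ) + δ ≤ (2^ suc m - 1#) * δ
    bound = by-diff (*-nonneg (*-nonneg (0≤y-x (1≤2^ m)) (Bd⇒0≤ b)) (0≤y-x δ≤1)) (alg' (2^ m) δ)
      where
      alg' = solve 2 (λ t d → (# 2 :* t :- # 1) :* d :- ((d :* ((t :- # 1) :* d) :+ (t :- # 1) :* d) :+ d) := (t :- # 1) :* d :* (# 1 :- d)) refl

  power-near-one : ∀ {z δ} → Bd (z - 1#) δ → δ ≤ 1# → ∀ m → Bd (z ^ m - 1#) (2^ m * δ)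
  power-near-one {z} {δ} b δ≤1 m = Bd-≤ (by-diff (Bd⇒0≤ b) (alg (2^ m) δ)) (power-near-one′ b δ≤1 m)
    where
    alg = solve 2 (λ t d → t :* d :- (t :- # 1) :* d := d) refl

  ½^≤1 : ∀ n → ½ ^ n ≤ 1#
  ½^≤1 n = ½^-mono {0} {n} z≤n

  Bd-from-near : ∀ {z δ} → Bd (z - 1#) δ → Bd z (1# + δ)
  Bd-from-near {z} {δ} b = subst (λ t → Bd t (1# + δ)) (alg z) (Bd-+ (Bd-self 0≤1) b)
    where
    alg = solve 1 (λ z → # 1 :+ (z :- # 1) := z) refl

  module Build (K κ : ℕ) (K≡ : K ≡ 1024 ℕ.* κ) (1≤κ : 1 ℕ.≤ κ) (u : R) (u-near : Bd (u - 1#) (½ ^ 62)) where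

    U : ℕ
    U = K ℕ.* 24

    -- Lets a single spare `K` absorb the lower-order terms, that is small multiples of κ and
    -- constants, in every budget below.
    big : 20 ℕ.* κ ℕ.+ 20 ℕ.≤ K
    big = subst (20 ℕ.* κ ℕ.+ 20 ℕ.≤_) (sym K≡) (linear {20} {20 ℕ.* κ} (984 ℕ.* κ) (ℕₚ.*-monoʳ-≤ 20 1≤κ) (arith κ))
      where
      arith : ∀ κ → 20 ℕ.* κ ℕ.+ 20 ℕ.+ 20 ℕ.* κ ℕ.+ 984 ℕ.* κ ≡ 1024 ℕ.* κ ℕ.+ 20
      arith = solve-∀

    1≤K : 1 ℕ.≤ K
    1≤K = linear {20 ℕ.* κ ℕ.+ 20} {K} (20 ℕ.* κ ℕ.+ 19) big (arith κ K)
      where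
      arith : ∀ κ K → 1 ℕ.+ K ℕ.+ (20 ℕ.* κ ℕ.+ 19) ≡ K ℕ.+ (20 ℕ.* κ ℕ.+ 20)
      arith = solve-∀

    U≤ : U ℕ.≤ 2 ℕ.^ (15 ℕ.+ κ)
    U≤ = subst (λ k → k ℕ.* 24 ℕ.≤ 2 ℕ.^ (15 ℕ.+ κ)) (sym K≡) (ℕₚ.≤-trans (ℕₚ.≤-reflexive (arith κ))
      (ℕₚ.≤-trans (ℕₚ.*-mono-≤ (ℕₚ.≤ᵇ⇒≤ 24576 (2 ℕ.^ 15) _) (ℕₚ.<⇒≤ (n<2^n κ))) (ℕₚ.≤-reflexive (sym (ℕₚ.^-distribˡ-+-* 2 15 κ)))))
      where
      arith : ∀ κ → 1024 ℕ.* κ ℕ.* 24 ≡ 24576 ℕ.* κ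
      arith = solve-∀

    block< : ∀ i → i ℕ.< U → block i ℕ.< K
    block< i i<U = DM.m<n*o⇒m/o<n {i} {K} {24} i<U

    weight-block : ∀ i → i ℕ.< U → weight K (block i) ℕ.+ 19 ℕ.* block i ≡ 27 ℕ.* K
    weight-block i i<U = trans (lem K (K ℕ.∸ block i) (block i)) (trans (cong (λ t → 8 ℕ.* K ℕ.+ 19 ℕ.* t) (ℕₚ.m∸n+n≡m (ℕₚ.<⇒≤ (block< i i<U)))) (lem' K))
      where
      lem : ∀ K m k → 8 ℕ.* K ℕ.+ 19 ℕ.* m ℕ.+ 19 ℕ.* k ≡ 8 ℕ.* K ℕ.+ 19 ℕ.* (m ℕ.+ k)
      lem = solve-∀
      lem' : ∀ K → 8 ℕ.* K ℕ.+ 19 ℕ.* K ≡ 27 ℕ.* K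
      lem' = solve-∀

    v : ℕ → R
    v l = u ^ l

    -- At most seven factors `u` cost at most seven bits: 62 - 7 = 55.
    v-near : ∀ l → l ℕ.< 8 → Bd (v l - 1#) (½ ^ 55)
    v-near l l<8 = Bd-≤ (≤-trans (*-monoˡ-≤ (0≤½^ 62) (2^-mono-≤ (ℕₚ.≤-pred l<8))) (≤-reflexive (½^-scale 7 55)))
      (power-near-one u-near (½^≤1 62) l)

    α^-Bd : ∀ e → e ℕ.< 3 → Bd (α ^ e) (2^ 2)
    α^-Bd e e<3 = Bd-≤ (2^-mono-≤ (ℕₚ.≤-pred e<3)) (Bd-^ (Bd-0≤ 0≤α α≤2) e)

    Δ : ℕ → ℕ → R
    Δ t i = diff (v (level i)) (v (level i) - 1#) t (block i)

    -- with w = 2^19 the first bound is sharp for t < 4K, with w = 2^55 the second one for t ≥ 4K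
    Δ-Sz-low : ∀ t i → t ℕ.≤ 4 ℕ.* K → Sz (Δ t i) (19 ℕ.* t) (19 ℕ.* block i ℕ.+ κ)
    Δ-Sz-low t i t≤ = Bd-≤ bound (Bd-scale (0≤2^ (19 ℕ.* t))
        (diff-Bd {w = 2^ 19} {w' = ½ ^ 19} (Bd-from-near near) near (0≤2^ 19) (0≤½^ 19) (2^*½^ 19) t k))
      where
      k = block i
      near = v-near (level i) (level< i)
      Y = ½ ^ 55
      s = Y + (1# + Y) * ½ ^ 19
      -- The left side is 1 + 2^-36 + 2^-55, so close to 1 that its powers up to the exponent 4 K
      -- stay below 2^κ.
      base : 2^ 19 * s ≤ 1# + ½ ^ 31
      base = by-diff (+-nonneg (subst (λ z → 0# ≤ ½ ^ 31 - z) halves (0≤y-x (½^-mono {31} {32} (ℕₚ.n≤1+n 31))))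
                (+-nonneg (0≤y-x (½^-mono {33} {36} (ℕₚ.m≤n+m 33 3))) (0≤y-x (½^-mono {33} {55} (ℕₚ.m≤n+m 33 22)))))
              (trans (cong (λ a → (1# + ½ ^ 31) - a) scaled) (alg (½ ^ 31) (½ ^ 33) (½ ^ 36) (½ ^ 55)))
        where
        scaled : 2^ 19 * s ≡ ½ ^ 36 + (1# + Y)
        scaled = trans (alg₀ (2^ 19) Y (½ ^ 19)) (trans (cong₂ (λ a b → a + (1# + Y) * b) (½^-scale 19 36) (2^*½^ 19)) (alg₁ (½ ^ 36) Y))
          where
          alg₀ = solve 3 (λ t y h → t :* (y :+ (# 1 :+ y) :* h) := t :* y :+ (# 1 :+ y) :* (t :* h)) refl
          alg₁ = solve 2 (λ a y → a :+ (# 1 :+ y) :* # 1 := a :+ (# 1 :+ y)) refl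
        halves : ½ ^ 32 ≡ ½ ^ 33 + ½ ^ 33
        halves = sym (trans (alg₂ ½ (½ ^ 32)) (trans (cong (_* ½ ^ 32) ½+½) (*-identityˡ _)))
          where
          alg₂ = solve 2 (λ h p → h :* p :+ h :* p := (h :+ h) :* p) refl
        alg = solve 4 (λ a c d e → (# 1 :+ a) :- (d :+ (# 1 :+ e)) := (a :- (c :+ c)) :+ ((c :- d) :+ (c :- e))) refl
      bound : 2^ (19 ℕ.* t) * ((2^ 19) ^ k * s ^ t) ≤ 2^ (19 ℕ.* k ℕ.+ κ)
      bound = ≤-trans (≤-reflexive (trans (alg₃ _ _ _) (cong₂ _*_ (sym (^-* (ι 2) 19 k))
          (trans (cong (_* s ^ t) (^-* (ι 2) 19 t)) (sym (*-^ (2^ 19) s t))))))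
        (≤-trans (*-monoʳ-≤ (0≤2^ (19 ℕ.* k)) (growth 30 κ (*-nonneg (0≤2^ 19) 0≤s) base t≤κ)) (≤-reflexive (sym (^-+ (ι 2) (19 ℕ.* k) κ))))
        where
        alg₃ = solve 3 (λ a b c → a :* (b :* c) := b :* (a :* c)) refl
        0≤s : 0# ≤ s
        0≤s = +-nonneg (0≤½^ 55) (*-nonneg (+-nonneg 0≤1 (0≤½^ 55)) (0≤½^ 19))
        t≤κ : t ℕ.≤ 2 ℕ.^ 30 ℕ.* κ
        t≤κ = ℕₚ.≤-trans t≤ (ℕₚ.≤-trans (ℕₚ.≤-reflexive (trans (cong (4 ℕ.*_) K≡) (sym (ℕₚ.*-assoc 4 1024 κ)))) (ℕₚ.*-monoˡ-≤ κ (ℕₚ.≤ᵇ⇒≤ 4096 (2 ℕ.^ 30) _)))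

    Δ-Sz-high : ∀ t i → Sz (Δ t i) (53 ℕ.* t) (55 ℕ.* block i)
    Δ-Sz-high t i = Bd-≤ bound (Bd-scale (0≤2^ (53 ℕ.* t))
        (diff-Bd {w = 2^ 55} {w' = ½ ^ 55} (Bd-from-near near) near (0≤2^ 55) (0≤½^ 55) (2^*½^ 55) t k))
      where
      k = block i
      near = v-near (level i) (level< i)
      Y = ½ ^ 55
      s = Y + (1# + Y) * Y
      0≤s : 0# ≤ s
      0≤s = +-nonneg (0≤½^ 55) (*-nonneg (+-nonneg 0≤1 (0≤½^ 55)) (0≤½^ 55))
      base : 2^ 53 * s ≤ 1#
      base = ≤-trans (*-monoʳ-≤ (0≤2^ 53) (≤-trans (+-monoʳ-≤ Y (*-monoˡ-≤ (0≤½^ 55) (+-monoʳ-≤ 1# (≤-trans (½^≤1 55) 1≤ι2)))) (≤-reflexive (alg Y))))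
        (≤-reflexive (trans (sym (*-assoc _ _ _)) (trans (cong (_* Y) (sym (^-+ (ι 2) 53 2))) (2^*½^ 55))))
        where
        alg = solve 1 (λ y → y :+ (# 1 :+ # 2) :* y := # 2 :* (# 2 :* # 1) :* y) refl
      bound : 2^ (53 ℕ.* t) * ((2^ 55) ^ k * s ^ t) ≤ 2^ (55 ℕ.* k)
      bound = ≤-trans (≤-reflexive (trans (alg₃ _ _ _) (cong₂ _*_ (sym (^-* (ι 2) 55 k))
          (trans (cong (_* s ^ t) (^-* (ι 2) 53 t)) (sym (*-^ (2^ 53) s t))))))
        (≤-trans (*-monoʳ-≤ (0≤2^ (55 ℕ.* k)) (≤-trans (^-mono-≤ (*-nonneg (0≤2^ 53) 0≤s) base t) (≤-reflexive (1^n t)))) (≤-reflexive (*-identityʳ _)))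
        where
        alg₃ = solve 3 (λ a b c → a :* (b :* c) := b :* (a :* c)) refl

    unknown : ℕ → ℕ
    unknown i = weight K (block i)

    -- The factor 2^(19 t) normalises the differences, so that all forms share one range and one
    -- target.
    coefficient : ℕ → ℕ → R
    coefficient t i = 2^ (19 ℕ.* t) * (α ^ coord i * Δ t i)

    private
      2^-3 : ∀ a b c → 2^ a * (2^ b * 2^ c) ≡ 2^ (a ℕ.+ (b ℕ.+ c))
      2^-3 a b c = trans (cong (2^ a *_) (sym (^-+ (ι 2) b c))) (sym (^-+ (ι 2) a (b ℕ.+ c)))

    range : ∀ t → t ℕ.< 4 ℕ.* K → ∀ (c : ℕ → ℕ) → (∀ i → i ℕ.< U → c i ℕ.< 2 ℕ.^ unknown i) →
      Bd (Σ< U (λ i → ι (c i) * coefficient t i)) (2^ (28 ℕ.* K))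
    range t t< c small = Bd-≤ (2^-mono-≤ {15 ℕ.+ κ ℕ.+ (27 ℕ.* K ℕ.+ κ ℕ.+ 2)} {28 ℕ.* K} (linear {20 ℕ.* κ ℕ.+ 20} {K} (18 ℕ.* κ ℕ.+ 3) big (arith K κ)))
        (Sz-0⁻¹ {q = 15 ℕ.+ κ ℕ.+ (27 ℕ.* K ℕ.+ κ ℕ.+ 2)} (Sz-Σ U (15 ℕ.+ κ) {p = 0} {q = 27 ℕ.* K ℕ.+ κ ℕ.+ 2} U≤ term))
      where
      arith : ∀ K κ → 15 ℕ.+ κ ℕ.+ (27 ℕ.* K ℕ.+ κ ℕ.+ 2) ℕ.+ K ℕ.+ (18 ℕ.* κ ℕ.+ 3) ≡ 28 ℕ.* K ℕ.+ (20 ℕ.* κ ℕ.+ 20)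
      arith = solve-∀
      arith' : ∀ w k κ → w ℕ.+ (2 ℕ.+ (19 ℕ.* k ℕ.+ κ)) ≡ w ℕ.+ 19 ℕ.* k ℕ.+ κ ℕ.+ 2
      arith' = solve-∀
      term : ∀ i → i ℕ.< U → Sz (ι (c i) * coefficient t i) 0 (27 ℕ.* K ℕ.+ κ ℕ.+ 2)
      term i i<U = Sz-0 {q = 27 ℕ.* K ℕ.+ κ ℕ.+ 2} (subst₂ Bd (cong (ι (c i) *_) (alg (α ^ coord i) (2^ (19 ℕ.* t)) (Δ t i)))
          (trans (2^-3 (unknown i) 2 (19 ℕ.* block i ℕ.+ κ)) (cong 2^_ (trans (arith' (unknown i) (block i) κ)
            (cong (λ e → e ℕ.+ κ ℕ.+ 2) (weight-block i i<U)))))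
          (Bd-* (Bd-0≤ (0≤ι (c i)) (ι≤2^ {c i} {unknown i} (ℕₚ.<⇒≤ (small i i<U)))) (Bd-* (α^-Bd (coord i) (coord< i)) (Δ-Sz-low t i (ℕₚ.<⇒≤ t<)))))
        where
        alg = solve 3 (λ a p d → a :* (p :* d) := p :* (a :* d)) refl

    f : (ℕ → ℤ) → ℕ → R
    f d x = Σ< U (λ i → ιℤ (d i) * (α ^ coord i * (ι (binomial x (block i)) * v (level i) ^ x)))

    g : (ℕ → ℤ) → ℕ → R
    g d t = Σ< U (λ i → ιℤ (d i) * (α ^ coord i * Δ t i))

    f≡W : ∀ d x → f d x ≡ W x (g d)
    f≡W d x = sym (trans (W-Σ x U (λ i t → ιℤ (d i) * (α ^ coord i * Δ t i))) (Σ<-cong U (λ i _ →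
      trans (W-* x (ιℤ (d i)) (λ t → α ^ coord i * Δ t i)) (cong (ιℤ (d i) *_)
        (trans (W-* x (α ^ coord i) (λ t → Δ t i)) (cong (α ^ coord i *_)
          (newton (v (level i)) (v (level i) - 1#) (split-1 (v (level i))) x (block i))))))))
      where
      split-1 = solve 1 (λ x → x := # 1 :+ (x :- # 1)) refl

    -- By Newton's formula the differences below 2^(-71 K - 19 t) add up to at most 2^(-71 K) (1 +
    -- 2^-19)^x, and the last factor costs only 2 K bits on this range.
    f-Sz : ∀ d → (∀ t → Sz (g d t) (71 ℕ.* K ℕ.+ 19 ℕ.* t) 0) → ∀ x → x ℕ.≤ 2 ℕ.^ 19 ℕ.* K → Sz (f d x) (69 ℕ.* K) 0
    f-Sz d small x x≤ = subst (λ z → Sz z (69 ℕ.* K) 0) (sym (f≡W d x))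
        (Sz-conv {p = 71 ℕ.* K} {q = 2 ℕ.* K} {p' = 69 ℕ.* K} {q' = 0} (ℕₚ.≤-reflexive (arith K))
          (Bd-≤ bound (Bd-scale (0≤2^ (71 ℕ.* K)) (W-Bd x {m = ½ ^ (71 ℕ.* K)} {h = ½ ^ 19} (λ t → Bd-≤ (≤-reflexive (½-split t))
            (Sz-½^⁻¹ {p = 71 ℕ.* K ℕ.+ 19 ℕ.* t} (small t)))))))
      where
      arith : ∀ K → 69 ℕ.* K ℕ.+ 2 ℕ.* K ≡ 71 ℕ.* K ℕ.+ 0
      arith = solve-∀
      ½-split : ∀ t → ½ ^ (71 ℕ.* K ℕ.+ 19 ℕ.* t) ≡ ½ ^ (71 ℕ.* K) * (½ ^ 19) ^ t
      ½-split t = trans (^-+ ½ (71 ℕ.* K) (19 ℕ.* t)) (cong (½ ^ (71 ℕ.* K) *_) (^-* ½ 19 t))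
      x≤' : x ℕ.≤ 2 ℕ.^ 18 ℕ.* (2 ℕ.* K)
      x≤' = ℕₚ.≤-trans x≤ (ℕₚ.≤-reflexive (ℕₚ.*-assoc (2 ℕ.^ 18) 2 K))
      bound : 2^ (71 ℕ.* K) * (½ ^ (71 ℕ.* K) * (1# + ½ ^ 19) ^ x) ≤ 2^ (2 ℕ.* K)
      bound = ≤-trans (≤-reflexive (trans (sym (*-assoc _ _ _)) (trans (cong (_* (1# + ½ ^ 19) ^ x) (2^*½^ (71 ℕ.* K))) (*-identityˡ _))))
        (growth 18 (2 ℕ.* K) (+-nonneg 0≤1 (0≤½^ 19)) ≤-refl x≤')

    Sz-ιℤ : ∀ i {m} → ℤ.∣ i ∣ ℕ.≤ 2 ℕ.^ m → Sz (ιℤ i) 0 m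
    Sz-ιℤ i {m} p = Sz-0 {q = m} (subst (Bd (ιℤ i)) (ι-^ 2 m) (∣∣-Bd i p))

    -- Nothing is imposed on these differences. The closeness of u to 1 yields 53 t bits, and the
    -- gain 34 t ≥ 136 K over 19 t covers 71 K + 63 K and the lower-order terms.
    g-high : ∀ d → (∀ i → i ℕ.< U → ℤ.∣ d i ∣ ℕ.≤ 2 ℕ.^ unknown i) → ∀ t → 4 ℕ.* K ℕ.≤ t → Sz (g d t) (71 ℕ.* K ℕ.+ 19 ℕ.* t) 0
    g-high d d≤ t t≥ = Sz-conv {p = 53 ℕ.* t} {q = 15 ℕ.+ κ ℕ.+ (63 ℕ.* K ℕ.+ 2)} {p' = 71 ℕ.* K ℕ.+ 19 ℕ.* t} {q' = 0}
        (linear (K ℕ.+ 19 ℕ.* κ ℕ.+ 3) (ℕₚ.+-mono-≤ (ℕₚ.*-monoʳ-≤ 34 t≥) big) (arith K κ t))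
        (Sz-Σ U (15 ℕ.+ κ) {p = 53 ℕ.* t} {q = 63 ℕ.* K ℕ.+ 2} U≤ term)
      where
      arith : ∀ K κ t → 71 ℕ.* K ℕ.+ 19 ℕ.* t ℕ.+ (15 ℕ.+ κ ℕ.+ (63 ℕ.* K ℕ.+ 2)) ℕ.+ (34 ℕ.* t ℕ.+ K) ℕ.+ (K ℕ.+ 19 ℕ.* κ ℕ.+ 3)
        ≡ 53 ℕ.* t ℕ.+ 0 ℕ.+ (34 ℕ.* (4 ℕ.* K) ℕ.+ (20 ℕ.* κ ℕ.+ 20))
      arith = solve-∀
      term : ∀ i → i ℕ.< U → Sz (ιℤ (d i) * (α ^ coord i * Δ t i)) (53 ℕ.* t) (63 ℕ.* K ℕ.+ 2)
      term i i<U = Sz-conv {p = 0 ℕ.+ (0 ℕ.+ 53 ℕ.* t)} {q = unknown i ℕ.+ (2 ℕ.+ 55 ℕ.* block i)} {p' = 53 ℕ.* t} {q' = 63 ℕ.* K ℕ.+ 2}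
          (ℕₚ.+-monoʳ-≤ (53 ℕ.* t) (ℕₚ.≤-trans (ℕₚ.≤-reflexive (trans (arith₁ (unknown i) (block i)) (cong (λ e → e ℕ.+ 36 ℕ.* block i ℕ.+ 2) (weight-block i i<U))))
            (linear 0 (ℕₚ.*-monoʳ-≤ 36 (ℕₚ.<⇒≤ (block< i i<U))) (arith₂ K (block i)))))
          (Sz-* {p = 0} {q = unknown i} {p' = 0 ℕ.+ 53 ℕ.* t} {q' = 2 ℕ.+ 55 ℕ.* block i} (Sz-ιℤ (d i) {unknown i} (d≤ i i<U))
            (Sz-* {p = 0} {q = 2} {p' = 53 ℕ.* t} {q' = 55 ℕ.* block i} (Sz-0 {q = 2} (α^-Bd (coord i) (coord< i))) (Δ-Sz-high t i)))
        where
        arith₁ : ∀ w k → w ℕ.+ (2 ℕ.+ 55 ℕ.* k) ≡ w ℕ.+ 19 ℕ.* k ℕ.+ 36 ℕ.* k ℕ.+ 2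
        arith₁ = solve-∀
        arith₂ : ∀ K k → 27 ℕ.* K ℕ.+ 36 ℕ.* k ℕ.+ 2 ℕ.+ 36 ℕ.* K ℕ.+ 0 ≡ 63 ℕ.* K ℕ.+ 2 ℕ.+ 36 ℕ.* k
        arith₂ = solve-∀

    g-low : ∀ d t → Bd (2^ (71 ℕ.* K) * Σ< U (λ i → ιℤ (d i) * coefficient t i)) 1# → Sz (g d t) (71 ℕ.* K ℕ.+ 19 ℕ.* t) 0
    g-low d t b = subst (λ z → Bd z 1#) (trans (cong (2^ (71 ℕ.* K) *_) (trans (Σ<-cong U (λ i _ → alg (ιℤ (d i)) (2^ (19 ℕ.* t)) (α ^ coord i * Δ t i)))
        (Σ<-*ˡ U (2^ (19 ℕ.* t)) _))) (trans (sym (*-assoc _ _ _)) (cong (_* g d t) (sym (^-+ (ι 2) (71 ℕ.* K) (19 ℕ.* t)))))) b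
      where
      alg = solve 3 (λ d p a → d :* (p :* a) := p :* (d :* a)) refl

    -- The target 71 K is budgeted backwards: 2 K are lost in the interpolation and 3 K to the
    -- common denominator, and slightly more than 64 K must be left for Liouville's inequality.
    auxiliary : ∃[ d ] (¬ (∀ i → i ℕ.< U → d i ≡ ℤ.+ 0) × (∀ i → i ℕ.< U → ℤ.∣ d i ∣ ℕ.≤ 2 ℕ.^ unknown i)
      × (∀ x → x ℕ.≤ 2 ℕ.^ 19 ℕ.* K → Sz (f d x) (69 ℕ.* K) 0))
    auxiliary = package (Box.siegel floor reflect U (4 ℕ.* K) unknown coefficient (28 ℕ.* K) (71 ℕ.* K) range (enough-unknowns K 1≤K))
      where
      package : ∃[ d ] (¬ (∀ i → i ℕ.< U → d i ≡ ℤ.+ 0) × (∀ i → i ℕ.< U → ℤ.∣ d i ∣ ℕ.≤ 2 ℕ.^ unknown i)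
          × (∀ t → t ℕ.< 4 ℕ.* K → Bd (2^ (71 ℕ.* K) * Σ< U (λ i → ιℤ (d i) * coefficient t i)) 1#)) →
        ∃[ d ] (¬ (∀ i → i ℕ.< U → d i ≡ ℤ.+ 0) × (∀ i → i ℕ.< U → ℤ.∣ d i ∣ ℕ.≤ 2 ℕ.^ unknown i)
          × (∀ x → x ℕ.≤ 2 ℕ.^ 19 ℕ.* K → Sz (f d x) (69 ℕ.* K) 0))
      package (d , nonzero , d≤ , small) = d , nonzero , d≤ , f-Sz d all-t
        where
        all-t : ∀ t → Sz (g d t) (71 ℕ.* K ℕ.+ 19 ℕ.* t) 0
        all-t t = decide (ℕₚ.<-≤-connex t (4 ℕ.* K))
          where
          decide : t ℕ.< 4 ℕ.* K ⊎ 4 ℕ.* K ℕ.≤ t → Sz (g d t) (71 ℕ.* K ℕ.+ 19 ℕ.* t) 0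
          decide (inj₁ t<) = g-low d t (small t t<)
          decide (inj₂ t≥) = g-high d d≤ t t≥

-- Vanishing on the grid and the contradiction.

level-of : ∀ l e → e ℕ.< 3 → (l ℕ.* 3 ℕ.+ e) DM./ 3 ≡ l
level-of l e e<3 = ℕₚ.*-cancelʳ-≡ ((l ℕ.* 3 ℕ.+ e) DM./ 3) l 3 (ℕₚ.+-cancelˡ-≡ e _ _
  (trans (cong (ℕ._+ (l ℕ.* 3 ℕ.+ e) DM./ 3 ℕ.* 3) (sym rem)) (trans (sym (DM.m≡m%n+[m/n]*n (l ℕ.* 3 ℕ.+ e) 3)) (ℕₚ.+-comm (l ℕ.* 3) e))))
  where
  rem : (l ℕ.* 3 ℕ.+ e) DM.% 3 ≡ e
  rem = trans (cong (DM._% 3) (ℕₚ.+-comm (l ℕ.* 3) e)) (trans (DM.[m+kn]%n≡m%n e l 3) (DM.m<n⇒m%n≡m e<3))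

coord-of : ∀ l e → e ℕ.< 3 → (l ℕ.* 3 ℕ.+ e) DM.% 3 ≡ e
coord-of l e e<3 = trans (cong (DM._% 3) (ℕₚ.+-comm (l ℕ.* 3) e)) (trans (DM.[m+kn]%n≡m%n e l 3) (DM.m<n⇒m%n≡m e<3))

index< : ∀ l e → l ℕ.< 8 → e ℕ.< 3 → l ℕ.* 3 ℕ.+ e ℕ.< 24
index< l e l<8 e<3 = ℕₚ.<-≤-trans (ℕₚ.+-monoʳ-< (l ℕ.* 3) e<3) (ℕₚ.≤-trans (ℕₚ.≤-reflexive (ℕₚ.+-comm (l ℕ.* 3) 3)) (ℕₚ.*-monoˡ-≤ 3 l<8))

index-decompose : ∀ i → i ≡ block i ℕ.* 24 ℕ.+ (level i ℕ.* 3 ℕ.+ coord i)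
index-decompose i = trans (DM.m≡m%n+[m/n]*n i 24) (trans (ℕₚ.+-comm (i DM.% 24) (block i ℕ.* 24))
  (cong (block i ℕ.* 24 ℕ.+_) (trans (DM.m≡m%n+[m/n]*n (i DM.% 24) 3) (ℕₚ.+-comm (coord i) (level i ℕ.* 3)))))

product-≤ : ∀ A a b c e → A ℕ.≤ 2 ℕ.^ a → a ℕ.+ (b ℕ.+ c) ℕ.≤ e → A ℕ.* (2 ℕ.^ b ℕ.* 2 ℕ.^ c) ℕ.≤ 2 ℕ.^ e
product-≤ A a b c e A≤ le = ℕₚ.≤-trans (ℕₚ.*-mono-≤ A≤ (ℕₚ.≤-reflexive (sym (ℕₚ.^-distribˡ-+-* 2 b c))))
  (ℕₚ.≤-trans (ℕₚ.≤-reflexive (sym (ℕₚ.^-distribˡ-+-* 2 a (b ℕ.+ c)))) (ℕₚ.^-monoʳ-≤ 2 le))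

module Endgame (𝓚 : CubicField) where
  open Arithmetic 𝓚
  open ZeroEstimate 𝓚
  open Auxiliary 𝓚

  nonzero-* : ∀ {x y} → x ≢ 0# → y ≢ 0# → x * y ≢ 0#
  nonzero-* {x} {y} p q eq = go (domain x y eq)
    where
    go : x ≡ 0# ⊎ y ≡ 0# → ⊥
    go (inj₁ e) = p e
    go (inj₂ e) = q e

  1≢0 : 1# ≢ 0#
  1≢0 e = 1≰0 (≤-reflexive e)

  nonzero-^ : ∀ {x} → x ≢ 0# → ∀ n → x ^ n ≢ 0#
  nonzero-^ p zero    = 1≢0
  nonzero-^ p (suc n) = nonzero-* p (nonzero-^ p n)

  Deg-Σ : ∀ d n {f : ℕ → ℕ → R} → (∀ k → k ℕ.< n → Deg d (f k)) → Deg d (λ x → Σ< n (λ k → f k x))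
  Deg-Σ d zero    h = Deg-≤ z≤n (λ _ → refl)
  Deg-Σ d (suc n) h = Deg-+ d (Deg-Σ d n (λ k k<n → h k (ℕₚ.m≤n⇒m≤1+n k<n))) (h n (ℕₚ.n<1+n n))

  -- The argument for abstract `u`, `w`, `ζ`. Numerators and denominators of `u` and `w` have
  -- natural coordinates, and `Q` bounds the bits of the common denominator. Of the rows of the
  -- grid, seven are consumed by elimination and `n₀` remain for the final count of roots.
  module Refute (K κ : ℕ) (K≡ : K ≡ 1024 ℕ.* κ) (1≤κ : 1 ℕ.≤ κ) (u : R) (u-near : Bd (u - 1#) (½ ^ 62))
    (u^≢1 : ∀ l → 1 ℕ.≤ l → l ℕ.≤ 7 → u ^ l ≢ 1#)
    (w ζ : R) (q S n₀ Q : ℕ) (w≡ : w ≡ u ^ q * ζ) (ζ-near : Bd (ζ - 1#) (½ ^ (110 ℕ.* K)))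
    (u≢0 : u ≢ 0#) (w≢0 : w ≢ 0#)
    (Du Nu Dw Nw : R) (Du-nat : NatCoords Du) (Nu-nat : NatCoords Nu) (Dw-nat : NatCoords Dw) (Nw-nat : NatCoords Nw)
    (u*Du : u * Du ≡ Nu) (w*Dw : w * Dw ≡ Nw) (Du≢0 : Du ≢ 0#) (Dw≢0 : Dw ≢ 0#)
    (n≤q : n₀ ℕ.+ 7 ℕ.≤ q) (enough : 2 ℕ.^ 7 ℕ.* K ℕ.≤ n₀ ℕ.* S) (Sq≤ : S ℕ.* q ℕ.≤ 2 ℕ.^ 19 ℕ.* K) (7S≤κ : 7 ℕ.* S ℕ.≤ κ)
    (Den≤ : Dw ^ S * Du ^ (n₀ ℕ.+ 7) ≤ 2^ Q) (7Λ≤ : 7 ℕ.* (Q ℕ.+ 2 ℕ.* κ) ℕ.≤ 2 ℕ.* K) where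

    open Build K κ K≡ 1≤κ u u-near

    n₁ Λ : ℕ
    n₁ = n₀ ℕ.+ 7
    Λ = Q ℕ.+ 2 ℕ.* κ

    Den : R
    Den = Dw ^ S * Du ^ n₁

    Y : ℕ → ℕ → R
    Y r s = u ^ r * w ^ s

    Y-step : ∀ r s → Y (suc r) s ≡ u * Y r s
    Y-step r s = *-assoc _ _ _

    Y≢0 : ∀ r s → Y r s ≢ 0#
    Y≢0 r s = nonzero-* (nonzero-^ u≢0 r) (nonzero-^ w≢0 s)

    Den^7≢0 : Den ^ 7 ≢ 0#
    Den^7≢0 = nonzero-^ (nonzero-* (nonzero-^ Dw≢0 S) (nonzero-^ Du≢0 n₁)) 7

    point : ℕ → ℕ → ℕ
    point r s = r ℕ.+ s ℕ.* q

    -- The heart of the extrapolation: up to a power of ζ ≈ 1 the grid value is u^x at x = r + sq,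
    -- although the height of `Y r s` involves `r` and `s` only.
    Y≡ : ∀ r s → Y r s ≡ u ^ point r s * ζ ^ s
    Y≡ r s = trans (cong (λ t → u ^ r * t) (trans (cong (_^ s) w≡) (trans (*-^ (u ^ q) ζ s) (cong (_* ζ ^ s) (trans (sym (^-* u q s)) (cong (u ^_) (ℕₚ.*-comm q s)))))))
      (trans (sym (*-assoc _ _ _)) (cong (_* ζ ^ s) (sym (^-+ u r (s ℕ.* q)))))

    point≤ : ∀ r s → r ℕ.< n₁ → s ℕ.< S → point r s ℕ.≤ 2 ℕ.^ 19 ℕ.* K
    point≤ r s r<n s<S = ℕₚ.≤-trans (ℕₚ.+-monoˡ-≤ (s ℕ.* q) (ℕₚ.<⇒≤ (ℕₚ.<-≤-trans r<n n≤q))) (ℕₚ.≤-trans (ℕₚ.*-monoˡ-≤ q s<S) Sq≤)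

    u^-Bd : ∀ m → m ℕ.≤ 2 ℕ.^ 19 ℕ.* K ℕ.* 7 → Bd (u ^ m) (2^ κ)
    u^-Bd m m≤ = growth-Bd 61 κ (Bd-from-near u-near) (ℕₚ.≤-trans m≤ (ℕₚ.≤-trans (ℕₚ.≤-reflexive (trans (cong (λ k → 2 ℕ.^ 19 ℕ.* k ℕ.* 7) K≡) (arith (2 ℕ.^ 19) κ)))
        (ℕₚ.*-monoˡ-≤ κ (ℕₚ.≤ᵇ⇒≤ (2 ℕ.^ 19 ℕ.* 7168) (2 ℕ.^ 61) _))))
      where
      arith : ∀ c κ → c ℕ.* (1024 ℕ.* κ) ℕ.* 7 ≡ c ℕ.* 7168 ℕ.* κ
      arith = solve-∀

    S≤κ : S ℕ.≤ κ
    S≤κ = ℕₚ.≤-trans (ℕₚ.m≤m+n S (6 ℕ.* S)) 7S≤κ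

    ζ^-Bd : ∀ s → s ℕ.≤ S → Bd (ζ ^ s) (2^ κ)
    ζ^-Bd s s≤S = Bd-≤ (2^-mono-≤ (ℕₚ.≤-trans s≤S S≤κ)) (Bd-^ (Bd-≤ (+-monoʳ-≤ 1# (½^≤1 (110 ℕ.* K))) (Bd-from-near ζ-near)) s)

    m≤m*7 : ∀ m → m ℕ.≤ m ℕ.* 7
    m≤m*7 m = ℕₚ.m≤m*n m 7

    Y-Bd : ∀ r s → r ℕ.< n₁ → s ℕ.< S → Bd (Y r s) (2^ (2 ℕ.* κ))
    Y-Bd r s r<n s<S = subst₂ Bd (sym (Y≡ r s)) (trans (sym (^-+ (ι 2) κ κ)) (cong 2^_ (cong (κ ℕ.+_) (sym (ℕₚ.+-identityʳ κ)))))
      (Bd-* (u^-Bd (point r s) (ℕₚ.≤-trans (point≤ r s r<n s<S) (m≤m*7 (2 ℕ.^ 19 ℕ.* K)))) (ζ^-Bd s (ℕₚ.<⇒≤ s<S)))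

    -- The value `Y r s` times the common denominator, written without division so that its
    -- coordinates are visibly natural.
    V : ℕ → ℕ → R
    V r s = (Nw ^ s * Dw ^ (S ℕ.∸ s)) * (Nu ^ r * Du ^ (n₁ ℕ.∸ r))

    split-power : ∀ {x D N} → x * D ≡ N → ∀ m n → m ℕ.≤ n → N ^ m * D ^ (n ℕ.∸ m) ≡ x ^ m * D ^ n
    split-power {x} {D} {N} eq m n m≤n = trans (cong (λ t → t ^ m * D ^ (n ℕ.∸ m)) (sym eq)) (trans (cong (_* D ^ (n ℕ.∸ m)) (*-^ x D m))
      (trans (*-assoc _ _ _) (cong (x ^ m *_) (trans (sym (^-+ D m (n ℕ.∸ m))) (cong (D ^_) (ℕₚ.m+[n∸m]≡n m≤n))))))

    V≡ : ∀ r s → r ℕ.≤ n₁ → s ℕ.≤ S → V r s ≡ Y r s * Den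
    V≡ r s r≤ s≤ = trans (cong₂ _*_ (split-power w*Dw s S s≤) (split-power u*Du r n₁ r≤)) (alg (w ^ s) (Dw ^ S) (u ^ r) (Du ^ n₁))
      where
      alg = solve 4 (λ a b c d → (a :* b) :* (c :* d) := (c :* a) :* (b :* d)) refl

    Den-nat : NatCoords Den
    Den-nat = NatCoords-* (NatCoords-^ Dw-nat S) (NatCoords-^ Du-nat n₁)

    V-nat : ∀ r s → NatCoords (V r s)
    V-nat r s = NatCoords-* (NatCoords-* (NatCoords-^ Nw-nat s) (NatCoords-^ Dw-nat (S ℕ.∸ s)))
      (NatCoords-* (NatCoords-^ Nu-nat r) (NatCoords-^ Du-nat (n₁ ℕ.∸ r)))

    Den-Bd : Bd Den (2^ Q)
    Den-Bd = Bd-0≤ (NatCoords⇒0≤ Den-nat) Den≤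

    V-Bd : ∀ r s → r ℕ.< n₁ → s ℕ.< S → Bd (V r s) (2^ Λ)
    V-Bd r s r<n s<S = subst₂ Bd (sym (V≡ r s (ℕₚ.<⇒≤ r<n) (ℕₚ.<⇒≤ s<S))) (trans (*-comm _ _) (sym (^-+ (ι 2) Q (2 ℕ.* κ)))) (Bd-* (Y-Bd r s r<n s<S) Den-Bd)

    binomial≤ : ∀ x k → x ℕ.≤ 2 ℕ.^ 19 ℕ.* K → ι (binomial x k) ≤ 2^ (19 ℕ.* k ℕ.+ 2 ℕ.* K)
    binomial≤ x k x≤ = ≤-trans (≤-reflexive (sym (trans (cong (2^ (19 ℕ.* k) *_) (cong (ι (binomial x k) *_) (sym (^-* ½ 19 k))))
        (trans (alg (2^ (19 ℕ.* k)) (ι (binomial x k)) (½ ^ (19 ℕ.* k))) (trans (cong (_* ι (binomial x k)) (2^*½^ (19 ℕ.* k))) (*-identityˡ _))))))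
      (≤-trans (*-monoʳ-≤ (0≤2^ (19 ℕ.* k)) (≤-trans (binomial-bound (0≤½^ 19) x k)
          (growth 18 (2 ℕ.* K) (+-nonneg 0≤1 (0≤½^ 19)) ≤-refl (ℕₚ.≤-trans x≤ (ℕₚ.≤-reflexive (ℕₚ.*-assoc (2 ℕ.^ 18) 2 K))))))
        (≤-reflexive (sym (^-+ (ι 2) (19 ℕ.* k) (2 ℕ.* K)))))
      where
      alg = solve 3 (λ t b h → t :* (b :* h) := t :* h :* b) refl

    module At (d : ℕ → ℤ) (d≤ : ∀ i → i ℕ.< U → ℤ.∣ d i ∣ ℕ.≤ 2 ℕ.^ unknown i)
      (f-small : ∀ x → x ℕ.≤ 2 ℕ.^ 19 ℕ.* K → Sz (f d x) (69 ℕ.* K) 0) (r s : ℕ) (r<n : r ℕ.< n₁) (s<S : s ℕ.< S) where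

      x : ℕ
      x = point r s

      x≤ : x ℕ.≤ 2 ℕ.^ 19 ℕ.* K
      x≤ = point≤ r s r<n s<S

      F : R
      F = Σ< U (λ i → ιℤ (d i) * (α ^ coord i * (ι (binomial x (block i)) * Y r s ^ level i)))

      d*binomial≤ : ∀ i → i ℕ.< U → ℤ.∣ d i ∣ ℕ.* binomial x (block i) ℕ.≤ 2 ℕ.^ (29 ℕ.* K)
      d*binomial≤ i i<U = ι-reflect (ℤ.∣ d i ∣ ℕ.* binomial x (block i)) (2 ℕ.^ (29 ℕ.* K)) (≤-trans (≤-reflexive (ι-* ℤ.∣ d i ∣ (binomial x (block i))))
        (≤-trans (*-mono-≤ (0≤ι ℤ.∣ d i ∣) (0≤2^ (19 ℕ.* block i ℕ.+ 2 ℕ.* K)) (ι≤2^ {ℤ.∣ d i ∣} {unknown i} (d≤ i i<U)) (binomial≤ x (block i) x≤))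
        (≤-reflexive (trans (sym (^-+ (ι 2) (unknown i) (19 ℕ.* block i ℕ.+ 2 ℕ.* K))) (trans (cong 2^_ (trans (sym (ℕₚ.+-assoc (unknown i) (19 ℕ.* block i) (2 ℕ.* K)))
          (trans (cong (ℕ._+ 2 ℕ.* K) (weight-block i i<U)) (arith K)))) (sym (ι-^ 2 (29 ℕ.* K))))))))
        where
        arith : ∀ K → 27 ℕ.* K ℕ.+ 2 ℕ.* K ≡ 29 ℕ.* K
        arith = solve-∀

      ∣d*binomial∣≤ : ∀ i → i ℕ.< U → ℤ.∣ d i ℤ.* ℤ.+ binomial x (block i) ∣ ℕ.≤ 2 ℕ.^ (29 ℕ.* K)
      ∣d*binomial∣≤ i i<U = ℕₚ.≤-trans (ℕₚ.≤-reflexive (ℤₚ.∣i*j∣≡∣i∣*∣j∣ (d i) (ℤ.+ binomial x (block i)))) (d*binomial≤ i i<U)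

      -- The quotient of the two powers is ζ^(s l); its s l ≤ 7 S ≤ κ factors lose at most κ bits,
      -- and so does the power of `u` in front.
      error-term : ∀ l → l ℕ.< 8 → Sz (Y r s ^ l - v l ^ x) (110 ℕ.* K) (2 ℕ.* κ)
      error-term l l<8 = subst (λ t → Sz t (110 ℕ.* K) (2 ℕ.* κ)) (sym eq)
          (Sz-conv {p = 0 ℕ.+ 110 ℕ.* K} {q = κ ℕ.+ s ℕ.* l} {p' = 110 ℕ.* K} {q' = 2 ℕ.* κ}
            (ℕₚ.+-monoʳ-≤ (110 ℕ.* K) (ℕₚ.+-monoʳ-≤ κ (ℕₚ.≤-trans s*l≤ (ℕₚ.≤-reflexive (sym (ℕₚ.+-identityʳ κ))))))
            (Sz-* {p = 0} {q = κ} {p' = 110 ℕ.* K} {q' = s ℕ.* l} (Sz-0 {q = κ} (u^-Bd (x ℕ.* l) (ℕₚ.*-mono-≤ x≤ (ℕₚ.≤-pred l<8)))) near))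
        where
        s*l≤ : s ℕ.* l ℕ.≤ κ
        s*l≤ = ℕₚ.≤-trans (ℕₚ.*-mono-≤ (ℕₚ.<⇒≤ s<S) (ℕₚ.≤-pred l<8)) (ℕₚ.≤-trans (ℕₚ.≤-reflexive (ℕₚ.*-comm S 7)) 7S≤κ)
        near : Sz (ζ ^ (s ℕ.* l) - 1#) (110 ℕ.* K) (s ℕ.* l)
        near = subst (Bd (2^ (110 ℕ.* K) * (ζ ^ (s ℕ.* l) - 1#))) (trans (alg₀ (2^ (110 ℕ.* K)) (2^ (s ℕ.* l)) (½ ^ (110 ℕ.* K))) (trans (cong (_* 2^ (s ℕ.* l)) (2^*½^ (110 ℕ.* K))) (*-identityˡ _)))
            (Bd-scale (0≤2^ (110 ℕ.* K)) (power-near-one ζ-near (½^≤1 (110 ℕ.* K)) (s ℕ.* l)))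
          where
          alg₀ = solve 3 (λ a b c → a :* (b :* c) := a :* c :* b) refl
        alg = solve 2 (λ a b → a :* b :- a := a :* (b :- # 1)) refl
        eq : Y r s ^ l - v l ^ x ≡ u ^ (x ℕ.* l) * (ζ ^ (s ℕ.* l) - 1#)
        eq = trans (cong₂ _-_ (trans (cong (_^ l) (Y≡ r s)) (trans (*-^ (u ^ x) (ζ ^ s) l) (cong₂ _*_ (sym (^-* u x l)) (sym (^-* ζ s l)))))
          (trans (sym (^-* u l x)) (cong (u ^_) (ℕₚ.*-comm l x)))) (alg (u ^ (x ℕ.* l)) (ζ ^ (s ℕ.* l)))

      -- The 110 K bits of closeness of ζ to 1 pay for the 69 K wanted and the 29 K of coefficients
      -- times binomials.
      F-f : Sz (F - f d x) (69 ℕ.* K) 0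
      F-f = subst (λ t → Sz t (69 ℕ.* K) 0) eq (Sz-conv {p = 110 ℕ.* K} {q = 15 ℕ.+ κ ℕ.+ (29 ℕ.* K ℕ.+ (2 ℕ.+ 2 ℕ.* κ))} {p' = 69 ℕ.* K} {q' = 0}
          (linear (11 ℕ.* K ℕ.+ 17 ℕ.* κ ℕ.+ 3) big (arith K κ))
          (Sz-Σ U (15 ℕ.+ κ) {p = 110 ℕ.* K} {q = 29 ℕ.* K ℕ.+ (2 ℕ.+ 2 ℕ.* κ)} U≤ term))
        where
        arith : ∀ K κ → 69 ℕ.* K ℕ.+ (15 ℕ.+ κ ℕ.+ (29 ℕ.* K ℕ.+ (2 ℕ.+ 2 ℕ.* κ))) ℕ.+ K ℕ.+ (11 ℕ.* K ℕ.+ 17 ℕ.* κ ℕ.+ 3) ≡ 110 ℕ.* K ℕ.+ 0 ℕ.+ (20 ℕ.* κ ℕ.+ 20)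
        arith = solve-∀
        h : ℕ → R
        h i = ιℤ (d i ℤ.* ℤ.+ binomial x (block i)) * (α ^ coord i * (Y r s ^ level i - v (level i) ^ x))
        term : ∀ i → i ℕ.< U → Sz (h i) (110 ℕ.* K) (29 ℕ.* K ℕ.+ (2 ℕ.+ 2 ℕ.* κ))
        term i i<U = Sz-* {p = 0} {q = 29 ℕ.* K} {p' = 110 ℕ.* K} {q' = 2 ℕ.+ 2 ℕ.* κ} (Sz-ιℤ (d i ℤ.* ℤ.+ binomial x (block i)) {29 ℕ.* K} (∣d*binomial∣≤ i i<U))
          (Sz-* {p = 0} {q = 2} {p' = 110 ℕ.* K} {q' = 2 ℕ.* κ} (Sz-0 {q = 2} (α^-Bd (coord i) (coord< i))) (error-term (level i) (level< i)))
        alg = solve 5 (λ d a b y v → d :* b :* (a :* (y :- v)) := d :* (a :* (b :* y)) :+ (:- # 1) :* (d :* (a :* (b :* v)))) refl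
        neg-one = solve 2 (λ a b → a :- b := a :+ (:- # 1) :* b) refl
        eq : Σ< U h ≡ F - f d x
        eq = trans (Σ<-cong U (λ i _ → trans (cong (_* (α ^ coord i * (Y r s ^ level i - v (level i) ^ x))) (ιℤ-* (d i) (ℤ.+ binomial x (block i))))
            (alg (ιℤ (d i)) (α ^ coord i) (ι (binomial x (block i))) (Y r s ^ level i) (v (level i) ^ x))))
          (trans (Σ<-+ U _ _) (trans (cong (F +_) (Σ<-*ˡ U (- 1#) _)) (sym (neg-one F (f d x)))))

      F-Sz : Sz F (69 ℕ.* K) 1
      F-Sz = subst (λ t → Sz t (69 ℕ.* K) 1) (alg F (f d x)) (Sz-+ {p = 69 ℕ.* K} {q = 0} F-f (f-small x x≤))
        where
        alg = solve 2 (λ a b → (a :- b) :+ b := a) refl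

      monomial : ℕ → R
      monomial i = α ^ coord i * (V r s ^ level i * Den ^ (7 ℕ.∸ level i))

      monomial-nat : ∀ i → NatCoords (monomial i)
      monomial-nat i = NatCoords-* (NatCoords-^ NatCoords-α (coord i)) (NatCoords-* (NatCoords-^ (V-nat r s) (level i)) (NatCoords-^ Den-nat (7 ℕ.∸ level i)))

      monomial≤ : ∀ i → monomial i ≤ ι (2 ℕ.^ (2 ℕ.+ 2 ℕ.* K))
      monomial≤ i = ≤-trans (Bd.upper (Bd-* (α^-Bd (coord i) (coord< i)) (Bd-* (Bd-^ (V-Bd r s r<n s<S) l) (Bd-^ (Bd-≤ (2^-mono-≤ (ℕₚ.m≤m+n Q (2 ℕ.* κ))) Den-Bd) (7 ℕ.∸ l)))))
          (≤-trans (*-monoʳ-≤ (0≤2^ 2) (≤-trans (≤-reflexive (trans (sym (^-+ (2^ Λ) l (7 ℕ.∸ l))) (trans (cong ((2^ Λ) ^_) (ℕₚ.m+[n∸m]≡n (ℕₚ.≤-pred (level< i))))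
            (trans (sym (^-* (ι 2) Λ 7)) (cong 2^_ (ℕₚ.*-comm Λ 7)))))) (2^-mono-≤ 7Λ≤)))
          (≤-reflexive (trans (sym (^-+ (ι 2) 2 (2 ℕ.* K))) (sym (ι-^ 2 (2 ℕ.+ 2 ℕ.* K))))))
        where
        l = level i

      z : R
      z = Σ< U (λ i → ιℤ (d i ℤ.* ℤ.+ binomial x (block i)) * monomial i)

      -- 29 K bits for a coefficient times a binomial, 2 K for a monomial, and one more `K` for the
      -- number of terms and constants.
      z-house : House z (2 ℕ.^ (32 ℕ.* K))
      z-house = House-≤ size≤ (House-Σ U (λ i i<U → House-scale (d i ℤ.* ℤ.+ binomial x (block i)) (∣d*binomial∣≤ i i<U) (NatCoords⇒House (monomial-nat i) (monomial≤ i))))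
        where
        arith : ∀ K κ → 15 ℕ.+ κ ℕ.+ (29 ℕ.* K ℕ.+ (2 ℕ.+ 2 ℕ.* K)) ℕ.+ K ℕ.+ (19 ℕ.* κ ℕ.+ 3) ≡ 32 ℕ.* K ℕ.+ (20 ℕ.* κ ℕ.+ 20)
        arith = solve-∀
        size≤ : U ℕ.* (2 ℕ.^ (29 ℕ.* K) ℕ.* 2 ℕ.^ (2 ℕ.+ 2 ℕ.* K)) ℕ.≤ 2 ℕ.^ (32 ℕ.* K)
        size≤ = product-≤ U (15 ℕ.+ κ) (29 ℕ.* K) (2 ℕ.+ 2 ℕ.* K) (32 ℕ.* K) U≤ (linear (19 ℕ.* κ ℕ.+ 3) big (arith K κ))

      z≡ : z ≡ Den ^ 7 * F
      z≡ = trans (Σ<-cong U (λ i i<U → trans (cong₂ (λ a b → a * (α ^ coord i * b)) (ιℤ-* (d i) (ℤ.+ binomial x (block i)))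
          (trans (cong (λ t → t ^ level i * Den ^ (7 ℕ.∸ level i)) (V≡ r s (ℕₚ.<⇒≤ r<n) (ℕₚ.<⇒≤ s<S)))
            (trans (cong (_* Den ^ (7 ℕ.∸ level i)) (*-^ (Y r s) Den (level i))) (trans (*-assoc _ _ _)
              (cong (Y r s ^ level i *_) (trans (sym (^-+ Den (level i) (7 ℕ.∸ level i))) (cong (Den ^_) (ℕₚ.m+[n∸m]≡n (ℕₚ.≤-pred (level< i))))))))))
          (alg (ιℤ (d i)) (ι (binomial x (block i))) (α ^ coord i) (Y r s ^ level i) (Den ^ 7)))) (Σ<-*ˡ U (Den ^ 7) _)
        where
        alg = solve 5 (λ d b a y D → d :* b :* (a :* (y :* D)) := D :* (d :* (a :* (b :* y)))) refl

      z-Bd : Bd z (½ ^ (66 ℕ.* K))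
      z-Bd = Sz-½^⁻¹ {p = 66 ℕ.* K} (subst (λ t → Sz t (66 ℕ.* K) 0) (sym z≡)
          (Sz-conv {p = 0 ℕ.+ 69 ℕ.* K} {q = Q ℕ.* 7 ℕ.+ 1} {p' = 66 ℕ.* K} {q' = 0}
            (linear 0 ineq (arith K Q))
            (Sz-* {p = 0} {q = Q ℕ.* 7} {p' = 69 ℕ.* K} {q' = 1} (Sz-^ {p = 0} {q = Q} (Sz-0 {q = Q} Den-Bd) 7) F-Sz)))
        where
        arith : ∀ K Q → 66 ℕ.* K ℕ.+ (Q ℕ.* 7 ℕ.+ 1) ℕ.+ (2 ℕ.* K ℕ.+ K) ℕ.+ 0 ≡ 0 ℕ.+ 69 ℕ.* K ℕ.+ 0 ℕ.+ (7 ℕ.* Q ℕ.+ 1)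
        arith = solve-∀
        ineq : 7 ℕ.* Q ℕ.+ 1 ℕ.≤ 2 ℕ.* K ℕ.+ K
        ineq = ℕₚ.+-mono-≤ (ℕₚ.≤-trans (ℕₚ.*-monoʳ-≤ 7 (ℕₚ.m≤m+n Q (2 ℕ.* κ))) 7Λ≤) 1≤K

      -- Liouville's inequality asks for 2 · 32 K + 6 bits of smallness, and 66 K are available. The
      -- common denominator is nonzero and cancels.
      F≡0 : F ≡ 0#
      F≡0 = pick (domain (Den ^ 7) F (trans (sym z≡) (liouville z-house z-Bd small)))
        where
        pick : Den ^ 7 ≡ 0# ⊎ F ≡ 0# → F ≡ 0#
        pick (inj₁ e) = contradiction e Den^7≢0
        pick (inj₂ e) = e
        T = 2 ℕ.^ (32 ℕ.* K)
        e = 32 ℕ.* K ℕ.+ 32 ℕ.* K ℕ.+ 5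
        arith : ∀ K κ → 32 ℕ.* K ℕ.+ 32 ℕ.* K ℕ.+ 5 ℕ.+ 1 ℕ.+ K ℕ.+ (K ℕ.+ 20 ℕ.* κ ℕ.+ 14) ≡ 66 ℕ.* K ℕ.+ (20 ℕ.* κ ℕ.+ 20)
        arith = solve-∀
        e+1≤ : e ℕ.+ 1 ℕ.≤ 66 ℕ.* K
        e+1≤ = linear (K ℕ.+ 20 ℕ.* κ ℕ.+ 14) big (arith K κ)
        T≤ : 25 ℕ.* (T ℕ.* T) ℕ.≤ 2 ℕ.^ e
        T≤ = product-≤ 25 5 (32 ℕ.* K) (32 ℕ.* K) e (ℕₚ.≤ᵇ⇒≤ 25 (2 ℕ.^ 5) _) (ℕₚ.≤-reflexive (ℕₚ.+-comm 5 (32 ℕ.* K ℕ.+ 32 ℕ.* K)))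
        small : ι (25 ℕ.* (T ℕ.* T)) * ½ ^ (66 ℕ.* K) ≤ ½
        small = ≤-trans (*-mono-≤ (0≤ι (25 ℕ.* (T ℕ.* T))) (0≤½^ (e ℕ.+ 1)) (ι≤2^ {25 ℕ.* (T ℕ.* T)} {e} T≤) (½^-mono {e ℕ.+ 1} {66 ℕ.* K} e+1≤))
          (≤-reflexive (trans (½^-scale e 1) (*-identityʳ ½)))

    module Vanishing (d : ℕ → ℤ) (F≡0 : ∀ r s → r ℕ.< n₁ → s ℕ.< S →
      Σ< U (λ i → ιℤ (d i) * (α ^ coord i * (ι (binomial (point r s) (block i)) * Y r s ^ level i))) ≡ 0#) where

      entry : ℕ → ℕ → R
      entry l k = Σ< 3 (λ e → ιℤ (d (k ℕ.* 24 ℕ.+ (l ℕ.* 3 ℕ.+ e))) * α ^ e)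

      P : ℕ → ℕ → R
      P l x = Σ< K (λ k → entry l k * ι (binomial x k))

      regroup : ∀ x y → Σ< U (λ i → ιℤ (d i) * (α ^ coord i * (ι (binomial x (block i)) * y ^ level i))) ≡ Σ< 8 (λ l → P l x * y ^ l)
      regroup x y = begin
        Σ< (K ℕ.* 24) h
          ≡⟨ Σ<-nest K 24 h ⟩
        Σ< K (λ k → Σ< (8 ℕ.* 3) (λ j → h (k ℕ.* 24 ℕ.+ j)))
          ≡⟨ Σ<-cong K (λ k _ → Σ<-nest 8 3 (λ j → h (k ℕ.* 24 ℕ.+ j))) ⟩
        Σ< K (λ k → Σ< 8 (λ l → Σ< 3 (λ e → h (k ℕ.* 24 ℕ.+ (l ℕ.* 3 ℕ.+ e)))))
          ≡⟨ Σ<-cong K (λ k _ → Σ<-cong 8 {λ l → Σ< 3 (λ e → h (k ℕ.* 24 ℕ.+ (l ℕ.* 3 ℕ.+ e)))} {λ l → y ^ l * (entry l k * ι (binomial x k))} (λ l l<8 → trans (Σ<-cong 3 {λ e → h (k ℕ.* 24 ℕ.+ (l ℕ.* 3 ℕ.+ e))} {λ e → ι (binomial x k) * y ^ l * (ιℤ (d (k ℕ.* 24 ℕ.+ (l ℕ.* 3 ℕ.+ e))) * α ^ e)} (λ e e<3 → single k l e l<8 e<3))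
               (trans (Σ<-*ˡ 3 (ι (binomial x k) * y ^ l) (λ e → ιℤ (d (k ℕ.* 24 ℕ.+ (l ℕ.* 3 ℕ.+ e))) * α ^ e)) (alg (ι (binomial x k)) (y ^ l) (entry l k))))) ⟩
        Σ< K (λ k → Σ< 8 (λ l → y ^ l * (entry l k * ι (binomial x k))))
          ≡⟨ Σ<-swap K 8 (λ k l → y ^ l * (entry l k * ι (binomial x k))) ⟩
        Σ< 8 (λ l → Σ< K (λ k → y ^ l * (entry l k * ι (binomial x k))))
          ≡⟨ Σ<-cong 8 {λ l → Σ< K (λ k → y ^ l * (entry l k * ι (binomial x k)))} {λ l → P l x * y ^ l} (λ l _ → trans (Σ<-*ˡ K (y ^ l) (λ k → entry l k * ι (binomial x k))) (*-comm (y ^ l) (P l x))) ⟩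
        Σ< 8 (λ l → P l x * y ^ l) ∎
        where
        open ≡-Reasoning
        h : ℕ → R
        h i = ιℤ (d i) * (α ^ coord i * (ι (binomial x (block i)) * y ^ level i))
        alg = solve 3 (λ b y c → b :* y :* c := y :* (c :* b)) refl
        alg' = solve 4 (λ d a b y → d :* (a :* (b :* y)) := b :* y :* (d :* a)) refl
        single : ∀ k l e → l ℕ.< 8 → e ℕ.< 3 → h (k ℕ.* 24 ℕ.+ (l ℕ.* 3 ℕ.+ e)) ≡ ι (binomial x k) * y ^ l * (ιℤ (d (k ℕ.* 24 ℕ.+ (l ℕ.* 3 ℕ.+ e))) * α ^ e)
        single k l e l<8 e<3 = trans (cong (ιℤ (d (k ℕ.* 24 ℕ.+ j)) *_) (cong₂ (λ a b → α ^ a * b) (trans (coord-at k j j<) (coord-of l e e<3))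
            (cong₂ (λ a b → ι (binomial x a) * y ^ b) (block-at k j j<) (trans (level-at k j j<) (level-of l e e<3)))))
            (alg' _ (α ^ e) (ι (binomial x k)) (y ^ l))
          where
          j = l ℕ.* 3 ℕ.+ e
          j< = index< l e l<8 e<3

      P-Deg : ∀ l → Deg K (P l)
      P-Deg l = Deg-Σ K K (λ k k<K → Deg-* K (entry l k) (Deg-≤ k<K (binomial-Deg k)))

      P≡0 : ∀ l → l ℕ.≤ 7 → ∀ x → P l x ≡ 0#
      P≡0 = zero-estimate 7 K n₀ P (λ l _ → P-Deg l) u^≢1 n≤q enough
          (λ r s r<n s<S → trans (sym (regroup (point r s) (Y r s))) (F≡0 r s r<n s<S))
        where
        open Grid u q S Y Y-step Y≢0 (ℕₚ.≤-trans (s≤s z≤n) (ℕₚ.≤-trans (ℕₚ.m≤n+m 7 n₀) n≤q))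

      entry≡0 : ∀ l k → l ℕ.≤ 7 → k ℕ.< K → entry l k ≡ 0#
      entry≡0 l k l≤7 k<K = newton-coefficients K (entry l) (P≡0 l l≤7) k k<K

      entry-lc : ∀ l k → entry l k ≡ lc (ιℤ (d (k ℕ.* 24 ℕ.+ (l ℕ.* 3 ℕ.+ 0)))) (ιℤ (d (k ℕ.* 24 ℕ.+ (l ℕ.* 3 ℕ.+ 1)))) (ιℤ (d (k ℕ.* 24 ℕ.+ (l ℕ.* 3 ℕ.+ 2))))
      entry-lc l k = alg _ _ _ α
        where
        alg = solve 4 (λ a b c α → # 0 :+ a :* # 1 :+ b :* (α :* # 1) :+ c :* (α :* (α :* # 1)) := a :+ b :* α :+ c :* (α :* α)) refl

      -- From functions back to integers: each `P l` vanishes, hence so do its Newton coefficients,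
      -- and 1, α, α² are independent.
      d≡0 : ∀ i → i ℕ.< U → d i ≡ ℤ.+ 0
      d≡0 i i<U = trans (cong d (index-decompose i)) (go (coord i) (coord< i))
        where
        k = block i
        l = level i
        all0 = independent (d (k ℕ.* 24 ℕ.+ (l ℕ.* 3 ℕ.+ 0))) (d (k ℕ.* 24 ℕ.+ (l ℕ.* 3 ℕ.+ 1))) (d (k ℕ.* 24 ℕ.+ (l ℕ.* 3 ℕ.+ 2)))
          (trans (sym (entry-lc l k)) (entry≡0 l k (ℕₚ.≤-pred (level< i)) (block< i i<U)))
        go : ∀ e → e ℕ.< 3 → d (k ℕ.* 24 ℕ.+ (l ℕ.* 3 ℕ.+ e)) ≡ ℤ.+ 0
        go 0 _ = proj₁ all0
        go 1 _ = proj₁ (proj₂ all0)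
        go 2 _ = proj₂ (proj₂ all0)
        go (suc (suc (suc e))) (s≤s (s≤s (s≤s ())))

    contradiction-reached : ⊥
    contradiction-reached = conclude auxiliary
      where
      conclude : ∃[ d ] (¬ (∀ i → i ℕ.< U → d i ≡ ℤ.+ 0) × (∀ i → i ℕ.< U → ℤ.∣ d i ∣ ℕ.≤ 2 ℕ.^ unknown i)
        × (∀ x → x ℕ.≤ 2 ℕ.^ 19 ℕ.* K → Sz (f d x) (69 ℕ.* K) 0)) → ⊥
      conclude (d , nonzero , d≤ , f-small) = nonzero (Vanishing.d≡0 d (λ r s r<n s<S → At.F≡0 d d≤ f-small r s r<n s<S))

-- Dirichlet approximation without logarithms.

last-index : (P : ℕ → Set) → (∀ n → Dec (P n)) → ∀ N → P 0 → ¬ P N → ∃[ n ] (n ℕ.< N × P n × ¬ P (suc n))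
last-index P P? zero    p ¬p = contradiction p ¬p
last-index P P? (suc N) p ¬p = decide (P? N)
  where
  decide : Dec (P N) → ∃[ n ] (n ℕ.< suc N × P n × ¬ P (suc n))
  decide (yes q) = N , ℕₚ.n<1+n N , q , ¬p
  decide (no ¬q) = widen (last-index P P? N p ¬q)
    where
    widen : ∃[ n ] (n ℕ.< N × P n × ¬ P (suc n)) → ∃[ n ] (n ℕ.< suc N × P n × ¬ P (suc n))
    widen (n , n<N , q) = n , ℕₚ.m≤n⇒m≤1+n n<N , q

module Dirichlet (𝓚 : CubicField) where
  open Arithmetic 𝓚
  open Auxiliary 𝓚 using (½^-mono; ½^-scale; ½^≤1)

  bernoulli-lower : ∀ {y} → 0# ≤ y → ∀ n → 1# + ι n * y ≤ (1# + y) ^ n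
  bernoulli-lower {y} 0≤y zero    = ≤-reflexive (trans (cong (1# +_) (zeroˡ y)) (+-identityʳ 1#))
  bernoulli-lower {y} 0≤y (suc n) = ≤-trans (by-diff (*-nonneg (0≤ι n) (*-nonneg 0≤y 0≤y))
      (trans (cong (λ t → (1# + y) * (1# + ι n * y) - (1# + t * y)) (ι-suc n)) (alg (ι n) y)))
    (*-monoʳ-≤ (+-nonneg 0≤1 0≤y) (bernoulli-lower 0≤y n))
    where
    alg = solve 2 (λ n y → (# 1 :+ y) :* (# 1 :+ n :* y) :- (# 1 :+ (# 1 :+ n) :* y) := n :* (y :* y)) refl

  -- A multiplicative grid of ratio β replaces logarithms: `b` acts as the integer part of log α^i /
  -- log ρ, up to a fixed scaling, and `t` as the fractional part measured in steps of log β.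
  module Cells (e g ρ : ℕ) (2≤ρ : 2 ℕ.≤ ρ) (ρ≤ : ρ ℕ.≤ 2 ℕ.^ suc g) where

    ε β : R
    ε = ½ ^ suc e
    β = 1# + ε

    -- β^M is at least 2, so `T` steps of ratio β reach ρ. The scale `Z` satisfies ε Z = 8, enough
    -- to swallow the rounding errors of size 2.
    T M Z : ℕ
    M = 2 ℕ.^ suc e
    T = M ℕ.* suc g
    Z = 2 ℕ.^ (4 ℕ.+ e)

    ρ^ : ℕ → R
    ρ^ b = ι ρ ^ b

    A : ℕ → ℕ → R
    A b t = ι Z * ρ^ b * β ^ t

    0≤ε : 0# ≤ ε
    0≤ε = 0≤½^ (suc e)

    1≤β : 1# ≤ β
    1≤β = ≤-trans (≤-reflexive (sym (+-identityʳ 1#))) (+-monoʳ-≤ 1# 0≤ε)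

    0≤β : 0# ≤ β
    0≤β = ≤-trans 0≤1 1≤β

    M*ε : ι M * ε ≡ 1#
    M*ε = trans (cong (_* ε) (ι-^ 2 (suc e))) (2^*½^ (suc e))

    1≤ρ^ : ∀ b → 1# ≤ ρ^ b
    1≤ρ^ = 1≤^ (ι-mono-≤ {1} {ρ} (ℕₚ.≤-trans (s≤s z≤n) 2≤ρ))

    0≤ρ^ : ∀ b → 0# ≤ ρ^ b
    0≤ρ^ b = ≤-trans 0≤1 (1≤ρ^ b)

    ρ≤β^T : ι ρ ≤ β ^ T
    ρ≤β^T = ≤-trans (ι≤2^ {ρ} {suc g} ρ≤) (≤-trans (^-mono-≤ (0≤ι 2) two (suc g)) (≤-reflexive (sym (^-* β M (suc g)))))
      where
      two : ι 2 ≤ β ^ M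
      two = ≤-trans (≤-reflexive (cong (1# +_) (sym M*ε))) (bernoulli-lower 0≤ε M)

    -- Z ρ^b β^t ≤ m for β = 1 + 1/M, with denominators cleared
    C : ℕ → ℕ → ℕ → Set
    C m b t = Z ℕ.* ρ ℕ.^ b ℕ.* suc M ℕ.^ t ℕ.≤ m ℕ.* M ℕ.^ t

    1≤M^ : ∀ t → 1 ℕ.≤ M ℕ.^ t
    1≤M^ t = ℕₚ.m^n>0 M {{ℕₚ.m^n≢0 2 (suc e)}} t

    lhs-ι : ∀ b t → ι (Z ℕ.* ρ ℕ.^ b ℕ.* suc M ℕ.^ t) ≡ ι (M ℕ.^ t) * A b t
    lhs-ι b t = trans (ι-* (Z ℕ.* ρ ℕ.^ b) (suc M ℕ.^ t)) (trans (cong₂ _*_ (trans (ι-* Z (ρ ℕ.^ b)) (cong (ι Z *_) (ι-^ ρ b)))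
        (trans (ι-^ (suc M) t) (trans (cong (_^ t) sucM) (trans (*-^ (ι M) β t) (cong (_* β ^ t) (sym (ι-^ M t))))))) (alg (ι Z * ρ^ b) (ι (M ℕ.^ t)) (β ^ t)))
      where
      alg = solve 3 (λ a b c → a :* (b :* c) := b :* (a :* c)) refl
      alg' = solve 2 (λ m e → m :* (# 1 :+ e) := m :* e :+ m) refl
      sucM : ι (suc M) ≡ ι M * β
      sucM = sym (trans (alg' (ι M) ε) (trans (cong (_+ ι M) M*ε) (sym (ι-suc M))))

    C⇒A≤ : ∀ m b t → C m b t → A b t ≤ ι m
    C⇒A≤ m b t c = cancel-ι-≤ (M ℕ.^ t) (1≤M^ t) (≤-trans (≤-reflexive (sym (lhs-ι b t))) (≤-trans (ι-mono-≤ c)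
      (≤-reflexive (trans (ι-* m (M ℕ.^ t)) (*-comm _ _)))))

    ¬C⇒≤A : ∀ m b t → ¬ C m b t → ι m ≤ A b t
    ¬C⇒≤A m b t ¬c = cancel-ι-≤ (M ℕ.^ t) (1≤M^ t) (≤-trans (≤-reflexive (trans (*-comm _ _) (sym (ι-* m (M ℕ.^ t)))))
      (≤-trans (ι-mono-≤ (ℕₚ.<⇒≤ (ℕₚ.≰⇒> ¬c))) (≤-reflexive (lhs-ι b t))))

    Cell : ℕ → Set
    Cell m = ∃[ b ] ∃[ t ] (t ℕ.< T × A b t ≤ ι m × ι m ≤ A b (suc t))

    cell : ∀ m → Z ℕ.≤ m → Cell m
    cell m Z≤m = with-b (last-index (λ b → Z ℕ.* ρ ℕ.^ b ℕ.≤ m) (λ b → Z ℕ.* ρ ℕ.^ b ℕ.≤? m) m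
        (ℕₚ.≤-trans (ℕₚ.≤-reflexive (ℕₚ.*-identityʳ Z)) Z≤m)
        (λ le → ℕₚ.<⇒≱ (ℕₚ.<-≤-trans (n<2^n m) (ℕₚ.≤-trans (ℕₚ.^-monoˡ-≤ m 2≤ρ) (ℕₚ.m≤n*m (ρ ℕ.^ m) Z {{ℕₚ.m^n≢0 2 (4 ℕ.+ e)}}))) le))
      where
      with-b : ∃[ b ] (b ℕ.< m × Z ℕ.* ρ ℕ.^ b ℕ.≤ m × ¬ (Z ℕ.* ρ ℕ.^ suc b ℕ.≤ m)) → Cell m
      with-b (b , _ , le , nle) = with-t (last-index (C m b) (λ t → Z ℕ.* ρ ℕ.^ b ℕ.* suc M ℕ.^ t ℕ.≤? m ℕ.* M ℕ.^ t) T
          (ℕₚ.*-monoˡ-≤ 1 le) not-T)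
        where
        with-t : ∃[ t ] (t ℕ.< T × C m b t × ¬ C m b (suc t)) → Cell m
        with-t (t , t<T , c , ¬c) = b , t , t<T , C⇒A≤ m b t c , ¬C⇒≤A m b (suc t) ¬c
        not-T : ¬ C m b T
        not-T c = ℕₚ.1+n≰n (ι-reflect (suc m) m (≤-trans (ι-mono-≤ (ℕₚ.≰⇒> nle)) (≤-trans (≤-reflexive
            (trans (ι-* Z (ρ ℕ.^ suc b)) (trans (cong (ι Z *_) (ι-^ ρ (suc b))) (alg (ι Z) (ι ρ) (ρ^ b)))))
          (≤-trans (*-monoʳ-≤ (*-nonneg (0≤ι Z) (0≤ρ^ b)) ρ≤β^T) (C⇒A≤ m b T c)))))
          where
          alg = solve 3 (λ z r p → z :* (r :* p) := z :* p :* r) refl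

    scale : ℕ
    scale = 5 ℕ.+ e

    X : ℕ → R
    X i = 2^ scale * α ^ i

    0≤X : ∀ i → 0# ≤ X i
    0≤X i = *-nonneg (0≤2^ scale) (^-nonneg 0≤α i)

    2Z≤X : ∀ i → ι Z + ι Z ≤ X i
    2Z≤X i = ≤-trans (≤-reflexive (trans (cong₂ _+_ (ι-^ 2 (4 ℕ.+ e)) (ι-^ 2 (4 ℕ.+ e))) (dbl (2^ (4 ℕ.+ e)))))
        (≤-trans (≤-reflexive (sym (*-identityʳ _))) (*-monoʳ-≤ (0≤2^ scale) (1≤^ 1≤α i)))
      where
      dbl = solve 1 (λ x → x :+ x := # 2 :* x) refl

    -- The cell is located for an integer close to `X i`, where comparisons are decidable; the
    -- tolerance 2 is the price of that rounding.
    record Approx (i : ℕ) : Set where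
      constructor approx
      field
        b t   : ℕ
        t<T   : t ℕ.< T
        lower : A b t - ι 2 ≤ X i
        upper : X i ≤ A b (suc t) + ι 2

    approximation : ∀ i → Approx i
    approximation i = from (floor (X i))
      where
      from : ∃[ z ] Bd (X i - ιℤ z) (ι 2) → Approx i
      from (z , bd l u) = build z l u z≥
        where
        z≥ : ℤ.+ Z ℤ.≤ z
        z≥ = reflect (ℤ.+ Z) z (≤-trans (by-diff (+-nonneg (0≤y-x (2Z≤X i)) (+-nonneg (0≤y-x u) (0≤y-x Z-large'))) (alg (X i) (ιℤ z) (ι Z))) ≤-refl)
          where
          Z-large' : ι 2 ≤ ι Z
          Z-large' = ι-mono-≤ {2} {Z} (ℕₚ.^-monoʳ-≤ 2 {1} {4 ℕ.+ e} (s≤s z≤n))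
          alg = solve 3 (λ x z y → z :- y := (x :- (y :+ y)) :+ ((# 2 :- (x :- z)) :+ (y :- # 2))) refl
        build : ∀ z → - ι 2 ≤ X i - ιℤ z → X i - ιℤ z ≤ ι 2 → ℤ.+ Z ℤ.≤ z → Approx i
        build (ℤ.+ m) l u (ℤ.+≤+ Z≤m) = use (cell m Z≤m)
          where
          use : Cell m → Approx i
          use (b , t , t<T , lo , up) = approx b t t<T
            (by-diff (+-nonneg (0≤y-x lo) (0≤y-x l)) (alg₁ (X i) (ι m) (A b t)))
            (by-diff (+-nonneg (0≤y-x up) (0≤y-x u)) (alg₂ (X i) (ι m) (A b (suc t))))
            where
            alg₁ = solve 3 (λ x m a → x :- (a :- # 2) := (m :- a) :+ ((x :- m) :- :- # 2)) refl
            alg₂ = solve 3 (λ x m a → (a :+ # 2) :- x := (a :- m) :+ (# 2 :- (x :- m))) refl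
        build ℤ.-[1+ m ] l u ()

    A-large : ∀ b t → ι Z ≤ A b t
    A-large b t = ≤-trans (≤-reflexive (sym (trans (*-identityʳ _) (*-identityʳ _))))
      (*-mono-≤ (*-nonneg (0≤ι Z) 0≤1) (^-nonneg 0≤β t) (*-monoʳ-≤ (0≤ι Z) (1≤ρ^ b)) (1≤^ 1≤β t))

    A-suc : ∀ b t → A b (suc t) ≡ A b t + ε * A b t
    A-suc b t = alg (ι Z * ρ^ b) ε (β ^ t)
      where
      alg = solve 3 (λ a e p → a :* ((# 1 :+ e) :* p) := a :* p :+ e :* (a :* p)) refl

    A-+ : ∀ c b t → A (c ℕ.+ b) t ≡ ρ^ c * A b t
    A-+ c b t = trans (cong (λ s → ι Z * s * β ^ t) (^-+ (ι ρ) c b)) (alg (ι Z) (ρ^ c) (ρ^ b) (β ^ t))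
      where
      alg = solve 4 (λ z c b t → z :* (c :* b) :* t := c :* (z :* b :* t)) refl

    8≤εA : ∀ b t → ι 8 ≤ ε * A b t
    8≤εA b t = ≤-trans (≤-reflexive (sym (trans (cong (ε *_) (trans (ι-^ 2 (4 ℕ.+ e)) (trans (cong 2^_ (cong suc (ℕₚ.+-comm 3 e))) (^-+ (ι 2) (suc e) 3))))
        (trans (alg₁ ε (2^ suc e)) (trans (cong (_* (2^ 3)) (2^*½^ (suc e))) alg₂)))))
      (*-monoʳ-≤ 0≤ε (A-large b t))
      where
      alg₁ = solve 2 (λ e m → e :* (m :* (# 2 :* (# 2 :* (# 2 :* # 1)))) := m :* e :* (# 2 :* (# 2 :* (# 2 :* # 1)))) refl
      alg₂ : 1# * (ι 2 * (ι 2 * (ι 2 * 1#))) ≡ ι 8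
      alg₂ = solve 0 (# 1 :* (# 2 :* (# 2 :* (# 2 :* # 1))) := # 8) refl

    Good : Set
    Good = ∃[ a ] ∃[ b ] (1 ℕ.≤ a × a ℕ.≤ T × Bd (α ^ a - ρ^ b) (½ ^ e * ρ^ b))

    -- With equal `t` the common factor β^t drops out of X j / X i = α^(c+1), which leaves ρ^(b'-b)
    -- up to one cell width and rounding.
    from-pair : ∀ i c → (p : Approx i) → (q : Approx (suc c ℕ.+ i)) → Approx.t p ≡ Approx.t q → suc c ℕ.≤ T → Good
    from-pair i c (approx b t t<T lo up) (approx b' .t t<T' lo' up') refl c≤T = compare (ℕₚ.≤-total b b')
      where
      j = suc c ℕ.+ i
      a = suc c
      X-+ : X j ≡ α ^ a * X i
      X-+ = trans (cong (2^ scale *_) (^-+ α a i)) (alg (2^ scale) (α ^ a) (α ^ i))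
        where
        alg = solve 3 (λ s a b → s :* (a :* b) := a :* (s :* b)) refl
      X-mono : X i ≤ X j
      X-mono = ≤-trans (≤-reflexive (sym (*-identityˡ _))) (≤-trans (*-monoˡ-≤ (0≤X i) (1≤^ 1≤α a)) (≤-reflexive (sym X-+)))
      good : ∀ k → k ℕ.+ b ≡ b' → Good
      good k eq = a , k , s≤s z≤n , c≤T , subst₂ Bd (cancel-X (α ^ a - ρ^ k)) (cancel-X (½ ^ e * ρ^ k))
          (Bd-scale (*-nonneg (0≤½^ scale) (^-nonneg 0≤α⁻¹ i)) scaled)
        where
        r = ρ^ k
        Aᵢ = A b t
        cancel-X : ∀ y → (½ ^ scale * α⁻¹ ^ i) * (X i * y) ≡ y
        cancel-X y = trans (alg (½ ^ scale) (α⁻¹ ^ i) (2^ scale) (α ^ i) y) (trans (cong₂ (λ s t → s * t * y) (2^*½^ scale) (^-inverse α*α⁻¹ i)) (alg' y))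
          where
          alg = solve 5 (λ h v s p y → (h :* v) :* (s :* p :* y) := (s :* h) :* (p :* v) :* y) refl
          alg' = solve 1 (λ y → # 1 :* # 1 :* y := y) refl
        A'≡ : A b' t ≡ r * Aᵢ
        A'≡ = trans (cong (λ s → A s t) (sym eq)) (A-+ k b t)
        ½e : ½ ^ e ≡ ε + ε
        ½e = sym (trans (alg ½ (½ ^ e)) (trans (cong (_* ½ ^ e) ½+½) (*-identityˡ _)))
          where
          alg = solve 2 (λ h p → h :* p :+ h :* p := (h :+ h) :* p) refl
        ε≤1 : ε ≤ 1#
        ε≤1 = ½^≤1 (suc e)
        lo₂ : r * Aᵢ - ι 2 ≤ X j
        lo₂ = subst (λ s → s - ι 2 ≤ X j) A'≡ lo'
        up₂ : X j ≤ (r * Aᵢ + ε * (r * Aᵢ)) + ι 2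
        up₂ = ≤-trans up' (≤-reflexive (cong (_+ ι 2) (trans (A-suc b' t) (cong (λ s → s + ε * s) A'≡))))
        up₁ : X i ≤ (Aᵢ + ε * Aᵢ) + ι 2
        up₁ = ≤-trans up (≤-reflexive (cong (_+ ι 2) (A-suc b t)))
        0≤r-1 : 0# ≤ r - 1#
        0≤r-1 = 0≤y-x (1≤ρ^ k)
        0≤r = 0≤ρ^ k
        slack : 0# ≤ r * (ε * Aᵢ - ι 8)
        slack = *-nonneg 0≤r (0≤y-x (8≤εA b t))
        0≤1-ε : 0# ≤ 1# - ε
        0≤1-ε = 0≤y-x ε≤1
        -- The allowed error 2 ε r X i holds one cell width ε r A and the rounding terms, because ε
        -- A ≥ 8.
        scaled : Bd (X i * (α ^ a - r)) (X i * (½ ^ e * r))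
        scaled = subst₂ Bd (sym (trans (distr (X i) (α ^ a) r) (cong (_- r * X i) (sym X-+)))) (sym (cong (λ s → X i * (s * r)) ½e))
          (bd (by-diff (+-nonneg (+-nonneg (0≤y-x lo₂) (*-nonneg 0≤r (0≤y-x up₁))) lower-rest) (l-alg (X i) (X j) r ε Aᵢ))
              (by-diff (+-nonneg (+-nonneg (0≤y-x up₂) (*-nonneg 0≤r (0≤y-x lo))) lower-rest) (u-alg (X i) (X j) r ε Aᵢ)))
          where
          distr = solve 3 (λ x a r → x :* (a :- r) := a :* x :- r :* x) refl
          lower-rest : 0# ≤ ((r * (ε * Aᵢ - ι 8) + (ι 2 * (r - 1#) + ι 4 * (r * (1# - ε)))) + (ε + ε) * (r * (X i - (Aᵢ - ι 2))))
          lower-rest = +-nonneg (+-nonneg slack (+-nonneg (*-nonneg (0≤ι 2) 0≤r-1) (*-nonneg (0≤ι 4) (*-nonneg 0≤r 0≤1-ε))))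
            (*-nonneg (+-nonneg 0≤ε 0≤ε) (*-nonneg 0≤r (0≤y-x lo)))
          l-alg = solve 5 (λ x y r e a → (y :- r :* x) :- :- (x :* ((e :+ e) :* r)) := ((y :- (r :* a :- # 2)) :+ r :* (((a :+ e :* a) :+ # 2) :- x)) :+ ((r :* (e :* a :- # 8) :+ (# 2 :* (r :- # 1) :+ # 4 :* (r :* (# 1 :- e)))) :+ (e :+ e) :* (r :* (x :- (a :- # 2))))) refl
          u-alg = solve 5 (λ x y r e a → x :* ((e :+ e) :* r) :- (y :- r :* x) := ((((r :* a :+ e :* (r :* a)) :+ # 2) :- y) :+ r :* (x :- (a :- # 2))) :+ ((r :* (e :* a :- # 8) :+ (# 2 :* (r :- # 1) :+ # 4 :* (r :* (# 1 :- e)))) :+ (e :+ e) :* (r :* (x :- (a :- # 2))))) refl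
      compare : b ℕ.≤ b' ⊎ b' ℕ.≤ b → Good
      compare (inj₁ b≤b') = good (b' ℕ.∸ b) (ℕₚ.m∸n+n≡m b≤b')
      compare (inj₂ b'≤b) = decide (ℕₚ.m≤n⇒m<n∨m≡n b'≤b)
        where
        decide : b' ℕ.< b ⊎ b' ≡ b → Good
        decide (inj₂ eq) = good 0 (sym eq)
        -- Otherwise A is at least 2 A', so 2 A' - 2 ≤ X i ≤ X j ≤ (3/2) A' + 2, which forces A' ≤ 8
        -- against A' ≥ 16.
        decide (inj₁ b'<b) = ⊥-elim (1≰0 (≤-trans (ι-mono-≤ {1} {8} (s≤s z≤n)) impossible))
          where
          A' = A b' t
          2A'≤A : ι 2 * A' ≤ A b t
          2A'≤A = ≤-trans (*-monoˡ-≤ (*-nonneg (*-nonneg (0≤ι Z) (0≤ρ^ b')) (^-nonneg 0≤β t))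
              (≤-trans (ι-mono-≤ {2} {ρ} 2≤ρ) (≤-trans (≤-reflexive (sym (*-identityʳ _))) (^-monoʳ-≤ (ι-mono-≤ {1} {ρ} (ℕₚ.≤-trans (s≤s z≤n) 2≤ρ)) {1} {b ℕ.∸ b'} (ℕₚ.m<n⇒0<n∸m b'<b)))))
            (≤-reflexive (trans (sym (A-+ (b ℕ.∸ b') b' t)) (cong (λ s → A s t) (ℕₚ.m∸n+n≡m b'≤b))))
          up₃ : X j ≤ (A' + ε * A') + ι 2
          up₃ = ≤-trans up' (≤-reflexive (cong (_+ ι 2) (A-suc b' t)))
          εA'≤ : ι 2 * (ε * A') ≤ A'
          εA'≤ = ≤-trans (≤-reflexive (sym (*-assoc _ _ _))) (≤-trans (*-monoˡ-≤ (≤-trans (0≤ι Z) (A-large b' t))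
              (≤-trans (≤-reflexive (trans (sym (*-assoc _ _ _)) (trans (cong (_* ½ ^ e) (inv-spec 1)) (*-identityˡ _)))) (½^≤1 e))) (≤-reflexive (*-identityˡ _)))
          impossible : ι 8 ≤ 0#
          impossible = by-diff (+-nonneg (+-nonneg (+-nonneg sum sum) (0≤y-x εA'≤)) (0≤y-x 16≤A')) (alg (A b t) A' ε (X i) (X j))
            where
            sum = +-nonneg (+-nonneg (0≤y-x 2A'≤A) (0≤y-x lo)) (+-nonneg (0≤y-x X-mono) (0≤y-x up₃))
            16≤A' : ι 16 ≤ A'
            16≤A' = ≤-trans (ι-mono-≤ {16} {Z} (ℕₚ.^-monoʳ-≤ 2 {4} {4 ℕ.+ e} (ℕₚ.m≤m+n 4 e))) (A-large b' t)
            alg = solve 5 (λ a b e x y → # 0 :- # 8 := (((((a :- # 2 :* b) :+ (x :- (a :- # 2))) :+ ((y :- x) :+ (((b :+ e :* b) :+ # 2) :- y))) :+ (((a :- # 2 :* b) :+ (x :- (a :- # 2))) :+ ((y :- x) :+ (((b :+ e :* b) :+ # 2) :- y)))) :+ (b :- # 2 :* (e :* b))) :+ (b :- # 16)) refl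

    abstract
      chosen : ∀ i → Approx i
      chosen = approximation

    slot : Fin (suc T) → Fin T
    slot i = fromℕ< (Approx.t<T (chosen (toℕ i)))

    slot-t : ∀ i → toℕ (slot i) ≡ Approx.t (chosen (toℕ i))
    slot-t i = Finₚ.toℕ-fromℕ< (Approx.t<T (chosen (toℕ i)))

    from-collision : ∀ m n (p : Approx m) (q : Approx n) → m ℕ.< n → n ℕ.≤ T → Approx.t p ≡ Approx.t q → Good
    from-collision m n p q m<n n≤T same = shift (n ℕ.∸ suc m) (trans (sym (ℕₚ.+-suc (n ℕ.∸ suc m) m)) (ℕₚ.m∸n+n≡m m<n)) n≤T q same
      where
      shift : ∀ c {n} → suc c ℕ.+ m ≡ n → n ℕ.≤ T → (q : Approx n) → Approx.t p ≡ Approx.t q → Good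
      shift c refl n≤T q same = from-pair m c p q same (ℕₚ.≤-trans (ℕₚ.m≤m+n (suc c) m) n≤T)

    -- `suc T` exponents share `T` values of `t`, so two of them collide; their difference is the
    -- exponent `a`.
    dirichlet : Good
    dirichlet = from-collision (toℕ i) (toℕ j) (chosen (toℕ i)) (chosen (toℕ j)) i<j (ℕₚ.≤-pred (Finₚ.toℕ<n j))
        (trans (sym (slot-t i)) (trans (cong toℕ same) (slot-t j)))
      where
      collision : ∃[ i ] ∃[ j ] (i Fin.< j × slot i ≡ slot j)
      collision = Finₚ.pigeonhole (ℕₚ.n<1+n T) slot
      i = proj₁ collision
      j = proj₁ (proj₂ collision)
      i<j = proj₁ (proj₂ (proj₂ collision))
      same = proj₂ (proj₂ (proj₂ collision))

-- From the digit equation to the quantities u, w and ζ.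

Narayana-mono-≤ : ∀ {i j} → i ℕ.≤ j → Narayana i ℕ.≤ Narayana j
Narayana-mono-≤ {i} le = go (ℕₚ.≤⇒≤′ le)
  where
  go : ∀ {j} → i ℕ.≤′ j → Narayana i ℕ.≤ Narayana j
  go (ℕ.≤′-reflexive refl) = ℕₚ.≤-refl
  go (ℕ.≤′-step {j} p) = ℕₚ.≤-trans (go p) (Narayana-mono j)

cube-root-≤ : ∀ x y → x ℕ.^ 3 ℕ.≤ y ℕ.^ 3 → x ℕ.≤ y
cube-root-≤ x y le = ℕₚ.≮⇒≥ (λ y<x → ℕₚ.<⇒≱ (ℕₚ.^-monoˡ-< 3 y<x) le)

module Equation (𝓚 : CubicField) (p : ℕ) (n d₁ d₂ d₃ ℓ m k : ℕ) where
  ρ E ν : ℕ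
  ρ = suc (suc p)
  E = ℓ ℕ.+ (m ℕ.+ k)
  ν = 2 ℕ.+ n

  open Arithmetic 𝓚
  open Auxiliary 𝓚
  open Endgame 𝓚 using (nonzero-*; nonzero-^; 1≢0)

  r P r⁻¹ P⁻¹ : R
  r = ι ρ
  P = ι (suc p)
  r⁻¹ = inv (suc p)
  P⁻¹ = inv p

  r≡ : r ≡ 1# + P
  r≡ = ι-suc (suc p)

  repunit-ι : ∀ j → P * ι (repunit ρ j) ≡ r ^ j - 1#
  repunit-ι zero = trans (zeroʳ P) (sym (-‿inverseʳ 1#))
  repunit-ι (suc j) = trans (cong (P *_) (trans (ι-suc (ρ ℕ.* repunit ρ j)) (cong (1# +_) (ι-* ρ (repunit ρ j)))))
      (trans (alg P r (ι (repunit ρ j))) (trans (cong (λ t → P + r * t) (repunit-ι j)) (trans (cong (λ t → t + r * (r ^ j - 1#)) P≡) (alg' r (r ^ j)))))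
    where
    P≡ : P ≡ r - 1#
    P≡ = sym (trans (cong (_- 1#) r≡) (alg₂ P))
      where
      alg₂ = solve 1 (λ p → (# 1 :+ p) :- # 1 := p) refl
    alg = solve 3 (λ p r t → p :* (# 1 :+ r :* t) := p :+ r :* (p :* t)) refl
    alg' = solve 2 (λ r t → (r :- # 1) :+ r :* (t :- # 1) := r :* t :- # 1) refl

  1≤r^ : ∀ j → 1# ≤ r ^ j
  1≤r^ = 1≤^ (ι-mono-≤ {1} {ρ} (s≤s z≤n))

  0≤r^ : ∀ j → 0# ≤ r ^ j
  0≤r^ j = ≤-trans 0≤1 (1≤r^ j)

  module Solution (1≤k : 1 ℕ.≤ k) (k≤m : k ℕ.≤ m) (m≤ℓ : m ℕ.≤ ℓ) (d₁< : d₁ ℕ.< ρ) (d₂< : d₂ ℕ.< ρ) (d₃< : d₃ ℕ.< ρ) (0<d₁ : 0 ℕ.< d₁)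
    (eq : Narayana n ≡ d₁ ℕ.* repunit ρ ℓ ℕ.* ρ ℕ.^ (m ℕ.+ k) ℕ.+ d₂ ℕ.* repunit ρ m ℕ.* ρ ℕ.^ k ℕ.+ d₃ ℕ.* repunit ρ k) where

    c₁ c₂ c₃ : R
    c₁ = ι d₁
    c₂ = ι d₂
    c₃ = ι d₃

    -- Multiplication by ρ - 1 turns repunits into differences of powers. Besides the main term only
    -- order (ρ - 1) ρ^(m+k) is left, without the large factor ρ^ℓ.
    remainder : R
    remainder = P * N n - c₁ * r ^ E

    remainder≡ : remainder ≡ (c₂ * (r ^ (m ℕ.+ k) - r ^ k) + c₃ * (r ^ k - 1#)) - c₁ * r ^ (m ℕ.+ k)
    remainder≡ = trans (cong (_- c₁ * r ^ E) (trans (cong (P *_) N≡) (trans (alg₁ P c₁ c₂ c₃ (ι (repunit ρ ℓ)) (ι (repunit ρ m)) (ι (repunit ρ k)) (r ^ (m ℕ.+ k)) (r ^ k))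
        (trans (cong₂ (λ s t → c₁ * (s * r ^ (m ℕ.+ k)) + (c₂ * (t * r ^ k) + c₃ * (P * ι (repunit ρ k)))) (repunit-ι ℓ) (repunit-ι m))
          (cong (λ s → c₁ * ((r ^ ℓ - 1#) * r ^ (m ℕ.+ k)) + (c₂ * ((r ^ m - 1#) * r ^ k) + c₃ * s)) (repunit-ι k))))))
        (trans (cong (λ s → c₁ * ((r ^ ℓ - 1#) * r ^ (m ℕ.+ k)) + (c₂ * ((r ^ m - 1#) * r ^ k) + c₃ * (r ^ k - 1#)) - c₁ * s) (^-+ r ℓ (m ℕ.+ k)))
        (trans (alg₂ c₁ c₂ c₃ (r ^ ℓ) (r ^ m) (r ^ k) (r ^ (m ℕ.+ k))) (cong (λ s → (c₂ * (s - r ^ k) + c₃ * (r ^ k - 1#)) - c₁ * r ^ (m ℕ.+ k)) (sym (^-+ r m k)))))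
      where
      N≡ : N n ≡ c₁ * ι (repunit ρ ℓ) * r ^ (m ℕ.+ k) + c₂ * ι (repunit ρ m) * r ^ k + c₃ * ι (repunit ρ k)
      N≡ = trans (cong ι eq) (trans (ι-+ (d₁ ℕ.* repunit ρ ℓ ℕ.* ρ ℕ.^ (m ℕ.+ k) ℕ.+ d₂ ℕ.* repunit ρ m ℕ.* ρ ℕ.^ k) (d₃ ℕ.* repunit ρ k))
        (cong₂ _+_ (trans (ι-+ (d₁ ℕ.* repunit ρ ℓ ℕ.* ρ ℕ.^ (m ℕ.+ k)) (d₂ ℕ.* repunit ρ m ℕ.* ρ ℕ.^ k))
          (cong₂ _+_ (trans (ι-* (d₁ ℕ.* repunit ρ ℓ) (ρ ℕ.^ (m ℕ.+ k))) (cong₂ _*_ (ι-* d₁ (repunit ρ ℓ)) (ι-^ ρ (m ℕ.+ k))))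
            (trans (ι-* (d₂ ℕ.* repunit ρ m) (ρ ℕ.^ k)) (cong₂ _*_ (ι-* d₂ (repunit ρ m)) (ι-^ ρ k))))) (ι-* d₃ (repunit ρ k))))
      alg₁ = solve 9 (λ p a b c x y z s t → p :* (a :* x :* s :+ b :* y :* t :+ c :* z) := a :* (p :* x :* s) :+ (b :* (p :* y :* t) :+ c :* (p :* z))) refl
      alg₂ = solve 7 (λ a b c x y z s → a :* ((x :- # 1) :* s) :+ (b :* ((y :- # 1) :* z) :+ c :* (z :- # 1)) :- a :* (x :* s) := (b :* (y :* z :- z) :+ c :* (z :- # 1)) :- a :* s) refl

    c≤P : ∀ {d} → d ℕ.< ρ → ι d ≤ P
    c≤P (s≤s le) = ι-mono-≤ le

    remainder-Bd : Bd remainder (P * r ^ (m ℕ.+ k))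
    remainder-Bd = subst (λ t → Bd t (P * s)) (sym remainder≡) (bd
        (by-diff (+-nonneg (+-nonneg (*-nonneg (0≤ι d₂) 0≤s-t) (*-nonneg (0≤ι d₃) 0≤t-1)) (*-nonneg (0≤y-x (c≤P d₁<)) (0≤r^ (m ℕ.+ k)))) (l P c₁ c₂ c₃ s t))
        (by-diff (+-nonneg (+-nonneg (*-nonneg (0≤y-x (c≤P d₂<)) 0≤s-t) (*-nonneg (0≤y-x (c≤P d₃<)) 0≤t-1)) (+-nonneg (0≤ι (suc p)) (*-nonneg (0≤ι d₁) (0≤r^ (m ℕ.+ k))))) (h P c₁ c₂ c₃ s t)))
      where
      s = r ^ (m ℕ.+ k)
      t = r ^ k
      0≤s-t : 0# ≤ s - t
      0≤s-t = 0≤y-x (^-monoʳ-≤ (ι-mono-≤ {1} {ρ} (s≤s z≤n)) (ℕₚ.m≤n+m k m))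
      0≤t-1 : 0# ≤ t - 1#
      0≤t-1 = 0≤y-x (1≤r^ k)
      l = solve 6 (λ p a b c s t → ((b :* (s :- t) :+ c :* (t :- # 1)) :- a :* s) :- :- (p :* s) := (b :* (s :- t) :+ c :* (t :- # 1)) :+ (p :- a) :* s) refl
      h = solve 6 (λ p a b c s t → p :* s :- ((b :* (s :- t) :+ c :* (t :- # 1)) :- a :* s) := ((p :- b) :* (s :- t) :+ (p :- c) :* (t :- # 1)) :+ (p :+ a :* s)) refl

    N≤2r^E : Narayana n ℕ.≤ 2 ℕ.* ρ ℕ.^ E
    N≤2r^E = ι-reflect _ _ (cancel-ι-≤ (suc p) (s≤s z≤n) (≤-trans
        (by-diff (+-nonneg (0≤y-x (Bd.upper remainder-Bd)) (+-nonneg (*-nonneg (0≤y-x (c≤P d₁<)) (0≤r^ E)) (*-nonneg (0≤ι (suc p)) (0≤y-x mk≤E)))) (alg P (N n) c₁ (r ^ E) (r ^ (m ℕ.+ k))))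
        (≤-reflexive (cong (P *_) (sym (trans (ι-* 2 (ρ ℕ.^ E)) (cong (ι 2 *_) (ι-^ ρ E))))))))
      where
      mk≤E : r ^ (m ℕ.+ k) ≤ r ^ E
      mk≤E = ^-monoʳ-≤ (ι-mono-≤ {1} {ρ} (s≤s z≤n)) (ℕₚ.m≤n+m (m ℕ.+ k) ℓ)
      alg = solve 5 (λ p n c e s → p :* (# 2 :* e) :- p :* n := (p :* s :- (p :* n :- c :* e)) :+ ((p :- c) :* e :+ p :* (e :- s))) refl

    repunit-lower : ∀ j → ρ ℕ.^ j ℕ.≤ repunit ρ (suc j)
    repunit-lower zero = s≤s z≤n
    repunit-lower (suc j) = ℕₚ.≤-trans (ℕₚ.*-monoʳ-≤ ρ (repunit-lower j)) (ℕₚ.n≤1+n _)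

    r^≤N : ∀ j → suc j ≡ ℓ → ρ ℕ.^ (j ℕ.+ (m ℕ.+ k)) ℕ.≤ Narayana n
    r^≤N j refl = subst (ρ ℕ.^ (j ℕ.+ (m ℕ.+ k)) ℕ.≤_) (sym eq) (ℕₚ.≤-trans (ℕₚ.≤-reflexive (ℕₚ.^-distribˡ-+-* ρ j (m ℕ.+ k)))
      (ℕₚ.≤-trans (ℕₚ.*-monoˡ-≤ (ρ ℕ.^ (m ℕ.+ k)) (ℕₚ.≤-trans (repunit-lower j) (ℕₚ.m≤n*m (repunit ρ (suc j)) d₁ {{ℕ.>-nonZero 0<d₁}})))
      (ℕₚ.≤-trans (ℕₚ.m≤m+n _ (d₂ ℕ.* repunit ρ m ℕ.* ρ ℕ.^ k)) (ℕₚ.m≤m+n _ (d₃ ℕ.* repunit ρ k)))))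

    N≤α^ν : N n ≤ α ^ ν
    N≤α^ν = ≤-trans (ι-mono-≤ (ℕₚ.≤-trans (Narayana-mono n) (Narayana-mono (suc n))))
        (≤-trans (by-diff (+-nonneg (*-nonneg (0≤y-x 1≤α) (0≤ι (Narayana (suc n)))) (*-nonneg 0≤α⁻¹ (0≤ι (Narayana n)))) (trans (cong (_- N (2 ℕ.+ n)) (power-of-α n)) (alg (N (2 ℕ.+ n)) (α - 1#) (N (suc n)) α⁻¹ (N n))))
        (^-monoʳ-≤ 1≤α (ℕₚ.n≤1+n (suc n))))
      where
      alg = solve 5 (λ a b c d e → (a :+ b :* c :+ d :* e) :- a := b :* c :+ d :* e) refl

    ζ : R
    ζ = (c₁ * π * r ^ E) * (P⁻¹ * α⁻¹ ^ ν)

    α⁻ν-inverse : α ^ ν * α⁻¹ ^ ν ≡ 1#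
    α⁻ν-inverse = ^-inverse α*α⁻¹ ν

    0≤α⁻ν : 0# ≤ α⁻¹ ^ ν
    0≤α⁻ν = ^-nonneg 0≤α⁻¹ ν

    π≤7 : π ≤ ι 7
    π≤7 = ≤-trans (+-monoʳ-≤ (ι 3) (*-mono-≤ 0≤α (0≤ι 2) α≤2 α≤2)) (≤-reflexive (solve 0 (# 3 :+ # 2 :* # 2 := # 7) refl))

    0≤π : 0# ≤ π
    0≤π = +-nonneg (0≤ι 3) (*-nonneg 0≤α 0≤α)

    -- ζ - 1 is P times the Binet error minus π times the remainder, divided by P α^ν.
    ζ-1 : Bd (ζ - 1#) ((ι 9 * 5/4 ^ n + ι 7 * r ^ (m ℕ.+ k)) * α⁻¹ ^ ν)
    ζ-1 = subst₂ Bd (sym ζ-1≡) bound (Bd-* (Bd-- (Bd-* (Bd-self (0≤ι (suc p))) (binet n)) (Bd-* (Bd-0≤ 0≤π π≤7) remainder-Bd)) (Bd-self (*-nonneg (inv-pos p) 0≤α⁻ν)))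
      where
      bound : (P * (ι 9 * 5/4 ^ n) + ι 7 * (P * r ^ (m ℕ.+ k))) * (P⁻¹ * α⁻¹ ^ ν) ≡ (ι 9 * 5/4 ^ n + ι 7 * r ^ (m ℕ.+ k)) * α⁻¹ ^ ν
      bound = trans (alg P P⁻¹ (ι 9 * 5/4 ^ n) (ι 7) (r ^ (m ℕ.+ k)) (α⁻¹ ^ ν)) (trans (cong (_* ((ι 9 * 5/4 ^ n + ι 7 * r ^ (m ℕ.+ k)) * α⁻¹ ^ ν)) (inv-spec p)) (*-identityˡ _))
        where
        alg = solve 6 (λ p i a s b v → (p :* a :+ s :* (p :* b)) :* (i :* v) := p :* i :* ((a :+ s :* b) :* v)) refl
      ζ-1≡ : ζ - 1# ≡ (P * (π * N n - α ^ ν) - π * remainder) * (P⁻¹ * α⁻¹ ^ ν)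
      ζ-1≡ = trans (cong (λ t → ζ - t) (sym one)) (alg P P⁻¹ (α ^ ν) (α⁻¹ ^ ν) π (N n) c₁ (r ^ E))
        where
        one : (P * P⁻¹) * (α ^ ν * α⁻¹ ^ ν) ≡ 1#
        one = trans (cong₂ _*_ (inv-spec p) α⁻ν-inverse) (*-identityˡ 1#)
        alg = solve 8 (λ p i a v t n c e → (c :* t :* e) :* (i :* v) :- (p :* i) :* (a :* v) := (p :* (t :* n :- a) :- t :* (p :* n :- c :* e)) :* (i :* v)) refl

    module Near (Z j : ℕ) (n≥ : 6 ℕ.* (Z ℕ.+ 5) ℕ.≤ n) (ℓ≡ : suc j ≡ ℓ) (2^≤ : 2 ℕ.^ (Z ℕ.+ 4) ℕ.≤ ρ ℕ.^ j) where

      y : R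
      y = 5/4 * α⁻¹

      0≤y : 0# ≤ y
      0≤y = *-nonneg 0≤5/4 0≤α⁻¹

      ¼≡ : ¼ ≡ ½ * ½
      ¼≡ = trans (sym (*-identityʳ ¼)) (trans (cong (¼ *_) (sym (trans (cong₂ _*_ (inv-spec 1) (inv-spec 1)) (*-identityˡ 1#)))) (trans (alg ¼ ½) (trans (cong (_* (½ * ½)) (inv-spec 3)) (*-identityˡ _))))
        where
        alg = solve 2 (λ q h → q :* ((# 2 :* h) :* (# 2 :* h)) := # 4 :* q :* (h :* h)) refl

      α⁻² : α⁻¹ * α⁻¹ ≡ α - 1#
      α⁻² = trans (alg α) (trans (cong ((α - 1#) *_) α*α⁻¹) (*-identityʳ _))
        where
        alg = solve 1 (λ a → (a :* (a :- # 1)) :* (a :* (a :- # 1)) := (a :- # 1) :* (a :* (a :* (a :- # 1)))) refl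

      α-1≤½ : α - 1# ≤ ½
      α-1≤½ = ≤-trans (cancel-ι-≤ 2 (s≤s z≤n) (≤-trans (by-diff (0≤y-x α-upper) (alg α)) (≤-reflexive (sym (inv-spec 1))))) ≤-refl
        where
        alg = solve 1 (λ a → # 1 :- # 2 :* (a :- # 1) := # 3 :- # 2 :* a) refl

      -- α^-2 = α - 1 ≤ 1/2 gives y² ≤ 25/32, and the cube of 25/32 is below 1/2.
      y²≤ : y ^ 2 ≤ ι 25 * ½ ^ 5
      y²≤ = ≤-trans (≤-reflexive (trans (alg ¼ α⁻¹) (cong₂ (λ s t → ι 25 * (s * s) * t) ¼≡ α⁻²)))
        (≤-trans (*-monoʳ-≤ (*-nonneg (0≤ι 25) (*-nonneg (*-nonneg 0≤½ 0≤½) (*-nonneg 0≤½ 0≤½))) α-1≤½) (≤-reflexive (alg' ½)))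
        where
        alg = solve 2 (λ q v → (# 5 :* q :* v) :* ((# 5 :* q :* v) :* # 1) := # 25 :* (q :* q) :* (v :* v)) refl
        alg' = solve 1 (λ h → # 25 :* ((h :* h) :* (h :* h)) :* h := # 25 :* (h :* (h :* (h :* (h :* (h :* # 1)))))) refl

      y^6≤½ : y ^ 6 ≤ ½
      y^6≤½ = ≤-trans (≤-reflexive (^-* y 2 3)) (≤-trans (^-mono-≤ (^-nonneg 0≤y 2) y²≤ 3) (≤-trans (≤-reflexive (trans (*-^ (ι 25) (½ ^ 5) 3)
          (cong₂ _*_ (sym (ι-^ 25 3)) (sym (^-* ½ 5 3))))) (≤-trans (*-monoˡ-≤ (0≤½^ 15) (ι≤2^ {25 ℕ.^ 3} {14} (ℕₚ.≤ᵇ⇒≤ (25 ℕ.^ 3) (2 ℕ.^ 14) _)))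
          (≤-reflexive (trans (½^-scale 14 1) (*-identityʳ ½))))))

      y≤1 : y ≤ 1#
      y≤1 = ≤-trans (*-monoʳ-≤ 0≤5/4 (Bd.upper Bd-α⁻¹)) (≤-trans (by-diff (*-nonneg (inv-pos 3) (inv-pos 3)) (alg ¼)) (≤-reflexive (trans (cong₂ _*_ (inv-spec 3) (inv-spec 3)) (*-identityˡ 1#))))
        where
        alg = solve 1 (λ q → (# 4 :* q) :* (# 4 :* q) :- # 5 :* q :* (# 3 :* q) := q :* q) refl

      ≤1-power : ∀ {x} → 0# ≤ x → x ≤ 1# → ∀ i → x ^ i ≤ 1#
      ≤1-power 0≤x x≤1 i = ≤-trans (^-mono-≤ 0≤x x≤1 i) (≤-reflexive (1^n i))

      y^n≤ : y ^ n ≤ ½ ^ (Z ℕ.+ 5)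
      y^n≤ = ≤-trans (≤-reflexive (trans (cong (y ^_) (sym (ℕₚ.m+[n∸m]≡n n≥))) (^-+ y (6 ℕ.* (Z ℕ.+ 5)) (n ℕ.∸ 6 ℕ.* (Z ℕ.+ 5)))))
        (≤-trans (*-monoʳ-≤ (^-nonneg 0≤y (6 ℕ.* (Z ℕ.+ 5))) (≤1-power 0≤y y≤1 (n ℕ.∸ 6 ℕ.* (Z ℕ.+ 5)))) (≤-trans (≤-reflexive (trans (*-identityʳ _) (^-* y 6 (Z ℕ.+ 5))))
          (^-mono-≤ (^-nonneg 0≤y 6) y^6≤½ (Z ℕ.+ 5))))

      α⁻¹≤1 : α⁻¹ ≤ 1#
      α⁻¹≤1 = ≤-trans (≤-trans (≤-reflexive (sym (*-identityˡ _))) (*-monoˡ-≤ 0≤α⁻¹ 1≤α)) (≤-reflexive α*α⁻¹)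

      first : (ι 9 * 5/4 ^ n) * α⁻¹ ^ ν ≤ ½ ^ suc Z
      first = ≤-trans (≤-reflexive (alg (ι 9) (5/4 ^ n) α⁻¹ (α⁻¹ ^ n))) (≤-trans (*-monoʳ-≤ (*-nonneg (0≤ι 9) (*-nonneg (^-nonneg 0≤5/4 n) (^-nonneg 0≤α⁻¹ n)))
          (≤1-power 0≤α⁻¹ α⁻¹≤1 2)) (≤-trans (≤-reflexive (trans (*-identityʳ _) (cong (ι 9 *_) (sym (*-^ 5/4 α⁻¹ n)))))
          (≤-trans (*-mono-≤ (0≤ι 9) (0≤½^ (Z ℕ.+ 5)) (ι≤2^ {9} {4} (ℕₚ.≤ᵇ⇒≤ 9 16 _)) y^n≤) (≤-reflexive (trans (cong (λ e → 2^ 4 * ½ ^ e) (ℕₚ.+-comm Z 5)) (½^-scale 4 (suc Z)))))))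
        where
        alg = solve 4 (λ c f v w → (c :* f) :* (v :* (v :* w)) := (c :* (f :* w)) :* (v :* (v :* # 1))) refl

      -- ρ^(ℓ-1+m+k) ≤ N n ≤ α^ν, so ρ^(m+k) / α^ν is at most ρ^-(ℓ-1).
      second : (ι 7 * r ^ (m ℕ.+ k)) * α⁻¹ ^ ν ≤ ½ ^ suc Z
      second = ≤-trans (≤-reflexive (*-assoc _ _ _)) (≤-trans (*-mono-≤ (0≤ι 7) (0≤½^ (Z ℕ.+ 4)) (ι≤2^ {7} {3} (ℕₚ.≤ᵇ⇒≤ 7 8 _)) core)
          (≤-reflexive (trans (cong (λ e → 2^ 3 * ½ ^ e) (ℕₚ.+-comm Z 4)) (½^-scale 3 (suc Z)))))
        where
        x = r ^ (m ℕ.+ k) * α⁻¹ ^ ν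
        0≤x : 0# ≤ x
        0≤x = *-nonneg (0≤r^ (m ℕ.+ k)) 0≤α⁻ν
        r^j : 2^ (Z ℕ.+ 4) ≤ r ^ j
        r^j = ≤-trans (≤-reflexive (sym (ι-^ 2 (Z ℕ.+ 4)))) (≤-trans (ι-mono-≤ 2^≤) (≤-reflexive (ι-^ ρ j)))
        ≤1 : 2^ (Z ℕ.+ 4) * x ≤ 1#
        ≤1 = ≤-trans (*-monoˡ-≤ 0≤x r^j) (≤-trans (≤-reflexive (trans (sym (*-assoc _ _ _)) (cong (_* α⁻¹ ^ ν) (trans (sym (^-+ r j (m ℕ.+ k))) (sym (ι-^ ρ (j ℕ.+ (m ℕ.+ k))))))))
          (≤-trans (*-monoˡ-≤ 0≤α⁻ν (≤-trans (ι-mono-≤ (r^≤N j ℓ≡)) N≤α^ν)) (≤-reflexive α⁻ν-inverse)))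
        core : x ≤ ½ ^ (Z ℕ.+ 4)
        core = Bd.upper (Sz-½^⁻¹ {p = Z ℕ.+ 4} (Bd-0≤ (*-nonneg (0≤2^ (Z ℕ.+ 4)) 0≤x) ≤1))

      ζ-near : Bd (ζ - 1#) (½ ^ Z)
      ζ-near = Bd-≤ (≤-trans (≤-reflexive (distribʳ _ _ _)) (≤-trans (+-mono-≤ first second) (≤-reflexive (trans (alg ½ (½ ^ Z)) (trans (cong (_* ½ ^ Z) ½+½) (*-identityˡ _)))))) ζ-1
        where
        alg = solve 2 (λ h p → h :* p :+ h :* p := (h :+ h) :* p) refl

    module Parameters (Z : ℕ) (ζ-near : Bd (ζ - 1#) (½ ^ suc Z))
      (K κ : ℕ) (K≡ : K ≡ 1024 ℕ.* κ) (1≤κ : 1 ℕ.≤ κ) (Z≡ : suc Z ≡ 110 ℕ.* K)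
      (g : ℕ) (ρ≤ : ρ ℕ.≤ 2 ℕ.^ suc g)
      (a b : ℕ) (1≤a : 1 ℕ.≤ a) (near : Bd (α ^ a - r ^ b) (½ ^ 62 * r ^ b))
      (q r₀ : ℕ) (ν≡ : ν ≡ r₀ ℕ.+ q ℕ.* a) (r₀≤a : r₀ ℕ.≤ a) (S n₀ : ℕ)
      (n≤q : n₀ ℕ.+ 7 ℕ.≤ q) (enough : 2 ℕ.^ 7 ℕ.* K ℕ.≤ n₀ ℕ.* S) (Sq≤ : S ℕ.* q ℕ.≤ 2 ℕ.^ 19 ℕ.* K) (7S≤κ : 7 ℕ.* S ℕ.≤ κ)
      (Sq≤' : S ℕ.* q ℕ.≤ 2 ℕ.^ 60 ℕ.* κ) (n₁≤' : n₀ ℕ.+ 7 ℕ.≤ 2 ℕ.^ 60 ℕ.* κ)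
      (Λ≤ : 7 ℕ.* ((a ℕ.+ (4 ℕ.+ suc g)) ℕ.* S ℕ.+ κ ℕ.+ (κ ℕ.+ a ℕ.* (n₀ ℕ.+ 7)) ℕ.+ 2 ℕ.* κ) ℕ.≤ 2 ℕ.* K) where

      n₁ Q : ℕ
      n₁ = n₀ ℕ.+ 7
      Q = (a ℕ.+ (4 ℕ.+ suc g)) ℕ.* S ℕ.+ κ ℕ.+ (κ ℕ.+ a ℕ.* n₁)

      unit-nonzero : ∀ {x y} → x * y ≡ 1# → x ≢ 0#
      unit-nonzero {x} {y} xy x≡0 = 1≢0 (trans (sym xy) (trans (cong (_* y) x≡0) (zeroˡ y)))

      r*r⁻¹ : r * r⁻¹ ≡ 1#
      r*r⁻¹ = inv-spec (suc p)

      r^*r⁻^ : ∀ i → r ^ i * r⁻¹ ^ i ≡ 1#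
      r^*r⁻^ = ^-inverse r*r⁻¹

      α≢0 : α ≢ 0#
      α≢0 = unit-nonzero α*α⁻¹

      r≢0 : r ≢ 0#
      r≢0 = unit-nonzero r*r⁻¹

      r⁻¹≢0 : r⁻¹ ≢ 0#
      r⁻¹≢0 = unit-nonzero (trans (*-comm _ _) r*r⁻¹)

      u : R
      u = α ^ a * r⁻¹ ^ b

      u≢0 : u ≢ 0#
      u≢0 = nonzero-* {α ^ a} {r⁻¹ ^ b} (nonzero-^ {α} α≢0 a) (nonzero-^ {r⁻¹} r⁻¹≢0 b)

      u*Du : u * r ^ b ≡ α ^ a
      u*Du = trans (*-assoc _ _ _) (trans (cong (α ^ a *_) (trans (*-comm _ _) (r^*r⁻^ b))) (*-identityʳ _))

      u-near : Bd (u - 1#) (½ ^ 62)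
      u-near = subst₂ Bd lhs rhs (Bd-* near (Bd-self (^-nonneg (inv-pos (suc p)) b)))
        where
        alg = solve 3 (λ x y z → (x :- y) :* z := x :* z :- y :* z) refl
        lhs : (α ^ a - r ^ b) * r⁻¹ ^ b ≡ u - 1#
        lhs = trans (alg (α ^ a) (r ^ b) (r⁻¹ ^ b)) (cong (λ t → u - t) (r^*r⁻^ b))
        rhs : ½ ^ 62 * r ^ b * r⁻¹ ^ b ≡ ½ ^ 62
        rhs = trans (*-assoc _ _ _) (trans (cong (½ ^ 62 *_) (r^*r⁻^ b)) (*-identityʳ _))

      -- The step (x, y, w) ↦ (w, x, y + w) never loses a positive coordinate at α or α²; hence no
      -- positive power of α is rational.
      power-coords : ∀ i → ∃[ x ] ∃[ y ] ∃[ w ] (1 ℕ.≤ y ℕ.+ w × α ^ suc i ≡ lc (ι x) (ι y) (ι w))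
      power-coords zero = 0 , 1 , 0 , s≤s z≤n , alg α
        where
        alg = solve 1 (λ α → α :* # 1 := # 0 :+ # 1 :* α :+ # 0 :* (α :* α)) refl
      power-coords (suc i) = next (power-coords i)
        where
        next : ∃[ x ] ∃[ y ] ∃[ w ] (1 ℕ.≤ y ℕ.+ w × α ^ suc i ≡ lc (ι x) (ι y) (ι w)) →
          ∃[ x ] ∃[ y ] ∃[ w ] (1 ℕ.≤ y ℕ.+ w × α ^ suc (suc i) ≡ lc (ι x) (ι y) (ι w))
        next (x , y , w , pos , e) = w , x , y ℕ.+ w , ℕₚ.≤-trans pos (ℕₚ.m≤n+m (y ℕ.+ w) x) , NatCoords.eq (NatCoords-step (nat x y w e))

      α^-irrational : ∀ i M → α ^ suc i ≢ ι M
      α^-irrational i M α≡M = refute (power-coords i)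
        where
        refute : ¬ (∃[ x ] ∃[ y ] ∃[ w ] (1 ℕ.≤ y ℕ.+ w × α ^ suc i ≡ lc (ι x) (ι y) (ι w)))
        refute (x , y , w , pos , e) = ℕₚ.<⇒≢ pos (sym (cong₂ ℕ._+_ (ℤₚ.+-injective (proj₁ (proj₂ zeros))) (ℤₚ.+-injective (proj₂ (proj₂ zeros)))))
          where
          alg = solve 5 (λ x m y w α → (x :- m) :+ y :* α :+ w :* (α :* α) := (x :+ y :* α :+ w :* (α :* α)) :- m) refl
          zeros = independent (ℤ.+ x ℤ.- ℤ.+ M) (ℤ.+ y) (ℤ.+ w) (trans (cong (λ t → t + ι y * α + ι w * (α * α)) (ιℤ-pos-sub x M))
            (trans (alg (ι x) (ι M) (ι y) (ι w) α) (trans (cong (_- ι M) (trans (sym e) α≡M)) (-‿inverseʳ _))))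

      u^-cleared : ∀ l → α ^ (a ℕ.* l) ≡ u ^ l * ι (ρ ℕ.^ (b ℕ.* l))
      u^-cleared l = begin
        α ^ (a ℕ.* l)               ≡⟨ ^-* α a l ⟩
        (α ^ a) ^ l                 ≡⟨ cong (λ t → t ^ l) (sym u*Du) ⟩
        (u * r ^ b) ^ l             ≡⟨ *-^ u (r ^ b) l ⟩
        u ^ l * (r ^ b) ^ l         ≡⟨ cong (u ^ l *_) (sym (^-* r b l)) ⟩
        u ^ l * r ^ (b ℕ.* l)       ≡⟨ cong (u ^ l *_) (sym (ι-^ ρ (b ℕ.* l))) ⟩
        u ^ l * ι (ρ ℕ.^ (b ℕ.* l)) ∎
        where open ≡-Reasoning

      positive-irrational : ∀ i M → 1 ℕ.≤ i → α ^ i ≢ ι M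
      positive-irrational (suc i) M _ = α^-irrational i M

      -- Otherwise the positive power α^(a l) would be the integer ρ^(b l).
      u^≢1 : ∀ l → 1 ℕ.≤ l → l ℕ.≤ 7 → u ^ l ≢ 1#
      u^≢1 l 1≤l _ u≡1 = positive-irrational (a ℕ.* l) M (ℕₚ.*-mono-≤ 1≤a 1≤l)
          (trans (u^-cleared l) (trans (cong (λ t → t * ι M) u≡1) (*-identityˡ (ι M))))
        where
        M = ρ ℕ.^ (b ℕ.* l)

      w : R
      w = u ^ q * ζ

      π≢0 : π ≢ 0#
      π≢0 π≡0 = 1≰0 (≤-trans (ι-mono-≤ {1} {3} (s≤s z≤n)) (≤-trans (≤-trans (≤-reflexive (sym (+-identityʳ (ι 3)))) (+-monoʳ-≤ (ι 3) (*-nonneg 0≤α 0≤α))) (≤-reflexive π≡0)))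

      c₁≢0 : c₁ ≢ 0#
      c₁≢0 e = 1≰0 (≤-trans (ι-mono-≤ {1} {d₁} 0<d₁) (≤-reflexive e))

      α⁻¹≢0 : α⁻¹ ≢ 0#
      α⁻¹≢0 = unit-nonzero {α⁻¹} {α} (trans (*-comm α⁻¹ α) α*α⁻¹)

      P⁻¹≢0 : P⁻¹ ≢ 0#
      P⁻¹≢0 = unit-nonzero {P⁻¹} {P} (trans (*-comm P⁻¹ P) (inv-spec p))

      ζ≢0 : ζ ≢ 0#
      ζ≢0 = nonzero-* {c₁ * π * r ^ E} {P⁻¹ * α⁻¹ ^ ν} (nonzero-* {c₁ * π} {r ^ E} (nonzero-* {c₁} {π} c₁≢0 π≢0) (nonzero-^ {r} r≢0 E))
        (nonzero-* {P⁻¹} {α⁻¹ ^ ν} P⁻¹≢0 (nonzero-^ {α⁻¹} α⁻¹≢0 ν))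

      w≢0 : w ≢ 0#
      w≢0 = nonzero-* {u ^ q} {ζ} (nonzero-^ {u} u≢0 q) ζ≢0

      -- Positive and negative part of E - b q: truncated subtraction makes one of them zero, and
      -- ρ^(E - b q) splits between numerator and denominator of `w`.
      o⁺ o⁻ : ℕ
      o⁺ = E ℕ.∸ b ℕ.* q
      o⁻ = b ℕ.* q ℕ.∸ E

      exponents : b ℕ.* q ℕ.+ o⁺ ≡ E ℕ.+ o⁻
      exponents = go (ℕₚ.≤-total E (b ℕ.* q))
        where
        go : E ℕ.≤ b ℕ.* q ⊎ b ℕ.* q ℕ.≤ E → b ℕ.* q ℕ.+ o⁺ ≡ E ℕ.+ o⁻
        go (inj₁ le) = trans (cong (b ℕ.* q ℕ.+_) (ℕₚ.m≤n⇒m∸n≡0 le)) (trans (ℕₚ.+-identityʳ _) (sym (ℕₚ.m+[n∸m]≡n le)))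
        go (inj₂ le) = trans (ℕₚ.m+[n∸m]≡n le) (sym (trans (cong (E ℕ.+_) (ℕₚ.m≤n⇒m∸n≡0 le)) (ℕₚ.+-identityʳ _)))

      Dw Nw : R
      Dw = α ^ r₀ * r ^ o⁻ * P
      Nw = r ^ o⁺ * (c₁ * π)

      -- Here the large exponents disappear: α^(q a) cancels α^ν up to α^r₀, and ρ^(b q) cancels ρ^E
      -- up to the split remainder.
      w*Dw : w * Dw ≡ Nw
      w*Dw = begin
        u ^ q * ζ * Dw
          ≡⟨ cong (λ t → t * ζ * Dw) (trans (*-^ (α ^ a) (r⁻¹ ^ b) q) (cong₂ _*_ (trans (sym (^-* α a q)) (cong (α ^_) (ℕₚ.*-comm a q))) (sym (^-* r⁻¹ b q)))) ⟩
        α ^ (q ℕ.* a) * r⁻¹ ^ (b ℕ.* q) * ζ * Dw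
          ≡⟨ alg (α ^ (q ℕ.* a)) (r⁻¹ ^ (b ℕ.* q)) c₁ π (r ^ E) P⁻¹ (α⁻¹ ^ ν) (α ^ r₀) (r ^ o⁻) P ⟩
        (P * P⁻¹) * ((α ^ r₀ * α ^ (q ℕ.* a)) * α⁻¹ ^ ν) * (r⁻¹ ^ (b ℕ.* q) * (r ^ E * r ^ o⁻)) * (c₁ * π)
          ≡⟨ cong₂ (λ s t → s * t * (c₁ * π)) (cong₂ _*_ (inv-spec p) alpha) rho ⟩
        1# * 1# * r ^ o⁺ * (c₁ * π)
          ≡⟨ alg' (r ^ o⁺) (c₁ * π) ⟩
        Nw ∎
        where
        open ≡-Reasoning
        alg = solve 10 (λ A s c t e i v x y p → A :* s :* ((c :* t :* e) :* (i :* v)) :* (x :* y :* p) := (p :* i) :* ((x :* A) :* v) :* (s :* (e :* y)) :* (c :* t)) refl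
        alg' = solve 2 (λ x y → # 1 :* # 1 :* x :* y := x :* y) refl
        alpha : (α ^ r₀ * α ^ (q ℕ.* a)) * α⁻¹ ^ ν ≡ 1#
        alpha = trans (cong (_* α⁻¹ ^ ν) (trans (sym (^-+ α r₀ (q ℕ.* a))) (cong (α ^_) (sym ν≡)))) α⁻ν-inverse
        rho : r⁻¹ ^ (b ℕ.* q) * (r ^ E * r ^ o⁻) ≡ r ^ o⁺
        rho = trans (cong (r⁻¹ ^ (b ℕ.* q) *_) (trans (sym (^-+ r E o⁻)) (trans (cong (r ^_) (sym exponents)) (^-+ r (b ℕ.* q) o⁺))))
          (trans (sym (*-assoc _ _ _)) (trans (cong (_* r ^ o⁺) (trans (*-comm _ _) (r^*r⁻^ (b ℕ.* q)))) (*-identityˡ _)))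

      δ : R
      δ = 1# + ½ ^ 61

      0≤δ : 0# ≤ δ
      0≤δ = +-nonneg 0≤1 (0≤½^ 61)

      1≤δ : 1# ≤ δ
      1≤δ = ≤-trans (≤-reflexive (sym (+-identityʳ 1#))) (+-monoʳ-≤ 1# (0≤½^ 61))

      -- 1 / (1 - h) ≤ 1 + 2 h for h = 2^-62, whence the choice of δ.
      r^b≤ : r ^ b ≤ δ * α ^ a
      r^b≤ = by-diff (+-nonneg (*-nonneg (+-nonneg 0≤1 (+-nonneg 0≤h 0≤h)) (0≤y-x (Bd.lower near))) (*-nonneg (*-nonneg 0≤h 0≤1-2h) (0≤r^ b)))
          (trans (cong (λ t → (1# + t) * α ^ a - r ^ b) halves) (alg h (α ^ a) (r ^ b)))
        where
        h = ½ ^ 62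
        0≤h = 0≤½^ 62
        halves : ½ ^ 61 ≡ h + h
        halves = sym (trans (alg₀ ½ (½ ^ 61)) (trans (cong (_* ½ ^ 61) ½+½) (*-identityˡ _)))
          where
          alg₀ = solve 2 (λ h p → h :* p :+ h :* p := (h :+ h) :* p) refl
        0≤1-2h : 0# ≤ 1# - (h + h)
        0≤1-2h = subst (λ t → 0# ≤ 1# - t) halves (0≤y-x (½^≤1 61))
        alg = solve 3 (λ h x y → (# 1 :+ (h :+ h)) :* x :- y := (# 1 :+ (h :+ h)) :* ((x :- y) :- :- (h :* y)) :+ h :* (# 1 :- (h :+ h)) :* y) refl

      α^ν≤ : α ^ ν ≤ 2^ 4 * r ^ E
      α^ν≤ = ≤-trans (≤-reflexive (sym (*-identityˡ _))) (≤-trans (*-monoˡ-≤ (^-nonneg 0≤α ν) 1≤2ζ)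
          (≤-trans (≤-reflexive (trans (alg (ι 2) c₁ π (r ^ E) P⁻¹ (α⁻¹ ^ ν) (α ^ ν)) (trans (cong (λ t → (ι 2 * (c₁ * P⁻¹ * π)) * r ^ E * t) α⁻ν-inverse) (*-identityʳ _))))
          (*-monoˡ-≤ (0≤r^ E) (≤-trans (*-monoʳ-≤ (0≤ι 2) (≤-trans (*-mono-≤ (*-nonneg (0≤ι d₁) (inv-pos p)) (0≤ι 7) (≤-trans (*-monoˡ-≤ (inv-pos p) (c≤P d₁<)) (≤-reflexive (inv-spec p))) π≤7) (≤-reflexive (*-identityˡ _))))
            (≤-trans (≤-reflexive (sym (ι-* 2 7))) (ι≤2^ {14} {4} (ℕₚ.≤ᵇ⇒≤ 14 16 _)))))))
        where
        alg = solve 7 (λ t c p e i v a → t :* ((c :* p :* e) :* (i :* v)) :* a := (t :* (c :* i :* p)) :* e :* (a :* v)) refl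
        -- The exponent `suc Z` is positive, so ζ is at least 1/2.
        1≤2ζ : 1# ≤ ι 2 * ζ
        1≤2ζ = by-diff (+-nonneg (*-nonneg (0≤ι 2) (0≤y-x (Bd.lower ζ-near))) (0≤y-x (≤-trans (*-monoʳ-≤ (0≤ι 2) (½^-mono {1} {suc Z} (s≤s z≤n))) (≤-reflexive (trans (sym (*-assoc _ _ _)) (trans (*-identityʳ _) (inv-spec 1)))))))
            (alg₁ ζ (½ ^ suc Z))
          where
          alg₁ = solve 2 (λ z d → # 2 :* z :- # 1 := # 2 :* ((z :- # 1) :- :- d) :+ (# 1 :- # 2 :* d)) refl

      -- ρ^b is at most δ α^a and α^ν at most 16 ρ^E, so b q can exceed E only by what 16 δ^q
      -- allows.
      r^o⁻≤ : r ^ o⁻ ≤ 2^ 4 * δ ^ q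
      r^o⁻≤ = go (ℕₚ.≤-total E (b ℕ.* q))
        where
        go : E ℕ.≤ b ℕ.* q ⊎ b ℕ.* q ℕ.≤ E → r ^ o⁻ ≤ 2^ 4 * δ ^ q
        go (inj₂ le) = ≤-trans (≤-reflexive (cong (r ^_) (ℕₚ.m≤n⇒m∸n≡0 le))) (≤-trans (≤-reflexive (sym (*-identityˡ 1#))) (*-mono-≤ 0≤1 (^-nonneg 0≤δ q) (1≤2^ 4) (1≤^ 1≤δ q)))
        go (inj₁ le) = subst₂ _≤_ (cancel (r ^ o⁻)) (trans (cong (r⁻¹ ^ E *_) (alg (2^ 4) (r ^ E) (δ ^ q))) (cancel (2^ 4 * δ ^ q)))
            (*-monoʳ-≤ (^-nonneg (inv-pos (suc p)) E) bound)
          where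
          alg = solve 3 (λ c e d → d :* (c :* e) := e :* (c :* d)) refl
          cancel : ∀ x → r⁻¹ ^ E * (r ^ E * x) ≡ x
          cancel x = trans (sym (*-assoc _ _ _)) (trans (cong (_* x) (trans (*-comm _ _) (r^*r⁻^ E))) (*-identityˡ _))
          bound : r ^ E * r ^ o⁻ ≤ δ ^ q * (2^ 4 * r ^ E)
          bound = ≤-trans (≤-reflexive (trans (sym (^-+ r E o⁻)) (trans (cong (r ^_) (ℕₚ.m+[n∸m]≡n le)) (^-* r b q))))
            (≤-trans (^-mono-≤ (0≤r^ b) r^b≤ q) (≤-trans (≤-reflexive (trans (*-^ δ (α ^ a) q) (cong (δ ^ q *_) (sym (^-* α a q)))))
            (*-monoʳ-≤ (^-nonneg 0≤δ q) (≤-trans (^-monoʳ-≤ 1≤α (ℕₚ.≤-trans (ℕₚ.≤-reflexive (ℕₚ.*-comm a q)) (ℕₚ.≤-trans (ℕₚ.m≤n+m (q ℕ.* a) r₀) (ℕₚ.≤-reflexive (sym ν≡))))) α^ν≤))))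

      α^≤2^ : ∀ i → α ^ i ≤ 2^ i
      α^≤2^ = ^-mono-≤ 0≤α α≤2

      Dw≤ : Dw ≤ 2^ (a ℕ.+ (4 ℕ.+ suc g)) * δ ^ q
      Dw≤ = ≤-trans (*-mono-≤ (*-nonneg (^-nonneg 0≤α r₀) (0≤r^ o⁻)) (0≤2^ (suc g)) (*-mono-≤ (^-nonneg 0≤α r₀) (*-nonneg (0≤2^ 4) (^-nonneg 0≤δ q)) (≤-trans (α^≤2^ r₀) (2^-mono-≤ r₀≤a)) r^o⁻≤)
          (≤-trans (ι-mono-≤ (ℕₚ.n≤1+n (suc p))) (ι≤2^ {ρ} {suc g} ρ≤)))
        (≤-reflexive (trans (alg (2^ a) (2^ 4) (δ ^ q) (2^ suc g)) (cong (_* δ ^ q) (trans (cong (2^ a *_) (sym (^-+ (ι 2) 4 (suc g)))) (sym (^-+ (ι 2) a (4 ℕ.+ suc g)))))))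
        where
        alg = solve 4 (λ x c d g → x :* (c :* d) :* g := x :* (c :* g) :* d) refl

      δ^≤ : ∀ i → i ℕ.≤ 2 ℕ.^ 60 ℕ.* κ → δ ^ i ≤ 2^ κ
      δ^≤ i i≤ = growth 60 κ 0≤δ ≤-refl i≤

      0≤Dw : 0# ≤ Dw
      0≤Dw = *-nonneg (*-nonneg (^-nonneg 0≤α r₀) (0≤r^ o⁻)) (0≤ι (suc p))

      Den≤ : Dw ^ S * (r ^ b) ^ n₁ ≤ 2^ Q
      Den≤ = ≤-trans (*-mono-≤ (^-nonneg 0≤Dw S) (0≤2^ (κ ℕ.+ a ℕ.* n₁)) left right) (≤-reflexive (sym (^-+ (ι 2) (B ℕ.* S ℕ.+ κ) (κ ℕ.+ a ℕ.* n₁))))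
        where
        B = a ℕ.+ (4 ℕ.+ suc g)
        left : Dw ^ S ≤ 2^ (B ℕ.* S ℕ.+ κ)
        left = ≤-trans (^-mono-≤ 0≤Dw Dw≤ S) (≤-trans (≤-reflexive (trans (*-^ (2^ B) (δ ^ q) S) (cong₂ _*_ (sym (^-* (ι 2) B S)) (trans (sym (^-* δ q S)) (cong (δ ^_) (ℕₚ.*-comm q S))))))
          (≤-trans (*-monoʳ-≤ (0≤2^ (B ℕ.* S)) (δ^≤ (S ℕ.* q) Sq≤')) (≤-reflexive (sym (^-+ (ι 2) (B ℕ.* S) κ)))))
        right : (r ^ b) ^ n₁ ≤ 2^ (κ ℕ.+ a ℕ.* n₁)
        right = ≤-trans (^-mono-≤ (0≤r^ b) r^b≤ n₁) (≤-trans (≤-reflexive (*-^ δ (α ^ a) n₁)) (≤-trans (*-mono-≤ (^-nonneg 0≤δ n₁) (0≤2^ (a ℕ.* n₁)) (δ^≤ n₁ n₁≤') (≤-trans (≤-reflexive (sym (^-* α a n₁))) (α^≤2^ (a ℕ.* n₁))))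
          (≤-reflexive (sym (^-+ (ι 2) κ (a ℕ.* n₁))))))

      impossible : ⊥
      impossible = Endgame.Refute.contradiction-reached 𝓚 K κ K≡ 1≤κ u u-near u^≢1 w ζ q S n₀ Q refl
        (subst (λ t → Bd (ζ - 1#) (½ ^ t)) Z≡ ζ-near) u≢0 w≢0 (r ^ b) (α ^ a) Dw Nw
        (NatCoords-^ (NatCoords-ι ρ) b) (NatCoords-^ NatCoords-α a)
        (NatCoords-* (NatCoords-* (NatCoords-^ NatCoords-α r₀) (NatCoords-^ (NatCoords-ι ρ) o⁻)) (NatCoords-ι (suc p)))
        (NatCoords-* (NatCoords-^ (NatCoords-ι ρ) o⁺) (NatCoords-* (NatCoords-ι d₁) (NatCoords-+ (NatCoords-ι 3) (NatCoords-* NatCoords-α NatCoords-α))))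
        u*Du w*Dw (nonzero-^ {r} r≢0 b) (nonzero-* {α ^ r₀ * r ^ o⁻} {P} (nonzero-* {α ^ r₀} {r ^ o⁻} (nonzero-^ {α} α≢0 r₀) (nonzero-^ {r} r≢0 o⁻)) (unit-nonzero {P} {P⁻¹} (inv-spec p)))
        n≤q enough Sq≤ 7S≤κ Den≤ Λ≤

-- Choice of the parameters and refutation of large n.

-- the arithmetic behind the choice κ ≈ ν/2^20, K = 1024κ, S = 512a, q = ⌊ν/a⌋, n₀ ≈ K/(4a)
module Numbers (g a κ ν c : ℕ) (1≤g : 1 ℕ.≤ g) (1≤a : 1 ℕ.≤ a) (a≤ : a ℕ.≤ c ℕ.* g) (c≥ : 4096 ℕ.≤ c)
  (ν≤ : ν ℕ.≤ 1048576 ℕ.* κ) (κ≤ : 1048576 ℕ.* κ ℕ.≤ ν ℕ.+ 1048576) (c²g²≤ : 64 ℕ.* (c ℕ.* c) ℕ.* (g ℕ.* g) ℕ.≤ κ) where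

  K S q n₀ : ℕ
  K = 1024 ℕ.* κ
  S = 512 ℕ.* a

  instance
    a≢0 : ℕ.NonZero a
    a≢0 = ℕ.>-nonZero 1≤a
    4a≢0 : ℕ.NonZero (4 ℕ.* a)
    4a≢0 = ℕₚ.m*n≢0 4 a

  q = ν DM./ a
  n₀ = suc (K DM./ (4 ℕ.* a))

  -- The quadratic condition behind the lower limit for n: the denominator of w contains α^r₀ with
  -- r₀ ≤ a and is raised to the power S = 512 a.
  a²≤ : 512 ℕ.* (a ℕ.* a) ℕ.≤ 8 ℕ.* κ
  a²≤ = ℕₚ.≤-trans (ℕₚ.*-monoʳ-≤ 512 (ℕₚ.*-mono-≤ a≤ a≤)) (ℕₚ.≤-trans (ℕₚ.≤-reflexive (lem c g)) (ℕₚ.*-monoʳ-≤ 8 c²g²≤))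
    where
    lem : ∀ c g → 512 ℕ.* (c ℕ.* g ℕ.* (c ℕ.* g)) ≡ 8 ℕ.* (64 ℕ.* (c ℕ.* c) ℕ.* (g ℕ.* g))
    lem = solve-∀

  ga≤ : 3600 ℕ.* (g ℕ.* a) ℕ.≤ κ
  ga≤ = ℕₚ.≤-trans (ℕₚ.*-mono-≤ (ℕₚ.≤ᵇ⇒≤ 3600 (64 ℕ.* 4096) _) (ℕₚ.*-monoʳ-≤ g a≤)) (ℕₚ.≤-trans (ℕₚ.*-monoˡ-≤ (g ℕ.* (c ℕ.* g)) (ℕₚ.*-monoʳ-≤ 64 c≥))
      (ℕₚ.≤-trans (ℕₚ.≤-reflexive (lem c g)) c²g²≤))
    where
    lem : ∀ c g → 64 ℕ.* c ℕ.* (g ℕ.* (c ℕ.* g)) ≡ 64 ℕ.* (c ℕ.* c) ℕ.* (g ℕ.* g)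
    lem = solve-∀

  a≤ga : a ℕ.≤ g ℕ.* a
  a≤ga = ℕₚ.m≤n*m a g {{ℕ.>-nonZero 1≤g}}

  g≤ga : g ℕ.≤ g ℕ.* a
  g≤ga = ℕₚ.m≤m*n g a

  1≤ga : 1 ℕ.≤ g ℕ.* a
  1≤ga = ℕₚ.≤-trans 1≤g g≤ga

  κ≥ : 3600 ℕ.≤ κ
  κ≥ = ℕₚ.≤-trans (ℕₚ.*-monoʳ-≤ 3600 1≤ga) ga≤

  1≤κ : 1 ℕ.≤ κ
  1≤κ = ℕₚ.≤-trans (s≤s z≤n) κ≥

  7S≤κ : 7 ℕ.* S ℕ.≤ κ
  7S≤κ = ℕₚ.≤-trans (linear {3584 ℕ.* a} {3584 ℕ.* (g ℕ.* a)} (16 ℕ.* (g ℕ.* a)) (ℕₚ.*-monoʳ-≤ 3584 a≤ga) (lem a (g ℕ.* a))) ga≤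
    where
    lem : ∀ a x → 7 ℕ.* (512 ℕ.* a) ℕ.+ 3584 ℕ.* x ℕ.+ 16 ℕ.* x ≡ 3600 ℕ.* x ℕ.+ 3584 ℕ.* a
    lem = solve-∀

  small≤κ : (g ℕ.+ 5) ℕ.* S ℕ.+ 8 ℕ.* a ℕ.≤ κ
  small≤κ = ℕₚ.≤-trans (linear {2568 ℕ.* a} {2568 ℕ.* (g ℕ.* a)} (520 ℕ.* (g ℕ.* a)) (ℕₚ.*-monoʳ-≤ 2568 a≤ga) (lem g a)) ga≤
    where
    lem : ∀ g a → (g ℕ.+ 5) ℕ.* (512 ℕ.* a) ℕ.+ 8 ℕ.* a ℕ.+ 2568 ℕ.* (g ℕ.* a) ℕ.+ 520 ℕ.* (g ℕ.* a) ≡ 3600 ℕ.* (g ℕ.* a) ℕ.+ 2568 ℕ.* a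
    lem = solve-∀

  4n₁a≤ : 4 ℕ.* (a ℕ.* (n₀ ℕ.+ 7)) ℕ.≤ K ℕ.+ 32 ℕ.* a
  4n₁a≤ = ℕₚ.≤-trans (ℕₚ.≤-reflexive (lem a (K DM./ (4 ℕ.* a)))) (ℕₚ.+-monoˡ-≤ (32 ℕ.* a) (DM.m/n*n≤m K (4 ℕ.* a)))
    where
    lem : ∀ a x → 4 ℕ.* (a ℕ.* (suc x ℕ.+ 7)) ≡ x ℕ.* (4 ℕ.* a) ℕ.+ 32 ℕ.* a
    lem = solve-∀

  n₁a≤ : a ℕ.* (n₀ ℕ.+ 7) ℕ.≤ 256 ℕ.* κ ℕ.+ 8 ℕ.* a
  n₁a≤ = ℕₚ.*-cancelˡ-≤ 4 (ℕₚ.≤-trans 4n₁a≤ (ℕₚ.≤-reflexive (lem κ a)))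
    where
    lem : ∀ κ a → 1024 ℕ.* κ ℕ.+ 32 ℕ.* a ≡ 4 ℕ.* (256 ℕ.* κ ℕ.+ 8 ℕ.* a)
    lem = solve-∀

  n₁a≤ν : (n₀ ℕ.+ 7) ℕ.* a ℕ.≤ ν
  n₁a≤ν = ℕₚ.≤-trans (ℕₚ.≤-reflexive (ℕₚ.*-comm (n₀ ℕ.+ 7) a)) (ℕₚ.≤-trans n₁a≤ (linear (1044719 ℕ.* κ ℕ.+ 512 ℕ.* a ℕ.* (g ℕ.+ 5) ℕ.+ 11911424)
      (ℕₚ.+-mono-≤ (ℕₚ.+-mono-≤ κ≤ small≤κ) (ℕₚ.*-monoʳ-≤ 3600 κ≥)) (lem κ a g ν)))
    where
    lem : ∀ κ a g ν → 256 ℕ.* κ ℕ.+ 8 ℕ.* a ℕ.+ (ν ℕ.+ 1048576 ℕ.+ κ ℕ.+ 3600 ℕ.* κ) ℕ.+ (1044719 ℕ.* κ ℕ.+ 512 ℕ.* a ℕ.* (g ℕ.+ 5) ℕ.+ 11911424)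
      ≡ ν ℕ.+ (1048576 ℕ.* κ ℕ.+ ((g ℕ.+ 5) ℕ.* (512 ℕ.* a) ℕ.+ 8 ℕ.* a) ℕ.+ 3600 ℕ.* 3600)
    lem = solve-∀

  n≤q : n₀ ℕ.+ 7 ℕ.≤ q
  n≤q = ℕₚ.≤-trans (ℕₚ.≤-reflexive (sym (DM.m*n/n≡m (n₀ ℕ.+ 7) a))) (DM./-monoˡ-≤ a n₁a≤ν)

  enough : 2 ℕ.^ 7 ℕ.* K ℕ.≤ n₀ ℕ.* S
  enough = ℕₚ.≤-trans (ℕₚ.*-monoʳ-≤ 128 (ℕₚ.<⇒≤ K<)) (ℕₚ.≤-reflexive (lem n₀ a))
    where
    K< : K ℕ.< n₀ ℕ.* (4 ℕ.* a)
    K< = ℕₚ.≤-<-trans (ℕₚ.≤-reflexive (DM.m≡m%n+[m/n]*n K (4 ℕ.* a))) (ℕₚ.+-monoˡ-< (K DM./ (4 ℕ.* a) ℕ.* (4 ℕ.* a)) (DM.m%n<n K (4 ℕ.* a)))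
    lem : ∀ x a → 128 ℕ.* (x ℕ.* (4 ℕ.* a)) ≡ x ℕ.* (512 ℕ.* a)
    lem = solve-∀

  aq≤ν : a ℕ.* q ℕ.≤ ν
  aq≤ν = ℕₚ.≤-trans (ℕₚ.≤-reflexive (ℕₚ.*-comm a q)) (DM.m/n*n≤m ν a)

  Sq≤512ν : S ℕ.* q ℕ.≤ 512 ℕ.* ν
  Sq≤512ν = ℕₚ.≤-trans (ℕₚ.≤-reflexive (ℕₚ.*-assoc 512 a q)) (ℕₚ.*-monoʳ-≤ 512 aq≤ν)

  Sq≤2^29κ : S ℕ.* q ℕ.≤ 536870912 ℕ.* κ
  Sq≤2^29κ = ℕₚ.≤-trans Sq≤512ν (ℕₚ.≤-trans (ℕₚ.*-monoʳ-≤ 512 ν≤) (ℕₚ.≤-reflexive (sym (ℕₚ.*-assoc 512 1048576 κ))))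

  Sq≤ : S ℕ.* q ℕ.≤ 2 ℕ.^ 19 ℕ.* K
  Sq≤ = ℕₚ.≤-trans Sq≤2^29κ (ℕₚ.≤-reflexive (ℕₚ.*-assoc (2 ℕ.^ 19) 1024 κ))

  Sq≤' : S ℕ.* q ℕ.≤ 2 ℕ.^ 60 ℕ.* κ
  Sq≤' = ℕₚ.≤-trans Sq≤2^29κ (ℕₚ.*-monoˡ-≤ κ (ℕₚ.≤ᵇ⇒≤ 536870912 (2 ℕ.^ 60) _))

  n₁≤' : n₀ ℕ.+ 7 ℕ.≤ 2 ℕ.^ 60 ℕ.* κ
  n₁≤' = ℕₚ.≤-trans n≤q (ℕₚ.≤-trans (DM.m/n≤m ν a) (ℕₚ.≤-trans ν≤ (ℕₚ.*-monoˡ-≤ κ (ℕₚ.≤ᵇ⇒≤ 1048576 (2 ℕ.^ 60) _))))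

  -- In units of κ the four contributions are 8, 1, 256 and 4; 7 · 269 = 1883 stays below 2048.
  Λ≤ : 7 ℕ.* ((a ℕ.+ (4 ℕ.+ suc g)) ℕ.* S ℕ.+ κ ℕ.+ (κ ℕ.+ a ℕ.* (n₀ ℕ.+ 7)) ℕ.+ 2 ℕ.* κ) ℕ.≤ 2 ℕ.* K
  Λ≤ = linear {512 ℕ.* (a ℕ.* a) ℕ.* 7 ℕ.+ ((g ℕ.+ 5) ℕ.* S ℕ.+ 8 ℕ.* a) ℕ.* 7 ℕ.+ a ℕ.* (n₀ ℕ.+ 7) ℕ.* 7} {8 ℕ.* κ ℕ.* 7 ℕ.+ κ ℕ.* 7 ℕ.+ (256 ℕ.* κ ℕ.+ 8 ℕ.* a) ℕ.* 7}
      (165 ℕ.* κ) (ℕₚ.+-mono-≤ (ℕₚ.+-mono-≤ (ℕₚ.*-monoˡ-≤ 7 a²≤) (ℕₚ.*-monoˡ-≤ 7 small≤κ)) (ℕₚ.*-monoˡ-≤ 7 n₁a≤)) (lem a g κ (n₀ ℕ.+ 7))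
    where
    lem : ∀ a g κ n → 7 ℕ.* ((a ℕ.+ (4 ℕ.+ suc g)) ℕ.* (512 ℕ.* a) ℕ.+ κ ℕ.+ (κ ℕ.+ a ℕ.* n) ℕ.+ 2 ℕ.* κ) ℕ.+ (8 ℕ.* κ ℕ.* 7 ℕ.+ κ ℕ.* 7 ℕ.+ (256 ℕ.* κ ℕ.+ 8 ℕ.* a) ℕ.* 7) ℕ.+ 165 ℕ.* κ
      ≡ 2 ℕ.* (1024 ℕ.* κ) ℕ.+ (512 ℕ.* (a ℕ.* a) ℕ.* 7 ℕ.+ ((g ℕ.+ 5) ℕ.* (512 ℕ.* a) ℕ.+ 8 ℕ.* a) ℕ.* 7 ℕ.+ a ℕ.* n ℕ.* 7)
    lem = solve-∀

  module WithN (n : ℕ) (ν≡ : ν ≡ 2 ℕ.+ n) where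

    κ≤n : 1048576 ℕ.* κ ℕ.≤ 2 ℕ.+ n ℕ.+ 1048576
    κ≤n = subst (λ t → 1048576 ℕ.* κ ℕ.≤ t ℕ.+ 1048576) ν≡ κ≤

    -- 6 · 110 · 1024 = 675840 is well below 2^20, the approximate ratio of n to κ.
    n-large : 6 ℕ.* (110 ℕ.* K ℕ.+ 5) ℕ.≤ n
    n-large = linear (372436 ℕ.* κ ℕ.+ 31392) (ℕₚ.+-mono-≤ κ≤n (ℕₚ.*-monoʳ-≤ 300 κ≥)) (lem κ n)
      where
      lem : ∀ κ n → 6 ℕ.* (110 ℕ.* (1024 ℕ.* κ) ℕ.+ 5) ℕ.+ (2 ℕ.+ n ℕ.+ 1048576 ℕ.+ 300 ℕ.* κ) ℕ.+ (372436 ℕ.* κ ℕ.+ 31392)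
        ≡ n ℕ.+ (1048576 ℕ.* κ ℕ.+ 300 ℕ.* 3600)
      lem = solve-∀

    -- 3 · 110 · 1024 = 337920 against 5 · 2^20 / 12, about 436906, in units of κ.
    bits : ∀ i → n ℕ.≤ 12 ℕ.* i ℕ.+ 12 → 3 ℕ.* (110 ℕ.* K ℕ.+ 4) ℕ.+ (1 ℕ.+ 3 ℕ.* suc g) ℕ.≤ 5 ℕ.* i
    bits i n≤ = ℕₚ.*-cancelˡ-≤ 12 (linear (1185839 ℕ.* κ ℕ.+ 3564 ℕ.* g ℕ.+ 1956858)
        (ℕₚ.+-mono-≤ (ℕₚ.+-mono-≤ (ℕₚ.*-monoʳ-≤ 5 n≤) (ℕₚ.*-monoʳ-≤ 5 κ≤n)) (ℕₚ.+-mono-≤ (ℕₚ.≤-trans (ℕₚ.*-monoʳ-≤ 3600 g≤ga) ga≤) (ℕₚ.*-monoʳ-≤ 2000 κ≥))) (lem κ n i g))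
      where
      lem : ∀ κ n i g → 12 ℕ.* (3 ℕ.* (110 ℕ.* (1024 ℕ.* κ) ℕ.+ 4) ℕ.+ (1 ℕ.+ 3 ℕ.* suc g)) ℕ.+ (5 ℕ.* (12 ℕ.* i ℕ.+ 12) ℕ.+ 5 ℕ.* (2 ℕ.+ n ℕ.+ 1048576) ℕ.+ (κ ℕ.+ 2000 ℕ.* κ)) ℕ.+ (1185839 ℕ.* κ ℕ.+ 3564 ℕ.* g ℕ.+ 1956858)
        ≡ 12 ℕ.* (5 ℕ.* i) ℕ.+ (5 ℕ.* n ℕ.+ 5 ℕ.* (1048576 ℕ.* κ) ℕ.+ (3600 ℕ.* g ℕ.+ 2000 ℕ.* 3600))
      lem = solve-∀

module _ (ν W : ℕ) .{{_ : ℕ.NonZero W}} where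

  quotient-upper : ν ℕ.≤ W ℕ.* suc (ν DM./ W)
  quotient-upper = ℕₚ.≤-trans (ℕₚ.≤-reflexive (DM.m≡m%n+[m/n]*n ν W)) (ℕₚ.≤-trans (ℕₚ.+-monoˡ-≤ (ν DM./ W ℕ.* W) (ℕₚ.<⇒≤ (DM.m%n<n ν W)))
    (ℕₚ.≤-reflexive (ℕₚ.*-comm (suc (ν DM./ W)) W)))

  quotient-lower : W ℕ.* suc (ν DM./ W) ℕ.≤ ν ℕ.+ W
  quotient-lower = ℕₚ.≤-trans (ℕₚ.≤-reflexive (trans (ℕₚ.*-comm W (suc (ν DM./ W))) (ℕₚ.+-comm W (ν DM./ W ℕ.* W)))) (ℕₚ.+-monoˡ-≤ W (DM.m/n*n≤m ν W))

  quotient-large : ∀ X → W ℕ.* X ℕ.≤ ν → X ℕ.≤ suc (ν DM./ W)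
  quotient-large X le = ℕₚ.≤-trans (ℕₚ.≤-reflexive (sym (DM.m*n/n≡m X W))) (ℕₚ.≤-trans (DM./-monoˡ-≤ W (ℕₚ.≤-trans (ℕₚ.≤-reflexive (ℕₚ.*-comm X W)) le)) (ℕₚ.n≤1+n _))

Narayana-bits : ∀ i → 2 ℕ.^ (5 ℕ.* i) ℕ.≤ Narayana (suc (12 ℕ.* i))
Narayana-bits i = ℕₚ.≤-trans (ℕₚ.≤-reflexive (sym (ℕₚ.^-*-assoc 2 5 i))) (ℕₚ.≤-trans (ℕₚ.^-monoˡ-≤ i (ℕₚ.≤ᵇ⇒≤ 32 36 _)) (Narayana-12 i))

module Core (𝓚 : CubicField) (p g n d₁ d₂ d₃ ℓ m k c : ℕ) (1≤g : 1 ℕ.≤ g) (ρ≤ : suc (suc p) ℕ.≤ 2 ℕ.^ suc g)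
  (c≥ : 4096 ℕ.≤ c) (T≤ : 2 ℕ.^ 63 ℕ.* suc g ℕ.≤ c ℕ.* g) (n≥ : 1048576 ℕ.* (64 ℕ.* (c ℕ.* c) ℕ.* (g ℕ.* g)) ℕ.≤ n)
  (1≤k : 1 ℕ.≤ k) (k≤m : k ℕ.≤ m) (m≤ℓ : m ℕ.≤ ℓ) (d₁< : d₁ ℕ.< suc (suc p)) (d₂< : d₂ ℕ.< suc (suc p)) (d₃< : d₃ ℕ.< suc (suc p)) (0<d₁ : 0 ℕ.< d₁)
  (eq : Narayana n ≡ d₁ ℕ.* repunit (suc (suc p)) ℓ ℕ.* suc (suc p) ℕ.^ (m ℕ.+ k) ℕ.+ d₂ ℕ.* repunit (suc (suc p)) m ℕ.* suc (suc p) ℕ.^ k ℕ.+ d₃ ℕ.* repunit (suc (suc p)) k) where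

  open Equation 𝓚 p n d₁ d₂ d₃ ℓ m k
  open Solution 1≤k k≤m m≤ℓ d₁< d₂< d₃< 0<d₁ eq
  open Arithmetic 𝓚 using (R; Bd; α; ½; _^_; _*_; _-_; ι)

  X : ℕ
  X = 64 ℕ.* (c ℕ.* c) ℕ.* (g ℕ.* g)

  ℓ-pred : ∃[ j ] suc j ≡ ℓ
  ℓ-pred = ℕ.pred ℓ , ℕₚ.suc-pred ℓ {{ℕ.>-nonZero (ℕₚ.≤-trans 1≤k (ℕₚ.≤-trans k≤m m≤ℓ))}}

  -- With m and k at most ℓ = j + 1, N n is at most 2 ρ^(3 j + 3), while it has at least 5 i bits.
  -- Comparing cubes avoids fractional exponents.
  ρ^j-large : ∀ j Z i → suc j ≡ ℓ → suc (12 ℕ.* i) ℕ.≤ n → 3 ℕ.* Z ℕ.+ (1 ℕ.+ 3 ℕ.* suc g) ℕ.≤ 5 ℕ.* i → 2 ℕ.^ Z ℕ.≤ ρ ℕ.^ j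
  ρ^j-large j Z i ℓ≡ i≤ bits = cube-root-≤ (2 ℕ.^ Z) (ρ ℕ.^ j) (ℕₚ.*-cancelʳ-≤ _ _ (2 ℕ.^ (1 ℕ.+ 3 ℕ.* suc g)) {{ℕₚ.m^n≢0 2 (1 ℕ.+ 3 ℕ.* suc g)}} (begin
      (2 ℕ.^ Z) ℕ.^ 3 ℕ.* 2 ℕ.^ (1 ℕ.+ 3 ℕ.* suc g)   ≡⟨ cong (ℕ._* 2 ℕ.^ (1 ℕ.+ 3 ℕ.* suc g)) (trans (ℕₚ.^-*-assoc 2 Z 3) (cong (2 ℕ.^_) (ℕₚ.*-comm Z 3))) ⟩
      2 ℕ.^ (3 ℕ.* Z) ℕ.* 2 ℕ.^ (1 ℕ.+ 3 ℕ.* suc g)   ≡⟨ sym (ℕₚ.^-distribˡ-+-* 2 (3 ℕ.* Z) (1 ℕ.+ 3 ℕ.* suc g)) ⟩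
      2 ℕ.^ (3 ℕ.* Z ℕ.+ (1 ℕ.+ 3 ℕ.* suc g))         ≤⟨ ℕₚ.^-monoʳ-≤ 2 bits ⟩
      2 ℕ.^ (5 ℕ.* i)                                 ≤⟨ Narayana-bits i ⟩
      Narayana (suc (12 ℕ.* i))                       ≤⟨ Narayana-mono-≤ i≤ ⟩
      Narayana n                                      ≤⟨ N≤2r^E ⟩
      2 ℕ.* ρ ℕ.^ E                                   ≤⟨ ℕₚ.*-monoʳ-≤ 2 (ℕₚ.^-monoʳ-≤ ρ E≤) ⟩
      2 ℕ.* ρ ℕ.^ (j ℕ.* 3 ℕ.+ 3)                     ≡⟨ cong (2 ℕ.*_) (ℕₚ.^-distribˡ-+-* ρ (j ℕ.* 3) 3) ⟩
      2 ℕ.* (ρ ℕ.^ (j ℕ.* 3) ℕ.* ρ ℕ.^ 3)             ≤⟨ ℕₚ.*-monoʳ-≤ 2 (ℕₚ.*-monoʳ-≤ (ρ ℕ.^ (j ℕ.* 3)) (ℕₚ.≤-trans (ℕₚ.^-monoˡ-≤ 3 ρ≤) (ℕₚ.≤-reflexive (trans (ℕₚ.^-*-assoc 2 (suc g) 3) (cong (2 ℕ.^_) (ℕₚ.*-comm (suc g) 3)))))) ⟩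
      2 ℕ.* (ρ ℕ.^ (j ℕ.* 3) ℕ.* 2 ℕ.^ (3 ℕ.* suc g)) ≡⟨ trans (swap (ρ ℕ.^ (j ℕ.* 3)) (2 ℕ.^ (3 ℕ.* suc g))) (cong₂ ℕ._*_ (sym (ℕₚ.^-*-assoc ρ j 3)) refl) ⟩
      (ρ ℕ.^ j) ℕ.^ 3 ℕ.* 2 ℕ.^ (1 ℕ.+ 3 ℕ.* suc g)   ∎))
    where
    open ℕₚ.≤-Reasoning
    swap : ∀ x y → 2 ℕ.* (x ℕ.* y) ≡ x ℕ.* (2 ℕ.* y)
    swap = solve-∀
    E≤ : E ℕ.≤ j ℕ.* 3 ℕ.+ 3
    E≤ = ℕₚ.≤-trans (ℕₚ.+-monoʳ-≤ ℓ (ℕₚ.+-mono-≤ m≤ℓ (ℕₚ.≤-trans k≤m m≤ℓ))) (ℕₚ.≤-reflexive (trans (cong (λ t → t ℕ.+ (t ℕ.+ t)) (sym ℓ≡)) (lem j)))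
      where
      lem : ∀ j → suc j ℕ.+ (suc j ℕ.+ suc j) ≡ j ℕ.* 3 ℕ.+ 3
      lem = solve-∀

  refute : ∀ κ → ν ℕ.≤ 1048576 ℕ.* κ → 1048576 ℕ.* κ ℕ.≤ ν ℕ.+ 1048576 → X ℕ.≤ κ → ∃[ a ] ∃[ b ] (1 ℕ.≤ a × a ℕ.≤ 2 ℕ.^ 63 ℕ.* suc g × Bd (α ^ a - r ^ b) (½ ^ 62 * r ^ b)) → ∃[ j ] suc j ≡ ℓ → ⊥
  refute κ ν≤ κ≤ X≤κ (a , b , 1≤a , a≤ , near) (j , ℓ≡) = Parameters.impossible Z ζ-near' K κ refl 1≤κ Z≡ g ρ≤ a b 1≤a near
      q (ν DM.% a) (DM.m≡m%n+[m/n]*n ν a) (ℕₚ.<⇒≤ (DM.m%n<n ν a)) S n₀ n≤q enough Sq≤ 7S≤κ Sq≤' n₁≤' Λ≤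
    where
    open Numbers g a κ ν c 1≤g 1≤a (ℕₚ.≤-trans a≤ T≤) c≥ ν≤ κ≤ X≤κ
    open WithN n refl
    1≤110K : 1 ℕ.≤ 110 ℕ.* K
    1≤110K = ℕₚ.*-mono-≤ {1} {110} {1} {K} (s≤s z≤n) (ℕₚ.*-mono-≤ {1} {1024} {1} {κ} (s≤s z≤n) 1≤κ)
    Z : ℕ
    Z = ℕ.pred (110 ℕ.* K)
    Z≡ : suc Z ≡ 110 ℕ.* K
    Z≡ = ℕₚ.suc-pred (110 ℕ.* K) {{ℕ.>-nonZero 1≤110K}}
    i : ℕ
    i = ℕ.pred n DM./ 12
    1≤n : 1 ℕ.≤ n
    1≤n = ℕₚ.≤-trans (ℕₚ.≤-trans (ℕₚ.≤-trans 1≤110K (ℕₚ.m≤m+n (110 ℕ.* K) 5)) (ℕₚ.m≤n*m (110 ℕ.* K ℕ.+ 5) 6)) n-large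
    n≡ : suc (ℕ.pred n) ≡ n
    n≡ = ℕₚ.suc-pred n {{ℕ.>-nonZero 1≤n}}
    i≤ : suc (12 ℕ.* i) ℕ.≤ n
    i≤ = ℕₚ.≤-trans (s≤s (ℕₚ.≤-trans (ℕₚ.≤-reflexive (ℕₚ.*-comm 12 i)) (DM.m/n*n≤m (ℕ.pred n) 12))) (ℕₚ.≤-reflexive n≡)
    n≤ : n ℕ.≤ 12 ℕ.* i ℕ.+ 12
    n≤ = ℕₚ.≤-trans (ℕₚ.≤-reflexive (sym n≡)) (ℕₚ.≤-trans (s≤s (ℕₚ.≤-reflexive (DM.m≡m%n+[m/n]*n (ℕ.pred n) 12)))
      (ℕₚ.≤-trans (ℕₚ.+-monoˡ-≤ (i ℕ.* 12) (DM.m%n<n (ℕ.pred n) 12)) (ℕₚ.≤-reflexive (trans (ℕₚ.+-comm 12 (i ℕ.* 12)) (cong (ℕ._+ 12) (ℕₚ.*-comm i 12))))))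
    ζ-near' : Bd (ζ - ι 1) (½ ^ suc Z)
    ζ-near' = subst (λ t → Bd (ζ - ι 1) (½ ^ t)) (sym Z≡) (Near.ζ-near (110 ℕ.* K) j n-large ℓ≡ (ρ^j-large j (110 ℕ.* K ℕ.+ 4) i ℓ≡ i≤ (bits i n≤)))

  module Conclude (W : ℕ) .{{_ : ℕ.NonZero W}} (W≡ : W ≡ 1048576) where

    contradictory : ⊥
    contradictory = refute κ (subst (λ t → ν ℕ.≤ t ℕ.* κ) W≡ (quotient-upper ν W)) (subst (λ t → t ℕ.* κ ℕ.≤ ν ℕ.+ t) W≡ (quotient-lower ν W))
        (quotient-large ν W X (subst (λ t → t ℕ.* X ℕ.≤ ν) (sym W≡) (ℕₚ.≤-trans n≥ (ℕₚ.m≤n+m n 2))))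
        -- The value 62 is the closeness of u to 1 required by the auxiliary function; it costs a ≤
        -- 2^63 (g + 1).
        (Dirichlet.Cells.dirichlet 𝓚 62 g (suc (suc p)) (s≤s (s≤s z≤n)) ρ≤) ℓ-pred
      where
      κ : ℕ
      κ = suc (ν DM./ W)

-- A rational lower bound for the logarithm.

module Exponential (𝓡 : OrderedRing) where
  open OrderedRingProperties 𝓡

  term : R → ℕ → R
  term x zero    = 1#
  term x (suc i) = term x i * x * inv i

  partial : R → ℕ → R
  partial x zero    = 0#
  partial x (suc N) = partial x N + term x N

  y : R
  y = inv 3

  0≤y : 0# ≤ y
  0≤y = inv-pos 3

  -- the coefficients of (1 - y z)^(-M)
  negbin : ℕ → ℕ → R
  negbin M       zero    = 1#
  negbin zero    (suc i) = 0#
  negbin (suc M) (suc i) = negbin M (suc i) + y * negbin (suc M) i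

  0≤negbin : ∀ M i → 0# ≤ negbin M i
  0≤negbin M       zero    = 0≤1
  0≤negbin zero    (suc i) = ≤-refl
  0≤negbin (suc M) (suc i) = +-nonneg (0≤negbin M (suc i)) (*-nonneg 0≤y (0≤negbin (suc M) i))

  -- Consecutive coefficients have ratio y (M + i) / (i + 1), which is at least M y / (i + 1), the
  -- ratio of the exponential series at M y.
  negbin-ratio : ∀ M i → ι M * y * negbin M i ≤ ι (suc i) * negbin M (suc i)
  negbin-ratio zero i = ≤-trans (≤-reflexive (alg y (negbin 0 i))) (*-nonneg (0≤ι (suc i)) (0≤negbin 0 (suc i)))
    where
    alg = solve 2 (λ y b → # 0 :* y :* b := # 0) refl
  negbin-ratio (suc M) zero = ≤-trans (≤-reflexive (trans (cong (λ t → t * y * 1#) (ι-suc M)) (alg (ι M) y))) (≤-trans (+-mono-≤ (negbin-ratio M 0) ≤-refl) (≤-reflexive (alg' (negbin M 1) y)))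
    where
    alg = solve 2 (λ m y → (# 1 :+ m) :* y :* # 1 := m :* y :* # 1 :+ y) refl
    alg' = solve 2 (λ b y → # 1 :* b :+ y := # 1 :* (b :+ y :* # 1)) refl
  negbin-ratio (suc M) (suc i) = ≤-trans (≤-reflexive (cong (λ t → t * y * B) (ι-suc M)))
      (by-diff (+-nonneg (0≤y-x (negbin-ratio M (suc i))) (*-nonneg 0≤y (+-nonneg (0≤y-x (≤-trans (≤-reflexive (cong (λ t → t * y * C) (sym (ι-suc M)))) (negbin-ratio (suc M) i))) (*-nonneg 0≤y (0≤negbin (suc M) i)))))
        (alg (ι M) y s A C D))
    where
    A = negbin M (suc i)
    C = negbin (suc M) i
    B = A + y * C
    D = negbin M (suc (suc i))
    s = ι (suc i)
    alg = solve 6 (λ m y s a c d → (# 1 :+ s) :* (d :+ y :* (a :+ y :* c)) :- (# 1 :+ m) :* y :* (a :+ y :* c) := ((# 1 :+ s) :* d :- m :* y :* a) :+ y :* ((s :* (a :+ y :* c) :- (# 1 :+ m) :* y :* c) :+ y :* c)) refl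

  term≤negbin : ∀ M i → term (ι M * y) i ≤ negbin M i
  term≤negbin M zero    = ≤-refl
  term≤negbin M (suc i) = ≤-trans (*-monoˡ-≤ (inv-pos i) (≤-trans (*-monoˡ-≤ (*-nonneg (0≤ι M) 0≤y) (term≤negbin M i)) (≤-reflexive (*-comm _ _))))
    (≤-trans (*-monoˡ-≤ (inv-pos i) (negbin-ratio M i)) (≤-reflexive (trans (alg (ι (suc i)) (negbin M (suc i)) (inv i)) (trans (cong (_* negbin M (suc i)) (inv-spec i)) (*-identityˡ _)))))
    where
    alg = solve 3 (λ s b i → s :* b :* i := s :* i :* b) refl

  negbins : ℕ → ℕ → R
  negbins M zero    = 0#
  negbins M (suc N) = negbins M N + negbin M N

  partial≤ : ∀ M N → partial (ι M * y) N ≤ negbins M N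
  partial≤ M zero    = ≤-refl
  partial≤ M (suc N) = +-mono-≤ (partial≤ M N) (term≤negbin M N)

  negbins-rec : ∀ M N → negbins (suc M) (suc N) ≡ negbins M (suc N) + y * negbins (suc M) N
  negbins-rec M zero    = alg 1# y
    where
    alg = solve 2 (λ b y → # 0 :+ b := # 0 :+ b :+ y :* # 0) refl
  negbins-rec M (suc N) = trans (cong (_+ negbin (suc M) (suc N)) (negbins-rec M N)) (alg (negbins M (suc N)) y (negbins (suc M) N) (negbin M (suc N)) (negbin (suc M) N))
    where
    alg = solve 5 (λ a y b c d → a :+ y :* b :+ (c :+ y :* d) := a :+ c :+ y :* (b :+ d)) refl

  b : R
  b = ι 4 * inv 2

  0≤b : 0# ≤ b
  0≤b = *-nonneg (0≤ι 4) (inv-pos 2)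

  -- The recursion for partial sums gives (1 - y) times the sum for `suc M` at most the sum for `M`.
  -- As y = 1/4, the factor is b = 4/3.
  negbins-step : ∀ M N → negbins (suc M) N ≤ b * negbins M N
  negbins-step M zero = ≤-reflexive (sym (zeroʳ b))
  negbins-step M (suc N) = ≤-trans (≤-reflexive (trans (trans (sym (*-identityˡ s)) (cong (_* s) (sym one))) (alg (inv 2) y s))) (*-monoʳ-≤ 0≤b main)
    where
    s = negbins (suc M) (suc N)
    one : ι 3 * inv 2 * (ι 4 * y) ≡ 1#
    one = trans (cong₂ _*_ (inv-spec 2) (inv-spec 3)) (*-identityˡ 1#)
    alg = solve 3 (λ i y s → # 3 :* i :* (# 4 :* y) :* s := # 4 :* i :* (# 3 :* y :* s)) refl
    alg₁ = solve 3 (λ a y s → a :- # 3 :* y :* s := (a :+ y :* s) :- # 4 :* y :* s) refl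
    alg₂ = solve 4 (λ a y t u → (a :+ y :* (t :+ u)) :- (a :+ y :* t) := y :* u) refl
    main : ι 3 * y * s ≤ negbins M (suc N)
    main = by-diff (*-nonneg 0≤y (0≤negbin (suc M) N)) (trans (alg₁ (negbins M (suc N)) y s)
      (trans (cong (λ t → (negbins M (suc N) + y * s) - t) (trans (cong (_* s) (inv-spec 3)) (trans (*-identityˡ s) (negbins-rec M N))))
        (alg₂ (negbins M (suc N)) y (negbins (suc M) N) (negbin (suc M) N))))

  negbins≤ : ∀ M N → negbins M N ≤ b ^ M
  negbins≤ zero zero          = 0≤1
  negbins≤ zero (suc zero)    = ≤-reflexive (+-identityˡ 1#)
  negbins≤ zero (suc (suc N)) = ≤-trans (≤-reflexive (+-identityʳ _)) (negbins≤ zero (suc N))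
  negbins≤ (suc M) N = ≤-trans (negbins-step M N) (*-monoʳ-≤ 0≤b (negbins≤ M N))

  -- (4/3)² = 2 · 8/9 falls short of 2 by a factor that leaves room for 1/9, the ε demanded by
  -- `LtLog`.
  eight-ninths : R
  eight-ninths = ι 8 * inv 8

  b² : b ^ 2 ≡ ι 2 * eight-ninths
  b² = trans (alg (inv 2)) (trans (cong (ι 16 *_) inv2²) (alg' (inv 8)))
    where
    alg = solve 1 (λ i → (# 4 :* i) :* ((# 4 :* i) :* # 1) := # 16 :* (i :* i)) refl
    alg' = solve 1 (λ i → # 16 :* i := # 2 :* (# 8 :* i)) refl
    alg'' = solve 2 (λ i j → i :* i :* (# 9 :* j) := (# 3 :* i) :* (# 3 :* i) :* j) refl
    inv2² : inv 2 * inv 2 ≡ inv 8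
    inv2² = trans (sym (*-identityʳ _)) (trans (cong (inv 2 * inv 2 *_) (sym (inv-spec 8))) (trans (alg'' (inv 2) (inv 8))
      (trans (cong (_* inv 8) (trans (cong₂ _*_ (inv-spec 2) (inv-spec 2)) (*-identityˡ 1#))) (*-identityˡ _))))

  nine : ι 8 * inv 8 + inv 8 ≡ 1#
  nine = trans (alg (inv 8)) (inv-spec 8)
    where
    alg = solve 1 (λ i → # 8 :* i :+ i := # 9 :* i) refl

  eight-ninths≤1 : eight-ninths ≤ 1#
  eight-ninths≤1 = ≤-trans (≤-trans (≤-reflexive (sym (+-identityʳ _))) (+-monoʳ-≤ eight-ninths (inv-pos 8))) (≤-reflexive nine)

  -- Σ_{i<N} x^i/i! ≤ (1 - x/M)^(-M) = (4/3)^M for x = M/4, and (4/3)^2 < 2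
  exp-bound : ∀ g N → 1 ℕ.≤ g → partial (ι (2 ℕ.* g) * y) N + inv 8 ≤ ι 2 ^ g
  exp-bound (suc g) N _ = ≤-trans (+-mono-≤ (≤-trans (partial≤ (2 ℕ.* suc g) N) (≤-trans (negbins≤ (2 ℕ.* suc g) N) bound)) inv8≤)
      (≤-reflexive (trans (sym (distribˡ _ _ _)) (trans (cong (ι 2 ^ suc g *_) nine) (*-identityʳ _))))
    where
    inv8≤ : inv 8 ≤ ι 2 ^ suc g * inv 8
    inv8≤ = ≤-trans (≤-reflexive (sym (*-identityˡ _))) (*-monoˡ-≤ (inv-pos 8) (1≤^ (ι-mono-≤ {1} {2} (s≤s z≤n)) (suc g)))
    0≤e : 0# ≤ eight-ninths
    0≤e = *-nonneg (0≤ι 8) (inv-pos 8)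
    bound : b ^ (2 ℕ.* suc g) ≤ ι 2 ^ suc g * eight-ninths
    bound = ≤-trans (≤-reflexive (trans (^-* b 2 (suc g)) (trans (cong (_^ suc g) b²) (*-^ (ι 2) eight-ninths (suc g)))))
      (*-monoʳ-≤ (^-nonneg (0≤ι 2) (suc g)) (≤-trans (*-monoʳ-≤ 0≤e (≤-trans (^-mono-≤ 0≤e eight-ninths≤1 g) (≤-reflexive (1^n g)))) (≤-reflexive (*-identityʳ _))))

module Rationals where
  open Construction using (int; int-+; int-*; int-pos)
  open ℚ-Solver.+-*-Solver using (solve; con; _:+_; _:*_; _:-_; :-_; _:=_)

  1/_ : ℕ → ℚ
  1/ k = (ℤ.+ 1) ℚ./ suc k

  fromℕ-int : ∀ n → fromℕ ℚ._+_ 0ℚ 1ℚ n ≡ int (ℤ.+ n)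
  fromℕ-int zero = refl
  fromℕ-int (suc zero) = refl
  fromℕ-int (suc (suc n)) = trans (cong (1ℚ ℚ.+_) (fromℕ-int (suc n))) (int-+ (ℤ.+ 1) (ℤ.+ suc n))

  1/-spec : ∀ k → fromℕ ℚ._+_ 0ℚ 1ℚ (suc k) ℚ.* 1/ k ≡ 1ℚ
  1/-spec k = trans (cong (ℚ._* 1/ k) (fromℕ-int (suc k))) (ℚₚ.toℚᵘ-injective (ℚᵘₚ.≃-trans (ℚₚ.toℚᵘ-homo-* (int (ℤ.+ suc k)) (1/ k))
    (ℚᵘₚ.≃-trans (ℚᵘₚ.*-cong (ℚₚ.toℚᵘ-fromℚᵘ (ℚᵘ.mkℚᵘ (ℤ.+ suc k) 0)) (ℚₚ.toℚᵘ-fromℚᵘ (ℚᵘ.mkℚᵘ (ℤ.+ 1) k)))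
    (ℚᵘ.*≡* (trans (ℤₚ.*-identityʳ _) (trans (ℤₚ.*-identityʳ (ℤ.+ suc k)) (trans (cong (λ z → ℤ.+ suc z) (sym (ℕₚ.+-identityʳ k))) (sym (ℤₚ.*-identityˡ _)))))))))

  ℚ-orderedRing : OrderedRing
  ℚ-orderedRing = record
    { R = ℚ ; _+_ = ℚ._+_ ; _*_ = ℚ._*_ ; -_ = ℚ.-_ ; 0# = 0ℚ ; 1# = 1ℚ
    ; isCommutativeRing = ℚₚ.+-*-isCommutativeRing
    ; _≤_ = ℚ._≤_ ; ≤-refl = ℚₚ.≤-refl ; ≤-trans = ℚₚ.≤-trans ; +-mono-≤ = ℚₚ.+-mono-≤
    ; *-nonneg = Construction.*-≥0
    ; 0≤1 = ℚₚ.<⇒≤ (ℚₚ.positive⁻¹ 1ℚ)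
    ; inv = 1/_ ; inv-pos = λ k → ℚₚ.<⇒≤ (ℚₚ.positive⁻¹ (1/ k) {{ℚₚ.normalize-pos 1 (suc k)}})
    ; inv-spec = 1/-spec }

  open OrderedRingProperties ℚ-orderedRing using (ι; _^_; ι-^; ι-mono-≤)
  open Exponential ℚ-orderedRing using (term; partial; exp-bound)

  expTerm≡ : ∀ q i → expTerm q i ≡ term q i
  expTerm≡ q zero    = refl
  expTerm≡ q (suc i) = cong (λ t → t ℚ.* q ℚ.* 1/ i) (expTerm≡ q i)

  expPartial≡ : ∀ q N → expPartial q N ≡ partial q N
  expPartial≡ q zero    = refl
  expPartial≡ q (suc N) = cong₂ ℚ._+_ (expPartial≡ q N) (expTerm≡ q N)

  half : ℕ → ℚ
  half g = int (ℤ.+ g) ℚ.* 1/ 1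

  half≡ : ∀ g → ι (2 ℕ.* g) ℚ.* 1/ 3 ≡ half g
  half≡ g = trans (cong (ℚ._* 1/ 3) (trans (fromℕ-int (2 ℕ.* g)) (trans (cong int (ℤₚ.pos-* 2 g)) (sym (int-* (ℤ.+ 2) (ℤ.+ g))))))
    (solve 1 (λ x → con (int (ℤ.+ 2)) :* x :* con (1/ 3) := x :* con (1/ 1)) refl (int (ℤ.+ g)))

  half-LtLog : ∀ g ρ → 1 ℕ.≤ g → 2 ℕ.^ g ℕ.≤ ρ → LtLog (half g) ρ
  half-LtLog g ρ 1≤g le = 1/ 8 , ℚₚ.positive⁻¹ (1/ 8) , λ N → subst₂ (λ s t → s ℚ.+ 1/ 8 ℚ.≤ t) (trans (cong (λ q → partial q N) (half≡ g)) (sym (expPartial≡ (half g) N))) (fromℕ-int ρ)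
    (ℚₚ.≤-trans (exp-bound g N 1≤g) (ℚₚ.≤-trans (ℚₚ.≤-reflexive (sym (ι-^ 2 g))) (ι-mono-≤ le)))

  int-^ : ∀ g n → int (ℤ.+ g) ^ℚ n ≡ int (ℤ.+ (g ℕ.^ n))
  int-^ g zero    = refl
  int-^ g (suc n) = trans (cong (int (ℤ.+ g) ℚ.*_) (int-^ g n)) (trans (int-* (ℤ.+ g) (ℤ.+ (g ℕ.^ n))) (cong int (sym (ℤₚ.pos-* g (g ℕ.^ n)))))

  *-^ℚ : ∀ x y n → (x ℚ.* y) ^ℚ n ≡ x ^ℚ n ℚ.* y ^ℚ n
  *-^ℚ x y zero    = refl
  *-^ℚ x y (suc n) = trans (cong (x ℚ.* y ℚ.*_) (*-^ℚ x y n)) (solve 4 (λ x y p q → x :* y :* (p :* q) := x :* p :* (y :* q)) refl x y (x ^ℚ n) (y ^ℚ n))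

  int-mono-< : ∀ {m n} → m ℕ.< n → int (ℤ.+ m) ℚ.< int (ℤ.+ n)
  int-mono-< {m} {n} m<n = subst₂ ℚ._<_ (ℚₚ.+-identityʳ _) (trans (int-+ (ℤ.+ m) (ℤ.+ suc j)) (cong (λ t → int (ℤ.+ t)) (trans (ℕₚ.+-suc m j) (ℕₚ.m+[n∸m]≡n m<n))))
    (ℚₚ.+-monoʳ-< (int (ℤ.+ m)) (ℚₚ.positive⁻¹ (int (ℤ.+ suc j)) {{int-pos j}}))
    where
    j = n ℕ.∸ suc m

  -- 5.6 · 10^48 divided by 2^7, the denominator of (g/2)^7.
  C₁ : ℕ
  C₁ = 4375 ℕ.* 10 ℕ.^ 43

  C₀-half : ∀ g → C₀ ℚ.* (half g ^ℚ 7) ≡ int (ℤ.+ (C₁ ℕ.* g ℕ.^ 7))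
  C₀-half g = begin
    C₀ ℚ.* (half g ^ℚ 7)                                    ≡⟨ cong₂ ℚ._*_ split (*-^ℚ (int (ℤ.+ g)) (1/ 1) 7) ⟩
    (int (ℤ.+ C₁) ℚ.* int (ℤ.+ 128)) ℚ.* (G ℚ.* (1/ 1) ^ℚ 7) ≡⟨ solve 4 (λ a b c d → a :* b :* (c :* d) := b :* d :* (a :* c)) refl (int (ℤ.+ C₁)) (int (ℤ.+ 128)) G ((1/ 1) ^ℚ 7) ⟩
    (int (ℤ.+ 128) ℚ.* (1/ 1) ^ℚ 7) ℚ.* (int (ℤ.+ C₁) ℚ.* G) ≡⟨ ℚₚ.*-identityˡ (int (ℤ.+ C₁) ℚ.* G) ⟩
    int (ℤ.+ C₁) ℚ.* G                                      ≡⟨ cong (int (ℤ.+ C₁) ℚ.*_) (int-^ g 7) ⟩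
    int (ℤ.+ C₁) ℚ.* int (ℤ.+ (g ℕ.^ 7))                    ≡⟨ int-* (ℤ.+ C₁) (ℤ.+ (g ℕ.^ 7)) ⟩
    int (ℤ.+ C₁ ℤ.* ℤ.+ (g ℕ.^ 7))                          ≡⟨ cong int (sym (ℤₚ.pos-* C₁ (g ℕ.^ 7))) ⟩
    int (ℤ.+ (C₁ ℕ.* g ℕ.^ 7))                              ∎
    where
    open ≡-Reasoning
    G = int (ℤ.+ g) ^ℚ 7
    split : C₀ ≡ int (ℤ.+ C₁) ℚ.* int (ℤ.+ 128)
    split = sym (int-* (ℤ.+ C₁) (ℤ.+ 128))

  LtC₀Log7-intro : ∀ n g ρ → 1 ℕ.≤ g → 2 ℕ.^ g ℕ.≤ ρ → n ℕ.< C₁ ℕ.* g ℕ.^ 7 → LtC₀Log7 n ρ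
  LtC₀Log7-intro n g ρ 1≤g le n< = half g , Construction.*-≥0 int≥0 (ℚₚ.<⇒≤ (ℚₚ.positive⁻¹ (1/ 1))) , half-LtLog g ρ 1≤g le ,
      subst (int (ℤ.+ n) ℚ.<_) (sym (C₀-half g)) (int-mono-< n<)
    where
    int≥0 : 0ℚ ℚ.≤ int (ℤ.+ g)
    int≥0 = ℚₚ.nonNegative⁻¹ (int (ℤ.+ g)) {{ℚₚ.normalize-nonNeg g 1}}

open Rationals using (C₁; LtC₀Log7-intro)

-- Binary length of ρ, the lower bound for n, and the theorem.

binary-length : ∀ ρ → 2 ℕ.≤ ρ → ∃[ g ] (1 ℕ.≤ g × 2 ℕ.^ g ℕ.≤ ρ × ρ ℕ.≤ 2 ℕ.^ suc g)
binary-length ρ 2≤ρ = go ρ (ℕₚ.≤-trans (ℕₚ.<⇒≤ (n<2^n ρ)) (ℕₚ.^-monoʳ-≤ 2 (ℕₚ.n≤1+n ρ)))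
  where
  go : ∀ N → ρ ℕ.≤ 2 ℕ.^ suc N → ∃[ g ] (1 ℕ.≤ g × 2 ℕ.^ g ℕ.≤ ρ × ρ ℕ.≤ 2 ℕ.^ suc g)
  go zero    le = 1 , s≤s z≤n , 2≤ρ , ℕₚ.≤-trans le (s≤s (s≤s z≤n))
  go (suc N) le = decide (ρ ℕ.≤? 2 ℕ.^ suc N)
    where
    decide : Dec (ρ ℕ.≤ 2 ℕ.^ suc N) → ∃[ g ] (1 ℕ.≤ g × 2 ℕ.^ g ℕ.≤ ρ × ρ ℕ.≤ 2 ℕ.^ suc g)
    decide (yes le') = go N le'
    decide (no ¬le)  = suc N , s≤s z≤n , ℕₚ.<⇒≤ (ℕₚ.≰⇒> ¬le) , le

4Narayana< : ∀ n → 4 ℕ.* Narayana (3 ℕ.+ n) ℕ.< 2 ℕ.^ (3 ℕ.+ n)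
4Narayana< 0 = ℕₚ.≤ᵇ⇒≤ 5 8 _
4Narayana< 1 = ℕₚ.≤ᵇ⇒≤ 9 16 _
4Narayana< 2 = ℕₚ.≤ᵇ⇒≤ 13 32 _
4Narayana< (suc (suc (suc n))) = ℕₚ.≤-<-trans (ℕₚ.≤-reflexive (ℕₚ.*-distribˡ-+ 4 (Narayana (5 ℕ.+ n)) (Narayana (3 ℕ.+ n))))
  (ℕₚ.<-≤-trans (ℕₚ.+-mono-< (4Narayana< (suc (suc n))) (ℕₚ.<-≤-trans (4Narayana< n) (ℕₚ.^-monoʳ-≤ 2 {3 ℕ.+ n} {5 ℕ.+ n} (ℕₚ.m≤n+m (3 ℕ.+ n) 2))))
    (ℕₚ.≤-reflexive (cong (2 ℕ.^ (5 ℕ.+ n) ℕ.+_) (sym (ℕₚ.+-identityʳ _)))))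

-- A number with `e` digits is at least 2^(e-1), whereas `4Narayana<` puts it below 2^(n-2).
length<index : ∀ n e → 3 ℕ.≤ e → 2 ℕ.^ ℕ.pred e ℕ.≤ Narayana n → e ℕ.< n
length<index 0 (suc e) (s≤s 2≤e) le = contradiction (ℕₚ.≤-trans (ℕₚ.^-monoʳ-≤ 2 2≤e) le) (λ ())
length<index 1 (suc e) (s≤s 2≤e) le = contradiction (ℕₚ.≤-trans (ℕₚ.^-monoʳ-≤ 2 2≤e) le) (λ { (s≤s ()) })
length<index 2 (suc e) (s≤s 2≤e) le = contradiction (ℕₚ.≤-trans (ℕₚ.^-monoʳ-≤ 2 2≤e) le) (λ { (s≤s ()) })
length<index (suc (suc (suc n))) (suc e) (s≤s 2≤e) le = ℕₚ.≰⇒> λ n≤e → ℕₚ.<⇒≱ (4Narayana< n) (ℕₚ.≤-trans (ℕₚ.^-monoʳ-≤ 2 n≤e)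
  (ℕₚ.≤-trans (ℕₚ.*-monoʳ-≤ 2 le) (ℕₚ.*-monoˡ-≤ (Narayana (3 ℕ.+ n)) (s≤s (s≤s (z≤n {2}))))))

module _ (p n d₁ d₂ d₃ ℓ m k : ℕ) (1≤k : 1 ℕ.≤ k) (k≤m : k ℕ.≤ m) (m≤ℓ : m ℕ.≤ ℓ)
  (d₁< : d₁ ℕ.< suc (suc p)) (d₂< : d₂ ℕ.< suc (suc p)) (d₃< : d₃ ℕ.< suc (suc p)) (0<d₁ : 0 ℕ.< d₁)
  (eq : Narayana n ≡ d₁ ℕ.* repunit (suc (suc p)) ℓ ℕ.* suc (suc p) ℕ.^ (m ℕ.+ k) ℕ.+ d₂ ℕ.* repunit (suc (suc p)) m ℕ.* suc (suc p) ℕ.^ k ℕ.+ d₃ ℕ.* repunit (suc (suc p)) k) where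

  private
    ρ = suc (suc p)

  lower-bound : ℓ ℕ.+ m ℕ.+ k ℕ.< n
  lower-bound = from-pred (ℕ.pred ℓ) (ℕₚ.suc-pred ℓ {{ℕ.>-nonZero 1≤ℓ}})
    where
    1≤m = ℕₚ.≤-trans 1≤k k≤m
    1≤ℓ = ℕₚ.≤-trans 1≤m m≤ℓ
    from-pred : ∀ j → suc j ≡ ℓ → ℓ ℕ.+ m ℕ.+ k ℕ.< n
    from-pred j ℓ≡ = length<index n (ℓ ℕ.+ m ℕ.+ k) (ℕₚ.+-mono-≤ (ℕₚ.+-mono-≤ 1≤ℓ 1≤m) 1≤k)
      (ℕₚ.≤-trans (ℕₚ.≤-reflexive (cong (λ t → 2 ℕ.^ ℕ.pred t) (trans (cong (λ t → t ℕ.+ m ℕ.+ k) (sym ℓ≡)) (ℕₚ.+-assoc (suc j) m k))))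
      (ℕₚ.≤-trans (ℕₚ.^-monoˡ-≤ (j ℕ.+ (m ℕ.+ k)) (s≤s (s≤s (z≤n {p}))))
        (Equation.Solution.r^≤N Construction.cubicField p n d₁ d₂ d₃ ℓ m k 1≤k k≤m m≤ℓ d₁< d₂< d₃< 0<d₁ eq j ℓ≡)))

  module _ (g : ℕ) (1≤g : 1 ℕ.≤ g) (2^g≤ρ : 2 ℕ.^ g ℕ.≤ ρ) (ρ≤ : ρ ℕ.≤ 2 ℕ.^ suc g) where

    T≤ : ∀ M → M ℕ.* suc g ℕ.≤ (2 ℕ.* M) ℕ.* g
    T≤ M = ℕₚ.≤-trans (ℕₚ.*-monoʳ-≤ M (ℕₚ.+-monoˡ-≤ g 1≤g)) (ℕₚ.≤-reflexive (lem M g))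
      where
      lem : ∀ M g → M ℕ.* (g ℕ.+ g) ≡ 2 ℕ.* M ℕ.* g
      lem = solve-∀

    g²≤g⁷ : g ℕ.* g ℕ.≤ g ℕ.^ 7
    g²≤g⁷ = ℕₚ.≤-trans (ℕₚ.≤-reflexive (cong (g ℕ.*_) (sym (ℕₚ.*-identityʳ g)))) (ℕₚ.^-monoʳ-≤ g {{ℕ.>-nonZero 1≤g}} {2} {7} (s≤s (s≤s z≤n)))

    -- c = 2 · 2^63 bounds the Dirichlet exponent per unit of `g`; 2^20 · 64 · c² = 2^154 is about
    -- 2.28 · 10^46, below `C₁`.
    upper-bound : n ℕ.< C₁ ℕ.* g ℕ.^ 7
    upper-bound = ℕₚ.≰⇒> λ n≥ → Core.Conclude.contradictory Construction.cubicField p g n d₁ d₂ d₃ ℓ m k (2 ℕ.* 2 ℕ.^ 63) 1≤g ρ≤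
      (ℕₚ.≤ᵇ⇒≤ 4096 (2 ℕ.* 2 ℕ.^ 63) _) (T≤ (2 ℕ.^ 63)) (large (2 ℕ.* 2 ℕ.^ 63) C₁ (ℕₚ.≤ᵇ⇒≤ (1048576 ℕ.* (64 ℕ.* ((2 ℕ.* 2 ℕ.^ 63) ℕ.* (2 ℕ.* 2 ℕ.^ 63)))) C₁ _) n≥)
      1≤k k≤m m≤ℓ d₁< d₂< d₃< 0<d₁ eq 1048576 refl
      where
      large : ∀ c C → 1048576 ℕ.* (64 ℕ.* (c ℕ.* c)) ℕ.≤ C → C ℕ.* g ℕ.^ 7 ℕ.≤ n → 1048576 ℕ.* (64 ℕ.* (c ℕ.* c) ℕ.* (g ℕ.* g)) ℕ.≤ n
      large c C le n≥ = ℕₚ.≤-trans (ℕₚ.≤-reflexive (sym (ℕₚ.*-assoc 1048576 (64 ℕ.* (c ℕ.* c)) (g ℕ.* g)))) (ℕₚ.≤-trans (ℕₚ.*-mono-≤ le g²≤g⁷) n≥)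

open import Data.Nat using (_+_; _*_; _^_; _≤_; _<_)

theorem1p1 : (ρ : ℕ) → 2 ≤ ρ →
    (n d₁ d₂ d₃ ℓ m k : ℕ) →
    1 ≤ k → k ≤ m → m ≤ ℓ →
    d₁ < ρ → d₂ < ρ → d₃ < ρ → 0 < d₁ →
    Narayana n ≡ d₁ * repunit ρ ℓ * ρ ^ (m + k) + d₂ * repunit ρ m * ρ ^ k + d₃ * repunit ρ k →
    (ℓ + m + k < n) × LtC₀Log7 n ρ
theorem1p1 (suc (suc p)) 2≤ρ n d₁ d₂ d₃ ℓ m k 1≤k k≤m m≤ℓ d₁< d₂< d₃< 0<d₁ eq =
  lower-bound p n d₁ d₂ d₃ ℓ m k 1≤k k≤m m≤ℓ d₁< d₂< d₃< 0<d₁ eq , finish (binary-length (suc (suc p)) 2≤ρ)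
  where
  finish : ∃[ g ] (1 ℕ.≤ g × 2 ℕ.^ g ℕ.≤ suc (suc p) × suc (suc p) ℕ.≤ 2 ℕ.^ suc g) → LtC₀Log7 n (suc (suc p))
  finish (g , 1≤g , le , ρ≤) = LtC₀Log7-intro n g (suc (suc p)) 1≤g le
    (upper-bound p n d₁ d₂ d₃ ℓ m k 1≤k k≤m m≤ℓ d₁< d₂< d₃< 0<d₁ eq g 1≤g le ρ≤)
theorem1p1 (suc zero) (s≤s ())
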